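{- If $M\equiv 1 \pmod 8$, then \[ (1,8,8,0,0,0)(M) = (1,14,14,0,0,0)(M) + 2(2,7,14,0,0,0)(M)+4(3,5,14,0,0,2)(M). \] If $M\equiv 1\pmod 8$ and $7\mid M$, then \[ 7(1,8,8,0,0,0)\left(\tfrac{M}{7^2}\right) = -(1,14,14,0,0,0)(M) - 2(2,7,14,0,0,0)(M)+4(3,5,14,0,0,2)(M). \]
   Context: For integers $a,b,c,d,e,f$ and a number $M$, $(a,b,c,d,e,f)(M):=|\{(x,y,z)\in\mathbb Z^3: M=ax^2+by^2+cz^2+dyz+ezx+fxy\}|$; in particular this count is $0$ when $M$ is not an integer. $M$ denotes a positive integer. -}

module Defs where

open import Data.Integer as ℤ using (ℤ; +_)
open import Data.Nat using (ℕ)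
open import Data.Rational using (ℚ; _/_)
open import Data.Product using (Σ; _×_; _,_)
open import Data.List using (List; length)
open import Data.List.Relation.Unary.Unique.Propositional using (Unique)
open import Data.List.Membership.Propositional using (_∈_)
open import Function.Bundles using (_⇔_)
open import Relation.Binary.PropositionalEquality using (_≡_)

Triple : Set
Triple = ℤ × ℤ × ℤ

form : (a b c d e f : ℤ) → Triple → ℤ
form a b c d e f (x , y , z) =
  a ℤ.* x ℤ.* x ℤ.+ b ℤ.* y ℤ.* y ℤ.+ c ℤ.* z ℤ.* z
    ℤ.+ d ℤ.* y ℤ.* z ℤ.+ e ℤ.* z ℤ.* x ℤ.+ f ℤ.* x ℤ.* y

toℚ : ℤ → ℚ
toℚ k = k / 1

HasCard : (Triple → Set) → ℕ → Set
HasCard P n = Σ (List Triple) λ xs → Unique xs × (∀ v → (v ∈ xs) ⇔ P v) × length xs ≡ n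

-- (a,b,c,d,e,f)(M) = n  for a rational number M:
-- the number of (x,y,z) ∈ ℤ³ with M = form(x,y,z) is n.
-- (If M is not an integer the solution set is empty, so the count is 0.)
Rep : (a b c d e f : ℤ) → ℚ → ℕ → Set
Rep a b c d e f M n = HasCard (λ v → M ≡ toℚ (form a b c d e f v)) n

{-# OPTIONS --safe #-}
module Submission where

-- Write r, A, B, C for the counts of (1,8,8,0,0,0), (1,14,14,0,0,0), (2,7,14,0,0,0), (3,5,14,0,0,2), χ for the Legendre symbol modulo 7,
-- φ for the sum of q^(x²) over the integers x, O for the part of φ with odd exponents, and s_k(q) for s(q^k).
--
-- C(M) counts the representations of M by x² + 8p² + 8q² with (x , p , q) on a fixed tangent of the conic x² + 8p² + 8q² = 0 over 𝔽₇.
-- By symmetry all eight tangents give the same count. A vector lies on 1 − χ(M) of them, or on all eight if it is divisible by 7, so that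
-- 8 C(M) = (1 − χ(M)) r(M) + 7 r(M/49). There remain: r = A + 2B if χ(M) = 1, A = B = 0 if χ(M) = −1 (which is clear modulo 7), and
-- r(M) = 7 r(M/49) + 2 (A(M) + 2B(M)) if 7 divides M.
--
-- Multiplication by O_7 turns these ternary theta series into products of the binary series φ² and O O_7, which are Lambert series of the
-- characters modulo 4 and 7. The convolution identities between divisor sums that are needed are found by Liouville's method: for suitable
-- weights on the solutions of a x + b y = n in positive integers, Euclid's step (a , b , x , y) ↦ (a + b , b , x , y − x) makes the sum
-- telescope to a sum over the divisors of n. The Lambert series for φ² and O O_7 themselves come from quadratic relations (such as
-- V² = 4 φ_4² V_2 for the part V of φ² with odd exponents) which determine the coefficients recursively and hold on both sides.

open import Defs
open import Data.Nat as ℕ using (ℕ; zero; suc; _%_; _+_; _*_; _∸_; _≤_; _<_; z≤n; s≤s; NonZero)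
import Data.Nat.Properties as ℕₚ
open import Data.Nat.Tactic.RingSolver using () renaming (solve-∀ to ℕ-solve)
open import Data.Nat.Divisibility using (_∣_; divides; _∣?_; ∣-trans; ∣m∣n⇒∣m+n; ∣m+n∣m⇒∣n; n∣m⇒m%n≡0; m%n≡0⇒n∣m)
open import Data.Nat.Primality using (Prime; prime?; euclidsLemma)
open import Data.Nat.DivMod using (m*n/n≡m; m/n*n≡m; +-distrib-/-∣ˡ; +-distrib-/-∣ʳ; %-distribˡ-+; %-distribˡ-*; [m+kn]%n≡m%n; m*n%n≡0; m∣n⇒o%n%m≡o%m; m%n<n; m<n⇒m%n≡m; m%n%n≡m%n; [m+n]%n≡m%n; m≡m%n+[m/n]*n)
open import Data.Integer as ℤ using (ℤ; +_; -[1+_]) renaming (_+_ to _⊕_; _*_ to _⊗_; -_ to ⊝_; _-_ to _⊖_)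
import Data.Integer.Properties as ℤₚ
open import Algebra.Properties.AbelianGroup ℤₚ.+-0-abelianGroup using () renaming (∙-cancelˡ to +-cancelˡ)
open import Data.Integer.Tactic.RingSolver using (solve-∀)
open import Data.Integer.DivMod using (_%ℕ_; _/ℕ_; n%ℕd<d; a≡a%ℕn+[a/ℕn]*n)
open import Data.Rational using (_/_)
open import Data.Rational.Unnormalised using (mkℚᵘ; *≡*)
open import Data.Rational.Properties using (/-injective-≃; fromℚᵘ-cong)
open import Data.Product using (∃; _×_; _,_; proj₁; proj₂)
open import Data.Bool using (Bool; true; _∧_; if_then_else_)
open import Data.Sum using (_⊎_; inj₁; inj₂)
open import Data.List using (List; []; _∷_; _++_; map; filter; upTo; length)
import Data.List.Properties
open import Data.List.Relation.Unary.Any using (here; there)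
open import Data.List.Relation.Unary.All as All using (All; []; _∷_)
open import Data.List.Relation.Unary.AllPairs using ([]; _∷_)
open import Data.List.Relation.Unary.Unique.Propositional using (Unique)
import Data.List.Relation.Unary.Unique.Propositional.Properties as Uniqueₚ
open import Data.List.Membership.Propositional using (_∈_)
import Data.List.Membership.Propositional.Properties as ∈ₚ
open import Data.List.Membership.Propositional.Properties.WithK using (unique∧set⇒bag)
open import Data.List.Relation.Binary.BagAndSetEquality using (∼bag⇒↭)
open import Data.List.Relation.Binary.Permutation.Propositional as Perm using (_↭_)
open import Function using (_∘_; id; _$_)
open import Function.Bundles using (mk⇔; Equivalence)
open import Relation.Nullary using (¬_; Dec; yes; no; contradiction; ¬?)
open import Relation.Nullary.Decidable using (isYes; toWitness)
open import Relation.Binary.PropositionalEquality using (_≡_; _≢_; refl; sym; trans; cong; cong₂; subst; subst₂; module ≡-Reasoning)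

-- Finite sums over enumerated predicates

-- The cases depend on M modulo 7 and 8 only, and multiplication by O_7 respects them: all exponents
-- of O_7 are 7 modulo 56, so an identity of coefficients on one class modulo 56 can be recovered
-- from its product with O_7. The factor is chosen because O O_7 has exponents divisible by 8 and,
-- ℚ(√-7) having class number one, is the single Lambert series 4 ρ(q⁸). With q⁸ replaced by q,
-- everything concerns the four products of ρ and ρ_2 with φ² and φ_7². For these, Liouville's
-- method supplies two linear relations (`Alpha` and `Beta`). The obstacle is their boundary terms,
-- divisor sums with a growing factor m - 1 and the character χ at d in one relation and at m in the
-- other, where m d = n. They cancel in the difference if χ(n) = 1, since then χ(d) = χ(m). At
-- multiples of 7 they do not cancel, but the difference at 7n reproduces a combination of the
-- boundary terms at n, which the two relations evaluate once more. This is the source of the three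
-- cases for M modulo 7.

record Enum {A : Set} (P : A → Set) : Set where
  constructor enum
  field
    list     : List A
    unique   : Unique list
    sound    : ∀ {v} → v ∈ list → P v
    complete : ∀ {v} → P v → v ∈ list

open Enum

sumOver : {A : Set} → List A → (A → ℤ) → ℤ
sumOver []       f = + 0
sumOver (x ∷ xs) f = f x ⊕ sumOver xs f

∑ : {A : Set} {P : A → Set} → Enum P → (A → ℤ) → ℤ
∑ e f = sumOver (list e) f

variable
  A B : Set
  P : A → Set
  Q : B → Set

sumOver-cong : (xs : List A) {f g : A → ℤ} → (∀ {x} → x ∈ xs → f x ≡ g x) → sumOver xs f ≡ sumOver xs g
sumOver-cong []       h = refl
sumOver-cong (x ∷ xs) h = cong₂ _⊕_ (h (here refl)) (sumOver-cong xs (h ∘ there))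

sumOver-↭ : {xs ys : List A} (f : A → ℤ) → xs ↭ ys → sumOver xs f ≡ sumOver ys f
sumOver-↭ f Perm.refl         = refl
sumOver-↭ f (Perm.prep x p)   = cong (f x ⊕_) (sumOver-↭ f p)
sumOver-↭ {ys = _ ∷ _ ∷ ys} f (Perm.swap x y p) =
  trans (cong (λ s → f x ⊕ (f y ⊕ s)) (sumOver-↭ f p)) (exchange (f x) (f y) (sumOver ys f))
  where
  exchange : ∀ a b c → a ⊕ (b ⊕ c) ≡ b ⊕ (a ⊕ c)
  exchange = solve-∀
sumOver-↭ f (Perm.trans p q)  = trans (sumOver-↭ f p) (sumOver-↭ f q)

sumOver-++ : (xs ys : List A) (f : A → ℤ) → sumOver (xs ++ ys) f ≡ sumOver xs f ⊕ sumOver ys f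
sumOver-++ []       ys f = sym (ℤₚ.+-identityˡ _)
sumOver-++ (x ∷ xs) ys f = trans (cong (f x ⊕_) (sumOver-++ xs ys f)) (sym (ℤₚ.+-assoc (f x) _ _))

sumOver-map : (g : A → B) (xs : List A) (f : B → ℤ) → sumOver (map g xs) f ≡ sumOver xs (f ∘ g)
sumOver-map g []       f = refl
sumOver-map g (x ∷ xs) f = cong (f (g x) ⊕_) (sumOver-map g xs f)

sumOver-⊕ : (xs : List A) (f g : A → ℤ) → sumOver xs (λ x → f x ⊕ g x) ≡ sumOver xs f ⊕ sumOver xs g
sumOver-⊕ []       f g = refl
sumOver-⊕ (x ∷ xs) f g = trans (cong ((f x ⊕ g x) ⊕_) (sumOver-⊕ xs f g)) (interchange (f x) (g x) _ _)
  where
  interchange : ∀ a b c d → (a ⊕ b) ⊕ (c ⊕ d) ≡ (a ⊕ c) ⊕ (b ⊕ d)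
  interchange = solve-∀

sumOver-⊗ : (xs : List A) (c : ℤ) (f : A → ℤ) → sumOver xs (λ x → c ⊗ f x) ≡ c ⊗ sumOver xs f
sumOver-⊗ []       c f = sym (ℤₚ.*-zeroʳ c)
sumOver-⊗ (x ∷ xs) c f = trans (cong (c ⊗ f x ⊕_) (sumOver-⊗ xs c f)) (sym (ℤₚ.*-distribˡ-+ c (f x) _))

sumOver-0 : (xs : List A) → sumOver xs (λ _ → + 0) ≡ + 0
sumOver-0 []       = refl
sumOver-0 (x ∷ xs) = trans (ℤₚ.+-identityˡ _) (sumOver-0 xs)

unique-map : {f : A → B} (xs : List A) → (∀ {x y} → x ∈ xs → y ∈ xs → f x ≡ f y → x ≡ y) →
             Unique xs → Unique (map f xs)
unique-map []       inj []        = []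
unique-map {f = f} (x ∷ xs) inj (x∉ ∷ u) =
  All.tabulate fresh ∷ unique-map xs (λ p q → inj (there p) (there q)) u
  where
  fresh : ∀ {z} → z ∈ map f xs → f x ≢ z
  fresh z∈ eq with ∈ₚ.∈-map⁻ f z∈
  ... | y , y∈ , refl = All.lookup x∉ y∈ (inj (here refl) (there y∈) eq)

-- Duplicate-free lists with the same members are permutations of each other. Hence a sum over an
-- `Enum` depends on the predicate alone, and a counting identity amounts to two maps that are
-- mutually inverse on the predicates.
∑-bij : (e : Enum P) (e′ : Enum Q) (to : A → B) (from : B → A) →
        (∀ {v} → P v → Q (to v)) → (∀ {w} → Q w → P (from w)) →
        (∀ {v} → P v → from (to v) ≡ v) → (∀ {w} → Q w → to (from w) ≡ w) →
        {f : A → ℤ} {g : B → ℤ} → (∀ {v} → P v → f v ≡ g (to v)) → ∑ e f ≡ ∑ e′ g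
∑-bij e e′ to from to-P from-Q from-to to-from {f} {g} eq = begin
  sumOver (list e) f               ≡⟨ sumOver-cong (list e) (eq ∘ sound e) ⟩
  sumOver (list e) (g ∘ to)        ≡⟨ sumOver-map to (list e) g ⟨
  sumOver (map to (list e)) g      ≡⟨ sumOver-↭ g (∼bag⇒↭ (unique∧set⇒bag uniq (unique e′) (mk⇔ fwd bwd))) ⟩
  sumOver (list e′) g              ∎
  where
  open ≡-Reasoning
  uniq : Unique (map to (list e))
  uniq = unique-map (list e) (λ p q h → trans (sym (from-to (sound e p))) (trans (cong from h) (from-to (sound e q)))) (unique e)
  fwd : ∀ {w} → w ∈ map to (list e) → w ∈ list e′
  fwd w∈ with ∈ₚ.∈-map⁻ to w∈
  ... | v , v∈ , refl = complete e′ (to-P (sound e v∈))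
  bwd : ∀ {w} → w ∈ list e′ → w ∈ map to (list e)
  bwd w∈ = subst (_∈ map to (list e)) (to-from (sound e′ w∈)) (∈ₚ.∈-map⁺ to (complete e (from-Q (sound e′ w∈))))

∑-cong : (e : Enum P) {f g : A → ℤ} → (∀ {v} → P v → f v ≡ g v) → ∑ e f ≡ ∑ e g
∑-cong e h = sumOver-cong (list e) (h ∘ sound e)

∑-same : {P′ : A → Set} (e : Enum P) (e′ : Enum P′) → (∀ {v} → P v → P′ v) → (∀ {v} → P′ v → P v) →
         {f g : A → ℤ} → (∀ {v} → P v → f v ≡ g v) → ∑ e f ≡ ∑ e′ g
∑-same e e′ h k = ∑-bij e e′ id id h k (λ _ → refl) (λ _ → refl)

∑-⊕ : (e : Enum P) (f g : A → ℤ) → ∑ e (λ x → f x ⊕ g x) ≡ ∑ e f ⊕ ∑ e g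
∑-⊕ e = sumOver-⊕ (list e)

∑-⊗ : (e : Enum P) (c : ℤ) (f : A → ℤ) → ∑ e (λ x → c ⊗ f x) ≡ c ⊗ ∑ e f
∑-⊗ e = sumOver-⊗ (list e)

∑-0 : (e : Enum P) {f : A → ℤ} → (∀ {v} → P v → f v ≡ + 0) → ∑ e f ≡ + 0
∑-0 e h = trans (∑-cong e h) (sumOver-0 (list e))

filterE : {R : A → Set} → (∀ v → Dec (R v)) → Enum P → Enum (λ v → P v × R v)
filterE R? e = enum (filter R? (list e)) (Uniqueₚ.filter⁺ R? (unique e))
  (λ v∈ → let (p , r) = ∈ₚ.∈-filter⁻ R? {xs = list e} v∈ in sound e p , r)
  (λ (p , r) → ∈ₚ.∈-filter⁺ R? (complete e p) r)

∑-split : {R : A → Set} (R? : ∀ v → Dec (R v)) (e : Enum P) (f : A → ℤ) →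
          ∑ e f ≡ ∑ (filterE R? e) f ⊕ ∑ (filterE (¬? ∘ R?) e) f
∑-split {A = A} R? e f = go (list e)
  where
  left : ∀ a b c → a ⊕ (b ⊕ c) ≡ (a ⊕ b) ⊕ c
  left = solve-∀
  right : ∀ a b c → a ⊕ (b ⊕ c) ≡ b ⊕ (a ⊕ c)
  right = solve-∀
  go : (xs : List A) → sumOver xs f ≡ sumOver (filter R? xs) f ⊕ sumOver (filter (¬? ∘ R?) xs) f
  go []       = refl
  go (x ∷ xs) with R? x
  ... | yes _ = trans (cong (f x ⊕_) (go xs)) (left (f x) (sumOver (filter R? xs) f) (sumOver (filter (¬? ∘ R?) xs) f))
  ... | no  _ = trans (cong (f x ⊕_) (go xs)) (right (f x) (sumOver (filter R? xs) f) (sumOver (filter (¬? ∘ R?) xs) f))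

imageE : (e : Enum P) (to : A → B) (from : B → A) → (∀ {v} → P v → Q (to v)) → (∀ {w} → Q w → P (from w)) →
         (∀ {v} → P v → from (to v) ≡ v) → (∀ {w} → Q w → to (from w) ≡ w) → Enum Q
imageE {Q = Q} e to from h k from-to to-from = enum (map to (list e))
  (unique-map (list e) (λ p q eq → trans (sym (from-to (sound e p))) (trans (cong from eq) (from-to (sound e q)))) (unique e))
  back (λ q → subst (_∈ map to (list e)) (to-from q) (∈ₚ.∈-map⁺ to (complete e (k q))))
  where
  back : ∀ {w} → w ∈ map to (list e) → Q w
  back w∈ with ∈ₚ.∈-map⁻ to w∈
  ... | v , v∈ , refl = h (sound e v∈)

sameE : {P′ : A → Set} → Enum P → (∀ {v} → P v → P′ v) → (∀ {v} → P′ v → P v) → Enum P′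
sameE e h k = enum (list e) (unique e) (h ∘ sound e) (complete e ∘ k)

below : (n : ℕ) → Enum (_< n)
below n = enum (upTo n) (Uniqueₚ.upTo⁺ n) (∈ₚ.∈-upTo⁻) (∈ₚ.∈-upTo⁺)

pairs : List A → (A → List B) → List (A × B)
pairs []       f = []
pairs (x ∷ xs) f = map (x ,_) (f x) ++ pairs xs f

∈-pairs⁻ : (xs : List A) (f : A → List B) {a : A} {b : B} → (a , b) ∈ pairs xs f → a ∈ xs × b ∈ f a
∈-pairs⁻ (x ∷ xs) f ab∈ with ∈ₚ.∈-++⁻ (map (x ,_) (f x)) ab∈
... | inj₁ p with ∈ₚ.∈-map⁻ (x ,_) p
...   | b , b∈ , refl = here refl , b∈
∈-pairs⁻ (x ∷ xs) f ab∈ | inj₂ p with ∈-pairs⁻ xs f p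
... | a∈ , b∈ = there a∈ , b∈

∈-pairs⁺ : (xs : List A) (f : A → List B) {a : A} {b : B} → a ∈ xs → b ∈ f a → (a , b) ∈ pairs xs f
∈-pairs⁺ (x ∷ xs) f (here refl) b∈ = ∈ₚ.∈-++⁺ˡ (∈ₚ.∈-map⁺ (x ,_) b∈)
∈-pairs⁺ (x ∷ xs) f (there a∈) b∈ = ∈ₚ.∈-++⁺ʳ (map (x ,_) (f x)) (∈-pairs⁺ xs f a∈ b∈)

unique-pairs : (xs : List A) (f : A → List B) → Unique xs → (∀ a → Unique (f a)) → Unique (pairs xs f)
unique-pairs []       f []       v = []
unique-pairs (x ∷ xs) f (x∉ ∷ u) v =
  Uniqueₚ.++⁺ (Uniqueₚ.map⁺ (cong proj₂) (v x)) (unique-pairs xs f u v) disjoint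
  where
  disjoint : ∀ {w} → ¬ (w ∈ map (x ,_) (f x) × w ∈ pairs xs f)
  disjoint (p , q) with ∈ₚ.∈-map⁻ (x ,_) p
  ... | b , b∈ , refl = All.lookup x∉ (proj₁ (∈-pairs⁻ xs f q)) refl

ΣE : {Q : A → B → Set} → Enum P → (∀ a → Enum (Q a)) → Enum (λ (ab : A × B) → P (proj₁ ab) × Q (proj₁ ab) (proj₂ ab))
ΣE e f = enum (pairs (list e) (list ∘ f)) (unique-pairs (list e) (list ∘ f) (unique e) (unique ∘ f))
  (λ ab∈ → let (p , q) = ∈-pairs⁻ (list e) (list ∘ f) ab∈ in sound e p , sound (f _) q)
  (λ (p , q) → ∈-pairs⁺ (list e) (list ∘ f) (complete e p) (complete (f _) q))

∑-Σ : {Q : A → B → Set} (e : Enum P) (f : ∀ a → Enum (Q a)) (h : A × B → ℤ) →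
      ∑ (ΣE e f) h ≡ ∑ e (λ a → ∑ (f a) (λ b → h (a , b)))
∑-Σ {A = A} e f h = go (list e)
  where
  go : (xs : List A) → sumOver (pairs xs (list ∘ f)) h ≡ sumOver xs (λ a → ∑ (f a) (λ b → h (a , b)))
  go []       = refl
  go (x ∷ xs) = trans (sumOver-++ (map (x ,_) (list (f x))) _ h)
                      (cong₂ _⊕_ (sumOver-map (x ,_) (list (f x)) h) (go xs))

-- Formal power series as coefficient sequences

Seq : Set
Seq = ℕ → ℤ

infix  4 _≈_
infixl 7 _⋆_
infixl 6 _⊞_
infixr 8 _·_

_≈_ : Seq → Seq → Set
s ≈ t = ∀ n → s n ≡ t n

_⊞_ : Seq → Seq → Seq
(s ⊞ t) n = s n ⊕ t n

_·_ : ℤ → Seq → Seq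
(c · s) n = c ⊗ s n

-- The Cauchy product, by recursion on the shift of the first factor: in this form the ring laws
-- follow by induction on the exponent, without reindexing of finite sums.
_⋆_ : Seq → Seq → Seq
(s ⋆ t) zero    = s 0 ⊗ t 0
(s ⋆ t) (suc n) = s 0 ⊗ t (suc n) ⊕ ((s ∘ suc) ⋆ t) n

≈-sym : ∀ {s t} → s ≈ t → t ≈ s
≈-sym h n = sym (h n)

≈-trans : ∀ {s t u} → s ≈ t → t ≈ u → s ≈ u
≈-trans h k n = trans (h n) (k n)

⋆-cong : ∀ {s s′ t t′} → s ≈ s′ → t ≈ t′ → s ⋆ t ≈ s′ ⋆ t′
⋆-cong h k zero    = cong₂ _⊗_ (h 0) (k 0)
⋆-cong h k (suc n) = cong₂ _⊕_ (cong₂ _⊗_ (h 0) (k (suc n))) (⋆-cong (h ∘ suc) k n)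

⋆-sucʳ : ∀ s t n → (s ⋆ t) (suc n) ≡ s (suc n) ⊗ t 0 ⊕ (s ⋆ (t ∘ suc)) n
⋆-sucʳ s t zero    = ℤₚ.+-comm (s 0 ⊗ t 1) _
⋆-sucʳ s t (suc n) = trans (cong (s 0 ⊗ t (2 + n) ⊕_) (⋆-sucʳ (s ∘ suc) t n)) (exchange (s 0 ⊗ t (2 + n)) (s (2 + n) ⊗ t 0) _)
  where
  exchange : ∀ a b c → a ⊕ (b ⊕ c) ≡ b ⊕ (a ⊕ c)
  exchange = solve-∀

⋆-comm : ∀ s t → s ⋆ t ≈ t ⋆ s
⋆-comm s t zero    = ℤₚ.*-comm (s 0) (t 0)
⋆-comm s t (suc n) = trans (cong₂ _⊕_ (ℤₚ.*-comm (s 0) (t (suc n))) (⋆-comm (s ∘ suc) t n)) (sym (⋆-sucʳ t s n))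

⋆-distribʳ : ∀ s t u → (s ⊞ t) ⋆ u ≈ s ⋆ u ⊞ t ⋆ u
⋆-distribʳ s t u zero    = ℤₚ.*-distribʳ-+ (u 0) (s 0) (t 0)
⋆-distribʳ s t u (suc n) = trans (cong ((s 0 ⊕ t 0) ⊗ u (suc n) ⊕_) (⋆-distribʳ (s ∘ suc) (t ∘ suc) u n)) (regroup (s 0) (t 0) (u (suc n)) _ _)
  where
  regroup : ∀ a b c d e → (a ⊕ b) ⊗ c ⊕ (d ⊕ e) ≡ (a ⊗ c ⊕ d) ⊕ (b ⊗ c ⊕ e)
  regroup = solve-∀

⋆-distribˡ : ∀ s t u → s ⋆ (t ⊞ u) ≈ s ⋆ t ⊞ s ⋆ u
⋆-distribˡ s t u n = trans (⋆-comm s (t ⊞ u) n) (trans (⋆-distribʳ t u s n) (cong₂ _⊕_ (⋆-comm t s n) (⋆-comm u s n)))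

⋆-·ˡ : ∀ c s t → (c · s) ⋆ t ≈ c · (s ⋆ t)
⋆-·ˡ c s t zero    = ℤₚ.*-assoc c (s 0) (t 0)
⋆-·ˡ c s t (suc n) = trans (cong ((c ⊗ s 0) ⊗ t (suc n) ⊕_) (⋆-·ˡ c (s ∘ suc) t n)) (regroup c (s 0) (t (suc n)) _)
  where
  regroup : ∀ c a b d → (c ⊗ a) ⊗ b ⊕ c ⊗ d ≡ c ⊗ (a ⊗ b ⊕ d)
  regroup = solve-∀

⋆-·ʳ : ∀ c s t → s ⋆ (c · t) ≈ c · (s ⋆ t)
⋆-·ʳ c s t n = trans (⋆-comm s (c · t) n) (trans (⋆-·ˡ c t s n) (cong (c ⊗_) (⋆-comm t s n)))

⋆-assoc : ∀ s t u → (s ⋆ t) ⋆ u ≈ s ⋆ (t ⋆ u)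
⋆-assoc s t u zero    = ℤₚ.*-assoc (s 0) (t 0) (u 0)
⋆-assoc s t u (suc n) = begin
  (s 0 ⊗ t 0) ⊗ u (suc n) ⊕ (((s 0 · (t ∘ suc)) ⊞ (s ∘ suc) ⋆ t) ⋆ u) n
    ≡⟨ cong ((s 0 ⊗ t 0) ⊗ u (suc n) ⊕_) (trans (⋆-distribʳ (s 0 · (t ∘ suc)) ((s ∘ suc) ⋆ t) u n)
         (cong₂ _⊕_ (⋆-·ˡ (s 0) (t ∘ suc) u n) (⋆-assoc (s ∘ suc) t u n))) ⟩
  (s 0 ⊗ t 0) ⊗ u (suc n) ⊕ (s 0 ⊗ ((t ∘ suc) ⋆ u) n ⊕ ((s ∘ suc) ⋆ (t ⋆ u)) n)
    ≡⟨ regroup (s 0) (t 0) (u (suc n)) _ _ ⟩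
  s 0 ⊗ (t 0 ⊗ u (suc n) ⊕ ((t ∘ suc) ⋆ u) n) ⊕ ((s ∘ suc) ⋆ (t ⋆ u)) n ∎
  where
  open ≡-Reasoning
  regroup : ∀ a b c d e → (a ⊗ b) ⊗ c ⊕ (a ⊗ d ⊕ e) ≡ a ⊗ (b ⊗ c ⊕ d) ⊕ e
  regroup = solve-∀

⋆-exchange : ∀ s t u v → (s ⋆ t) ⋆ (u ⋆ v) ≈ (s ⋆ u) ⋆ (t ⋆ v)
⋆-exchange s t u v = ≈-trans (⋆-assoc s t (u ⋆ v)) (≈-trans (⋆-cong (λ _ → refl) inner) (≈-sym (⋆-assoc s u (t ⋆ v))))
  where
  inner : t ⋆ (u ⋆ v) ≈ u ⋆ (t ⋆ v)
  inner = ≈-trans (≈-sym (⋆-assoc t u v)) (≈-trans (⋆-cong (⋆-comm t u) (λ _ → refl)) (⋆-assoc u t v))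

⋆-zeroˡ : ∀ s t n → (∀ i → i ≤ n → s i ≡ + 0) → (s ⋆ t) n ≡ + 0
⋆-zeroˡ s t zero    h = cong (_⊗ t 0) (h 0 z≤n)
⋆-zeroˡ s t (suc n) h = cong₂ _⊕_ (cong (_⊗ t (suc n)) (h 0 z≤n)) (⋆-zeroˡ (s ∘ suc) t n (λ i i≤n → h (suc i) (s≤s i≤n)))

-- In the recursions `s` is the difference of two series known to agree below n; this and its
-- variants isolate the next coefficient of the difference.
⋆-lowest : ∀ s t n → (∀ i → i < n → s i ≡ + 0) → (s ⋆ t) n ≡ s n ⊗ t 0
⋆-lowest s t zero    h = refl
⋆-lowest s t (suc n) h = trans (⋆-sucʳ s t n)
  (trans (cong (s (suc n) ⊗ t 0 ⊕_) (⋆-zeroˡ s (t ∘ suc) n (λ i i≤n → h i (s≤s i≤n)))) (ℤₚ.+-identityʳ _))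

⋆-lowest₂ : ∀ s t n → (∀ i → i < n → s i ≡ + 0) → (s ⋆ t) (suc n) ≡ s (suc n) ⊗ t 0 ⊕ s n ⊗ t 1
⋆-lowest₂ s t n h = trans (⋆-sucʳ s t n) (cong (s (suc n) ⊗ t 0 ⊕_) (⋆-lowest s (t ∘ suc) n h))

antidiagonal : ∀ n → Enum (λ (ij : ℕ × ℕ) → proj₁ ij + proj₂ ij ≡ n)
antidiagonal n = imageE (below (suc n)) (λ i → i , n ∸ i) proj₁
  (λ { (s≤s i≤n) → ℕₚ.m+[n∸m]≡n i≤n }) (λ { {i , j} refl → s≤s (ℕₚ.m≤m+n i j) })
  (λ _ → refl) (λ { {i , j} refl → cong (i ,_) (ℕₚ.m+n∸m≡n i j) })

⋆-antidiagonal : ∀ s t n → (s ⋆ t) n ≡ ∑ (antidiagonal n) (λ (i , j) → s i ⊗ t j)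
⋆-antidiagonal s t n = trans (go s n) (sym (sumOver-map (λ i → i , n ∸ i) (upTo (suc n)) (λ (i , j) → s i ⊗ t j)))
  where
  shift : ∀ (f : ℕ → ℕ) m (h : ℕ → ℤ) → sumOver (Data.List.applyUpTo f m) h ≡ sumOver (upTo m) (h ∘ f)
  shift f m h = trans (cong (λ xs → sumOver xs h) (sym (Data.List.Properties.map-upTo f m))) (sumOver-map f (upTo m) h)
  go : ∀ s n → (s ⋆ t) n ≡ sumOver (upTo (suc n)) (λ i → s i ⊗ t (n ∸ i))
  go s zero    = sym (ℤₚ.+-identityʳ _)
  go s (suc n) = cong (s 0 ⊗ t (suc n) ⊕_) (trans (go (s ∘ suc) n) (sym (shift suc (suc n) (λ i → s i ⊗ t (suc n ∸ i)))))

module _ {wA : A → ℕ} {wB : B → ℕ} (EA : ∀ n → Enum (λ a → wA a ≡ n)) (EB : ∀ n → Enum (λ b → wB b ≡ n)) where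

  pairE : ∀ n → Enum (λ (ab : A × B) → wA (proj₁ ab) + wB (proj₂ ab) ≡ n)
  pairE n = imageE (ΣE (antidiagonal n) (λ (i , j) → ΣE (EA i) (λ _ → EB j)))
    proj₂ (λ (a , b) → (wA a , wB b) , (a , b))
    (λ { (refl , refl , refl) → refl }) (λ h → h , refl , refl) (λ { (_ , refl , refl) → refl }) (λ _ → refl)

  -- Pairs of total weight n are grouped by the weights of their components. This one principle
  -- serves both the theta series and the sums over solutions of a x + b y = n.
  ⋆-∑ : ∀ {n} (E : Enum (λ (ab : A × B) → wA (proj₁ ab) + wB (proj₂ ab) ≡ n)) (f : A → ℤ) (g : B → ℤ) →
        ∑ E (λ (a , b) → f a ⊗ g b) ≡ ((λ i → ∑ (EA i) f) ⋆ (λ j → ∑ (EB j) g)) n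
  ⋆-∑ {n} E f g = begin
    ∑ E (λ (a , b) → f a ⊗ g b)
      ≡⟨ ∑-bij E split (λ (a , b) → (wA a , wB b) , (a , b)) proj₂
           (λ h → h , refl , refl) (λ { (refl , refl , refl) → refl }) (λ _ → refl) (λ { (_ , refl , refl) → refl }) (λ _ → refl) ⟩
    ∑ split (λ (_ , a , b) → f a ⊗ g b)
      ≡⟨ ∑-Σ (antidiagonal n) (λ (i , j) → ΣE (EA i) (λ _ → EB j)) (λ (_ , a , b) → f a ⊗ g b) ⟩
    ∑ (antidiagonal n) (λ (i , j) → ∑ (ΣE (EA i) (λ _ → EB j)) (λ (a , b) → f a ⊗ g b))
      ≡⟨ ∑-cong (antidiagonal n) (λ {(i , j)} _ → product i j) ⟩
    ∑ (antidiagonal n) (λ (i , j) → ∑ (EA i) f ⊗ ∑ (EB j) g)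
      ≡⟨ ⋆-antidiagonal _ _ n ⟨
    ((λ i → ∑ (EA i) f) ⋆ (λ j → ∑ (EB j) g)) n ∎
    where
    open ≡-Reasoning
    split = ΣE (antidiagonal n) (λ (i , j) → ΣE (EA i) (λ _ → EB j))
    product : ∀ i j → ∑ (ΣE (EA i) (λ _ → EB j)) (λ (a , b) → f a ⊗ g b) ≡ ∑ (EA i) f ⊗ ∑ (EB j) g
    product i j = begin
      ∑ (ΣE (EA i) (λ _ → EB j)) (λ (a , b) → f a ⊗ g b)  ≡⟨ ∑-Σ (EA i) (λ _ → EB j) (λ (a , b) → f a ⊗ g b) ⟩
      ∑ (EA i) (λ a → ∑ (EB j) (λ b → f a ⊗ g b))         ≡⟨ ∑-cong (EA i) (λ {a} _ → trans (∑-⊗ (EB j) (f a) g) (ℤₚ.*-comm (f a) (∑ (EB j) g))) ⟩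
      ∑ (EA i) (λ a → ∑ (EB j) g ⊗ f a)                   ≡⟨ ∑-⊗ (EA i) (∑ (EB j) g) f ⟩
      ∑ (EB j) g ⊗ ∑ (EA i) f                             ≡⟨ ℤₚ.*-comm (∑ (EB j) g) (∑ (EA i) f) ⟩
      ∑ (EA i) f ⊗ ∑ (EB j) g                             ∎

-- The substitution q ↦ q^k

dil : ℕ → Seq → Seq
dil k s n with k ∣? n
... | yes (divides q _) = s q
... | no  _             = + 0

dil-* : ∀ k .{{_ : NonZero k}} s m → dil k s (m * k) ≡ s m
dil-* k s m with k ∣? (m * k)
... | yes (divides q eq) = cong s (sym (ℕₚ.*-cancelʳ-≡ m q k eq))
... | no  h              = contradiction (divides m refl) h

dil-∤ : ∀ k s n → ¬ (k ∣ n) → dil k s n ≡ + 0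
dil-∤ k s n h with k ∣? n
... | yes d = contradiction d h
... | no  _ = refl

dil-cong : ∀ k {s t} → s ≈ t → dil k s ≈ dil k t
dil-cong k h n with k ∣? n
... | yes (divides q _) = h q
... | no  _             = refl

dil-⊞ : ∀ k s t → dil k (s ⊞ t) ≈ dil k s ⊞ dil k t
dil-⊞ k s t n with k ∣? n
... | yes _ = refl
... | no  _ = refl

dil-· : ∀ k c s → dil k (c · s) ≈ c · dil k s
dil-· k c s n with k ∣? n
... | yes _ = refl
... | no  _ = sym (ℤₚ.*-zeroʳ c)

dil-unique : ∀ k .{{_ : NonZero k}} s t → (∀ n → ¬ (k ∣ n) → t n ≡ + 0) → (∀ m → t (m * k) ≡ s m) → t ≈ dil k s
dil-unique k s t h e n with k ∣? n
... | yes (divides q refl) = e q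
... | no  d                = h n d

dil-dil : ∀ j k .{{_ : NonZero j}} .{{_ : NonZero k}} s → dil j (dil k s) ≈ dil (j * k) s
dil-dil j k s n with j ∣? n
... | no  h = sym (dil-∤ (j * k) s n (λ d → h (∣-trans (divides k (ℕₚ.*-comm j k)) d)))
... | yes (divides q refl) with k ∣? q
...   | yes (divides r refl) = sym (trans (cong (dil (j * k) s) eq) (dil-* (j * k) {{ℕₚ.m*n≢0 j k}} s r))
  where
  eq : r * k * j ≡ r * (j * k)
  eq = trans (ℕₚ.*-assoc r k j) (cong (r *_) (ℕₚ.*-comm k j))
...   | no  h = sym (dil-∤ (j * k) s (q * j) λ { (divides r eq) → h (divides r (ℕₚ.*-cancelʳ-≡ q (r * k) j
    (trans eq (trans (cong (r *_) (ℕₚ.*-comm j k)) (sym (ℕₚ.*-assoc r k j)))))) })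

dil-⋆ : ∀ k .{{_ : NonZero k}} s t → dil k (s ⋆ t) ≈ dil k s ⋆ dil k t
dil-⋆ k s t = ≈-sym (dil-unique k (s ⋆ t) _ off on)
  where
  open ≡-Reasoning
  term : ℕ × ℕ → ℤ
  term (i , j) = dil k s i ⊗ dil k t j
  multiple? : ∀ ij → Dec (k ∣ proj₁ ij)
  multiple? (i , j) = k ∣? i
  rest-0 : ∀ n → ∑ (filterE (¬? ∘ multiple?) (antidiagonal n)) term ≡ + 0
  rest-0 n = ∑-0 (filterE (¬? ∘ multiple?) (antidiagonal n)) (λ {(i , j)} (_ , h) → cong (_⊗ dil k t j) (dil-∤ k s i h))
  reduce : ∀ n → (dil k s ⋆ dil k t) n ≡ ∑ (filterE multiple? (antidiagonal n)) term
  reduce n = trans (⋆-antidiagonal _ _ n) (trans (∑-split multiple? (antidiagonal n) term)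
    (trans (cong (∑ (filterE multiple? (antidiagonal n)) term ⊕_) (rest-0 n)) (ℤₚ.+-identityʳ _)))
  off : ∀ n → ¬ (k ∣ n) → (dil k s ⋆ dil k t) n ≡ + 0
  off n h = trans (reduce n) (∑-0 (filterE multiple? (antidiagonal n)) (λ { {i , j} (refl , d) →
    trans (cong (dil k s i ⊗_) (dil-∤ k t j (λ d′ → h (∣m∣n⇒∣m+n d d′)))) (ℤₚ.*-zeroʳ (dil k s i)) }))
  on : ∀ m → (dil k s ⋆ dil k t) (m * k) ≡ (s ⋆ t) m
  on m = begin
    (dil k s ⋆ dil k t) (m * k)                              ≡⟨ reduce (m * k) ⟩
    ∑ (filterE multiple? (antidiagonal (m * k))) term
      ≡⟨ ∑-bij (antidiagonal m) (filterE multiple? (antidiagonal (m * k)))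
           (λ (i , j) → i * k , j * k) (λ (i , j) → i ℕ./ k , j ℕ./ k)
           (λ { {i , j} refl → sym (ℕₚ.*-distribʳ-+ k i j) , divides i refl })
           (λ { {i , j} (eq , d) → back i j eq d })
           (λ { {i , j} _ → cong₂ _,_ (m*n/n≡m i k) (m*n/n≡m j k) })
           (λ { {i , j} (eq , d) → cong₂ _,_ (m/n*n≡m d) (m/n*n≡m (∣m+n∣m⇒∣n (subst (k ∣_) (sym eq) (divides m refl)) d)) })
           (λ {(i , j)} _ → sym (cong₂ _⊗_ (dil-* k s i) (dil-* k t j))) ⟨
    ∑ (antidiagonal m) (λ (i , j) → s i ⊗ t j)               ≡⟨ ⋆-antidiagonal s t m ⟨
    (s ⋆ t) m                                                ∎
    where
    back : ∀ i j → i + j ≡ m * k → k ∣ i → i ℕ./ k + j ℕ./ k ≡ m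
    back i j eq d = trans (sym (+-distrib-/-∣ˡ j d)) (trans (cong (ℕ._/ k) eq) (m*n/n≡m m k))

dil-∑ : ∀ k .{{_ : NonZero k}} {w : A → ℕ} (EA : ∀ n → Enum (λ a → w a ≡ n)) (f : A → ℤ) {n} (E : Enum (λ a → w a * k ≡ n)) →
        ∑ E f ≡ dil k (λ m → ∑ (EA m) f) n
dil-∑ k {w} EA f {n} E with k ∣? n
... | yes (divides q refl) = ∑-same E (EA q) (λ {a} → ℕₚ.*-cancelʳ-≡ (w a) q k) (cong (_* k)) (λ _ → refl)
... | no  h                = ∑-0 E (λ {a} eq → contradiction (divides (w a) (sym eq)) h)

-- Theta series

intE : ∀ n → Enum (λ x → ℤ.∣ x ∣ ≤ n)
intE n = enum (map +_ (upTo (suc n)) ++ map -[1+_] (upTo n))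
  (Uniqueₚ.++⁺ (Uniqueₚ.map⁺ ℤₚ.+-injective (Uniqueₚ.upTo⁺ (suc n))) (Uniqueₚ.map⁺ ℤₚ.-[1+-injective (Uniqueₚ.upTo⁺ n)) disjoint)
  snd cmp
  where
  disjoint : ∀ {v} → ¬ (v ∈ map +_ (upTo (suc n)) × v ∈ map -[1+_] (upTo n))
  disjoint (p , q) with ∈ₚ.∈-map⁻ +_ p | ∈ₚ.∈-map⁻ -[1+_] q
  ... | _ , _ , refl | _ , _ , ()
  snd : ∀ {v} → v ∈ map +_ (upTo (suc n)) ++ map -[1+_] (upTo n) → ℤ.∣ v ∣ ≤ n
  snd v∈ with ∈ₚ.∈-++⁻ (map +_ (upTo (suc n))) v∈
  ... | inj₁ p with ∈ₚ.∈-map⁻ +_ p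
  ...   | i , i∈ , refl = ℕₚ.≤-pred (∈ₚ.∈-upTo⁻ i∈)
  snd v∈ | inj₂ q with ∈ₚ.∈-map⁻ -[1+_] q
  ...   | i , i∈ , refl = ∈ₚ.∈-upTo⁻ i∈
  cmp : ∀ {v} → ℤ.∣ v ∣ ≤ n → v ∈ map +_ (upTo (suc n)) ++ map -[1+_] (upTo n)
  cmp {+ i}      h = ∈ₚ.∈-++⁺ˡ (∈ₚ.∈-map⁺ +_ (∈ₚ.∈-upTo⁺ (s≤s h)))
  cmp { -[1+ i ]} h = ∈ₚ.∈-++⁺ʳ (map +_ (upTo (suc n))) (∈ₚ.∈-map⁺ -[1+_] (∈ₚ.∈-upTo⁺ h))

levelE : (w : ℤ → ℕ) → (∀ x → ℤ.∣ x ∣ ≤ w x) → ∀ n → Enum (λ x → w x ≡ n)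
levelE w bound n = sameE (filterE (λ x → w x ℕ.≟ n) (intE n)) proj₂ (λ { {x} refl → bound x , refl })

sq : ℤ → ℕ
sq x = ℤ.∣ x ∣ * ℤ.∣ x ∣

odd : ℤ → ℤ
odd k = + 1 ⊕ (k ⊕ k)

n≤n*n : ∀ n → n ≤ n * n
n≤n*n zero    = z≤n
n≤n*n (suc n) = ℕₚ.m≤m*n (suc n) (suc n)

∣k∣≤∣odd∣ : ∀ k → ℤ.∣ k ∣ ≤ ℤ.∣ odd k ∣
∣k∣≤∣odd∣ (+ k)      = ℕₚ.≤-trans (ℕₚ.m≤m+n k k) (ℕₚ.n≤1+n (k + k))
∣k∣≤∣odd∣ -[1+ k ]   = s≤s (ℕₚ.m≤m+n k k)

∣x∣≤sq : ∀ x → ℤ.∣ x ∣ ≤ sq x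
∣x∣≤sq x = n≤n*n ℤ.∣ x ∣

sqE : ∀ n → Enum (λ x → sq x ≡ n)
sqE = levelE sq ∣x∣≤sq

oddE : ∀ n → Enum (λ k → sq (odd k) ≡ n)
oddE = levelE (sq ∘ odd) (λ k → ℕₚ.≤-trans (∣k∣≤∣odd∣ k) (n≤n*n _))

count : Enum P → ℤ
count e = ∑ e (λ _ → + 1)

φ O : Seq
φ n = count (sqE n)
O n = count (oddE n)

+-sq : ∀ x → + sq x ≡ x ⊗ x
+-sq (+ n)    = ℤₚ.pos-* n n
+-sq -[1+ n ] = refl

module _ where
  open ≡-Reasoning

  +-+* : ∀ a x k y → + (sq x * a + sq y * k) ≡ x ⊗ x ⊗ + a ⊕ y ⊗ y ⊗ + k
  +-+* a x k y = trans (ℤₚ.pos-+ (sq x * a) (sq y * k))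
    (cong₂ _⊕_ (trans (ℤₚ.pos-* (sq x) a) (cong (_⊗ + a) (+-sq x))) (trans (ℤₚ.pos-* (sq y) k) (cong (_⊗ + k) (+-sq y))))

  -- Weights are natural numbers while the changes of variables are identities of integer
  -- polynomials; this carries the latter over to the former.
  weigh : ∀ a x k y a′ x′ k′ y′ → x ⊗ x ⊗ + a ⊕ y ⊗ y ⊗ + k ≡ x′ ⊗ x′ ⊗ + a′ ⊕ y′ ⊗ y′ ⊗ + k′ →
          sq x * a + sq y * k ≡ sq x′ * a′ + sq y′ * k′
  weigh a x k y a′ x′ k′ y′ eq = ℤₚ.+-injective (trans (+-+* a x k y) (trans eq (sym (+-+* a′ x′ k′ y′))))

Even : ℤ → Set
Even z = ∃ λ t → z ≡ t ⊕ t

Odd : ℤ → Set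
Odd z = ∃ λ t → z ≡ odd t

parity : ∀ z → Even z ⊎ Odd z
parity (+ zero)  = inj₁ (+ 0 , refl)
parity (+ suc n) with parity (+ n)
... | inj₁ (t , eq) = inj₂ (t , cong (+ 1 ⊕_) eq)
... | inj₂ (t , eq) = inj₁ (+ 1 ⊕ t , trans (cong (+ 1 ⊕_) eq) (lemma t))
  where
  lemma : ∀ t → + 1 ⊕ (+ 1 ⊕ (t ⊕ t)) ≡ (+ 1 ⊕ t) ⊕ (+ 1 ⊕ t)
  lemma = solve-∀
parity -[1+ zero ]  = inj₂ (ℤ.-1ℤ , refl)
parity -[1+ suc n ] with parity -[1+ n ]
... | inj₁ (t , eq) = inj₂ (ℤ.-1ℤ ⊕ t , trans (cong (ℤ.-1ℤ ⊕_) eq) (lemma t))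
  where
  lemma : ∀ t → ℤ.-1ℤ ⊕ (t ⊕ t) ≡ + 1 ⊕ ((ℤ.-1ℤ ⊕ t) ⊕ (ℤ.-1ℤ ⊕ t))
  lemma = solve-∀
... | inj₂ (t , eq) = inj₁ (t , trans (cong (ℤ.-1ℤ ⊕_) eq) (lemma t))
  where
  lemma : ∀ t → ℤ.-1ℤ ⊕ (+ 1 ⊕ (t ⊕ t)) ≡ t ⊕ t
  lemma = solve-∀

double-injective : ∀ {s t} → s ⊕ s ≡ t ⊕ t → s ≡ t
double-injective {s} {t} eq = ℤₚ.*-cancelˡ-≡ (+ 2) s t (trans (double s) (trans eq (sym (double t))))
  where
  double : ∀ s → + 2 ⊗ s ≡ s ⊕ s
  double = solve-∀

Even⇒¬Odd : ∀ {z} → Even z → ¬ Odd z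
Even⇒¬Odd (s , refl) (t , eq) = no-half (s ⊖ t) (trans (lemma s t) (trans (cong (_⊖ (t ⊕ t)) eq) (lemma′ t)))
  where
  lemma : ∀ s t → (s ⊖ t) ⊕ (s ⊖ t) ≡ (s ⊕ s) ⊖ (t ⊕ t)
  lemma = solve-∀
  lemma′ : ∀ t → (+ 1 ⊕ (t ⊕ t)) ⊖ (t ⊕ t) ≡ + 1
  lemma′ = solve-∀
  no-half : ∀ u → u ⊕ u ≢ + 1
  no-half (+ zero)        ()
  no-half (+ suc zero)    ()
  no-half (+ suc (suc n)) eq with ℤₚ.+-injective eq
  ... | ()
  no-half -[1+ n ] ()

even? : ∀ z → Dec (Even z)
even? z with parity z
... | inj₁ e = yes e
... | inj₂ o = no (λ e → Even⇒¬Odd e o)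

¬Even⇒Odd : ∀ {z} → ¬ Even z → Odd z
¬Even⇒Odd {z} h with parity z
... | inj₁ e = contradiction e h
... | inj₂ o = o

-- The floor of z/2, a total function, so that the maps in the bijections need no parity proof as an
-- argument.
half : ℤ → ℤ
half z with parity z
... | inj₁ (t , _) = t
... | inj₂ (t , _) = t

half-even : ∀ {z} t → z ≡ t ⊕ t → half z ≡ t
half-even {z} t eq with parity z
... | inj₁ (s , eq′) = double-injective (trans (sym eq′) eq)
... | inj₂ o         = contradiction o (Even⇒¬Odd (t , eq))

half-odd : ∀ {z} t → z ≡ odd t → half z ≡ t
half-odd {z} t eq with parity z
... | inj₁ e         = contradiction (t , eq) (Even⇒¬Odd e)
... | inj₂ (s , eq′) = double-injective (+-cancelˡ (+ 1) _ _ (trans (sym eq′) eq))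

-- Lattice identities between theta series

scaledE : (w : ℤ → ℕ) → (∀ x → ℤ.∣ x ∣ ≤ w x) → ∀ k .{{_ : NonZero k}} n → Enum (λ x → w x * k ≡ n)
scaledE w bound k = levelE (λ x → w x * k) (λ x → ℕₚ.≤-trans (bound x) (ℕₚ.m≤m*n (w x) k))

φE : ∀ k .{{_ : NonZero k}} n → Enum (λ x → sq x * k ≡ n)
φE = scaledE sq ∣x∣≤sq

OE : ∀ k .{{_ : NonZero k}} n → Enum (λ x → sq (odd x) * k ≡ n)
OE = scaledE (sq ∘ odd) (λ k → ℕₚ.≤-trans (∣k∣≤∣odd∣ k) (n≤n*n _))

φE-count : ∀ k .{{_ : NonZero k}} n → count (φE k n) ≡ dil k φ n
φE-count k n = dil-∑ k sqE (λ _ → + 1) (φE k n)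

OE-count : ∀ k .{{_ : NonZero k}} n → count (OE k n) ≡ dil k O n
OE-count k n = dil-∑ k oddE (λ _ → + 1) (OE k n)

dil-1 : ∀ s → dil 1 s ≈ s
dil-1 s n = trans (cong (dil 1 s) (sym (ℕₚ.*-identityʳ n))) (dil-* 1 s n)

φφE : ∀ a b .{{_ : NonZero a}} .{{_ : NonZero b}} n → Enum (λ (xy : ℤ × ℤ) → sq (proj₁ xy) * a + sq (proj₂ xy) * b ≡ n)
φφE a b = pairE (φE a) (φE b)

OφE : ∀ a b .{{_ : NonZero a}} .{{_ : NonZero b}} n → Enum (λ (xy : ℤ × ℤ) → sq (odd (proj₁ xy)) * a + sq (proj₂ xy) * b ≡ n)
OφE a b = pairE (OE a) (φE b)

OOE : ∀ a b .{{_ : NonZero a}} .{{_ : NonZero b}} n → Enum (λ (xy : ℤ × ℤ) → sq (odd (proj₁ xy)) * a + sq (odd (proj₂ xy)) * b ≡ n)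
OOE a b = pairE (OE a) (OE b)

φφE-count : ∀ a b .{{_ : NonZero a}} .{{_ : NonZero b}} n → count (φφE a b n) ≡ (dil a φ ⋆ dil b φ) n
φφE-count a b n = trans (⋆-∑ (φE a) (φE b) (φφE a b n) (λ _ → + 1) (λ _ → + 1)) (⋆-cong (φE-count a) (φE-count b) n)

OφE-count : ∀ a b .{{_ : NonZero a}} .{{_ : NonZero b}} n → count (OφE a b n) ≡ (dil a O ⋆ dil b φ) n
OφE-count a b n = trans (⋆-∑ (OE a) (φE b) (OφE a b n) (λ _ → + 1) (λ _ → + 1)) (⋆-cong (OE-count a) (φE-count b) n)

OOE-count : ∀ a b .{{_ : NonZero a}} .{{_ : NonZero b}} n → count (OOE a b n) ≡ (dil a O ⋆ dil b O) n
OOE-count a b n = trans (⋆-∑ (OE a) (OE b) (OOE a b n) (λ _ → + 1) (λ _ → + 1)) (⋆-cong (OE-count a) (OE-count b) n)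

-- (x + y)/2 and (x − y)/2 for odd x and y are of opposite parity.
O² : O ⋆ O ≈ (+ 2) · (dil 2 O ⋆ dil 8 φ)
O² n = begin
  (O ⋆ O) n
    ≡⟨ ⋆-cong (dil-1 O) (dil-1 O) n ⟨
  (dil 1 O ⋆ dil 1 O) n
    ≡⟨ OOE-count 1 1 n ⟨
  count (OOE 1 1 n)
    ≡⟨ ∑-split same? (OOE 1 1 n) _ ⟩
  count (filterE same? (OOE 1 1 n)) ⊕ count (filterE (¬? ∘ same?) (OOE 1 1 n))
    ≡⟨ cong₂ _⊕_ sames opposites ⟩
  count (OφE 2 8 n) ⊕ count (OφE 2 8 n)
    ≡⟨ double (count (OφE 2 8 n)) ⟩
  + 2 ⊗ count (OφE 2 8 n)
    ≡⟨ cong (+ 2 ⊗_) (OφE-count 2 8 n) ⟩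
  + 2 ⊗ (dil 2 O ⋆ dil 8 φ) n ∎
  where
  open ≡-Reasoning
  double : ∀ s → s ⊕ s ≡ + 2 ⊗ s
  double = solve-∀
  same? : ∀ jk → Dec (Even (proj₁ jk ⊖ proj₂ jk))
  same? (j , k) = even? (j ⊖ k)
  k+2t : ∀ {j k} t → j ⊖ k ≡ t → j ≡ k ⊕ t
  k+2t {j} {k} t refl = lemma j k
    where
    lemma : ∀ j k → j ≡ k ⊕ (j ⊖ k)
    lemma = solve-∀
  sames : count (filterE same? (OOE 1 1 n)) ≡ count (OφE 2 8 n)
  sames = ∑-bij (filterE same? (OOE 1 1 n)) (OφE 2 8 n)
    (λ (j , k) → k ⊕ half (j ⊖ k) , half (j ⊖ k)) (λ (s , t) → s ⊕ t , s ⊖ t)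
    (λ { {j , k} (eq , t , e) → trans (to j k t e) eq })
    (λ { {s , t} eq → trans (from s t) eq , t , diff s t })
    (λ { {j , k} (_ , t , e) → from-to j k t e })
    (λ { {s , t} _ → to-from s t }) (λ _ → refl)
    where
    to : ∀ j k t → j ⊖ k ≡ t ⊕ t → sq (odd (k ⊕ half (j ⊖ k))) * 2 + sq (half (j ⊖ k)) * 8 ≡ sq (odd j) * 1 + sq (odd k) * 1
    to j k t e rewrite half-even t e | k+2t {j} {k} (t ⊕ t) e = weigh 2 (odd (k ⊕ t)) 8 t 1 (odd (k ⊕ (t ⊕ t))) 1 (odd k) (lemma k t)
      where
      lemma : ∀ k t → ((+ 1 ⊕ ((k ⊕ t) ⊕ (k ⊕ t)))) ⊗ ((+ 1 ⊕ ((k ⊕ t) ⊕ (k ⊕ t)))) ⊗ + 2 ⊕ t ⊗ t ⊗ + 8 ≡ (+ 1 ⊕ ((k ⊕ (t ⊕ t)) ⊕ (k ⊕ (t ⊕ t)))) ⊗ (+ 1 ⊕ ((k ⊕ (t ⊕ t)) ⊕ (k ⊕ (t ⊕ t)))) ⊗ + 1 ⊕ (+ 1 ⊕ (k ⊕ k)) ⊗ (+ 1 ⊕ (k ⊕ k)) ⊗ + 1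
      lemma = solve-∀
    from : ∀ s t → sq (odd (s ⊕ t)) * 1 + sq (odd (s ⊖ t)) * 1 ≡ sq (odd s) * 2 + sq t * 8
    from s t = weigh 1 (odd (s ⊕ t)) 1 (odd (s ⊖ t)) 2 (odd s) 8 t (lemma s t)
      where
      lemma : ∀ s t → (+ 1 ⊕ ((s ⊕ t) ⊕ (s ⊕ t))) ⊗ (+ 1 ⊕ ((s ⊕ t) ⊕ (s ⊕ t))) ⊗ + 1 ⊕ (+ 1 ⊕ ((s ⊖ t) ⊕ (s ⊖ t))) ⊗ (+ 1 ⊕ ((s ⊖ t) ⊕ (s ⊖ t))) ⊗ + 1 ≡ (+ 1 ⊕ (s ⊕ s)) ⊗ (+ 1 ⊕ (s ⊕ s)) ⊗ + 2 ⊕ t ⊗ t ⊗ + 8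
      lemma = solve-∀
    diff : ∀ s t → (s ⊕ t) ⊖ (s ⊖ t) ≡ t ⊕ t
    diff = solve-∀
    from-to : ∀ j k t → j ⊖ k ≡ t ⊕ t → ((k ⊕ half (j ⊖ k)) ⊕ half (j ⊖ k) , (k ⊕ half (j ⊖ k)) ⊖ half (j ⊖ k)) ≡ (j , k)
    from-to j k t e rewrite half-even t e | k+2t {j} {k} (t ⊕ t) e = cong₂ _,_ (lemma k t) (lemma′ k t)
      where
      lemma : ∀ k t → (k ⊕ t) ⊕ t ≡ k ⊕ (t ⊕ t)
      lemma = solve-∀
      lemma′ : ∀ k t → (k ⊕ t) ⊖ t ≡ k
      lemma′ = solve-∀
    to-from : ∀ s t → ((s ⊖ t) ⊕ half ((s ⊕ t) ⊖ (s ⊖ t)) , half ((s ⊕ t) ⊖ (s ⊖ t))) ≡ (s , t)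
    to-from s t rewrite half-even t (diff s t) = cong (_, t) (lemma s t)
      where
      lemma : ∀ s t → (s ⊖ t) ⊕ t ≡ s
      lemma = solve-∀
  opposites : count (filterE (¬? ∘ same?) (OOE 1 1 n)) ≡ count (OφE 2 8 n)
  opposites = ∑-bij (filterE (¬? ∘ same?) (OOE 1 1 n)) (OφE 2 8 n)
    (λ (j , k) → half (j ⊖ k) , j ⊖ half (j ⊖ k)) (λ (s , t) → s ⊕ t , t ⊖ s ⊖ + 1)
    (λ { {j , k} (eq , h) → let (t , e) = ¬Even⇒Odd h in trans (to j k t e) eq })
    (λ { {s , t} eq → trans (from s t) eq , λ e → Even⇒¬Odd e (s , diff s t) })
    (λ { {j , k} (_ , h) → let (t , e) = ¬Even⇒Odd h in from-to j k t e })
    (λ { {s , t} _ → to-from s t }) (λ _ → refl)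
    where
    to : ∀ j k s → j ⊖ k ≡ odd s → sq (odd (half (j ⊖ k))) * 2 + sq (j ⊖ half (j ⊖ k)) * 8 ≡ sq (odd j) * 1 + sq (odd k) * 1
    to j k s e rewrite half-odd s e | k+2t {j} {k} (odd s) e = weigh 2 (odd s) 8 (k ⊕ odd s ⊖ s) 1 (odd (k ⊕ odd s)) 1 (odd k) (lemma k s)
      where
      lemma : ∀ k s → (+ 1 ⊕ (s ⊕ s)) ⊗ (+ 1 ⊕ (s ⊕ s)) ⊗ + 2 ⊕ (k ⊕ (+ 1 ⊕ (s ⊕ s)) ⊖ s) ⊗ (k ⊕ (+ 1 ⊕ (s ⊕ s)) ⊖ s) ⊗ + 8 ≡ (+ 1 ⊕ ((k ⊕ (+ 1 ⊕ (s ⊕ s))) ⊕ (k ⊕ (+ 1 ⊕ (s ⊕ s))))) ⊗ (+ 1 ⊕ ((k ⊕ (+ 1 ⊕ (s ⊕ s))) ⊕ (k ⊕ (+ 1 ⊕ (s ⊕ s))))) ⊗ + 1 ⊕ (+ 1 ⊕ (k ⊕ k)) ⊗ (+ 1 ⊕ (k ⊕ k)) ⊗ + 1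
      lemma = solve-∀
    from : ∀ s t → sq (odd (s ⊕ t)) * 1 + sq (odd (t ⊖ s ⊖ + 1)) * 1 ≡ sq (odd s) * 2 + sq t * 8
    from s t = weigh 1 (odd (s ⊕ t)) 1 (odd (t ⊖ s ⊖ + 1)) 2 (odd s) 8 t (lemma s t)
      where
      lemma : ∀ s t → (+ 1 ⊕ ((s ⊕ t) ⊕ (s ⊕ t))) ⊗ (+ 1 ⊕ ((s ⊕ t) ⊕ (s ⊕ t))) ⊗ + 1 ⊕ (+ 1 ⊕ ((t ⊖ s ⊖ + 1) ⊕ (t ⊖ s ⊖ + 1))) ⊗ (+ 1 ⊕ ((t ⊖ s ⊖ + 1) ⊕ (t ⊖ s ⊖ + 1))) ⊗ + 1 ≡ (+ 1 ⊕ (s ⊕ s)) ⊗ (+ 1 ⊕ (s ⊕ s)) ⊗ + 2 ⊕ t ⊗ t ⊗ + 8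
      lemma = solve-∀
    diff : ∀ s t → (s ⊕ t) ⊖ (t ⊖ s ⊖ + 1) ≡ (+ 1 ⊕ (s ⊕ s))
    diff = solve-∀
    from-to : ∀ j k s → j ⊖ k ≡ odd s → (half (j ⊖ k) ⊕ (j ⊖ half (j ⊖ k)) , (j ⊖ half (j ⊖ k)) ⊖ half (j ⊖ k) ⊖ + 1) ≡ (j , k)
    from-to j k s e rewrite half-odd s e | k+2t {j} {k} (odd s) e = cong₂ _,_ (lemma k s) (lemma′ k s)
      where
      lemma : ∀ k s → s ⊕ (k ⊕ (+ 1 ⊕ (s ⊕ s)) ⊖ s) ≡ k ⊕ (+ 1 ⊕ (s ⊕ s))
      lemma = solve-∀
      lemma′ : ∀ k s → (k ⊕ (+ 1 ⊕ (s ⊕ s)) ⊖ s) ⊖ s ⊖ + 1 ≡ k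
      lemma′ = solve-∀
    to-from : ∀ s t → (half ((s ⊕ t) ⊖ (t ⊖ s ⊖ + 1)) , (s ⊕ t) ⊖ half ((s ⊕ t) ⊖ (t ⊖ s ⊖ + 1))) ≡ (s , t)
    to-from s t rewrite half-odd s (diff s t) = cong (s ,_) (lemma s t)
      where
      lemma : ∀ s t → (s ⊕ t) ⊖ s ≡ t
      lemma = solve-∀

φ-split : φ ≈ dil 4 φ ⊞ O
φ-split n = trans (∑-split even? (sqE n) _) (cong₂ _⊕_ (trans evens (φE-count 4 n)) odds)
  where
  twice : ∀ t → sq (t ⊕ t) ≡ sq t * 4
  twice t = ℤₚ.+-injective (trans (+-sq (t ⊕ t)) (trans (lemma t) (sym (trans (ℤₚ.pos-* (sq t) 4) (cong (_⊗ + 4) (+-sq t))))))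
    where
    lemma : ∀ t → (t ⊕ t) ⊗ (t ⊕ t) ≡ t ⊗ t ⊗ + 4
    lemma = solve-∀
  evens : count (filterE even? (sqE n)) ≡ count (φE 4 n)
  evens = ∑-bij (filterE even? (sqE n)) (φE 4 n) half (λ t → t ⊕ t)
    (λ { {x} (eq , t , refl) → trans (cong (λ z → sq z * 4) (half-even t refl)) (trans (sym (twice t)) eq) })
    (λ { {t} eq → trans (twice t) eq , t , refl })
    (λ { {x} (_ , t , refl) → cong (λ z → z ⊕ z) (half-even t refl) })
    (λ { {t} _ → half-even t refl }) (λ _ → refl)
  odds : count (filterE (¬? ∘ even?) (sqE n)) ≡ count (oddE n)
  odds = ∑-bij (filterE (¬? ∘ even?) (sqE n)) (oddE n) half odd
    (λ { {x} (eq , h) → let (t , e) = ¬Even⇒Odd h in trans (cong sq (trans (cong odd (half-odd t e)) (sym e))) eq })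
    (λ { {t} eq → eq , λ e → Even⇒¬Odd e (t , refl) })
    (λ { {x} (_ , h) → let (t , e) = ¬Even⇒Odd h in trans (cong odd (half-odd t e)) (sym e) })
    (λ { {t} _ → half-odd t refl }) (λ _ → refl)

-- The square of φ

f : Seq
f = φ ⋆ φ

+-+*1 : ∀ x k y {n} → sq x * 1 + sq y * k ≡ n → x ⊗ x ⊕ y ⊗ y ⊗ + k ≡ + n
+-+*1 x k y eq = trans (cong (_⊕ y ⊗ y ⊗ + k) (sym (ℤₚ.*-identityʳ (x ⊗ x)))) (trans (sym (+-+* 1 x k y)) (cong +_ eq))

-- Multiplication by 1 + i in the Gaussian integers: (u , v) ↦ (u + v , u - v) doubles u² + v² and
-- reaches every pair of equal parity.
f-even : ∀ k → f (k * 2) ≡ f k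
f-even n = begin
  f (n * 2)                       ≡⟨ ⋆-cong (dil-1 φ) (dil-1 φ) (n * 2) ⟨
  (dil 1 φ ⋆ dil 1 φ) (n * 2)     ≡⟨ φφE-count 1 1 (n * 2) ⟨
  count (φφE 1 1 (n * 2))
    ≡⟨ ∑-bij (φφE 1 1 (n * 2)) (φφE 1 1 n)
         (λ (x , y) → y ⊕ half (x ⊖ y) , half (x ⊖ y)) (λ (u , v) → u ⊕ v , u ⊖ v)
         (λ { {x , y} eq → let (t , e) = same x y eq in to x y t e eq })
         (λ { {u , v} eq → trans (from u v) (trans (two u v) (cong (_* 2) eq)) })
         (λ { {x , y} eq → let (t , e) = same x y eq in from-to x y t e })
         (λ { {u , v} _ → to-from u v }) (λ _ → refl) ⟩
  count (φφE 1 1 n)               ≡⟨ φφE-count 1 1 n ⟩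
  (dil 1 φ ⋆ dil 1 φ) n           ≡⟨ ⋆-cong (dil-1 φ) (dil-1 φ) n ⟩
  f n                             ∎
  where
  open ≡-Reasoning
  y+2t : ∀ x y → x ≡ y ⊕ (x ⊖ y)
  y+2t = solve-∀
  same : ∀ x y → sq x * 1 + sq y * 1 ≡ n * 2 → Even (x ⊖ y)
  same x y eq with parity (x ⊖ y)
  ... | inj₁ e       = e
  ... | inj₂ (t , e) = contradiction (y ⊗ y ⊕ y ⊗ odd t ⊕ t ⊗ t ⊕ t ⊗ t ⊕ t ⊕ t , odd-sum) (Even⇒¬Odd {+ (n * 2)} (+ n , even-n))
    where
    double : ∀ m → m ⊗ + 2 ≡ m ⊕ m
    double = solve-∀
    even-n : + (n * 2) ≡ + n ⊕ + n
    even-n = trans (ℤₚ.pos-* n 2) (double (+ n))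
    lemma : ∀ y t → (y ⊕ (+ 1 ⊕ (t ⊕ t))) ⊗ (y ⊕ (+ 1 ⊕ (t ⊕ t))) ⊕ y ⊗ y ⊗ + 1 ≡
      + 1 ⊕ ((y ⊗ y ⊕ y ⊗ (+ 1 ⊕ (t ⊕ t)) ⊕ t ⊗ t ⊕ t ⊗ t ⊕ t ⊕ t) ⊕ (y ⊗ y ⊕ y ⊗ (+ 1 ⊕ (t ⊕ t)) ⊕ t ⊗ t ⊕ t ⊗ t ⊕ t ⊕ t))
    lemma = solve-∀
    odd-sum : + (n * 2) ≡ odd (y ⊗ y ⊕ y ⊗ odd t ⊕ t ⊗ t ⊕ t ⊗ t ⊕ t ⊕ t)
    odd-sum = trans (sym (+-+*1 x 1 y eq)) (trans (cong (λ z → z ⊗ z ⊕ y ⊗ y ⊗ + 1) (trans (y+2t x y) (cong (y ⊕_) e))) (lemma y t))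
  two : ∀ u v → sq u * 2 + sq v * 2 ≡ (sq u * 1 + sq v * 1) * 2
  two u v = trans (sym (ℕₚ.*-distribʳ-+ 2 (sq u) (sq v))) (cong (_* 2) (sym (cong₂ _+_ (ℕₚ.*-identityʳ (sq u)) (ℕₚ.*-identityʳ (sq v)))))
  from : ∀ u v → sq (u ⊕ v) * 1 + sq (u ⊖ v) * 1 ≡ sq u * 2 + sq v * 2
  from u v = weigh 1 (u ⊕ v) 1 (u ⊖ v) 2 u 2 v (lemma u v)
    where
    lemma : ∀ u v → (u ⊕ v) ⊗ (u ⊕ v) ⊗ + 1 ⊕ (u ⊖ v) ⊗ (u ⊖ v) ⊗ + 1 ≡ u ⊗ u ⊗ + 2 ⊕ v ⊗ v ⊗ + 2
    lemma = solve-∀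
  from-to : ∀ x y t → x ⊖ y ≡ t ⊕ t → ((y ⊕ half (x ⊖ y)) ⊕ half (x ⊖ y) , (y ⊕ half (x ⊖ y)) ⊖ half (x ⊖ y)) ≡ (x , y)
  from-to x y t e rewrite half-even t e = cong₂ _,_ (trans (ℤₚ.+-assoc y t t) (trans (cong (y ⊕_) (sym e)) (sym (y+2t x y)))) (lemma y t)
    where
    lemma : ∀ y t → (y ⊕ t) ⊖ t ≡ y
    lemma = solve-∀
  to : ∀ x y t → x ⊖ y ≡ t ⊕ t → sq x * 1 + sq y * 1 ≡ n * 2 → sq (y ⊕ half (x ⊖ y)) * 1 + sq (half (x ⊖ y)) * 1 ≡ n
  to x y t e eq = ℕₚ.*-cancelʳ-≡ _ n 2 (begin
    (sq u * 1 + sq v * 1) * 2              ≡⟨ two u v ⟨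
    sq u * 2 + sq v * 2                    ≡⟨ from u v ⟨
    sq (u ⊕ v) * 1 + sq (u ⊖ v) * 1        ≡⟨ cong (λ (x , y) → sq x * 1 + sq y * 1) (from-to x y t e) ⟩
    sq x * 1 + sq y * 1                    ≡⟨ eq ⟩
    n * 2                                  ∎)
    where
    u v : ℤ
    u = y ⊕ half (x ⊖ y)
    v = half (x ⊖ y)
  diff : ∀ u v → (u ⊕ v) ⊖ (u ⊖ v) ≡ v ⊕ v
  diff = solve-∀
  to-from : ∀ u v → ((u ⊖ v) ⊕ half ((u ⊕ v) ⊖ (u ⊖ v)) , half ((u ⊕ v) ⊖ (u ⊖ v))) ≡ (u , v)
  to-from u v rewrite half-even v (diff u v) = cong (_, v) (lemma u v)
    where
    lemma : ∀ u v → (u ⊖ v) ⊕ v ≡ u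
    lemma = solve-∀

-- The values x² + 7y² with x and y odd

Π : Seq
Π = O ⋆ dil 7 O

Π-count : ∀ n → Π n ≡ count (OOE 1 7 n)
Π-count n = trans (⋆-cong (≈-sym (dil-1 O)) (λ _ → refl) n) (sym (OOE-count 1 7 n))

same? : (jk : ℤ × ℤ) → Dec (Even (proj₁ jk ⊖ proj₂ jk))
same? (j , k) = even? (j ⊖ k)

-- odd (− 1 − k) = − odd k, so the reflection k ↦ − 1 − k swaps x ≡ y and x ≡ − y mod 4.
module Reflection (n : ℕ) where

  reflect : ℤ × ℤ → ℤ × ℤ
  reflect (j , k) = j , ⊝ (+ 1 ⊕ k)

  weight : ∀ j k → sq (odd j) * 1 + sq (odd (⊝ (+ 1 ⊕ k))) * 7 ≡ sq (odd j) * 1 + sq (odd k) * 7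
  weight j k = weigh 1 (odd j) 7 (odd (⊝ (+ 1 ⊕ k))) 1 (odd j) 7 (odd k) (lemma j k)
    where
    lemma : ∀ j k → (+ 1 ⊕ (j ⊕ j)) ⊗ (+ 1 ⊕ (j ⊕ j)) ⊗ + 1 ⊕ (+ 1 ⊕ (⊝ (+ 1 ⊕ k) ⊕ ⊝ (+ 1 ⊕ k))) ⊗ (+ 1 ⊕ (⊝ (+ 1 ⊕ k) ⊕ ⊝ (+ 1 ⊕ k))) ⊗ + 7 ≡
      (+ 1 ⊕ (j ⊕ j)) ⊗ (+ 1 ⊕ (j ⊕ j)) ⊗ + 1 ⊕ (+ 1 ⊕ (k ⊕ k)) ⊗ (+ 1 ⊕ (k ⊕ k)) ⊗ + 7
    lemma = solve-∀

  involutive : ∀ j k → reflect (reflect (j , k)) ≡ (j , k)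
  involutive j k = cong (j ,_) (lemma k)
    where
    lemma : ∀ k → ⊝ (+ 1 ⊕ ⊝ (+ 1 ⊕ k)) ≡ k
    lemma = solve-∀

  flip : ∀ j k → j ⊖ ⊝ (+ 1 ⊕ k) ≡ + 1 ⊕ ((j ⊖ k) ⊕ (k ⊕ k))
  flip = solve-∀

  even⇒odd : ∀ j k → Even (j ⊖ k) → Odd (j ⊖ ⊝ (+ 1 ⊕ k))
  even⇒odd j k (t , e) = t ⊕ k , trans (flip j k) (cong (+ 1 ⊕_) (trans (cong (_⊕ (k ⊕ k)) e) (lemma t k)))
    where
    lemma : ∀ t k → (t ⊕ t) ⊕ (k ⊕ k) ≡ (t ⊕ k) ⊕ (t ⊕ k)
    lemma = solve-∀

  odd⇒even : ∀ j k → Odd (j ⊖ k) → Even (j ⊖ ⊝ (+ 1 ⊕ k))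
  odd⇒even j k (t , e) = + 1 ⊕ t ⊕ k , trans (flip j k) (trans (cong (λ z → + 1 ⊕ (z ⊕ (k ⊕ k))) e) (lemma t k))
    where
    lemma : ∀ t k → + 1 ⊕ ((+ 1 ⊕ (t ⊕ t)) ⊕ (k ⊕ k)) ≡ (+ 1 ⊕ t ⊕ k) ⊕ (+ 1 ⊕ t ⊕ k)
    lemma = solve-∀

  halves : count (filterE same? (OOE 1 7 n)) ≡ count (filterE (¬? ∘ same?) (OOE 1 7 n))
  halves = ∑-bij (filterE same? (OOE 1 7 n)) (filterE (¬? ∘ same?) (OOE 1 7 n)) reflect reflect
    (λ { {j , k} (eq , e) → trans (weight j k) eq , λ e′ → Even⇒¬Odd e′ (even⇒odd j k e) })
    (λ { {j , k} (eq , h) → trans (weight j k) eq , odd⇒even j k (¬Even⇒Odd h) })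
    (λ { {j , k} _ → involutive j k }) (λ { {j , k} _ → involutive j k }) (λ _ → refl)

-- Division by (1 + √−7)/2 maps x + y√−7, x ≡ y mod 4, to (x + 7y)/4 + ((x − y)/4)√−7.
Π-double : ∀ k → Π (k * 16) ≡ Π (k * 8)
Π-double n = begin
  Π (n * 16)                                                 ≡⟨ Π-count (n * 16) ⟩
  count (OOE 1 7 (n * 16))                                   ≡⟨ ∑-split same? (OOE 1 7 (n * 16)) _ ⟩
  count S₊ ⊕ count (filterE (¬? ∘ same?) (OOE 1 7 (n * 16)))   ≡⟨ cong (count S₊ ⊕_) (sym (Reflection.halves (n * 16))) ⟩
  count S₊ ⊕ count S₊                                        ≡⟨ cong (λ c → c ⊕ c) divide ⟩
  count T₋ ⊕ count T₋                                        ≡⟨ cong (_⊕ count T₋) (sym (Reflection.halves (n * 8))) ⟩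
  count (filterE same? (OOE 1 7 (n * 8))) ⊕ count T₋         ≡⟨ ∑-split same? (OOE 1 7 (n * 8)) _ ⟨
  count (OOE 1 7 (n * 8))                                    ≡⟨ Π-count (n * 8) ⟨
  Π (n * 8)                                                  ∎
  where
  open ≡-Reasoning
  S₊ = filterE same? (OOE 1 7 (n * 16))
  T₋ = filterE (¬? ∘ same?) (OOE 1 7 (n * 8))
  k+d : ∀ j k → j ≡ k ⊕ (j ⊖ k)
  k+d = solve-∀
  -- For x = `odd j` and y = `odd k`, t is (x - y)/4. Were it even, x² + 7y² would be 8 times the
  -- odd number 1 + 2w and not a multiple of 16.
  t-odd : ∀ j k t → j ⊖ k ≡ t ⊕ t → sq (odd j) * 1 + sq (odd k) * 7 ≡ n * 16 → Odd t
  t-odd j k t e eq with parity t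
  ... | inj₂ o          = o
  ... | inj₁ (s , refl) = contradiction (w , ℤₚ.*-cancelˡ-≡ (+ 8) (+ n ⊕ + n) (odd w) eq₈) (Even⇒¬Odd (+ n , refl))
    where
    w : ℤ
    w = k ⊕ k ⊕ k ⊗ k ⊕ k ⊗ k ⊕ odd k ⊗ s ⊕ + 4 ⊗ s ⊗ s
    sixteen : ∀ m → + 8 ⊗ (m ⊕ m) ≡ m ⊗ + 16
    sixteen = solve-∀
    lemma : ∀ k s → (+ 1 ⊕ ((k ⊕ ((s ⊕ s) ⊕ (s ⊕ s))) ⊕ (k ⊕ ((s ⊕ s) ⊕ (s ⊕ s))))) ⊗ (+ 1 ⊕ ((k ⊕ ((s ⊕ s) ⊕ (s ⊕ s))) ⊕ (k ⊕ ((s ⊕ s) ⊕ (s ⊕ s))))) ⊕ (+ 1 ⊕ (k ⊕ k)) ⊗ (+ 1 ⊕ (k ⊕ k)) ⊗ + 7 ≡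
      + 8 ⊗ (+ 1 ⊕ ((k ⊕ k ⊕ k ⊗ k ⊕ k ⊗ k ⊕ (+ 1 ⊕ (k ⊕ k)) ⊗ s ⊕ + 4 ⊗ s ⊗ s) ⊕ (k ⊕ k ⊕ k ⊗ k ⊕ k ⊗ k ⊕ (+ 1 ⊕ (k ⊕ k)) ⊗ s ⊕ + 4 ⊗ s ⊗ s)))
    lemma = solve-∀
    eq₈ : + 8 ⊗ (+ n ⊕ + n) ≡ + 8 ⊗ odd w
    eq₈ = begin
      + 8 ⊗ (+ n ⊕ + n)                              ≡⟨ sixteen (+ n) ⟩
      + n ⊗ + 16                                     ≡⟨ ℤₚ.pos-* n 16 ⟨
      + (n * 16)                                     ≡⟨ +-+*1 (odd j) 7 (odd k) eq ⟨
      odd j ⊗ odd j ⊕ odd k ⊗ odd k ⊗ + 7            ≡⟨ cong (λ z → odd z ⊗ odd z ⊕ odd k ⊗ odd k ⊗ + 7) (trans (k+d j k) (cong (k ⊕_) e)) ⟩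
      odd (k ⊕ ((s ⊕ s) ⊕ (s ⊕ s))) ⊗ odd (k ⊕ ((s ⊕ s) ⊕ (s ⊕ s))) ⊕ odd k ⊗ odd k ⊗ + 7   ≡⟨ lemma k s ⟩
      + 8 ⊗ odd w                                    ∎
  weight : ∀ k s → sq (odd (k ⊕ (odd s ⊕ odd s))) * 1 + sq (odd k) * 7 ≡ (sq (odd (odd k ⊕ s)) * 1 + sq (odd s) * 7) * 2
  weight k s = trans (weigh 1 (odd (k ⊕ (odd s ⊕ odd s))) 7 (odd k) 2 (odd (odd k ⊕ s)) 14 (odd s) (lemma k s))
                     (sym (trans (ℕₚ.*-distribʳ-+ 2 (sq (odd (odd k ⊕ s)) * 1) _) (cong₂ _+_ (ℕₚ.*-assoc (sq (odd (odd k ⊕ s))) 1 2) (ℕₚ.*-assoc (sq (odd s)) 7 2))))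
    where
    lemma : ∀ k s → (+ 1 ⊕ ((k ⊕ ((+ 1 ⊕ (s ⊕ s)) ⊕ (+ 1 ⊕ (s ⊕ s)))) ⊕ (k ⊕ ((+ 1 ⊕ (s ⊕ s)) ⊕ (+ 1 ⊕ (s ⊕ s)))))) ⊗ (+ 1 ⊕ ((k ⊕ ((+ 1 ⊕ (s ⊕ s)) ⊕ (+ 1 ⊕ (s ⊕ s)))) ⊕ (k ⊕ ((+ 1 ⊕ (s ⊕ s)) ⊕ (+ 1 ⊕ (s ⊕ s)))))) ⊗ + 1 ⊕ (+ 1 ⊕ (k ⊕ k)) ⊗ (+ 1 ⊕ (k ⊕ k)) ⊗ + 7 ≡
      (+ 1 ⊕ (((+ 1 ⊕ (k ⊕ k)) ⊕ s) ⊕ ((+ 1 ⊕ (k ⊕ k)) ⊕ s))) ⊗ (+ 1 ⊕ (((+ 1 ⊕ (k ⊕ k)) ⊕ s) ⊕ ((+ 1 ⊕ (k ⊕ k)) ⊕ s))) ⊗ + 2 ⊕ (+ 1 ⊕ (s ⊕ s)) ⊗ (+ 1 ⊕ (s ⊕ s)) ⊗ + 14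
    lemma = solve-∀
  to from : ℤ × ℤ → ℤ × ℤ
  to (j , k) = odd k ⊕ half (half (j ⊖ k)) , half (half (j ⊖ k))
  from (J , L) = half (J ⊖ L) ⊕ (odd L ⊕ odd L) , half (J ⊖ L)
  to-eq : ∀ j k s → j ⊖ k ≡ odd s ⊕ odd s → to (j , k) ≡ (odd k ⊕ s , s)
  to-eq j k s e rewrite half-even (odd s) e | half-odd {odd s} s refl = refl
  from-eq : ∀ J L k → J ⊖ L ≡ odd k → from (J , L) ≡ (k ⊕ (odd L ⊕ odd L) , k)
  from-eq J L k e rewrite half-odd k e = refl
  diff : ∀ k s → (odd k ⊕ s) ⊖ s ≡ odd k
  diff k s = lemma (odd k) s
    where
    lemma : ∀ x s → (x ⊕ s) ⊖ s ≡ x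
    lemma = solve-∀
  diff′ : ∀ k u → (k ⊕ u) ⊖ k ≡ u
  diff′ = solve-∀
  cases : ∀ j k → sq (odd j) * 1 + sq (odd k) * 7 ≡ n * 16 × Even (j ⊖ k) → ∃ λ s → j ⊖ k ≡ odd s ⊕ odd s
  cases j k (eq , t , e) with t-odd j k t e eq
  ... | s , refl = s , e
  divide : count S₊ ≡ count T₋
  divide = ∑-bij S₊ T₋ to from
    (λ { {j , k} p → let (s , e) = cases j k p in
         subst (λ (J , L) → sq (odd J) * 1 + sq (odd L) * 7 ≡ n * 8 × ¬ Even (J ⊖ L)) (sym (to-eq j k s e))
           (ℕₚ.*-cancelʳ-≡ _ (n * 8) 2 (trans (sym (weight k s)) (trans (cong (λ z → sq (odd z) * 1 + sq (odd k) * 7) (sym (trans (k+d j k) (cong (k ⊕_) e))))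
              (trans (proj₁ p) (sym (ℕₚ.*-assoc n 8 2)))))
           , λ e′ → Even⇒¬Odd e′ (k , diff k s)) })
    (λ { {J , L} (eq , h) → let (k , e) = ¬Even⇒Odd h in
         subst (λ (j , k) → sq (odd j) * 1 + sq (odd k) * 7 ≡ n * 16 × Even (j ⊖ k)) (sym (from-eq J L k e))
           (trans (weight k L) (trans (cong (_* 2) (trans (cong (λ z → sq (odd z) * 1 + sq (odd L) * 7) (sym (trans (k+d′ J L) (cong (_⊕ L) e)))) eq)) (ℕₚ.*-assoc n 8 2))
           , odd L , diff′ k (odd L ⊕ odd L)) })
    (λ { {j , k} p → let (s , e) = cases j k p in
         trans (cong from (to-eq j k s e)) (trans (from-eq (odd k ⊕ s) s k (diff k s)) (cong (_, k) (sym (trans (k+d j k) (cong (k ⊕_) e))))) })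
    (λ { {J , L} (eq , h) → let (k , e) = ¬Even⇒Odd h in
         trans (cong to (from-eq J L k e)) (trans (to-eq (k ⊕ (odd L ⊕ odd L)) k L (diff′ k (odd L ⊕ odd L))) (cong (_, L) (sym (trans (k+d′ J L) (cong (_⊕ L) e))))) })
    (λ _ → refl)
    where
    k+d′ : ∀ J L → J ≡ (J ⊖ L) ⊕ L
    k+d′ = solve-∀

-- Supports in residue classes

Supp : (m : ℕ) .{{_ : NonZero m}} → ℕ → Seq → Set
Supp m r s = ∀ n → n % m ≢ r → s n ≡ + 0

supp-⋆ : ∀ m .{{_ : NonZero m}} {r r′ s t} → Supp m r s → Supp m r′ t → Supp m ((r + r′) % m) (s ⋆ t)
supp-⋆ m {r} {r′} {s} {t} hs ht n n≢ = trans (⋆-antidiagonal s t n) (∑-0 (antidiagonal n) (λ {(i , j)} eq → term i j eq))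
  where
  term : ∀ i j → i + j ≡ n → s i ⊗ t j ≡ + 0
  term i j eq with i % m ℕ.≟ r | j % m ℕ.≟ r′
  ... | no h     | _        = cong (_⊗ t j) (hs i h)
  ... | yes _    | no h     = trans (cong (s i ⊗_) (ht j h)) (ℤₚ.*-zeroʳ (s i))
  ... | yes refl | yes refl = contradiction (trans (cong (_% m) (sym eq)) (%-distribˡ-+ i j m)) n≢

supp-dil : ∀ m .{{_ : NonZero m}} k s → m ∣ k → Supp m 0 (dil k s)
supp-dil m k s m∣k n n≢ = dil-∤ k s n (λ k∣n → n≢ (n∣m⇒m%n≡0 n m (∣-trans m∣k k∣n)))

odd-sq : ∀ k → ∃ λ T → sq (odd k) ≡ 1 + T * 8
odd-sq k = let (T , eq) = go (abs k) in T , trans (cong (λ z → z * z) (proj₂ (∣odd∣ k))) eq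
  where
  ∣odd∣ : ∀ k → ∃ λ j → ℤ.∣ odd k ∣ ≡ 1 + (j + j)
  ∣odd∣ (+ j)    = j , refl
  ∣odd∣ -[1+ j ] = j , refl
  abs : ℤ → ℕ
  abs k = proj₁ (∣odd∣ k)
  step : ∀ j → (1 + (suc j + suc j)) * (1 + (suc j + suc j)) ≡ (1 + (j + j)) * (1 + (j + j)) + suc j * 8
  step = ℕ-solve
  regroup : ∀ T j → 1 + T * 8 + suc j * 8 ≡ 1 + (T + suc j) * 8
  regroup = ℕ-solve
  go : ∀ j → ∃ λ T → (1 + (j + j)) * (1 + (j + j)) ≡ 1 + T * 8
  go zero    = 0 , refl
  go (suc j) = let (T , eq) = go j in T + suc j , trans (step j) (trans (cong (_+ suc j * 8) eq) (regroup T j))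

-- Odd squares are 1 modulo 8.
supp-O : ∀ m .{{_ : NonZero m}} c .{{_ : NonZero c}} → m ∣ 8 → Supp m (c % m) (dil c O)
supp-O m c (divides q m*q) n n≢ = trans (sym (OE-count c n)) (∑-0 (OE c n) (λ {k} eq → contradiction (residue k eq) n≢))
  where
  open ≡-Reasoning
  regroup : ∀ T c q m → (1 + T * (q * m)) * c ≡ c + (T * q * c) * m
  regroup = ℕ-solve
  residue : ∀ k → sq (odd k) * c ≡ n → n % m ≡ c % m
  residue k eq = let (T , e) = odd-sq k in begin
    n % m                         ≡⟨ cong (_% m) eq ⟨
    (sq (odd k) * c) % m          ≡⟨ cong (λ z → (z * c) % m) (trans e (cong (λ z → 1 + T * z) m*q)) ⟩
    ((1 + T * (q * m)) * c) % m   ≡⟨ cong (_% m) (regroup T c q m) ⟩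
    (c + (T * q * c) * m) % m     ≡⟨ [m+kn]%n≡m%n c (T * q * c) m ⟩
    c % m                         ∎

supp-O₁ : ∀ m .{{_ : NonZero m}} → m ∣ 8 → Supp m (1 % m) O
supp-O₁ m d n h = trans (sym (dil-1 O n)) (supp-O m 1 d n h)

8∣8 : 8 ∣ 8
8∣8 = divides 1 refl
4∣8 : 4 ∣ 8
4∣8 = divides 2 refl

refl≈ : ∀ {s} → s ≈ s
refl≈ _ = refl

·-cong : ∀ c {s t} → s ≈ t → c · s ≈ c · t
·-cong c h n = cong (c ⊗_) (h n)

⊞-cong : ∀ {s s′ t t′} → s ≈ s′ → t ≈ t′ → s ⊞ t ≈ s′ ⊞ t′
⊞-cong h k n = cong₂ _⊕_ (h n) (k n)

⋆-·· : ∀ c d s t → (c · s) ⋆ (d · t) ≈ (c ⊗ d) · (s ⋆ t)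
⋆-·· c d s t n = trans (⋆-·ˡ c s (d · t) n) (trans (cong (c ⊗_) (⋆-·ʳ d s t n)) (sym (ℤₚ.*-assoc c d _)))

⋆-expand : ∀ s t u v → (s ⊞ t) ⋆ (u ⊞ v) ≈ (s ⋆ u ⊞ s ⋆ v) ⊞ (t ⋆ u ⊞ t ⋆ v)
⋆-expand s t u v = ≈-trans (⋆-distribʳ s t (u ⊞ v)) (⊞-cong (⋆-distribˡ s u v) (⋆-distribˡ t u v))

-- Quadratic relations for φ² and O O_7

V : Seq
V = (+ 2) · (O ⋆ dil 4 φ)

supp-V : Supp 4 1 V
supp-V n h = trans (cong (+ 2 ⊗_) (supp-⋆ 4 (supp-O₁ 4 4∣8) (supp-dil 4 4 φ (divides 1 refl)) n h)) refl

-- Even exponents are settled by `f-even`. At odd ones, in the expansion of (φ_4 + O)² only the two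
-- mixed products survive, φ_4² and O² having even exponents.
f-V : f ≈ dil 2 f ⊞ V
f-V n with 2 ∣? n
... | yes (divides k refl) = trans (f-even k) (sym (trans (cong (f k ⊕_) (supp-V (k * 2) even)) (ℤₚ.+-identityʳ (f k))))
  where
  even : k * 2 % 4 ≢ 1
  even eq with trans (sym (m%[n*o]%o≡m%o′ (k * 2))) (trans (cong (_% 2) eq) refl) | m*n%n≡0 k 2
    where
    m%[n*o]%o≡m%o′ : ∀ m → m % 4 % 2 ≡ m % 2
    m%[n*o]%o≡m%o′ m = m∣n⇒o%n%m≡o%m 2 4 m (divides 2 refl)
  ... | e | z with trans (sym e) z
  ...   | ()
... | no h = begin
  f n                                                     ≡⟨ trans (⋆-cong φ-split φ-split n) (⋆-expand (dil 4 φ) O (dil 4 φ) O n) ⟩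
  (φ₄φ₄ ⊕ (dil 4 φ ⋆ O) n) ⊕ ((O ⋆ dil 4 φ) n ⊕ (O ⋆ O) n)   ≡⟨ cong₂ (λ a b → (a ⊕ (dil 4 φ ⋆ O) n) ⊕ ((O ⋆ dil 4 φ) n ⊕ b)) (off (dil 4 f) (supp-dil 2 4 f (divides 2 refl)) φ₄φ₄ (dil-⋆ 4 φ φ n)) O²-0 ⟩
  (+ 0 ⊕ (dil 4 φ ⋆ O) n) ⊕ ((O ⋆ dil 4 φ) n ⊕ + 0)       ≡⟨ cong (λ a → (+ 0 ⊕ a) ⊕ ((O ⋆ dil 4 φ) n ⊕ + 0)) (⋆-comm (dil 4 φ) O n) ⟩
  (+ 0 ⊕ (O ⋆ dil 4 φ) n) ⊕ ((O ⋆ dil 4 φ) n ⊕ + 0)       ≡⟨ collect ((O ⋆ dil 4 φ) n) ⟩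
  + 0 ⊕ V n                                               ∎
  where
  open ≡-Reasoning
  φ₄φ₄ : ℤ
  φ₄φ₄ = (dil 4 φ ⋆ dil 4 φ) n
  n%2≢0 : n % 2 ≢ 0
  n%2≢0 eq = h (m%n≡0⇒n∣m n 2 eq)
  off : ∀ s → Supp 2 0 s → ∀ z → s n ≡ z → z ≡ + 0
  off s hs z eq = trans (sym eq) (hs n n%2≢0)
  O²-0 : (O ⋆ O) n ≡ + 0
  O²-0 = trans (O² n) (cong (+ 2 ⊗_) (supp-⋆ 2 (supp-dil 2 2 O (divides 1 refl)) (supp-dil 2 8 φ (divides 4 refl)) n n%2≢0))
  collect : ∀ a → (+ 0 ⊕ a) ⊕ (a ⊕ + 0) ≡ + 0 ⊕ + 2 ⊗ a
  collect = solve-∀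

-- The relation `O²` says that O² = V_2, so that 4 O² φ_4² regroups as required.
V² : V ⋆ V ≈ (+ 4) · (dil 4 f ⋆ dil 2 V)
V² = ≈-trans (⋆-·· (+ 2) (+ 2) Oφ Oφ) (·-cong (+ 4) (≈-trans (⋆-exchange O (dil 4 φ) O (dil 4 φ))
  (≈-trans (⋆-comm (O ⋆ O) (dil 4 φ ⋆ dil 4 φ)) (⋆-cong (≈-sym (dil-⋆ 4 φ φ)) O²-V))))
  where
  Oφ : Seq
  Oφ = O ⋆ dil 4 φ
  O²-V : O ⋆ O ≈ dil 2 V
  O²-V = ≈-trans O² (≈-trans (·-cong (+ 2) (≈-trans (⋆-cong refl≈ (≈-sym (dil-dil 2 4 φ))) (≈-sym (dil-⋆ 2 O (dil 4 φ)))))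
    (≈-sym (dil-· 2 (+ 2) Oφ)))

π : Seq
π k = Π (k * 8)

-- For odd x and y, x² + 7y² ≡ 1 + 7 ≡ 0 modulo 8.
Π-π : Π ≈ dil 8 π
Π-π = dil-unique 8 π Π
  (λ n h → supp-⋆ 8 (supp-O₁ 8 8∣8) (supp-O 8 7 8∣8) n (λ eq → h (m%n≡0⇒n∣m n 8 eq)))
  (λ _ → refl)

π-double : ∀ k → π (k * 2) ≡ π k
π-double k = trans (cong Π (ℕₚ.*-assoc k 2 8)) (Π-double k)

Z : Seq
Z = φ ⋆ dil 7 φ

dil-injective : ∀ k .{{_ : NonZero k}} {s t} → dil k s ≈ dil k t → s ≈ t
dil-injective k {s} {t} h n = trans (sym (dil-* k s n)) (trans (h (n * k)) (dil-* k t n))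

O₇² : dil 7 O ⋆ dil 7 O ≈ (+ 2) · (dil 14 O ⋆ dil 56 φ)
O₇² = ≈-trans (≈-sym (dil-⋆ 7 O O)) (≈-trans (dil-cong 7 O²) (≈-trans (dil-· 7 (+ 2) (dil 2 O ⋆ dil 8 φ))
  (·-cong (+ 2) (≈-trans (dil-⋆ 7 (dil 2 O) (dil 8 φ)) (⋆-cong (dil-dil 7 2 O) (dil-dil 7 8 φ))))))

Z₈ : dil 8 Z ≈ dil 8 φ ⋆ dil 56 φ
Z₈ = ≈-trans (dil-⋆ 8 φ (dil 7 φ)) (⋆-cong refl≈ (dil-dil 8 7 φ))

Π₂ : dil 2 Π ≈ dil 2 O ⋆ dil 14 O
Π₂ = ≈-trans (dil-⋆ 2 O (dil 7 O)) (⋆-cong refl≈ (dil-dil 2 7 O))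

-- Apply `O²` to O² and to O_7²; the four factors regroup into φ_8 φ_56 and O_2 O_14.
Π² : Π ⋆ Π ≈ (+ 4) · (dil 8 Z ⋆ dil 2 Π)
Π² = ≈-trans (⋆-exchange O (dil 7 O) O (dil 7 O)) (≈-trans (⋆-cong O² O₇²) (≈-trans (⋆-·· (+ 2) (+ 2) (dil 2 O ⋆ dil 8 φ) (dil 14 O ⋆ dil 56 φ))
  (·-cong (+ 4) (≈-trans (⋆-exchange (dil 2 O) (dil 8 φ) (dil 14 O) (dil 56 φ))
    (≈-trans (⋆-comm (dil 2 O ⋆ dil 14 O) (dil 8 φ ⋆ dil 56 φ)) (⋆-cong (≈-sym Z₈) (≈-sym Π₂)))))))

dil-comm : ∀ j k .{{_ : NonZero j}} .{{_ : NonZero k}} s → dil j (dil k s) ≈ dil k (dil j s)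
dil-comm j k s = ≈-trans (dil-dil j k s) (≈-trans (λ n → cong (λ m → dil m s n) (ℕₚ.*-comm j k)) (≈-sym (dil-dil k j s)))

π² : π ⋆ π ≈ (+ 4) · (Z ⋆ dil 2 π)
π² = dil-injective 8 (≈-trans (dil-⋆ 8 π π) (≈-trans (⋆-cong (≈-sym Π-π) (≈-sym Π-π)) (≈-trans Π²
  (≈-trans (·-cong (+ 4) (≈-trans (⋆-cong refl≈ (≈-trans (dil-cong 2 Π-π) (dil-comm 2 8 π))) (≈-sym (dil-⋆ 8 Z (dil 2 π)))))
    (≈-sym (dil-· 8 (+ 4) (Z ⋆ dil 2 π)))))))

-- In (φ_4 + O)(φ_28 + O_7) the mixed products φ_4 O_7 and O φ_28 have exponents 3 and 1 modulo 4.
Z-parts : ∀ n → n % 4 ≢ 1 → n % 4 ≢ 3 → Z n ≡ dil 4 Z n ⊕ Π n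
Z-parts n n≢1 n≢3 = begin
  Z n
    ≡⟨ trans (⋆-cong φ-split (≈-trans (dil-cong 7 φ-split) (dil-⊞ 7 (dil 4 φ) O)) n) (⋆-expand (dil 4 φ) O (dil 7 (dil 4 φ)) (dil 7 O) n) ⟩
  ((dil 4 φ ⋆ dil 7 (dil 4 φ)) n ⊕ (dil 4 φ ⋆ dil 7 O) n) ⊕ ((O ⋆ dil 7 (dil 4 φ)) n ⊕ Π n)
    ≡⟨ cong₂ (λ a b → ((dil 4 φ ⋆ dil 7 (dil 4 φ)) n ⊕ a) ⊕ (b ⊕ Π n))
         (supp-⋆ 4 (supp-dil 4 4 φ (divides 1 refl)) (supp-O 4 7 4∣8) n n≢3)
         (supp-⋆ 4 (supp-O₁ 4 4∣8) φ₂₈ n n≢1) ⟩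
  ((dil 4 φ ⋆ dil 7 (dil 4 φ)) n ⊕ + 0) ⊕ (+ 0 ⊕ Π n)
    ≡⟨ cong₂ _⊕_ (trans (ℤₚ.+-identityʳ _) (trans (⋆-cong refl≈ (dil-comm 7 4 φ) n) (sym (dil-⋆ 4 φ (dil 7 φ) n)))) (ℤₚ.+-identityˡ (Π n)) ⟩
  dil 4 Z n ⊕ Π n ∎
  where
  open ≡-Reasoning
  φ₂₈ : Supp 4 0 (dil 7 (dil 4 φ))
  φ₂₈ m h = trans (dil-comm 7 4 φ m) (supp-dil 4 4 (dil 7 φ) (divides 1 refl) m h)

Z-4k+2 : ∀ k → Z (2 + k * 4) ≡ + 0
Z-4k+2 k = trans (Z-parts (2 + k * 4) (λ e → 2≢1 (trans (sym mod4) e)) (λ e → 2≢3 (trans (sym mod4) e)))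
  (cong₂ _⊕_ (dil-∤ 4 Z (2 + k * 4) (λ d → 2≢0 (trans (sym mod4) (n∣m⇒m%n≡0 (2 + k * 4) 4 d))))
    (trans (Π-π (2 + k * 4)) (dil-∤ 8 π (2 + k * 4) (λ d → 2≢0 (trans (sym mod4) (n∣m⇒m%n≡0 (2 + k * 4) 4 (∣-trans 4∣8 d)))))))
  where
  mod4 : (2 + k * 4) % 4 ≡ 2
  mod4 = [m+kn]%n≡m%n 2 k 4
  2≢0 : 2 ≢ 0
  2≢0 ()
  2≢1 : 2 ≢ 1
  2≢1 ()
  2≢3 : 2 ≢ 3
  2≢3 ()

Z-4k : ∀ k → Z (k * 4) ≡ Z k ⊕ dil 2 π k
Z-4k k = trans (Z-parts (k * 4) (λ e → 0≢1 (trans (sym mod4) e)) (λ e → 0≢3 (trans (sym mod4) e)))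
  (cong₂ _⊕_ (dil-* 4 Z k) (trans (Π-π (k * 4)) (trans (sym (dil-dil 4 2 π (k * 4))) (dil-* 4 (dil 2 π) k))))
  where
  mod4 : (k * 4) % 4 ≡ 0
  mod4 = m*n%n≡0 k 4
  0≢1 : 0 ≢ 1
  0≢1 ()
  0≢3 : 0 ≢ 3
  0≢3 ()

-- Sums over the solutions of a x + b y = n in positive integers; a pair (i , j) of naturals stands for (suc i , suc j).

divE : ∀ n → Enum (λ (ax : ℕ × ℕ) → suc (proj₁ ax) * suc (proj₂ ax) ≡ n)
divE n = sameE (filterE (λ (a , x) → suc a * suc x ℕ.≟ n) (ΣE (below n) (λ _ → below n))) proj₂
  (λ { {a , x} refl → (ℕₚ.m≤m*n (suc a) (suc x) , ℕₚ.m≤n*m (suc x) (suc a)) , refl })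

solutions : ∀ n → Enum (λ (s : (ℕ × ℕ) × (ℕ × ℕ)) →
  suc (proj₁ (proj₁ s)) * suc (proj₂ (proj₁ s)) + suc (proj₁ (proj₂ s)) * suc (proj₂ (proj₂ s)) ≡ n)
solutions = pairE divE divE

∑ₛ : ℕ → (ℕ → ℕ → ℕ → ℕ → ℤ) → ℤ
∑ₛ n h = ∑ (solutions n) (λ ((a , x) , (b , y)) → h (suc a) (suc b) (suc x) (suc y))

-- The solutions of a x + b y = n with y > x, in the coordinate z = y - x. The same equation
-- describes the solutions (a + b , b , x , z) whose first coefficient exceeds the second, so that
-- Euclid's step becomes a change of reading.
InQ : ℕ → (ℕ × ℕ) × (ℕ × ℕ) → Set
InQ n ((a , x) , (b , z)) = (suc a + suc b) * suc x + suc b * suc z ≡ n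

QE : ∀ n → Enum (InQ n)
QE n = sameE (filterE in? (ΣE (ΣE (below n) (λ _ → below n)) (λ _ → ΣE (below n) (λ _ → below n)))) proj₂
  (λ { {(a , x) , (b , z)} refl → bounds a x b z , refl })
  where
  in? : ∀ s → Dec (InQ n s)
  in? ((a , x) , (b , z)) = (suc a + suc b) * suc x + suc b * suc z ℕ.≟ n
  bounds : ∀ a x b z → let n = (suc a + suc b) * suc x + suc b * suc z in (a < n × x < n) × (b < n × z < n)
  bounds a x b z =
    (ℕₚ.≤-trans (ℕₚ.≤-trans (ℕₚ.m≤m+n (suc a) (suc b)) (ℕₚ.m≤m*n (suc a + suc b) (suc x))) (ℕₚ.m≤m+n _ _) ,
     ℕₚ.≤-trans (ℕₚ.m≤n*m (suc x) (suc a + suc b)) (ℕₚ.m≤m+n _ _)) ,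
    (ℕₚ.≤-trans (ℕₚ.m≤m*n (suc b) (suc z)) (ℕₚ.m≤n+m _ ((suc a + suc b) * suc x)) ,
     ℕₚ.≤-trans (ℕₚ.m≤n*m (suc z) (suc b)) (ℕₚ.m≤n+m _ ((suc a + suc b) * suc x)))

∑q : ℕ → (ℕ → ℕ → ℕ → ℕ → ℤ) → ℤ
∑q n h = ∑ (QE n) (λ ((a , x) , (b , z)) → h (suc a) (suc b) (suc x) (suc z))

-- The diagonal solutions: a d + b d = n with x = y = d, or d x + d y = n with equal coefficients.
InD : ℕ → (ℕ × ℕ) × ℕ → Set
InD n ((a , b) , d) = (suc a + suc b) * suc d ≡ n

DE : ∀ n → Enum (InD n)
DE n = sameE (filterE in? (ΣE (ΣE (below n) (λ _ → below n)) (λ _ → below n))) proj₂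
  (λ { {(a , b) , d} refl → bounds a b d , refl })
  where
  in? : ∀ s → Dec (InD n s)
  in? ((a , b) , d) = (suc a + suc b) * suc d ℕ.≟ n
  bounds : ∀ a b d → let n = (suc a + suc b) * suc d in (a < n × b < n) × d < n
  bounds a b d =
    (ℕₚ.≤-trans (ℕₚ.m≤m+n (suc a) (suc b)) (ℕₚ.m≤m*n _ (suc d)) , ℕₚ.≤-trans (ℕₚ.m≤n+m (suc b) (suc a)) (ℕₚ.m≤m*n _ (suc d))) ,
    ℕₚ.m≤n*m (suc d) (suc a + suc b)

∑d : ℕ → (ℕ → ℕ → ℕ → ℤ) → ℤ
∑d n h = ∑ (DE n) (λ ((a , b) , d) → h (suc a) (suc b) (suc d))

∑q-⊕ : ∀ n h k → ∑q n (λ a b x z → h a b x z ⊕ k a b x z) ≡ ∑q n h ⊕ ∑q n k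
∑q-⊕ n h k = ∑-⊕ (QE n) _ _

∑d-⊕ : ∀ n h k → ∑d n (λ a b d → h a b d ⊕ k a b d) ≡ ∑d n h ⊕ ∑d n k
∑d-⊕ n h k = ∑-⊕ (DE n) _ _

∑q-cong : ∀ n {h k} → (∀ a b x z → h a b x z ≡ k a b x z) → ∑q n h ≡ ∑q n k
∑q-cong n e = ∑-cong (QE n) (λ {((a , x) , (b , z))} _ → e (suc a) (suc b) (suc x) (suc z))

∑d-cong : ∀ n {h k} → (∀ a b d → h a b d ≡ k a b d) → ∑d n h ≡ ∑d n k
∑d-cong n e = ∑-cong (DE n) (λ {((a , b) , d)} _ → e (suc a) (suc b) (suc d))

∑ₛ-by-xy : ∀ n h → ∑ₛ n h ≡ (∑q n (λ a b x z → h a b x (x + z)) ⊕ ∑q n (λ a b x z → h b a (x + z) x)) ⊕ ∑d n (λ a b d → h a b d d)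
∑ₛ-by-xy n h = begin
  ∑ (solutions n) h′                                    ≡⟨ ∑-split x<y? (solutions n) h′ ⟩
  ∑ (filterE x<y? (solutions n)) h′ ⊕ ∑ R h′            ≡⟨ cong₂ _⊕_ less (∑-split y<x? R h′) ⟩
  ∑q n (λ a b x z → h a b x (x + z)) ⊕ (∑ (filterE y<x? R) h′ ⊕ ∑ (filterE (¬? ∘ y<x?) R) h′)
    ≡⟨ cong (∑q n (λ a b x z → h a b x (x + z)) ⊕_) (cong₂ _⊕_ greater equal) ⟩
  ∑q n (λ a b x z → h a b x (x + z)) ⊕ (∑q n (λ a b x z → h b a (x + z) x) ⊕ ∑d n (λ a b d → h a b d d))
    ≡⟨ ℤₚ.+-assoc (∑q n (λ a b x z → h a b x (x + z))) _ _ ⟨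
  (∑q n (λ a b x z → h a b x (x + z)) ⊕ ∑q n (λ a b x z → h b a (x + z) x)) ⊕ ∑d n (λ a b d → h a b d d) ∎
  where
  open ≡-Reasoning
  h′ : (ℕ × ℕ) × (ℕ × ℕ) → ℤ
  h′ ((a , x) , (b , y)) = h (suc a) (suc b) (suc x) (suc y)
  x<y? y<x? : (s : (ℕ × ℕ) × (ℕ × ℕ)) → Dec _
  x<y? ((a , x) , (b , y)) = x ℕ.<? y
  y<x? ((a , x) , (b , y)) = y ℕ.<? x
  R = filterE (¬? ∘ x<y?) (solutions n)
  back : ∀ x y → x < y → x + suc (y ∸ suc x) ≡ y
  back x y x<y = trans (ℕₚ.+-suc x _) (ℕₚ.m+[n∸m]≡n x<y)
  forth : ∀ x z → x + suc z ∸ suc x ≡ z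
  forth x z = trans (cong (_∸ suc x) (ℕₚ.+-suc x z)) (ℕₚ.m+n∸m≡n (suc x) z)
  weight : ∀ a b x z → (suc a + suc b) * suc x + suc b * suc z ≡ suc a * suc x + suc b * suc (x + suc z)
  weight = ℕ-solve
  weight′ : ∀ a b x z → (suc a + suc b) * suc x + suc b * suc z ≡ suc b * suc (x + suc z) + suc a * suc x
  weight′ = ℕ-solve
  less : ∑ (filterE x<y? (solutions n)) h′ ≡ ∑q n (λ a b x z → h a b x (x + z))
  less = ∑-bij (filterE x<y? (solutions n)) (QE n)
    (λ ((a , x) , (b , y)) → (a , x) , (b , y ∸ suc x)) (λ ((a , x) , (b , z)) → (a , x) , (b , x + suc z))
    (λ { {(a , x) , (b , y)} (e , x<y) → trans (weight a b x (y ∸ suc x)) (trans (cong (λ w → suc a * suc x + suc b * suc w) (back x y x<y)) e) })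
    (λ { {(a , x) , (b , z)} e → trans (sym (weight a b x z)) e , ℕₚ.m<m+n x (s≤s z≤n) })
    (λ { {(a , x) , (b , y)} (e , x<y) → cong (λ w → (a , x) , (b , w)) (back x y x<y) })
    (λ { {(a , x) , (b , z)} e → cong (λ w → (a , x) , (b , w)) (forth x z) })
    (λ { {(a , x) , (b , y)} (e , x<y) → cong (λ w → h (suc a) (suc b) (suc x) (suc w)) (sym (back x y x<y)) })
  greater : ∑ (filterE y<x? R) h′ ≡ ∑q n (λ a b x z → h b a (x + z) x)
  greater = ∑-bij (filterE y<x? R) (QE n)
    (λ ((a , x) , (b , y)) → (b , y) , (a , x ∸ suc y)) (λ ((a , x) , (b , z)) → (b , x + suc z) , (a , x))
    (λ { {(a , x) , (b , y)} ((e , _) , y<x) → trans (weight′ b a y (x ∸ suc y)) (trans (cong (λ w → suc a * suc w + suc b * suc y) (back y x y<x)) e) })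
    (λ { {(a , x) , (b , z)} e → (trans (sym (weight′ a b x z)) e , ℕₚ.≤⇒≯ (ℕₚ.m≤m+n x (suc z))) , ℕₚ.m<m+n x (s≤s z≤n) })
    (λ { {(a , x) , (b , y)} (_ , y<x) → cong (λ w → (a , w) , (b , y)) (back y x y<x) })
    (λ { {(a , x) , (b , z)} e → cong (λ w → (a , x) , (b , w)) (forth x z) })
    (λ { {(a , x) , (b , y)} (_ , y<x) → cong (λ w → h (suc a) (suc b) (suc w) (suc y)) (sym (back y x y<x)) })
  equal : ∑ (filterE (¬? ∘ y<x?) R) h′ ≡ ∑d n (λ a b d → h a b d d)
  equal = ∑-bij (filterE (¬? ∘ y<x?) R) (DE n)
    (λ ((a , x) , (b , y)) → (a , b) , x) (λ ((a , b) , d) → (a , d) , (b , d))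
    (λ { {(a , x) , (b , y)} ((e , ≮) , ≯) → trans (ℕₚ.*-distribʳ-+ (suc x) (suc a) (suc b)) (trans (cong (λ w → suc a * suc x + suc b * suc w) (same x y ≮ ≯)) e) })
    (λ { {(a , b) , d} e → (trans (sym (ℕₚ.*-distribʳ-+ (suc d) (suc a) (suc b))) e , ℕₚ.<-irrefl refl) , ℕₚ.<-irrefl refl })
    (λ { {(a , x) , (b , y)} ((e , ≮) , ≯) → cong (λ w → (a , x) , (b , w)) (same x y ≮ ≯) })
    (λ _ → refl)
    (λ { {(a , x) , (b , y)} ((e , ≮) , ≯) → cong (λ w → h (suc a) (suc b) (suc x) (suc w)) (sym (same x y ≮ ≯)) })
    where
    same : ∀ x y → ¬ x < y → ¬ y < x → x ≡ y
    same x y ≮ ≯ = ℕₚ.≤-antisym (ℕₚ.≮⇒≥ ≯) (ℕₚ.≮⇒≥ ≮)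

∑ₛ-transpose : ∀ n h → ∑ₛ n h ≡ ∑ₛ n (λ a b x y → h x y a b)
∑ₛ-transpose n h = ∑-bij (solutions n) (solutions n) t t (λ { {s} e → weight s e }) (λ { {s} e → weight s e }) (λ _ → refl) (λ _ → refl) (λ _ → refl)
  where
  t : (ℕ × ℕ) × (ℕ × ℕ) → (ℕ × ℕ) × (ℕ × ℕ)
  t ((a , x) , (b , y)) = (x , a) , (y , b)
  weight : ∀ s → suc (proj₁ (proj₁ s)) * suc (proj₂ (proj₁ s)) + suc (proj₁ (proj₂ s)) * suc (proj₂ (proj₂ s)) ≡ n →
    suc (proj₂ (proj₁ s)) * suc (proj₁ (proj₁ s)) + suc (proj₂ (proj₂ s)) * suc (proj₁ (proj₂ s)) ≡ n
  weight ((a , x) , (b , y)) e = trans (cong₂ _+_ (ℕₚ.*-comm (suc x) (suc a)) (ℕₚ.*-comm (suc y) (suc b))) e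

∑q-transpose : ∀ n h → ∑q n h ≡ ∑q n (λ a b x z → h z x b a)
∑q-transpose n h = ∑-bij (QE n) (QE n) t t (λ { {(a , x) , (b , z)} e → trans (weight a b x z) e })
  (λ { {(a , x) , (b , z)} e → trans (weight a b x z) e }) (λ _ → refl) (λ _ → refl) (λ _ → refl)
  where
  t : (ℕ × ℕ) × (ℕ × ℕ) → (ℕ × ℕ) × (ℕ × ℕ)
  t ((a , x) , (b , z)) = (z , b) , (x , a)
  weight : ∀ a b x z → (suc z + suc x) * suc b + suc x * suc a ≡ (suc a + suc b) * suc x + suc b * suc z
  weight = ℕ-solve

∑d-swap : ∀ n h → ∑d n h ≡ ∑d n (λ a b d → h b a d)
∑d-swap n h = ∑-bij (DE n) (DE n) t t (λ { {(a , b) , d} e → trans (cong (_* suc d) (ℕₚ.+-comm (suc b) (suc a))) e })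
  (λ { {(a , b) , d} e → trans (cong (_* suc d) (ℕₚ.+-comm (suc b) (suc a))) e }) (λ _ → refl) (λ _ → refl) (λ _ → refl)
  where
  t : (ℕ × ℕ) × ℕ → (ℕ × ℕ) × ℕ
  t ((a , b) , d) = (b , a) , d

-- The equation a x + b y = n is symmetric under exchanging (a , b) with (x , y), and `InQ` under (a
-- , b , x , z) ↦ (z , x , b , a); the split by x and y thus becomes one by a and b.
∑ₛ-by-ab : ∀ n h → ∑ₛ n h ≡ (∑q n (λ a b x z → h b (a + b) z x) ⊕ ∑q n (λ a b x z → h (a + b) b x z)) ⊕ ∑d n (λ a b d → h d d a b)
∑ₛ-by-ab n h = trans (∑ₛ-transpose n h) (trans (∑ₛ-by-xy n (λ a b x y → h x y a b))
  (cong (_⊕ ∑d n (λ a b d → h d d a b)) (cong₂ _⊕_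
    (trans (∑q-transpose n (λ a b x z → h x (x + z) a b)) (∑q-cong n (λ a b x z → cong (λ w → h b w z x) (ℕₚ.+-comm b a))))
    (trans (∑q-transpose n (λ a b x z → h (x + z) x b a)) (∑q-cong n (λ a b x z → cong (λ w → h w b x z) (ℕₚ.+-comm b a)))))))

-- Euclid's step (a , b , x , y) ↦ (a + b , b , x , y − x) is a bijection from the solutions with y > x onto those with a > b.
euclid : ∀ (F g : ℕ → ℕ → ℕ → ℕ → ℤ) → (∀ a b x y → g a b x y ≡ g b a y x) →
         (∀ a b x z → F a b x (x + z) ⊕ F b a (x + z) x ≡ g (a + b) b x z ⊖ g a b x (x + z)) →
         ∀ n → ∑ₛ n F ⊕ ∑ₛ n F ≡ ∑d n (λ a b d → g (a + b) b d 0) ⊖ ∑d n (λ x y d → g d d x y)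
euclid F g g-sym step n = combine (∑ₛ n F) (∑q n Tg) (∑q n g₊) (∑d n gd) (∑d n (λ a b d → g d d a b)) (∑d n F₀) (∑d n (λ a b d → g (a + b) b d 0))
  F-sum (trans (sym g-sum₁) g-sum₂) D-sum
  where
  open ≡-Reasoning
  Tg g₊ F₁ F₂ : ℕ → ℕ → ℕ → ℕ → ℤ
  Tg a b x z = g (a + b) b x z
  g₊ a b x z = g a b x (x + z)
  F₁ a b x z = F a b x (x + z)
  F₂ a b x z = F b a (x + z) x
  F₀ gd : ℕ → ℕ → ℕ → ℤ
  F₀ a b d = F a b d d
  gd a b d = g a b d d
  solve₁ : ∀ u v w → u ⊕ v ≡ w → u ≡ w ⊖ v
  solve₁ u v w e = trans (lemma u v) (cong (_⊖ v) e)
    where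
    lemma : ∀ u v → u ≡ (u ⊕ v) ⊖ v
    lemma = solve-∀
  add-back : ∀ u v → (u ⊖ v) ⊕ v ≡ u
  add-back = solve-∀
  F-sum : ∑ₛ n F ⊕ ∑q n g₊ ≡ ∑q n Tg ⊕ ∑d n F₀
  F-sum = begin
    ∑ₛ n F ⊕ ∑q n g₊                                     ≡⟨ cong (_⊕ ∑q n g₊) (trans (∑ₛ-by-xy n F) (cong (_⊕ ∑d n F₀) (sym (∑q-⊕ n F₁ F₂)))) ⟩
    (∑q n (λ a b x z → F₁ a b x z ⊕ F₂ a b x z) ⊕ ∑d n F₀) ⊕ ∑q n g₊   ≡⟨ cong (λ s → (s ⊕ ∑d n F₀) ⊕ ∑q n g₊) (∑q-cong n step) ⟩
    (∑q n (λ a b x z → Tg a b x z ⊖ g₊ a b x z) ⊕ ∑d n F₀) ⊕ ∑q n g₊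
      ≡⟨ rearrange (∑q n (λ a b x z → Tg a b x z ⊖ g₊ a b x z)) (∑d n F₀) (∑q n g₊) ⟩
    (∑q n (λ a b x z → Tg a b x z ⊖ g₊ a b x z) ⊕ ∑q n g₊) ⊕ ∑d n F₀
      ≡⟨ cong (_⊕ ∑d n F₀) (trans (sym (∑q-⊕ n (λ a b x z → Tg a b x z ⊖ g₊ a b x z) g₊)) (∑q-cong n (λ a b x z → add-back (Tg a b x z) (g₊ a b x z)))) ⟩
    ∑q n Tg ⊕ ∑d n F₀ ∎
    where
    rearrange : ∀ u v w → (u ⊕ v) ⊕ w ≡ (u ⊕ w) ⊕ v
    rearrange = solve-∀
  -- The sum of `g` is evaluated twice, split by x and y here and by a and b below. By symmetry both
  -- halves agree each time, so the comparison gives twice the difference of `∑q n Tg` and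
  -- `∑q n g₊`, which is where `F` is doubled.
  g-sum₁ : ∑ₛ n g ≡ (∑q n g₊ ⊕ ∑q n g₊) ⊕ ∑d n gd
  g-sum₁ = trans (∑ₛ-by-xy n g) (cong (λ s → (∑q n g₊ ⊕ s) ⊕ ∑d n gd) (∑q-cong n (λ a b x z → sym (g-sym a b x (x + z)))))
  g-sum₂ : ∑ₛ n g ≡ (∑q n Tg ⊕ ∑q n Tg) ⊕ ∑d n (λ a b d → g d d a b)
  g-sum₂ = trans (∑ₛ-by-ab n g) (cong (λ s → (s ⊕ ∑q n Tg) ⊕ ∑d n (λ a b d → g d d a b)) (∑q-cong n (λ a b x z → sym (g-sym (a + b) b x z))))
  -- The diagonal x = y obeys `step` with z = 0. This is why the boundary term contains `g` at the
  -- argument 0, outside the positive solutions.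
  D-sum : (∑d n F₀ ⊕ ∑d n F₀) ⊕ ∑d n gd ≡ ∑d n (λ a b d → g (a + b) b d 0)
  D-sum = begin
    (∑d n F₀ ⊕ ∑d n F₀) ⊕ ∑d n gd                       ≡⟨ cong (λ s → (∑d n F₀ ⊕ s) ⊕ ∑d n gd) (∑d-swap n F₀) ⟩
    (∑d n F₀ ⊕ ∑d n (λ a b d → F₀ b a d)) ⊕ ∑d n gd     ≡⟨ cong (_⊕ ∑d n gd) (∑d-⊕ n F₀ (λ a b d → F₀ b a d)) ⟨
    ∑d n (λ a b d → F₀ a b d ⊕ F₀ b a d) ⊕ ∑d n gd      ≡⟨ ∑d-⊕ n (λ a b d → F₀ a b d ⊕ F₀ b a d) gd ⟨
    ∑d n (λ a b d → (F₀ a b d ⊕ F₀ b a d) ⊕ gd a b d)   ≡⟨ ∑d-cong n {k = λ a b d → g (a + b) b d 0} (λ a b d → trans (cong (_⊕ gd a b d) (step₀ a b d)) (add-back _ (gd a b d))) ⟩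
    ∑d n (λ a b d → g (a + b) b d 0)                    ∎
    where
    step₀ : ∀ a b d → F a b d d ⊕ F b a d d ≡ g (a + b) b d 0 ⊖ g a b d d
    step₀ a b d = subst (λ w → F a b d w ⊕ F b a w d ≡ g (a + b) b d 0 ⊖ g a b d w) (ℕₚ.+-identityʳ d) (step a b d 0)
  combine : ∀ S q q₊ c c′ f₀ e → S ⊕ q₊ ≡ q ⊕ f₀ → (q₊ ⊕ q₊) ⊕ c ≡ (q ⊕ q) ⊕ c′ → (f₀ ⊕ f₀) ⊕ c ≡ e → S ⊕ S ≡ e ⊖ c′
  combine S q q₊ c c′ f₀ e h₁ h₂ h₃ = begin
    S ⊕ S                                          ≡⟨ cong (λ s → s ⊕ s) (solve₁ S q₊ (q ⊕ f₀) h₁) ⟩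
    ((q ⊕ f₀) ⊖ q₊) ⊕ ((q ⊕ f₀) ⊖ q₊)              ≡⟨ lemma q f₀ q₊ c c′ ⟩
    (((f₀ ⊕ f₀) ⊕ c) ⊖ c′) ⊕ (((q ⊕ q) ⊕ c′) ⊖ ((q₊ ⊕ q₊) ⊕ c))   ≡⟨ cong₂ (λ u v → (u ⊖ c′) ⊕ (v ⊖ ((q₊ ⊕ q₊) ⊕ c))) h₃ (sym h₂) ⟩
    (e ⊖ c′) ⊕ (((q₊ ⊕ q₊) ⊕ c) ⊖ ((q₊ ⊕ q₊) ⊕ c))   ≡⟨ trans (cong ((e ⊖ c′) ⊕_) (ℤₚ.+-inverseʳ ((q₊ ⊕ q₊) ⊕ c))) (ℤₚ.+-identityʳ (e ⊖ c′)) ⟩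
    e ⊖ c′                                         ∎
    where
    lemma : ∀ q f₀ q₊ c c′ → ((q ⊕ f₀) ⊖ q₊) ⊕ ((q ⊕ f₀) ⊖ q₊) ≡ (((f₀ ⊕ f₀) ⊕ c) ⊖ c′) ⊕ (((q ⊕ q) ⊕ c′) ⊖ ((q₊ ⊕ q₊) ⊕ c))
    lemma = solve-∀

sumBelow : ℕ → (ℕ → ℤ) → ℤ
sumBelow zero    h = + 0
sumBelow (suc n) h = sumBelow n h ⊕ h n

∑-below : ∀ n h → ∑ (below n) h ≡ sumBelow n h
∑-below zero    h = refl
∑-below (suc n) h = trans (cong (λ xs → sumOver xs h) (sym (Data.List.Properties.upTo-∷ʳ n)))
  (trans (sumOver-++ (upTo n) (n ∷ []) h) (cong₂ _⊕_ (∑-below n h) (ℤₚ.+-identityʳ (h n))))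

-- Group by the sum m = a + b: a boundary term becomes a sum over factorisations n = m d of row sums
-- over 0 < b < m. In the shifted encoding m stands for `suc m` and b for `suc b`.
∑d-divisors : ∀ n (k : ℕ → ℕ → ℕ → ℕ → ℤ) →
  ∑d n (λ a b d → k a b (a + b) d) ≡ ∑ (divE n) (λ (m , d) → sumBelow m (λ b → k (m ∸ b) (suc b) (suc m) (suc d)))
∑d-divisors n k = trans
  (∑-bij (DE n) (ΣE (divE n) (λ (m , _) → below m))
    (λ ((a , b) , d) → (a + suc b , d) , b) (λ ((m , d) , b) → (m ∸ suc b , b) , d)
    (λ { {(a , b) , d} e → e , ℕₚ.m≤n+m (suc b) a })
    (λ { {(m , d) , b} (e , b<m) → trans (cong (λ w → suc w * suc d) (ℕₚ.m∸n+n≡m b<m)) e })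
    (λ { {(a , b) , d} e → cong (λ w → (w , b) , d) (ℕₚ.m+n∸n≡m a (suc b)) })
    (λ { {(m , d) , b} (e , b<m) → cong (λ w → (w , d) , b) (ℕₚ.m∸n+n≡m b<m) })
    (λ { {(a , b) , d} e → cong (λ w → k w (suc b) (suc (a + suc b)) (suc d)) (sym (trans (cong (_∸ b) (ℕₚ.+-suc a b)) (ℕₚ.m+n∸n≡m (suc a) b))) }))
  (trans (∑-Σ (divE n) (λ (m , _) → below m) (λ ((m , d) , b) → k (m ∸ b) (suc b) (suc m) (suc d)))
         (∑-cong (divE n) (λ {(m , d)} _ → ∑-below m (λ b → k (m ∸ b) (suc b) (suc m) (suc d)))))

-- Sums over divisors

D : (ℕ → ℕ → ℤ) → Seq
D h n = ∑ (divE n) (λ (a , x) → h (suc a) (suc x))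

∑ₛ-⋆ : ∀ h k n → ∑ₛ n (λ a b x y → h a x ⊗ k b y) ≡ (D h ⋆ D k) n
∑ₛ-⋆ h k n = ⋆-∑ divE divE (solutions n) (λ (a , x) → h (suc a) (suc x)) (λ (b , y) → k (suc b) (suc y))

D-cong : ∀ {h k} → (∀ a x → h a x ≡ k a x) → D h ≈ D k
D-cong e n = ∑-cong (divE n) (λ {(a , x)} _ → e (suc a) (suc x))

D-cong-on : ∀ {h k} n → (∀ a x → a * x ≡ n → h a x ≡ k a x) → D h n ≡ D k n
D-cong-on n e = ∑-cong (divE n) (λ {(a , x)} eq → e (suc a) (suc x) eq)

D-⊕ : ∀ h k → D (λ a x → h a x ⊕ k a x) ≈ D h ⊞ D k
D-⊕ h k n = ∑-⊕ (divE n) (λ (a , x) → h (suc a) (suc x)) (λ (a , x) → k (suc a) (suc x))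

D-⊗ : ∀ c h → D (λ a x → c ⊗ h a x) ≈ c · D h
D-⊗ c h n = ∑-⊗ (divE n) c (λ (a , x) → h (suc a) (suc x))

D-⊖ : ∀ h k → D (λ a x → h a x ⊖ k a x) ≈ D h ⊞ ℤ.-1ℤ · D k
D-⊖ h k n = trans (D-cong (λ a x → cong (h a x ⊕_) (sym (ℤₚ.-1*i≡-i (k a x)))) n)
  (trans (D-⊕ h (λ a x → ℤ.-1ℤ ⊗ k a x) n) (cong (D h n ⊕_) (D-⊗ ℤ.-1ℤ k n)))

D-0 : ∀ {h} n → (∀ a x → a * x ≡ n → h a x ≡ + 0) → D h n ≡ + 0
D-0 n e = ∑-0 (divE n) (λ {(a , x)} eq → e (suc a) (suc x) eq)

D-swap : ∀ h → D h ≈ D (λ a x → h x a)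
D-swap h n = ∑-bij (divE n) (divE n) (λ (a , x) → x , a) (λ (a , x) → x , a)
  (λ { {a , x} e → trans (ℕₚ.*-comm (suc x) (suc a)) e }) (λ { {a , x} e → trans (ℕₚ.*-comm (suc x) (suc a)) e })
  (λ _ → refl) (λ _ → refl) (λ _ → refl)

D-scale : ∀ c h → (∀ a x → ¬ (suc c ∣ a) → h a x ≡ + 0) → D h ≈ dil (suc c) (D (λ a x → h (a * suc c) x))
D-scale c h off n = begin
  D h n                                   ≡⟨ ∑-split div? (divE n) h′ ⟩
  ∑ E h′ ⊕ ∑ (filterE (¬? ∘ div?) (divE n)) h′
    ≡⟨ cong (∑ E h′ ⊕_) (∑-0 (filterE (¬? ∘ div?) (divE n)) (λ { {a , x} (_ , ∤) → off (suc a) (suc x) ∤ })) ⟩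
  ∑ E h′ ⊕ + 0                            ≡⟨ ℤₚ.+-identityʳ (∑ E h′) ⟩
  ∑ E h′                                  ≡⟨ ∑-bij E′ E
      -- Factors are stored as predecessors: `suc (c + a * suc c)` is `suc a * suc c`.
      (λ (a , x) → c + a * suc c , x) (λ (a , x) → ℕ.pred (suc a ℕ./ suc c) , x)
      (λ { {a , x} e → trans (weight a x) e , divides (suc a) refl })
      (λ { {a , x} (e , d) → trans (sym (weight (ℕ.pred (suc a ℕ./ suc c)) x)) (trans (cong (_* suc x) (restore a d)) e) })
      (λ { {a , x} e → cong (λ w → ℕ.pred w , x) (m*n/n≡m (suc a) (suc c)) })
      (λ { {a , x} (e , d) → cong (λ w → ℕ.pred w , x) (restore a d) })
      (λ _ → refl) ⟨
  ∑ E′ (λ (a , x) → h (suc a * suc c) (suc x))   ≡⟨ dil-∑ (suc c) divE (λ (a , x) → h (suc a * suc c) (suc x)) E′ ⟩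
  dil (suc c) (D (λ a x → h (a * suc c) x)) n    ∎
  where
  open ≡-Reasoning
  h′ : ℕ × ℕ → ℤ
  h′ (a , x) = h (suc a) (suc x)
  div? : (ax : ℕ × ℕ) → Dec (suc c ∣ suc (proj₁ ax))
  div? (a , x) = suc c ∣? suc a
  E = filterE div? (divE n)
  E′ : Enum (λ (ax : ℕ × ℕ) → suc (proj₁ ax) * suc (proj₂ ax) * suc c ≡ n)
  E′ = sameE (filterE (λ (a , x) → suc a * suc x * suc c ℕ.≟ n) (ΣE (below n) (λ _ → below n))) proj₂
    (λ { {a , x} refl → (ℕₚ.≤-trans (ℕₚ.m≤m*n (suc a) (suc x)) (ℕₚ.m≤m*n (suc a * suc x) (suc c)) ,
                         ℕₚ.≤-trans (ℕₚ.m≤n*m (suc x) (suc a)) (ℕₚ.m≤m*n (suc a * suc x) (suc c))) , refl })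
  weight : ∀ a x → suc a * suc c * suc x ≡ suc a * suc x * suc c
  weight a x = trans (ℕₚ.*-assoc (suc a) (suc c) (suc x)) (trans (cong (suc a *_) (ℕₚ.*-comm (suc c) (suc x))) (sym (ℕₚ.*-assoc (suc a) (suc x) (suc c))))
  restore : ∀ a → suc c ∣ suc a → suc (ℕ.pred (suc a ℕ./ suc c)) * suc c ≡ suc a
  restore a (divides (suc q) eq) = trans (cong (λ w → suc (ℕ.pred w) * suc c) (trans (cong (ℕ._/ suc c) eq) (m*n/n≡m (suc q) (suc c)))) (sym eq)

D-scaleʳ : ∀ c h → (∀ a x → ¬ (suc c ∣ x) → h a x ≡ + 0) → D h ≈ dil (suc c) (D (λ a x → h a (x * suc c)))
D-scaleʳ c h off = ≈-trans (D-swap h) (≈-trans (D-scale c (λ a x → h x a) (λ a x → off x a)) (dil-cong (suc c) (D-swap (λ a x → h x (a * suc c)))))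

-- Finite verification of identities between periodic functions

allBelow : ℕ → (ℕ → Bool) → Bool
allBelow zero    p = true
allBelow (suc n) p = p n ∧ allBelow n p

allBelow-sound : ∀ n p → allBelow n p ≡ true → ∀ i → i < n → p i ≡ true
allBelow-sound (suc n) p h i (s≤s i≤n) with p n in eq
... | true with i ℕ.≟ n
...   | yes refl = eq
...   | no  i≢n  = allBelow-sound n p h i (ℕₚ.≤∧≢⇒< i≤n i≢n)

equal? : ℤ → ℤ → Bool
equal? i j = isYes (i ℤ.≟ j)

equal?-sound : ∀ i j → equal? i j ≡ true → i ≡ j
equal?-sound i j h with i ℤ.≟ j
... | yes e = e

check₁ : ℕ → (h k : ℕ → ℤ) → Bool
check₁ M h k = allBelow M (λ a → equal? (h a) (k a))

check₁-sound : ∀ M h k → check₁ M h k ≡ true → ∀ a → a < M → h a ≡ k a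
check₁-sound M h k c a a<M = equal?-sound (h a) (k a) (allBelow-sound M _ c a a<M)

-- A Boolean, so that a closed instance is decided by evaluation and proved by `refl`.
check₄ : ℕ → ℕ → (h k : ℕ → ℕ → ℕ → ℕ → ℤ) → Bool
check₄ M K h k = allBelow M (λ a → allBelow M (λ b → allBelow K (λ x → check₁ K (h a b x) (k a b x))))

check₄-sound : ∀ M K h k → check₄ M K h k ≡ true → ∀ a b x y → a < M → b < M → x < K → y < K → h a b x y ≡ k a b x y
check₄-sound M K h k c a b x y a< b< x< y< = check₁-sound K (h a b x) (k a b x)
  (allBelow-sound K _ (allBelow-sound M _ (allBelow-sound M _ c a a<) b b<) x x<) y y<

-- F and g are given on residues: a , b modulo M and x , y modulo K.
module Periodic (M K : ℕ) .{{_ : NonZero M}} .{{_ : NonZero K}} (F g : ℕ → ℕ → ℕ → ℕ → ℤ)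
  (sym-check : check₄ M K g (λ a b x y → g b a y x) ≡ true)
  (step-check : check₄ M K (λ a b x z → F a b x ((x + z) % K) ⊕ F b a ((x + z) % K) x)
                           (λ a b x z → g ((a + b) % M) b x z ⊖ g a b x ((x + z) % K)) ≡ true) where

  F↑ g↑ : ℕ → ℕ → ℕ → ℕ → ℤ
  F↑ a b x y = F (a % M) (b % M) (x % K) (y % K)
  g↑ a b x y = g (a % M) (b % M) (x % K) (y % K)

  boundary : ∀ n → ∑ₛ n F↑ ⊕ ∑ₛ n F↑ ≡ ∑d n (λ a b d → g↑ (a + b) b d 0) ⊖ ∑d n (λ x y d → g↑ d d x y)
  boundary = euclid F↑ g↑
    (λ a b x y → check₄-sound M K _ _ sym-check (a % M) (b % M) (x % K) (y % K) (m%n<n a M) (m%n<n b M) (m%n<n x K) (m%n<n y K))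
    (λ a b x z → subst₂ (λ w v → F (a % M) (b % M) (x % K) w ⊕ F (b % M) (a % M) w (x % K) ≡ g v (b % M) (x % K) (z % K) ⊖ g (a % M) (b % M) (x % K) w)
      (sym (%-distribˡ-+ x z K)) (sym (%-distribˡ-+ a b M))
      (check₄-sound M K _ _ step-check (a % M) (b % M) (x % K) (z % K) (m%n<n a M) (m%n<n b M) (m%n<n x K) (m%n<n z K)))

sumBelow-cong : ∀ n {h k} → (∀ i → h i ≡ k i) → sumBelow n h ≡ sumBelow n k
sumBelow-cong zero    e = refl
sumBelow-cong (suc n) e = cong₂ _⊕_ (sumBelow-cong n e) (e n)

sumBelow-+ : ∀ m n h → sumBelow (m + n) h ≡ sumBelow m h ⊕ sumBelow n (λ i → h (m + i))
sumBelow-+ m zero    h = trans (cong (λ k → sumBelow k h) (ℕₚ.+-identityʳ m)) (sym (ℤₚ.+-identityʳ _))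
sumBelow-+ m (suc n) h = trans (cong (λ k → sumBelow k h) (ℕₚ.+-suc m n))
  (trans (cong (_⊕ h (m + n)) (sumBelow-+ m n h)) (ℤₚ.+-assoc (sumBelow m h) _ _))

sumBelow-suc : ∀ n h → sumBelow n (h ∘ suc) ≡ sumBelow (suc n) h ⊖ h 0
sumBelow-suc n h = trans (lemma (h 0) (sumBelow n (h ∘ suc))) (cong (_⊖ h 0) (trans (cong (_⊕ sumBelow n (h ∘ suc)) (sym (ℤₚ.+-identityˡ (h 0)))) (sym (sumBelow-+ 1 n h))))
  where
  lemma : ∀ a b → b ≡ (a ⊕ b) ⊖ a
  lemma = solve-∀

sumBelow-const : ∀ n c → sumBelow n (λ _ → c) ≡ + n ⊗ c
sumBelow-const zero    c = refl
sumBelow-const (suc n) c = trans (cong (_⊕ c) (sumBelow-const n c)) (lemma (+ n) c)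
  where
  lemma : ∀ n c → n ⊗ c ⊕ c ≡ (+ 1 ⊕ n) ⊗ c
  lemma = solve-∀

sumBelow-periodic : ∀ M .{{_ : NonZero M}} (q : ℕ → ℤ) r k → sumBelow (r + k * M) (λ b → q (b % M)) ≡ sumBelow r (λ b → q (b % M)) ⊕ + k ⊗ sumBelow M (λ b → q (b % M))
sumBelow-periodic M q r zero    = trans (cong (λ m → sumBelow m (λ b → q (b % M))) (ℕₚ.+-identityʳ r)) (sym (ℤₚ.+-identityʳ _))
sumBelow-periodic M q r (suc k) = begin
  sumBelow (r + (M + k * M)) q′                     ≡⟨ cong (λ m → sumBelow m q′) (rotate r M (k * M)) ⟩
  sumBelow (M + (r + k * M)) q′                     ≡⟨ sumBelow-+ M (r + k * M) q′ ⟩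
  sumBelow M q′ ⊕ sumBelow (r + k * M) (λ i → q ((M + i) % M))
    ≡⟨ cong (sumBelow M q′ ⊕_) (trans (sumBelow-cong (r + k * M) (λ i → cong q (trans (cong (_% M) (ℕₚ.+-comm M i)) ([m+n]%n≡m%n i M)))) (sumBelow-periodic M q r k)) ⟩
  sumBelow M q′ ⊕ (sumBelow r q′ ⊕ + k ⊗ sumBelow M q′)   ≡⟨ lemma (sumBelow M q′) (sumBelow r q′) (+ k) ⟩
  sumBelow r q′ ⊕ (+ 1 ⊕ + k) ⊗ sumBelow M q′       ∎
  where
  open ≡-Reasoning
  q′ : ℕ → ℤ
  q′ b = q (b % M)
  rotate : ∀ r M s → r + (M + s) ≡ M + (r + s)
  rotate = ℕ-solve
  lemma : ∀ P s k → P ⊕ (s ⊕ k ⊗ P) ≡ s ⊕ (+ 1 ⊕ k) ⊗ P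
  lemma = solve-∀

-- A closed form c for the row sums of q, verified on m < M and on the full period.
row-sum : ∀ M .{{_ : NonZero M}} (q : ℕ → ℕ → ℤ) (c P : ℕ → ℤ) →
  (∀ r k → c (r + k * M) ≡ c r ⊕ + k ⊗ P (r % M)) →
  check₁ M (λ r → sumBelow r (λ b → q r (b % M)) ⊖ q r 0) c ≡ true → check₁ M (λ r → sumBelow M (λ b → q r (b % M))) P ≡ true →
  ∀ m → sumBelow m (λ b → q (suc m % M) (suc b % M)) ≡ c (suc m)
row-sum M q c P growth c-check P-check m′ = begin
  sumBelow m′ (λ b → q r (suc b % M))                       ≡⟨ sumBelow-suc m′ (λ b → q r (b % M)) ⟩
  sumBelow m (λ b → q r (b % M)) ⊖ q r (0 % M)              ≡⟨ cong₂ (λ u v → sumBelow u (λ b → q r (b % M)) ⊖ q r v) (m≡m%n+[m/n]*n m M) (m*n%n≡0 0 M) ⟩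
  sumBelow (r + k * M) (λ b → q r (b % M)) ⊖ q r 0          ≡⟨ cong (_⊖ q r 0) (sumBelow-periodic M (q r) r k) ⟩
  (sumBelow r (λ b → q r (b % M)) ⊕ + k ⊗ sumBelow M (λ b → q r (b % M))) ⊖ q r 0
    ≡⟨ rearrange (sumBelow r (λ b → q r (b % M))) (+ k ⊗ sumBelow M (λ b → q r (b % M))) (q r 0) ⟩
  (sumBelow r (λ b → q r (b % M)) ⊖ q r 0) ⊕ + k ⊗ sumBelow M (λ b → q r (b % M))
    ≡⟨ cong₂ (λ u v → u ⊕ + k ⊗ v) (check₁-sound M _ _ c-check r (m%n<n m M)) (check₁-sound M _ _ P-check r (m%n<n m M)) ⟩
  c r ⊕ + k ⊗ P r                                           ≡⟨ cong (λ w → c r ⊕ + k ⊗ P w) (m%n%n≡m%n m M) ⟨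
  c r ⊕ + k ⊗ P (r % M)                                     ≡⟨ growth r k ⟨
  c (r + k * M)                                             ≡⟨ cong c (m≡m%n+[m/n]*n m M) ⟨
  c m                                                       ∎
  where
  open ≡-Reasoning
  m r k : ℕ
  m = suc m′
  r = m % M
  k = m ℕ./ M
  rearrange : ∀ a b c → (a ⊕ b) ⊖ c ≡ (a ⊖ c) ⊕ b
  rearrange = solve-∀

-- Residue characters

legendre₇ : ℕ → ℤ
legendre₇ 0 = + 0
legendre₇ 1 = + 1
legendre₇ 2 = + 1
legendre₇ 4 = + 1
legendre₇ _ = ℤ.-1ℤ

table₄ : ℤ → ℤ → ℤ → ℤ → ℕ → ℤ
table₄ a b c d 0 = a
table₄ a b c d 1 = b
table₄ a b c d 2 = c
table₄ a b c d _ = d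

χ χ₄ od ev is0 is2 is3 z₇ : ℕ → ℤ
χ n   = legendre₇ (n % 7)
χ₄ n  = table₄ (+ 0) (+ 1) (+ 0) ℤ.-1ℤ (n % 4)
is0 n = table₄ (+ 1) (+ 0) (+ 0) (+ 0) (n % 4)
is2 n = table₄ (+ 0) (+ 0) (+ 1) (+ 0) (n % 4)
is3 n = table₄ (+ 0) (+ 0) (+ 0) (+ 1) (n % 4)
od n  = + (n % 2)
ev n  = + 1 ⊖ od n
z₇ n  = if (n % 7) ℕ.≡ᵇ 0 then + 1 else + 0

χ-mod : ∀ M .{{_ : NonZero M}} → 7 ∣ M → ∀ n → χ (n % M) ≡ χ n
χ-mod M d n = cong legendre₇ (m∣n⇒o%n%m≡o%m 7 M n d)

z₇-mod : ∀ M .{{_ : NonZero M}} → 7 ∣ M → ∀ n → z₇ (n % M) ≡ z₇ n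
z₇-mod M d n = cong (λ r → if r ℕ.≡ᵇ 0 then + 1 else + 0) (m∣n⇒o%n%m≡o%m 7 M n d)

od-mod : ∀ M .{{_ : NonZero M}} → 2 ∣ M → ∀ n → od (n % M) ≡ od n
od-mod M d n = cong +_ (m∣n⇒o%n%m≡o%m 2 M n d)

ev-mod : ∀ M .{{_ : NonZero M}} → 2 ∣ M → ∀ n → ev (n % M) ≡ ev n
ev-mod M d n = cong (+ 1 ⊖_) (od-mod M d n)

mod₄ : ∀ (h : ℕ → ℤ) M .{{_ : NonZero M}} → 4 ∣ M → ∀ n → h (n % M % 4) ≡ h (n % 4)
mod₄ h M d n = cong h (m∣n⇒o%n%m≡o%m 4 M n d)

n∣n : ∀ {n} → n ∣ n
n∣n {n} = divides 1 (sym (ℕₚ.+-identityʳ n))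

residue-form : ∀ M .{{_ : NonZero M}} a b x y → ((a % M) * (x % M) + (b % M) * (y % M)) % M ≡ (a * x + b * y) % M
residue-form M a b x y = begin
  ((a % M) * (x % M) + (b % M) * (y % M)) % M                  ≡⟨ %-distribˡ-+ ((a % M) * (x % M)) _ M ⟩
  (((a % M) * (x % M)) % M + ((b % M) * (y % M)) % M) % M      ≡⟨ cong₂ (λ u v → (u + v) % M) (%-distribˡ-* a x M) (%-distribˡ-* b y M) ⟨
  ((a * x) % M + (b * y) % M) % M                              ≡⟨ %-distribˡ-+ (a * x) (b * y) M ⟨
  (a * x + b * y) % M                                          ∎
  where open ≡-Reasoning

∑ₛ-cong : ∀ n {h k} → (∀ a b x y → a * x + b * y ≡ n → h a b x y ≡ k a b x y) → ∑ₛ n h ≡ ∑ₛ n k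
∑ₛ-cong n e = ∑-cong (solutions n) (λ {((a , x) , (b , y))} eq → e (suc a) (suc b) (suc x) (suc y) eq)

∑ₛ-⊕ : ∀ n h k → ∑ₛ n (λ a b x y → h a b x y ⊕ k a b x y) ≡ ∑ₛ n h ⊕ ∑ₛ n k
∑ₛ-⊕ n h k = ∑-⊕ (solutions n) _ _

∑ₛ-⊗ : ∀ n c h → ∑ₛ n (λ a b x y → c ⊗ h a b x y) ≡ c ⊗ ∑ₛ n h
∑ₛ-⊗ n c h = ∑-⊗ (solutions n) c _

G Y : Seq
G = D (λ a x → χ₄ a)
Y = D (λ a x → χ₄ a ⊗ od x)

od-∤ : ∀ a → ¬ (2 ∣ a) → ev a ≡ + 0
od-∤ a h with a % 2 in eq | m%n<n a 2
... | 0 | _ = contradiction (m%n≡0⇒n∣m a 2 eq) h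
... | 1 | _ = refl
... | suc (suc _) | s≤s (s≤s ())

is2-∤ : ∀ a → ¬ (2 ∣ a) → is2 a ≡ + 0
is2-∤ a h with a % 4 in eq
... | 0 = refl
... | 1 = refl
... | suc (suc (suc _)) = refl
... | 2 = contradiction (m%n≡0⇒n∣m a 2 (trans (sym (m∣n⇒o%n%m≡o%m 2 4 a (divides 2 refl))) (cong (_% 2) eq))) h

is0-∤ : ∀ a → ¬ (4 ∣ a) → is0 a ≡ + 0
is0-∤ a h with a % 4 in eq
... | 0 = contradiction (m%n≡0⇒n∣m a 4 eq) h
... | 1 = refl
... | 2 = refl
... | suc (suc (suc _)) = refl

ev-2* : ∀ a → ev (a * 2) ≡ + 1
ev-2* a = cong (λ r → + 1 ⊖ + r) (m*n%n≡0 a 2)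

is2-2* : ∀ a → is2 (a * 2) ≡ od a
is2-2* a = trans (cong (table₄ (+ 0) (+ 0) (+ 1) (+ 0)) eq) (check₁-sound 2 (λ r → is2 (r * 2)) od refl′ (a % 2) (m%n<n a 2) ⟫ od-mod 2 n∣n a)
  where
  _⟫_ : ∀ {x y z : ℤ} → x ≡ y → y ≡ z → x ≡ z
  _⟫_ = trans
  refl′ : check₁ 2 (λ r → is2 (r * 2)) od ≡ true
  refl′ = refl
  eq : (a * 2) % 4 ≡ (a % 2 * 2) % 4
  eq = trans (cong (λ w → (w * 2) % 4) (m≡m%n+[m/n]*n a 2)) (trans (cong (_% 4) (expand (a % 2) (a ℕ./ 2))) ([m+kn]%n≡m%n (a % 2 * 2) (a ℕ./ 2) 4))
    where
    expand : ∀ r k → (r + k * 2) * 2 ≡ r * 2 + k * 4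
    expand = ℕ-solve

is0-4* : ∀ a → is0 (a * 4) ≡ + 1
is0-4* a = cong (table₄ (+ 1) (+ 0) (+ 0) (+ 0)) (m*n%n≡0 a 4)

G-scale : ∀ c (e : ℕ → ℤ) → (∀ x → ¬ (suc c ∣ x) → e x ≡ + 0) → (∀ x → e (x * suc c) ≡ + 1) → D (λ a x → χ₄ a ⊗ e x) ≈ dil (suc c) G
G-scale c e off on = ≈-trans (D-scaleʳ c (λ a x → χ₄ a ⊗ e x) (λ a x h → trans (cong (χ₄ a ⊗_) (off x h)) (ℤₚ.*-zeroʳ (χ₄ a))))
  (dil-cong (suc c) (D-cong (λ a x → trans (cong (χ₄ a ⊗_) (on x)) (ℤₚ.*-identityʳ (χ₄ a)))))

Y-scale : D (λ a x → χ₄ a ⊗ is2 x) ≈ dil 2 Y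
Y-scale = ≈-trans (D-scaleʳ 1 (λ a x → χ₄ a ⊗ is2 x) (λ a x h → trans (cong (χ₄ a ⊗_) (is2-∤ x h)) (ℤₚ.*-zeroʳ (χ₄ a))))
  (dil-cong 2 (D-cong (λ a x → cong (χ₄ a ⊗_) (is2-2* x))))

G-split : G ≈ dil 2 G ⊞ Y
G-split = ≈-trans (D-cong (λ a x → lemma (χ₄ a) (od x))) (≈-trans (D-⊕ (λ a x → χ₄ a ⊗ ev x) (λ a x → χ₄ a ⊗ od x))
  (⊞-cong (G-scale 1 ev od-∤ ev-2*) refl≈))
  where
  lemma : ∀ u v → u ≡ u ⊗ (+ 1 ⊖ v) ⊕ u ⊗ v
  lemma = solve-∀

-- Sums of two squares: ∑ χ₄(a) χ₄(b) κ(x , y)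

module TwoSquares where

  -- The value is 1, or -2 if both arguments are even. Since x and x + z are both even exactly when
  -- x and z are, `κ` is invariant under Euclid's step, and there remains an equation in a and b
  -- alone, `g₄ (a + b) b ⊖ g₄ a b ≡ + 2 ⊗ (χ₄ a ⊗ χ₄ b)`. The value -2 produces the coefficient -4
  -- in `split`.
  κ : ℕ → ℕ → ℤ
  κ x y = + 1 ⊖ + 3 ⊗ (ev x ⊗ ev y)

  m₄ : ℕ → ℤ
  m₄ n = is2 n ⊖ is0 n

  g₄ : ℕ → ℕ → ℤ
  g₄ a b = (od a ⊗ m₄ b ⊕ m₄ a ⊗ od b) ⊖ od a ⊗ od b ⊗ m₄ (a + b)

  F g : ℕ → ℕ → ℕ → ℕ → ℤ
  F a b x y = χ₄ a ⊗ χ₄ b ⊗ κ x y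
  g a b x y = κ x y ⊗ g₄ a b

  open Periodic 4 2 F g refl refl

  F-periodic : ∀ a b x y → F↑ a b x y ≡ F a b x y
  F-periodic a b x y = cong₂ _⊗_ (cong₂ _⊗_ (mod₄ (table₄ _ _ _ _) 4 n∣n a) (mod₄ (table₄ _ _ _ _) 4 n∣n b))
    (cong₂ (λ u v → + 1 ⊖ + 3 ⊗ (u ⊗ v)) (ev-mod 2 n∣n x) (ev-mod 2 n∣n y))

  -- For odd a and b, a x + b y ≡ 2 modulo 4 leaves two possibilities: x and y are odd, or one of
  -- them is 0 and the other 2 modulo 4. The second occurs in two orders, each with `κ` = -2.
  split : ∀ n → n % 4 ≡ 2 → ∑ₛ n F ≡ (Y ⋆ Y) n ⊖ + 4 ⊗ (dil 4 G ⋆ dil 2 Y) n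
  split n n≡2 = begin
    ∑ₛ n F
      ≡⟨ ∑ₛ-cong n (λ a b x y eq → pointwise a b x y (trans (cong (_% 4) eq) n≡2)) ⟩
    ∑ₛ n (λ a b x y → H₁ a b x y ⊕ ℤ.- + 2 ⊗ (H₂ a b x y ⊕ H₃ a b x y))
      ≡⟨ trans (∑ₛ-⊕ n H₁ (λ a b x y → ℤ.- + 2 ⊗ (H₂ a b x y ⊕ H₃ a b x y)))
           (cong (∑ₛ n H₁ ⊕_) (trans (∑ₛ-⊗ n (ℤ.- + 2) (λ a b x y → H₂ a b x y ⊕ H₃ a b x y)) (cong (ℤ.- + 2 ⊗_) (∑ₛ-⊕ n H₂ H₃)))) ⟩
    ∑ₛ n H₁ ⊕ ℤ.- + 2 ⊗ (∑ₛ n H₂ ⊕ ∑ₛ n H₃)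
      ≡⟨ cong₂ (λ u v → u ⊕ ℤ.- + 2 ⊗ v) (∑ₛ-⋆ (λ a x → χ₄ a ⊗ od x) (λ b y → χ₄ b ⊗ od y) n) (cong₂ _⊕_
           (trans (∑ₛ-⋆ (λ a x → χ₄ a ⊗ is0 x) (λ b y → χ₄ b ⊗ is2 y) n) (⋆-cong (G-scale 3 is0 is0-∤ is0-4*) Y-scale n))
           (trans (∑ₛ-⋆ (λ a x → χ₄ a ⊗ is2 x) (λ b y → χ₄ b ⊗ is0 y) n) (trans (⋆-cong Y-scale (G-scale 3 is0 is0-∤ is0-4*) n) (⋆-comm (dil 2 Y) (dil 4 G) n)))) ⟩
    (Y ⋆ Y) n ⊕ ℤ.- + 2 ⊗ ((dil 4 G ⋆ dil 2 Y) n ⊕ (dil 4 G ⋆ dil 2 Y) n)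
      ≡⟨ collect ((Y ⋆ Y) n) ((dil 4 G ⋆ dil 2 Y) n) ⟩
    (Y ⋆ Y) n ⊖ + 4 ⊗ (dil 4 G ⋆ dil 2 Y) n ∎
    where
    open ≡-Reasoning
    collect : ∀ u v → u ⊕ ℤ.- + 2 ⊗ (v ⊕ v) ≡ u ⊖ + 4 ⊗ v
    collect = solve-∀
    H₁ H₂ H₃ : ℕ → ℕ → ℕ → ℕ → ℤ
    H₁ a b x y = (χ₄ a ⊗ od x) ⊗ (χ₄ b ⊗ od y)
    H₂ a b x y = (χ₄ a ⊗ is0 x) ⊗ (χ₄ b ⊗ is2 y)
    H₃ a b x y = (χ₄ a ⊗ is2 x) ⊗ (χ₄ b ⊗ is0 y)
    -- The indicator of a x + b y ≡ 2 modulo 4. Multiplying by it turns an identity valid on one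
    -- class into one valid for all residues, which can be checked exhaustively.
    δ : ℕ → ℕ → ℕ → ℕ → ℤ
    δ a b x y = is2 (a * x + b * y)
    rhs : ℕ → ℕ → ℕ → ℕ → ℤ
    rhs a b x y = H₁ a b x y ⊕ ℤ.- + 2 ⊗ (H₂ a b x y ⊕ H₃ a b x y)
    pointwise : ∀ a b x y → (a * x + b * y) % 4 ≡ 2 → F a b x y ≡ rhs a b x y
    pointwise a b x y eq = trans (sym (F-mod a b x y)) (trans
      (trans (sym (ℤₚ.*-identityˡ _)) (trans (cong (_⊗ F (a % 4) (b % 4) (x % 4) (y % 4)) (sym δ≡1))
        (trans (check₄-sound 4 4 (λ a b x y → δ a b x y ⊗ F a b x y) (λ a b x y → δ a b x y ⊗ rhs a b x y) refl (a % 4) (b % 4) (x % 4) (y % 4) (m%n<n a 4) (m%n<n b 4) (m%n<n x 4) (m%n<n y 4))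
          (trans (cong (_⊗ rhs (a % 4) (b % 4) (x % 4) (y % 4)) δ≡1) (ℤₚ.*-identityˡ _)))))
      (rhs-mod a b x y))
      where
      δ≡1 : δ (a % 4) (b % 4) (x % 4) (y % 4) ≡ + 1
      δ≡1 = cong (table₄ (+ 0) (+ 0) (+ 1) (+ 0)) (trans (residue-form 4 a b x y) eq)
      c4 : ∀ n → χ₄ (n % 4) ≡ χ₄ n
      c4 = mod₄ (table₄ _ _ _ _) 4 n∣n
      F-mod : ∀ a b x y → F (a % 4) (b % 4) (x % 4) (y % 4) ≡ F a b x y
      F-mod a b x y = cong₂ _⊗_ (cong₂ _⊗_ (c4 a) (c4 b)) (cong₂ (λ u v → + 1 ⊖ + 3 ⊗ (u ⊗ v)) (ev-mod 4 (divides 2 refl) x) (ev-mod 4 (divides 2 refl) y))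
      prod : (e e′ : ℕ → ℤ) → (∀ n → e (n % 4) ≡ e n) → (∀ n → e′ (n % 4) ≡ e′ n) → ∀ a b x y →
        (χ₄ (a % 4) ⊗ e (x % 4)) ⊗ (χ₄ (b % 4) ⊗ e′ (y % 4)) ≡ (χ₄ a ⊗ e x) ⊗ (χ₄ b ⊗ e′ y)
      prod e e′ h h′ a b x y = cong₂ _⊗_ (cong₂ _⊗_ (c4 a) (h x)) (cong₂ _⊗_ (c4 b) (h′ y))
      i0 : ∀ n → is0 (n % 4) ≡ is0 n
      i0 = mod₄ (table₄ _ _ _ _) 4 n∣n
      i2 : ∀ n → is2 (n % 4) ≡ is2 n
      i2 = mod₄ (table₄ _ _ _ _) 4 n∣n
      rhs-mod : ∀ a b x y → rhs (a % 4) (b % 4) (x % 4) (y % 4) ≡ rhs a b x y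
      rhs-mod a b x y = cong₂ (λ u v → u ⊕ ℤ.- + 2 ⊗ v) (prod od od (od-mod 4 (divides 2 refl)) (od-mod 4 (divides 2 refl)) a b x y)
        (cong₂ _⊕_ (prod is0 is2 i0 i2 a b x y) (prod is2 is0 i2 i0 a b x y))

sumBelow-⊗ : ∀ n c h → sumBelow n (λ i → c ⊗ h i) ≡ c ⊗ sumBelow n h
sumBelow-⊗ zero    c h = sym (ℤₚ.*-zeroʳ c)
sumBelow-⊗ (suc n) c h = trans (cong (_⊕ c ⊗ h n) (sumBelow-⊗ n c h)) (sym (ℤₚ.*-distribˡ-+ c (sumBelow n h) (h n)))

∑d-rows : ∀ n M .{{_ : NonZero M}} (u : ℕ → ℕ → ℤ) (q : ℕ → ℕ → ℤ) (c : ℕ → ℤ) →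
  (∀ m → sumBelow m (λ b → q (suc m % M) (suc b % M)) ≡ c (suc m)) →
  ∑d n (λ a b d → u (a + b) d ⊗ q ((a + b) % M) (b % M)) ≡ D (λ m d → u m d ⊗ c m) n
∑d-rows n M u q c rows = trans (∑d-divisors n (λ a b m d → u m d ⊗ q (m % M) (b % M)))
  (∑-cong (divE n) (λ {(m , d)} _ → trans (sumBelow-⊗ m (u (suc m) (suc d)) (λ b → q (suc m % M) (suc b % M))) (cong (u (suc m) (suc d) ⊗_) (rows m))))

half-growth : ∀ r k j → (r + k * (j * 2)) ℕ./ 2 ≡ r ℕ./ 2 + k * j
half-growth r k j = trans (cong (λ w → (r + w) ℕ./ 2) (sym (ℕₚ.*-assoc k j 2))) (trans (+-distrib-/-∣ʳ r (divides (k * j) refl)) (cong (λ w → r ℕ./ 2 + w) (m*n/n≡m (k * j) 2)))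

pos-+* : ∀ a k j → + (a + k * j) ≡ + a ⊕ + k ⊗ + j
pos-+* a k j = trans (ℤₚ.pos-+ a (k * j)) (cong (+ a ⊕_) (ℤₚ.pos-* k j))

residue-product : ∀ M .{{_ : NonZero M}} a x → ((a % M) * (x % M)) % M ≡ (a * x) % M
residue-product M a x = sym (%-distribˡ-* a x M)

≡0⇒≡ : ∀ {u v} → u ⊖ v ≡ + 0 → u ≡ v
≡0⇒≡ {u} {v} h = trans (lemma u v) (trans (cong (_⊕ v) h) (ℤₚ.+-identityˡ v))
  where
  lemma : ∀ u v → u ≡ (u ⊖ v) ⊕ v
  lemma = solve-∀

double-cancel : ∀ {u v} → u ⊕ u ≡ + 2 ⊗ v → u ≡ v
double-cancel {u} {v} h = double-injective (trans h (lemma v))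
  where
  lemma : ∀ v → + 2 ⊗ v ≡ v ⊕ v
  lemma = solve-∀

module TwoSquaresBoundary where
  open TwoSquares
  open Periodic 4 2 F g refl refl

  i0 : ∀ n → is0 (n % 4) ≡ is0 n
  i0 = mod₄ (table₄ _ _ _ _) 4 n∣n
  i2 : ∀ n → is2 (n % 4) ≡ is2 n
  i2 = mod₄ (table₄ _ _ _ _) 4 n∣n
  i3 : ∀ n → is3 (n % 4) ≡ is3 n
  i3 = mod₄ (table₄ _ _ _ _) 4 n∣n
  o4 : ∀ n → od (n % 4) ≡ od n
  o4 = od-mod 4 (divides 2 refl)
  e4 : ∀ n → ev (n % 4) ≡ ev n
  e4 = ev-mod 4 (divides 2 refl)
  m4 : ∀ n → m₄ (n % 4) ≡ m₄ n
  m4 n = cong₂ _⊖_ (i2 n) (i0 n)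

  -- Row sums of periodic functions are linear up to periodic terms: `c` is ⌊m/2⌋ `s` + `u` with
  -- periodic `s` and `u`. The index 1 belongs to the rows in a and b, the index 2 to those in x and
  -- y.
  κ₀ s₁ u₁ s₂ u₂ c₁ c₂ g₀ : ℕ → ℤ
  κ₀ d = κ d 0
  s₁ m = m₄ m
  u₁ m = + 2 ⊗ is3 m
  c₁ m = + (m ℕ./ 2) ⊗ s₁ m ⊕ u₁ m
  s₂ m = + 2 ⊗ od m ⊖ ev m
  u₂ m = + 2 ⊗ ev m
  c₂ m = + (m ℕ./ 2) ⊗ s₂ m ⊕ u₂ m
  g₀ d = g₄ (d % 4) (d % 4)

  κs : ℕ → ℕ → ℤ
  κs m y = + 1 ⊖ + 3 ⊗ (ev m ⊗ ev y)

  rows₁ : ∀ m → sumBelow m (λ b → g₄ (suc m % 4) (suc b % 4)) ≡ c₁ (suc m)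
  rows₁ = row-sum 4 g₄ c₁ (λ r → + 2 ⊗ s₁ r) growth refl refl
    where
    lemma : ∀ h k s u → (h ⊕ k ⊗ + 2) ⊗ s ⊕ u ≡ (h ⊗ s ⊕ u) ⊕ k ⊗ (+ 2 ⊗ s)
    lemma = solve-∀
    growth : ∀ r k → c₁ (r + k * 4) ≡ c₁ r ⊕ + k ⊗ (+ 2 ⊗ s₁ (r % 4))
    growth r k = trans (cong₂ (λ h (t : ℤ × ℤ) → + h ⊗ proj₁ t ⊕ proj₂ t) (half-growth r k 2)
        (cong (λ w → (table₄ (+ 0) (+ 0) (+ 1) (+ 0) w ⊖ table₄ (+ 1) (+ 0) (+ 0) (+ 0) w) , + 2 ⊗ table₄ (+ 0) (+ 0) (+ 0) (+ 1) w) ([m+kn]%n≡m%n r k 4)))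
      (trans (cong (λ h → h ⊗ s₁ r ⊕ u₁ r) (pos-+* (r ℕ./ 2) k 2)) (trans (lemma (+ (r ℕ./ 2)) (+ k) (s₁ r) (u₁ r)) (cong (λ w → c₁ r ⊕ + k ⊗ (+ 2 ⊗ w)) (sym (m4 r)))))

  rows₂ : ∀ m → sumBelow m (λ b → κs (suc m % 2) (suc b % 2)) ≡ c₂ (suc m)
  rows₂ = row-sum 2 κs c₂ s₂ growth refl refl
    where
    lemma : ∀ h k s u → (h ⊕ k ⊗ + 1) ⊗ s ⊕ u ≡ (h ⊗ s ⊕ u) ⊕ k ⊗ s
    lemma = solve-∀
    growth : ∀ r k → c₂ (r + k * 2) ≡ c₂ r ⊕ + k ⊗ s₂ (r % 2)
    growth r k = trans (cong₂ (λ h w → + h ⊗ (+ 2 ⊗ + w ⊖ (+ 1 ⊖ + w)) ⊕ + 2 ⊗ (+ 1 ⊖ + w)) (half-growth r k 1) ([m+kn]%n≡m%n r k 2))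
      (trans (cong (λ h → h ⊗ s₂ r ⊕ u₂ r) (pos-+* (r ℕ./ 2) k 1)) (trans (lemma (+ (r ℕ./ 2)) (+ k) (s₂ r) (u₂ r))
        (cong (λ w → c₂ r ⊕ + k ⊗ (+ 2 ⊗ w ⊖ (+ 1 ⊖ w))) (sym (od-mod 2 n∣n r)))))

  first : ∀ n → ∑d n (λ a b d → g↑ (a + b) b d 0) ≡ D (λ m d → κ₀ d ⊗ c₁ m) n
  first n = trans (∑d-cong n (λ a b d → cong (_⊗ g₄ ((a + b) % 4) (b % 4)) (cong (λ w → + 1 ⊖ + 3 ⊗ (w ⊗ + 1)) (ev-mod 2 n∣n d)))) (∑d-rows n 4 (λ _ → κ₀) g₄ c₁ rows₁)

  second : ∀ n → ∑d n (λ x y d → g↑ d d x y) ≡ D (λ m d → g₀ d ⊗ c₂ m) n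
  second n = trans (∑d-cong n (λ x y d → trans (ℤₚ.*-comm (κ (x % 2) (y % 2)) (g₀ d)) (cong (g₀ d ⊗_) (by-sum x y)))) (∑d-rows n 2 (λ _ → g₀) κs c₂ rows₂)
    where
    by-sum : ∀ x y → κ (x % 2) (y % 2) ≡ κs ((x + y) % 2) (y % 2)
    by-sum x y = trans (check₄-sound 2 1 (λ x y _ _ → κ x y) (λ x y _ _ → κs ((x + y) % 2) y) refl (x % 2) (y % 2) 0 0 (m%n<n x 2) (m%n<n y 2) (s≤s z≤n) (s≤s z≤n))
      (cong (λ w → κs w (y % 2)) (sym (%-distribˡ-+ x y 2)))

  slope offset target : ℕ → ℕ → ℤ
  slope m d = κ₀ d ⊗ s₁ m ⊖ g₄ d d ⊗ s₂ m
  offset m d = κ₀ d ⊗ u₁ m ⊖ g₄ d d ⊗ u₂ m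
  target m d = + 2 ⊗ (is2 m ⊗ od d) ⊖ + 4 ⊗ (is3 m ⊗ is2 d)

  -- For m d ≡ 2 modulo 4 the two boundary sums grow with m at the same rate: `slope` vanishes
  -- there, and only the periodic `offset` is left.
  value : ∀ m d → (m * d) % 4 ≡ 2 → κ₀ d ⊗ c₁ m ⊖ g₀ d ⊗ c₂ m ≡ target m d
  value m d md = begin
    κ₀ d ⊗ (h ⊗ s₁ m ⊕ u₁ m) ⊖ g₀ d ⊗ (h ⊗ s₂ m ⊕ u₂ m)               ≡⟨ lemma (κ₀ d) h (s₁ m) (u₁ m) (g₀ d) (s₂ m) (u₂ m) ⟩
    h ⊗ (κ₀ d ⊗ s₁ m ⊖ g₀ d ⊗ s₂ m) ⊕ (κ₀ d ⊗ u₁ m ⊖ g₀ d ⊗ u₂ m)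
      ≡⟨ cong₂ (λ u v → h ⊗ u ⊕ v)
           (cong₂ _⊖_ (cong₂ _⊗_ (sym κ4) (sym (m4 m))) (cong (g₀ d ⊗_) (sym s4)))
           (cong₂ _⊖_ (cong₂ _⊗_ (sym κ4) (cong (+ 2 ⊗_) (sym (i3 m)))) (cong (g₀ d ⊗_) (cong (+ 2 ⊗_) (sym (e4 m))))) ⟩
    h ⊗ slope (m % 4) (d % 4) ⊕ offset (m % 4) (d % 4)                         ≡⟨ cong₂ (λ u v → h ⊗ u ⊕ v) (on slope (λ _ _ → + 0) refl) (on offset target refl) ⟩
    h ⊗ + 0 ⊕ target (m % 4) (d % 4)                                       ≡⟨ trans (cong (_⊕ target (m % 4) (d % 4)) (ℤₚ.*-zeroʳ h)) (ℤₚ.+-identityˡ _) ⟩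
    target (m % 4) (d % 4)                                                 ≡⟨ cong₂ (λ u v → + 2 ⊗ u ⊖ + 4 ⊗ v) (cong₂ _⊗_ (i2 m) (o4 d)) (cong₂ _⊗_ (i3 m) (i2 d)) ⟩
    target m d                                                             ∎
    where
    open ≡-Reasoning
    h : ℤ
    h = + (m ℕ./ 2)
    lemma : ∀ k h s u g s′ u′ → k ⊗ (h ⊗ s ⊕ u) ⊖ g ⊗ (h ⊗ s′ ⊕ u′) ≡ h ⊗ (k ⊗ s ⊖ g ⊗ s′) ⊕ (k ⊗ u ⊖ g ⊗ u′)
    lemma = solve-∀
    κ4 : κ₀ (d % 4) ≡ κ₀ d
    κ4 = cong (λ w → + 1 ⊖ + 3 ⊗ (w ⊗ + 1)) (e4 d)
    s4 : s₂ (m % 4) ≡ s₂ m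
    s4 = cong₂ (λ u v → + 2 ⊗ u ⊖ v) (o4 m) (e4 m)
    δ≡1 : is2 ((m % 4) * (d % 4)) ≡ + 1
    δ≡1 = cong (table₄ (+ 0) (+ 0) (+ 1) (+ 0)) (trans (residue-product 4 m d) md)
    on : (H K : ℕ → ℕ → ℤ) → check₄ 4 1 (λ m d _ _ → is2 (m * d) ⊗ H m d) (λ m d _ _ → is2 (m * d) ⊗ K m d) ≡ true → H (m % 4) (d % 4) ≡ K (m % 4) (d % 4)
    on H K c = trans (sym (trans (cong (_⊗ H (m % 4) (d % 4)) δ≡1) (ℤₚ.*-identityˡ _)))
      (trans (check₄-sound 4 1 (λ m d _ _ → is2 (m * d) ⊗ H m d) (λ m d _ _ → is2 (m * d) ⊗ K m d) c (m % 4) (d % 4) 0 0 (m%n<n m 4) (m%n<n d 4) (s≤s z≤n) (s≤s z≤n))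
        (trans (cong (_⊗ K (m % 4) (d % 4)) δ≡1) (ℤₚ.*-identityˡ _)))

  total : ∀ n → n % 4 ≡ 2 → ∑ₛ n F ≡ dil 2 Y n
  total n n≡2 = double-cancel (begin
    ∑ₛ n F ⊕ ∑ₛ n F            ≡⟨ cong (λ s → s ⊕ s) (∑ₛ-cong n (λ a b x y _ → sym (F-periodic a b x y))) ⟩
    ∑ₛ n F↑ ⊕ ∑ₛ n F↑          ≡⟨ boundary n ⟩
    ∑d n (λ a b d → g↑ (a + b) b d 0) ⊖ ∑d n (λ x y d → g↑ d d x y)   ≡⟨ cong₂ _⊖_ (first n) (second n) ⟩
    D (λ m d → κ₀ d ⊗ c₁ m) n ⊖ D (λ m d → g₀ d ⊗ c₂ m) n
      ≡⟨ trans (cong (D (λ m d → κ₀ d ⊗ c₁ m) n ⊕_) (sym (ℤₚ.-1*i≡-i _))) (sym (D-⊖ (λ m d → κ₀ d ⊗ c₁ m) (λ m d → g₀ d ⊗ c₂ m) n)) ⟩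
    D (λ m d → κ₀ d ⊗ c₁ m ⊖ g₀ d ⊗ c₂ m) n   ≡⟨ D-cong-on n (λ m d eq → value m d (trans (cong (_% 4) eq) n≡2)) ⟩
    D target n                      ≡⟨ D-⊖ (λ m d → + 2 ⊗ (is2 m ⊗ od d)) (λ m d → + 4 ⊗ (is3 m ⊗ is2 d)) n ⟩
    D (λ m d → + 2 ⊗ (is2 m ⊗ od d)) n ⊕ ℤ.-1ℤ ⊗ D (λ m d → + 4 ⊗ (is3 m ⊗ is2 d)) n
      -- Exchanging m and d gives both sums the factor `is2 d`; the character then appears as
      -- `od m ⊖ + 2 ⊗ is3 m`.
      ≡⟨ cong (_⊕ ℤ.-1ℤ ⊗ D (λ m d → + 4 ⊗ (is3 m ⊗ is2 d)) n) (D-swap (λ m d → + 2 ⊗ (is2 m ⊗ od d)) n) ⟩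
    D (λ m d → + 2 ⊗ (is2 d ⊗ od m)) n ⊕ ℤ.-1ℤ ⊗ D (λ m d → + 4 ⊗ (is3 m ⊗ is2 d)) n
      ≡⟨ D-⊖ (λ m d → + 2 ⊗ (is2 d ⊗ od m)) (λ m d → + 4 ⊗ (is3 m ⊗ is2 d)) n ⟨
    D (λ m d → + 2 ⊗ (is2 d ⊗ od m) ⊖ + 4 ⊗ (is3 m ⊗ is2 d)) n
      ≡⟨ D-cong (λ m d → trans (factor (is2 d) (od m) (is3 m)) (cong (λ w → + 2 ⊗ (w ⊗ is2 d)) (char m))) n ⟩
    D (λ m d → + 2 ⊗ (χ₄ m ⊗ is2 d)) n   ≡⟨ D-⊗ (+ 2) (λ m d → χ₄ m ⊗ is2 d) n ⟩
    + 2 ⊗ D (λ m d → χ₄ m ⊗ is2 d) n     ≡⟨ cong (+ 2 ⊗_) (Y-scale n) ⟩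
    + 2 ⊗ dil 2 Y n                      ∎)
    where
    open ≡-Reasoning
    factor : ∀ e o t → + 2 ⊗ (e ⊗ o) ⊖ + 4 ⊗ (t ⊗ e) ≡ + 2 ⊗ ((o ⊖ + 2 ⊗ t) ⊗ e)
    factor = solve-∀
    char : ∀ m → od m ⊖ + 2 ⊗ is3 m ≡ χ₄ m
    char m = trans (sym (cong₂ (λ u v → u ⊖ + 2 ⊗ v) (o4 m) (i3 m)))
      (trans (check₁-sound 4 (λ m → od m ⊖ + 2 ⊗ is3 m) χ₄ refl (m % 4) (m%n<n m 4)) (mod₄ (table₄ _ _ _ _) 4 n∣n m))

  Y² : ∀ n → n % 4 ≡ 2 → (Y ⋆ Y) n ≡ dil 2 Y n ⊕ + 4 ⊗ (dil 4 G ⋆ dil 2 Y) n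
  Y² n n≡2 = trans (lemma ((Y ⋆ Y) n) (+ 4 ⊗ (dil 4 G ⋆ dil 2 Y) n)) (cong (_⊕ + 4 ⊗ (dil 4 G ⋆ dil 2 Y) n) (trans (sym (split n n≡2)) (total n n≡2)))
    where
    lemma : ∀ u v → u ≡ (u ⊖ v) ⊕ v
    lemma = solve-∀

-- The shape x² + 7 y²: ∑ χ(a) χ(b) with weights modulo 2

τ ρ : Seq
τ = D (λ a x → χ a)
ρ = D (λ a x → χ a ⊗ od a)

χ-* : ∀ c (e : ℤ) → check₁ 7 (λ a → χ (a * c)) (λ a → e ⊗ χ a) ≡ true → ∀ a → χ (a * c) ≡ e ⊗ χ a
χ-* c e h a = begin
  χ (a * c)          ≡⟨ cong legendre₇ (trans (%-distribˡ-* a c 7) (trans (cong (λ w → (w * (c % 7)) % 7) (sym (m%n%n≡m%n a 7))) (sym (%-distribˡ-* (a % 7) c 7)))) ⟩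
  χ (a % 7 * c)      ≡⟨ check₁-sound 7 (λ a → χ (a * c)) (λ a → e ⊗ χ a) h (a % 7) (m%n<n a 7) ⟩
  e ⊗ χ (a % 7)      ≡⟨ cong (e ⊗_) (χ-mod 7 n∣n a) ⟩
  e ⊗ χ a            ∎
  where open ≡-Reasoning

χ-2* : ∀ a → χ (a * 2) ≡ χ a
χ-2* a = trans (χ-* 2 (+ 1) refl a) (ℤₚ.*-identityˡ (χ a))

ev-∤ : ∀ a → ¬ (2 ∣ a) → ev a ≡ + 0
ev-∤ = od-∤

τ-split : τ ≈ dil 2 τ ⊞ ρ
τ-split = ≈-trans (D-cong (λ a x → lemma (χ a) (od a))) (≈-trans (D-⊕ (λ a x → χ a ⊗ ev a) (λ a x → χ a ⊗ od a))
  (⊞-cong (≈-trans (D-scale 1 (λ a x → χ a ⊗ ev a) (λ a x h → trans (cong (χ a ⊗_) (ev-∤ a h)) (ℤₚ.*-zeroʳ (χ a))))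
    (dil-cong 2 (D-cong (λ a x → trans (cong₂ _⊗_ (χ-2* a) (ev-2* a)) (ℤₚ.*-identityʳ (χ a)))))) refl≈))
  where
  lemma : ∀ u v → u ≡ u ⊗ (+ 1 ⊖ v) ⊕ u ⊗ v
  lemma = solve-∀

τ-splitʳ : τ ≈ dil 2 τ ⊞ D (λ a x → χ a ⊗ od x)
τ-splitʳ = ≈-trans (D-cong (λ a x → lemma (χ a) (od x))) (≈-trans (D-⊕ (λ a x → χ a ⊗ ev x) (λ a x → χ a ⊗ od x))
  (⊞-cong (≈-trans (D-scaleʳ 1 (λ a x → χ a ⊗ ev x) (λ a x h → trans (cong (χ a ⊗_) (ev-∤ x h)) (ℤₚ.*-zeroʳ (χ a))))
    (dil-cong 2 (D-cong (λ a x → trans (cong (χ a ⊗_) (ev-2* x)) (ℤₚ.*-identityʳ (χ a)))))) refl≈))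
  where
  lemma : ∀ u v → u ≡ u ⊗ (+ 1 ⊖ v) ⊕ u ⊗ v
  lemma = solve-∀

-- As χ(2) = 1, the terms of τ with a even and those with x even both add up to τ_2, so the
-- complementary sums agree.
ρ-x : D (λ a x → χ a ⊗ od x) ≈ ρ
ρ-x n = +-cancelˡ (dil 2 τ n) _ _ (trans (sym (τ-splitʳ n)) (τ-split n))

ρ-scaleˣ : D (λ a x → χ a ⊗ od a ⊗ ev x) ≈ dil 2 ρ
ρ-scaleˣ = ≈-trans (D-scaleʳ 1 (λ a x → χ a ⊗ od a ⊗ ev x) (λ a x h → trans (cong (χ a ⊗ od a ⊗_) (ev-∤ x h)) (ℤₚ.*-zeroʳ (χ a ⊗ od a))))
  (dil-cong 2 (D-cong (λ a x → trans (cong (χ a ⊗ od a ⊗_) (ev-2* x)) (ℤₚ.*-identityʳ (χ a ⊗ od a)))))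

ρ-scaleᵃ : D (λ a x → χ a ⊗ ev a ⊗ od x) ≈ dil 2 ρ
ρ-scaleᵃ = ≈-trans (D-scale 1 (λ a x → χ a ⊗ ev a ⊗ od x) (λ a x h → cong (_⊗ od x) (trans (cong (χ a ⊗_) (ev-∤ a h)) (ℤₚ.*-zeroʳ (χ a)))))
  (dil-cong 2 (≈-trans (D-cong (λ a x → cong (_⊗ od x) (trans (cong₂ _⊗_ (χ-2* a) (ev-2* a)) (ℤₚ.*-identityʳ (χ a))))) ρ-x))

module SevenSquares where

  -- A function on P¹(𝔽₇): 1 at (1,0), (0,1) and (1,1), -1 at (1,3) and (1,5), and 0 elsewhere. It
  -- is symmetric and satisfies θ(a + b , b) - θ(a , b) = - χ(a) χ(b), which is Euclid's step apart
  -- from the weights modulo 2; hence the factor -2 in `g`.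
  θ : ℕ → ℕ → ℤ
  θ a b = (+ 1 ⊖ z₇ a ⊗ z₇ b) ⊗ (z₇ b ⊕ z₇ a ⊕ z₇ (a + 6 * b) ⊖ z₇ (b + 4 * a) ⊖ z₇ (b + 2 * a))

  -- The terms stand for ρ², - 2 τ ρ_2 and 4 ρ_2². In the last, one factor ρ_2 is realised by a odd,
  -- x even and the other by b even, y odd; with these realisations the step condition holds
  -- pointwise.
  F g : ℕ → ℕ → ℕ → ℕ → ℤ
  F a b x y = χ a ⊗ χ b ⊗ (od a ⊗ od b ⊖ + 2 ⊗ (od b ⊗ ev y) ⊕ + 4 ⊗ (od a ⊗ ev x ⊗ (ev b ⊗ od y)))
  g a b x y = ℤ.- + 2 ⊗ (ev (a * x + b * y) ⊗ (+ 1 ⊖ + 2 ⊗ (ev x ⊗ ev y)) ⊗ ((+ 1 ⊖ ev a ⊗ ev b) ⊗ θ a b))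

  open Periodic 14 2 F g refl refl

  7∣14 : 7 ∣ 14
  7∣14 = divides 2 refl
  2∣14 : 2 ∣ 14
  2∣14 = divides 7 refl

  F-periodic : ∀ a b x y → F↑ a b x y ≡ F a b x y
  F-periodic a b x y = cong₂ _⊗_ (cong₂ _⊗_ (χ-mod 14 7∣14 a) (χ-mod 14 7∣14 b)) (cong₂ _⊕_
    (cong₂ _⊖_ (cong₂ _⊗_ (od-mod 14 2∣14 a) (od-mod 14 2∣14 b)) (cong (+ 2 ⊗_) (cong₂ _⊗_ (od-mod 14 2∣14 b) (ev-mod 2 n∣n y))))
    (cong (+ 4 ⊗_) (cong₂ _⊗_ (cong₂ _⊗_ (od-mod 14 2∣14 a) (ev-mod 2 n∣n x)) (cong₂ _⊗_ (ev-mod 14 2∣14 b) (od-mod 2 n∣n y)))))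

  split : ∀ n → ∑ₛ n F ≡ ((ρ ⋆ ρ) n ⊖ + 2 ⊗ (τ ⋆ dil 2 ρ) n) ⊕ + 4 ⊗ (dil 2 ρ ⋆ dil 2 ρ) n
  split n = begin
    ∑ₛ n F
      ≡⟨ ∑ₛ-cong n (λ a b x y _ → expand (χ a) (χ b) (od a) (od b) (ev x) (ev y) (ev b) (od y)) ⟩
    ∑ₛ n (λ a b x y → (H₁ a b x y ⊕ ℤ.- + 2 ⊗ H₂ a b x y) ⊕ + 4 ⊗ H₃ a b x y)
      ≡⟨ trans (∑ₛ-⊕ n (λ a b x y → H₁ a b x y ⊕ ℤ.- + 2 ⊗ H₂ a b x y) (λ a b x y → + 4 ⊗ H₃ a b x y)) (cong₂ _⊕_
           (trans (∑ₛ-⊕ n H₁ (λ a b x y → ℤ.- + 2 ⊗ H₂ a b x y)) (cong (∑ₛ n H₁ ⊕_) (∑ₛ-⊗ n (ℤ.- + 2) H₂))) (∑ₛ-⊗ n (+ 4) H₃)) ⟩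
    (∑ₛ n H₁ ⊕ ℤ.- + 2 ⊗ ∑ₛ n H₂) ⊕ + 4 ⊗ ∑ₛ n H₃
      ≡⟨ cong₂ _⊕_ (cong₂ (λ u v → u ⊕ ℤ.- + 2 ⊗ v)
           (∑ₛ-⋆ (λ a x → χ a ⊗ od a) (λ b y → χ b ⊗ od b) n)
           (trans (∑ₛ-⋆ (λ a x → χ a) (λ b y → χ b ⊗ od b ⊗ ev y) n) (⋆-cong {τ} refl≈ ρ-scaleˣ n)))
         (cong (+ 4 ⊗_) (trans (∑ₛ-⋆ (λ a x → χ a ⊗ od a ⊗ ev x) (λ b y → χ b ⊗ ev b ⊗ od y) n) (⋆-cong ρ-scaleˣ ρ-scaleᵃ n))) ⟩
    ((ρ ⋆ ρ) n ⊕ ℤ.- + 2 ⊗ (τ ⋆ dil 2 ρ) n) ⊕ + 4 ⊗ (dil 2 ρ ⋆ dil 2 ρ) n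
      ≡⟨ tidy ((ρ ⋆ ρ) n) ((τ ⋆ dil 2 ρ) n) ((dil 2 ρ ⋆ dil 2 ρ) n) ⟩
    ((ρ ⋆ ρ) n ⊖ + 2 ⊗ (τ ⋆ dil 2 ρ) n) ⊕ + 4 ⊗ (dil 2 ρ ⋆ dil 2 ρ) n ∎
    where
    open ≡-Reasoning
    H₁ H₂ H₃ : ℕ → ℕ → ℕ → ℕ → ℤ
    H₁ a b x y = (χ a ⊗ od a) ⊗ (χ b ⊗ od b)
    H₂ a b x y = χ a ⊗ (χ b ⊗ od b ⊗ ev y)
    H₃ a b x y = (χ a ⊗ od a ⊗ ev x) ⊗ (χ b ⊗ ev b ⊗ od y)
    expand : ∀ s t o p e f h k → s ⊗ t ⊗ (o ⊗ p ⊖ + 2 ⊗ (p ⊗ f) ⊕ + 4 ⊗ (o ⊗ e ⊗ (h ⊗ k))) ≡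
      ((s ⊗ o) ⊗ (t ⊗ p) ⊕ ℤ.- + 2 ⊗ (s ⊗ (t ⊗ p ⊗ f))) ⊕ + 4 ⊗ ((s ⊗ o ⊗ e) ⊗ (t ⊗ h ⊗ k))
    expand = solve-∀
    tidy : ∀ u v w → (u ⊕ ℤ.- + 2 ⊗ v) ⊕ + 4 ⊗ w ≡ (u ⊖ + 2 ⊗ v) ⊕ + 4 ⊗ w
    tidy = solve-∀

  -- `w` is m/7 on multiples of 7 and 0 elsewhere. Only there do the row sums of `θ` grow: the
  -- values of `θ` at the points (1 , t) add up to 1 + 1 - 1 - 1 = 0, whereas for 7 ∣ m every b
  -- prime to 7 contributes 1.
  w c₁ c₂ : ℕ → ℤ
  w m = z₇ m ⊗ + (m ℕ./ 7)
  c₁ m = ev m ⊗ (+ 3 ⊗ w m) ⊕ od m ⊗ ((χ m ⊖ (+ 1 ⊖ z₇ m)) ⊕ + 6 ⊗ w m)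
  c₂ m = ev m ⊕ od m ⊗ (+ m ⊖ + 1)

  q₁ q₂ : ℕ → ℕ → ℤ
  q₁ a b = (+ 1 ⊖ ev a ⊗ ev b) ⊗ θ a b
  q₂ m y = + 1 ⊖ + 2 ⊗ (ev m ⊗ ev y)

  P₁ P₂ : ℕ → ℤ
  P₁ r = z₇ r ⊗ (+ 6 ⊗ ev r ⊕ + 12 ⊗ od r)
  P₂ r = + 2 ⊗ od r

  period : ∀ r k → (r + k * 14) % 14 ≡ r % 14
  period r k = [m+kn]%n≡m%n r k 14

  per : ∀ (h : ℕ → ℤ) → (∀ n → h (n % 14) ≡ h n) → ∀ r k → h (r + k * 14) ≡ h r
  per h h-mod r k = trans (sym (h-mod (r + k * 14))) (trans (cong h (period r k)) (h-mod r))

  rows₁ : ∀ m → sumBelow m (λ b → q₁ (suc m % 14) (suc b % 14)) ≡ c₁ (suc m)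
  rows₁ = row-sum 14 q₁ c₁ P₁ growth refl refl
    where
    lemma : ∀ e o x z h k → e ⊗ (+ 3 ⊗ (z ⊗ (h ⊕ k ⊗ + 2))) ⊕ o ⊗ ((x ⊖ (+ 1 ⊖ z)) ⊕ + 6 ⊗ (z ⊗ (h ⊕ k ⊗ + 2))) ≡
      (e ⊗ (+ 3 ⊗ (z ⊗ h)) ⊕ o ⊗ ((x ⊖ (+ 1 ⊖ z)) ⊕ + 6 ⊗ (z ⊗ h))) ⊕ k ⊗ (z ⊗ (+ 6 ⊗ e ⊕ + 12 ⊗ o))
    lemma = solve-∀
    seventh : ∀ r k → + ((r + k * 14) ℕ./ 7) ≡ + (r ℕ./ 7) ⊕ + k ⊗ + 2
    seventh r k = trans (cong +_ (trans (cong (λ v → (r + v) ℕ./ 7) (sym (ℕₚ.*-assoc k 2 7))) (trans (+-distrib-/-∣ʳ r (divides (k * 2) refl)) (cong (λ v → r ℕ./ 7 + v) (m*n/n≡m (k * 2) 7)))))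
      (pos-+* (r ℕ./ 7) k 2)
    shape : ℤ → ℤ → ℤ → ℤ → ℤ → ℤ
    shape e o x z h = e ⊗ (+ 3 ⊗ (z ⊗ h)) ⊕ o ⊗ ((x ⊖ (+ 1 ⊖ z)) ⊕ + 6 ⊗ (z ⊗ h))
    growth : ∀ r k → c₁ (r + k * 14) ≡ c₁ r ⊕ + k ⊗ P₁ (r % 14)
    growth r k = begin
      c₁ (r + k * 14)
        ≡⟨ cong₂ (λ e o → shape e o (χ (r + k * 14)) (z₇ (r + k * 14)) (+ ((r + k * 14) ℕ./ 7))) (per ev (ev-mod 14 2∣14) r k) (per od (od-mod 14 2∣14) r k) ⟩
      shape (ev r) (od r) (χ (r + k * 14)) (z₇ (r + k * 14)) (+ ((r + k * 14) ℕ./ 7))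
        ≡⟨ cong₂ (λ x z → shape (ev r) (od r) x z (+ ((r + k * 14) ℕ./ 7))) (per χ (χ-mod 14 7∣14) r k) (per z₇ (z₇-mod 14 7∣14) r k) ⟩
      shape (ev r) (od r) (χ r) (z₇ r) (+ ((r + k * 14) ℕ./ 7))
        ≡⟨ cong (shape (ev r) (od r) (χ r) (z₇ r)) (seventh r k) ⟩
      shape (ev r) (od r) (χ r) (z₇ r) (+ (r ℕ./ 7) ⊕ + k ⊗ + 2)
        ≡⟨ lemma (ev r) (od r) (χ r) (z₇ r) (+ (r ℕ./ 7)) (+ k) ⟩
      c₁ r ⊕ + k ⊗ (z₇ r ⊗ (+ 6 ⊗ ev r ⊕ + 12 ⊗ od r))
        ≡⟨ cong (λ u → c₁ r ⊕ + k ⊗ u) (cong₂ _⊗_ (z₇-mod 14 7∣14 r) (cong₂ (λ e o → + 6 ⊗ e ⊕ + 12 ⊗ o) (ev-mod 14 2∣14 r) (od-mod 14 2∣14 r))) ⟨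
      c₁ r ⊕ + k ⊗ P₁ (r % 14) ∎
      where open ≡-Reasoning

  rows₂ : ∀ m → sumBelow m (λ b → q₂ (suc m % 2) (suc b % 2)) ≡ c₂ (suc m)
  rows₂ = row-sum 2 q₂ c₂ P₂ growth refl refl
    where
    lemma : ∀ r k o → (+ 1 ⊖ o) ⊕ o ⊗ ((r ⊕ k ⊗ + 2) ⊖ + 1) ≡ ((+ 1 ⊖ o) ⊕ o ⊗ (r ⊖ + 1)) ⊕ k ⊗ (+ 2 ⊗ o)
    lemma = solve-∀
    growth : ∀ r k → c₂ (r + k * 2) ≡ c₂ r ⊕ + k ⊗ P₂ (r % 2)
    growth r k = trans (cong₂ (λ v u → (+ 1 ⊖ + v) ⊕ + v ⊗ (u ⊖ + 1)) ([m+kn]%n≡m%n r k 2) (pos-+* r k 2))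
      (trans (lemma (+ r) (+ k) (od r)) (cong (λ u → c₂ r ⊕ + k ⊗ (+ 2 ⊗ u)) (sym (od-mod 2 n∣n r))))

  u₁ u₂ : ℕ → ℕ → ℤ
  u₁ m d = ℤ.- + 2 ⊗ (ev (m * d) ⊗ (+ 1 ⊖ + 2 ⊗ ev d))
  u₂ m d = ℤ.- + 2 ⊗ (ev (m * d) ⊗ ((+ 1 ⊖ ev d ⊗ ev d) ⊗ (+ 1 ⊖ z₇ d)))

  ev-product : ∀ a x → ev (a % 14 * (x % 2)) ≡ ev (a * x)
  ev-product a x = trans (cong (λ v → + 1 ⊖ + v) (trans (%-distribˡ-* (a % 14) (x % 2) 2) (cong₂ (λ u v → (u * v) % 2) (m∣n⇒o%n%m≡o%m 2 14 a 2∣14) (m%n%n≡m%n x 2))))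
    (cong (λ v → + 1 ⊖ + v) (sym (%-distribˡ-* a x 2)))

  first : ∀ n → ∑d n (λ a b d → g↑ (a + b) b d 0) ≡ D (λ m d → u₁ m d ⊗ c₁ m) n
  first n = trans (∑d-cong n (λ a b d → pointwise (a + b) b d)) (∑d-rows n 14 u₁ q₁ c₁ rows₁)
    where
    regroup : ∀ s t q → ℤ.- + 2 ⊗ (s ⊗ (+ 1 ⊖ + 2 ⊗ (t ⊗ + 1)) ⊗ q) ≡ ℤ.- + 2 ⊗ (s ⊗ (+ 1 ⊖ + 2 ⊗ t)) ⊗ q
    regroup = solve-∀
    pointwise : ∀ m b d → g↑ m b d 0 ≡ u₁ m d ⊗ q₁ (m % 14) (b % 14)
    pointwise m b d = trans (cong₂ (λ s t → ℤ.- + 2 ⊗ (s ⊗ (+ 1 ⊖ + 2 ⊗ (t ⊗ + 1)) ⊗ q₁ (m % 14) (b % 14)))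
        (trans (cong ev (trans (cong (λ v → m % 14 * (d % 2) + v) (ℕₚ.*-zeroʳ (b % 14))) (ℕₚ.+-identityʳ _))) (ev-product m d)) (ev-mod 2 n∣n d))
      (regroup (ev (m * d)) (ev d) (q₁ (m % 14) (b % 14)))

  second : ∀ n → ∑d n (λ x y d → g↑ d d x y) ≡ D (λ m d → u₂ m d ⊗ c₂ m) n
  second n = trans (∑d-cong n pointwise) (∑d-rows n 2 u₂ q₂ c₂ rows₂)
    where
    regroup : ∀ s q t z → ℤ.- + 2 ⊗ (s ⊗ q ⊗ ((+ 1 ⊖ t ⊗ t) ⊗ z)) ≡ ℤ.- + 2 ⊗ (s ⊗ ((+ 1 ⊖ t ⊗ t) ⊗ z)) ⊗ q
    regroup = solve-∀
    pointwise : ∀ x y d → g↑ d d x y ≡ u₂ (x + y) d ⊗ q₂ ((x + y) % 2) (y % 2)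
    pointwise x y d = trans (cong₂ (λ s (t : ℤ × ℤ) → ℤ.- + 2 ⊗ (s ⊗ proj₁ t ⊗ proj₂ t)) sum-ev (cong₂ _,_ by-sum diagonal))
      (regroup (ev ((x + y) * d)) (q₂ ((x + y) % 2) (y % 2)) (ev d) (+ 1 ⊖ z₇ d))
      where
      diagonal : (+ 1 ⊖ ev (d % 14) ⊗ ev (d % 14)) ⊗ θ (d % 14) (d % 14) ≡ (+ 1 ⊖ ev d ⊗ ev d) ⊗ (+ 1 ⊖ z₇ d)
      diagonal = cong₂ _⊗_ (cong (λ e → + 1 ⊖ e ⊗ e) (ev-mod 14 2∣14 d))
        (trans (check₁-sound 14 (λ d → θ d d) (λ d → + 1 ⊖ z₇ d) refl (d % 14) (m%n<n d 14)) (cong (+ 1 ⊖_) (z₇-mod 14 7∣14 d)))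
      by-sum : + 1 ⊖ + 2 ⊗ (ev (x % 2) ⊗ ev (y % 2)) ≡ q₂ ((x + y) % 2) (y % 2)
      by-sum = trans (check₄-sound 2 1 (λ x y _ _ → + 1 ⊖ + 2 ⊗ (ev x ⊗ ev y)) (λ x y _ _ → q₂ ((x + y) % 2) y) refl (x % 2) (y % 2) 0 0 (m%n<n x 2) (m%n<n y 2) (s≤s z≤n) (s≤s z≤n))
        (cong (λ v → q₂ v (y % 2)) (sym (%-distribˡ-+ x y 2)))
      sum-ev : ev (d % 14 * (x % 2) + d % 14 * (y % 2)) ≡ ev ((x + y) * d)
      sum-ev = trans (cong ev (sym (ℕₚ.*-distribˡ-+ (d % 14) (x % 2) (y % 2))))
        (trans (cong (λ v → + 1 ⊖ + v) (trans (%-distribˡ-* (d % 14) (x % 2 + y % 2) 2)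
          (trans (cong₂ (λ u v → (u * v) % 2) (m∣n⇒o%n%m≡o%m 2 14 d 2∣14) (sym (%-distribˡ-+ x y 2))) (sym (%-distribˡ-* d (x + y) 2)))))
          (cong ev (ℕₚ.*-comm d (x + y))))

  -- Both sides vanish if m d is odd. Otherwise the growing term m - 1 of `c₂` requires m odd, hence
  -- d even, and then `u₂` is 0. What remains is the wanted character sum, a pair that is
  -- antisymmetric in m and d, and a multiple of the sum in `w-balance`.
  value : ∀ m d → u₁ m d ⊗ c₁ m ⊖ u₂ m d ⊗ c₂ m ≡
    (+ 2 ⊗ (χ m ⊗ od m ⊗ ev d) ⊕ (+ 2 ⊗ ((+ 1 ⊖ z₇ d) ⊗ od d ⊗ ev m) ⊖ + 2 ⊗ ((+ 1 ⊖ z₇ m) ⊗ od m ⊗ ev d))) ⊕ + 6 ⊗ (w m ⊗ (+ 2 ⊗ ev d ⊖ ev m))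
  value m d = trans (cong (λ v → shape (+ 1 ⊖ + v)) (%-distribˡ-* m d 2)) (cases (m % 2) (d % 2) (m%n<n m 2) (m%n<n d 2) (χ m) (z₇ m) (z₇ d) (w m) (+ m))
    where
    shape : ℤ → ℤ
    shape e = (ℤ.- + 2 ⊗ (e ⊗ (+ 1 ⊖ + 2 ⊗ ev d))) ⊗ c₁ m ⊖ (ℤ.- + 2 ⊗ (e ⊗ ((+ 1 ⊖ ev d ⊗ ev d) ⊗ (+ 1 ⊖ z₇ d)))) ⊗ c₂ m
    cases : ∀ r s → r < 2 → s < 2 → ∀ x z z′ w M →
      (ℤ.- + 2 ⊗ ((+ 1 ⊖ + ((r * s) % 2)) ⊗ (+ 1 ⊖ + 2 ⊗ (+ 1 ⊖ + s)))) ⊗ ((+ 1 ⊖ + r) ⊗ (+ 3 ⊗ w) ⊕ + r ⊗ ((x ⊖ (+ 1 ⊖ z)) ⊕ + 6 ⊗ w))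
        ⊖ (ℤ.- + 2 ⊗ ((+ 1 ⊖ + ((r * s) % 2)) ⊗ ((+ 1 ⊖ (+ 1 ⊖ + s) ⊗ (+ 1 ⊖ + s)) ⊗ (+ 1 ⊖ z′)))) ⊗ ((+ 1 ⊖ + r) ⊕ + r ⊗ (M ⊖ + 1)) ≡
      (+ 2 ⊗ (x ⊗ + r ⊗ (+ 1 ⊖ + s)) ⊕ (+ 2 ⊗ ((+ 1 ⊖ z′) ⊗ + s ⊗ (+ 1 ⊖ + r)) ⊖ + 2 ⊗ ((+ 1 ⊖ z) ⊗ + r ⊗ (+ 1 ⊖ + s)))) ⊕ + 6 ⊗ (w ⊗ (+ 2 ⊗ (+ 1 ⊖ + s) ⊖ (+ 1 ⊖ + r)))
    cases 0 0 _ _ = solve-∀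
    cases 0 1 _ _ = solve-∀
    cases 1 0 _ _ = solve-∀
    cases 1 1 _ _ = solve-∀
    cases (suc (suc _)) _ (s≤s (s≤s ())) _
    cases 0 (suc (suc _)) _ (s≤s (s≤s ()))
    cases 1 (suc (suc _)) _ (s≤s (s≤s ()))

  w-2* : ∀ m → w (m * 2) ≡ + 2 ⊗ w m
  w-2* m with m % 7 in eq
  ... | 0 = begin
    z₇ (m * 2) ⊗ + (m * 2 ℕ./ 7)            ≡⟨ cong₂ (λ u v → (if u ℕ.≡ᵇ 0 then + 1 else + 0) ⊗ + v) zero% quotient ⟩
    + 1 ⊗ + (m ℕ./ 7 * 2)                   ≡⟨ cong (+ 1 ⊗_) (ℤₚ.pos-* (m ℕ./ 7) 2) ⟩
    + 1 ⊗ (+ (m ℕ./ 7) ⊗ + 2)               ≡⟨ lemma (+ (m ℕ./ 7)) ⟩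
    + 2 ⊗ (+ 1 ⊗ + (m ℕ./ 7))               ∎
    where
    open ≡-Reasoning
    lemma : ∀ q → + 1 ⊗ (q ⊗ + 2) ≡ + 2 ⊗ (+ 1 ⊗ q)
    lemma = solve-∀
    zero% : (m * 2) % 7 ≡ 0
    zero% = trans (%-distribˡ-* m 2 7) (cong (λ v → (v * 2) % 7) eq)
    quotient : m * 2 ℕ./ 7 ≡ m ℕ./ 7 * 2
    quotient = trans (cong (λ v → v ℕ./ 7) (trans (cong (_* 2) (trans (m≡m%n+[m/n]*n m 7) (cong (λ v → v + m ℕ./ 7 * 7) eq)))
      (swap (m ℕ./ 7)))) (m*n/n≡m (m ℕ./ 7 * 2) 7)
      where
      swap : ∀ q → q * 7 * 2 ≡ q * 2 * 7
      swap = ℕ-solve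
  ... | suc r = cong (_⊗ + (m * 2 ℕ./ 7)) (off (suc r) (subst (_< 7) eq (m%n<n m 7)) (λ ()) (trans (%-distribˡ-* m 2 7) (cong (λ v → (v * 2) % 7) eq)))
    where
    off : ∀ s → s < 7 → s ≢ 0 → (m * 2) % 7 ≡ (s * 2) % 7 → z₇ (m * 2) ≡ + 0
    off s s<7 s≢0 e = trans (cong (λ v → if v ℕ.≡ᵇ 0 then + 1 else + 0) e) (go s s<7 s≢0)
      where
      go : ∀ s → s < 7 → s ≢ 0 → (if (s * 2) % 7 ℕ.≡ᵇ 0 then + 1 else + 0) ≡ + 0
      go 0 _ h = contradiction refl h
      go 1 _ _ = refl
      go 2 _ _ = refl
      go 3 _ _ = refl
      go 4 _ _ = refl
      go 5 _ _ = refl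
      go 6 _ _ = refl
      go (suc (suc (suc (suc (suc (suc (suc _))))))) (s≤s (s≤s (s≤s (s≤s (s≤s (s≤s (s≤s ()))))))) _

  -- Moving a factor 2 from m to d halves `w`, since `w` (2m) = 2 `w` (m); so the sum over even m is
  -- twice the sum over even d.
  w-balance : ∀ n → D (λ m d → w m ⊗ (+ 2 ⊗ ev d ⊖ ev m)) n ≡ + 0
  w-balance n = begin
    D (λ m d → w m ⊗ (+ 2 ⊗ ev d ⊖ ev m)) n
      ≡⟨ D-cong (λ m d → distribute (w m) (ev d) (ev m)) n ⟩
    D (λ m d → + 2 ⊗ (w m ⊗ ev d) ⊖ w m ⊗ ev m) n
      ≡⟨ D-⊖ (λ m d → + 2 ⊗ (w m ⊗ ev d)) (λ m d → w m ⊗ ev m) n ⟩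
    D (λ m d → + 2 ⊗ (w m ⊗ ev d)) n ⊕ ℤ.-1ℤ ⊗ D (λ m d → w m ⊗ ev m) n
      ≡⟨ cong₂ (λ u v → u ⊕ ℤ.-1ℤ ⊗ v)
           (trans (D-⊗ (+ 2) (λ m d → w m ⊗ ev d) n) (cong (+ 2 ⊗_) (trans (D-scaleʳ 1 (λ m d → w m ⊗ ev d) (λ m d h → trans (cong (w m ⊗_) (ev-∤ d h)) (ℤₚ.*-zeroʳ (w m))) n)
              (dil-cong 2 (D-cong (λ m d → trans (cong (w m ⊗_) (ev-2* d)) (ℤₚ.*-identityʳ (w m)))) n))))
           (trans (D-scale 1 (λ m d → w m ⊗ ev m) (λ m d h → trans (cong (w m ⊗_) (ev-∤ m h)) (ℤₚ.*-zeroʳ (w m))) n)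
              (trans (dil-cong 2 (≈-trans (D-cong (λ m d → trans (cong₂ _⊗_ (w-2* m) (ev-2* m)) (ℤₚ.*-identityʳ (+ 2 ⊗ w m)))) (D-⊗ (+ 2) (λ m d → w m))) n) (dil-· 2 (+ 2) (D (λ m d → w m)) n))) ⟩
    + 2 ⊗ dil 2 (D (λ m d → w m)) n ⊕ ℤ.-1ℤ ⊗ (+ 2 ⊗ dil 2 (D (λ m d → w m)) n)
      ≡⟨ cancel (dil 2 (D (λ m d → w m)) n) ⟩
    + 0 ∎
    where
    open ≡-Reasoning
    distribute : ∀ w e f → w ⊗ (+ 2 ⊗ e ⊖ f) ≡ + 2 ⊗ (w ⊗ e) ⊖ w ⊗ f
    distribute = solve-∀
    cancel : ∀ u → + 2 ⊗ u ⊕ ℤ.-1ℤ ⊗ (+ 2 ⊗ u) ≡ + 0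
    cancel = solve-∀

  total : ∀ n → ∑ₛ n F ≡ dil 2 ρ n
  total n = double-cancel (begin
    ∑ₛ n F ⊕ ∑ₛ n F            ≡⟨ cong (λ s → s ⊕ s) (∑ₛ-cong n (λ a b x y _ → sym (F-periodic a b x y))) ⟩
    ∑ₛ n F↑ ⊕ ∑ₛ n F↑          ≡⟨ boundary n ⟩
    ∑d n (λ a b d → g↑ (a + b) b d 0) ⊖ ∑d n (λ x y d → g↑ d d x y)   ≡⟨ cong₂ _⊖_ (first n) (second n) ⟩
    D (λ m d → u₁ m d ⊗ c₁ m) n ⊖ D (λ m d → u₂ m d ⊗ c₂ m) n
      ≡⟨ trans (cong (D (λ m d → u₁ m d ⊗ c₁ m) n ⊕_) (sym (ℤₚ.-1*i≡-i _))) (sym (D-⊖ (λ m d → u₁ m d ⊗ c₁ m) (λ m d → u₂ m d ⊗ c₂ m) n)) ⟩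
    D (λ m d → u₁ m d ⊗ c₁ m ⊖ u₂ m d ⊗ c₂ m) n   ≡⟨ D-cong value n ⟩
    D (λ m d → (t₁ m d ⊕ (t₂ m d ⊖ t₃ m d)) ⊕ t₄ m d) n
      ≡⟨ trans (D-⊕ (λ m d → t₁ m d ⊕ (t₂ m d ⊖ t₃ m d)) t₄ n) (cong₂ _⊕_
           (trans (D-⊕ t₁ (λ m d → t₂ m d ⊖ t₃ m d) n) (cong₂ _⊕_ (trans (D-⊗ (+ 2) (λ m d → χ m ⊗ od m ⊗ ev d) n) (cong (+ 2 ⊗_) (ρ-scaleˣ n)))
             (trans (D-⊖ t₂ t₃ n) (trans (cong (_⊕ ℤ.-1ℤ ⊗ D t₃ n) (D-swap t₂ n)) (cancel (D t₃ n))))))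
           (trans (D-⊗ (+ 6) (λ m d → w m ⊗ (+ 2 ⊗ ev d ⊖ ev m)) n) (cong (+ 6 ⊗_) (w-balance n)))) ⟩
    (+ 2 ⊗ dil 2 ρ n ⊕ + 0) ⊕ + 0   ≡⟨ trans (ℤₚ.+-identityʳ _) (ℤₚ.+-identityʳ _) ⟩
    + 2 ⊗ dil 2 ρ n                 ∎)
    where
    open ≡-Reasoning
    t₁ t₂ t₃ t₄ : ℕ → ℕ → ℤ
    t₁ m d = + 2 ⊗ (χ m ⊗ od m ⊗ ev d)
    t₂ m d = + 2 ⊗ ((+ 1 ⊖ z₇ d) ⊗ od d ⊗ ev m)
    t₃ m d = + 2 ⊗ ((+ 1 ⊖ z₇ m) ⊗ od m ⊗ ev d)
    t₄ m d = + 6 ⊗ (w m ⊗ (+ 2 ⊗ ev d ⊖ ev m))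
    cancel : ∀ u → u ⊕ ℤ.-1ℤ ⊗ u ≡ + 0
    cancel = solve-∀

  ρ² : ∀ n → ((ρ ⋆ ρ) n ⊖ + 2 ⊗ (τ ⋆ dil 2 ρ) n) ⊕ + 4 ⊗ (dil 2 ρ ⋆ dil 2 ρ) n ≡ dil 2 ρ n
  ρ² n = trans (sym (split n)) (total n)

-- Mixed sums: ∑ χ₄(b) times functions of a modulo 4 and of the solution modulo 7

-- The arguments are the values of a function D on the points (1,0), (0,1), (1,1) of P¹(𝔽₇) and the sum of its values on (1,3), (1,5).
manin : (d₁₀ d₀₁ d₁₁ d₁₃₊₁₅ : ℤ) → ℕ → ℕ → ℤ
manin p q r s 0 1 = q
manin p q r s 1 0 = p
manin p q r s 1 1 = r
manin p q r s 1 2 = q ⊕ r ⊖ s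
manin p q r s 1 3 = p ⊖ q ⊖ s
manin p q r s 2 1 = p ⊕ r ⊕ s
manin p q r s 0 3 = ⊝ q
manin p q r s 3 0 = ⊝ p
manin p q r s 3 3 = ⊝ r
manin p q r s 3 2 = ⊝ (q ⊕ r ⊖ s)
manin p q r s 3 1 = ⊝ (p ⊖ q ⊖ s)
manin p q r s 2 3 = ⊝ (p ⊕ r ⊕ s)
manin p q r s _ _ = + 0

-2ℤ : ℤ
-2ℤ = ℤ.- + 2

χ₄-mod : ∀ M .{{_ : NonZero M}} → 4 ∣ M → ∀ n → χ₄ (n % M) ≡ χ₄ n
χ₄-mod = mod₄ (table₄ _ _ _ _)

is2-mod : ∀ M .{{_ : NonZero M}} → 4 ∣ M → ∀ n → is2 (n % M) ≡ is2 n
is2-mod = mod₄ (table₄ _ _ _ _)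

is3-mod : ∀ M .{{_ : NonZero M}} → 4 ∣ M → ∀ n → is3 (n % M) ≡ is3 n
is3-mod = mod₄ (table₄ _ _ _ _)

z₇-∤ : ∀ a → ¬ (7 ∣ a) → z₇ a ≡ + 0
z₇-∤ a h with a % 7 in eq
... | 0     = contradiction (m%n≡0⇒n∣m a 7 eq) h
... | suc _ = refl

z₇-7* : ∀ a → z₇ (a * 7) ≡ + 1
z₇-7* a = cong (λ r → if r ℕ.≡ᵇ 0 then + 1 else + 0) (m*n%n≡0 a 7)

χ₄-7* : ∀ a → χ₄ (a * 7) ≡ ℤ.-1ℤ ⊗ χ₄ a
χ₄-7* a = trans (cong (table₄ (+ 0) (+ 1) (+ 0) ℤ.-1ℤ) (trans (%-distribˡ-* a 7 4) (trans (cong (λ w → (w * 3) % 4) (sym (m%n%n≡m%n a 4))) (sym (%-distribˡ-* (a % 4) 7 4)))))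
  (trans (check₁-sound 4 (λ a → χ₄ (a * 7)) (λ a → ℤ.-1ℤ ⊗ χ₄ a) refl (a % 4) (m%n<n a 4)) (cong (ℤ.-1ℤ ⊗_) (χ₄-mod 4 n∣n a)))

G₇ᵇ : D (λ b y → χ₄ b ⊗ z₇ b) ≈ ℤ.-1ℤ · dil 7 G
G₇ᵇ = ≈-trans (D-scale 6 (λ b y → χ₄ b ⊗ z₇ b) (λ b y h → trans (cong (χ₄ b ⊗_) (z₇-∤ b h)) (ℤₚ.*-zeroʳ (χ₄ b))))
  (≈-trans (dil-cong 7 (≈-trans (D-cong {k = λ b y → ℤ.-1ℤ ⊗ χ₄ b} (λ b y → trans (cong₂ _⊗_ (χ₄-7* b) (z₇-7* b)) (ℤₚ.*-identityʳ (ℤ.-1ℤ ⊗ χ₄ b)))) (D-⊗ ℤ.-1ℤ (λ b y → χ₄ b)))) (dil-· 7 ℤ.-1ℤ G))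

G₇ʸ : D (λ b y → χ₄ b ⊗ z₇ y) ≈ dil 7 G
G₇ʸ = G-scale 6 z₇ z₇-∤ z₇-7*

ρ₂ᵃ : D (λ a x → χ a ⊗ is2 a) ≈ dil 2 ρ
ρ₂ᵃ = ≈-trans (D-scale 1 (λ a x → χ a ⊗ is2 a) (λ a x h → trans (cong (χ a ⊗_) (is2-∤ a h)) (ℤₚ.*-zeroʳ (χ a))))
  (dil-cong 2 (D-cong (λ a x → cong₂ _⊗_ (χ-2* a) (is2-2* a))))

ρˣ : D (λ a x → χ x ⊗ od a) ≈ ρ
ρˣ = ≈-trans (D-swap (λ a x → χ x ⊗ od a)) ρ-x

ρ₂ˣ : D (λ a x → χ x ⊗ is2 a) ≈ dil 2 ρ
ρ₂ˣ = ≈-trans (D-scale 1 (λ a x → χ x ⊗ is2 a) (λ a x h → trans (cong (χ x ⊗_) (is2-∤ a h)) (ℤₚ.*-zeroʳ (χ x))))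
  (dil-cong 2 (≈-trans (D-cong (λ a x → cong (χ x ⊗_) (is2-2* a))) ρˣ))

∑ₛ-quad : ∀ n (p q k l : ℕ → ℕ → ℤ) (c₁ c₂ c₃ c₄ : ℤ) →
  ∑ₛ n (λ a b x y → (c₁ ⊗ (p a x ⊗ k b y) ⊕ c₂ ⊗ (q a x ⊗ k b y)) ⊕ (c₃ ⊗ (p a x ⊗ l b y) ⊕ c₄ ⊗ (q a x ⊗ l b y))) ≡
  (c₁ ⊗ (D p ⋆ D k) n ⊕ c₂ ⊗ (D q ⋆ D k) n) ⊕ (c₃ ⊗ (D p ⋆ D l) n ⊕ c₄ ⊗ (D q ⋆ D l) n)
∑ₛ-quad n p q k l c₁ c₂ c₃ c₄ = trans
  (∑ₛ-⊕ n (λ a b x y → c₁ ⊗ (p a x ⊗ k b y) ⊕ c₂ ⊗ (q a x ⊗ k b y)) (λ a b x y → c₃ ⊗ (p a x ⊗ l b y) ⊕ c₄ ⊗ (q a x ⊗ l b y)))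
  (cong₂ _⊕_ (pair c₁ c₂ k) (pair c₃ c₄ l))
  where
  one : ∀ c (p k : ℕ → ℕ → ℤ) → ∑ₛ n (λ a b x y → c ⊗ (p a x ⊗ k b y)) ≡ c ⊗ (D p ⋆ D k) n
  one c p k = trans (∑ₛ-⊗ n c (λ a b x y → p a x ⊗ k b y)) (cong (c ⊗_) (∑ₛ-⋆ p k n))
  pair : ∀ c d k → ∑ₛ n (λ a b x y → c ⊗ (p a x ⊗ k b y) ⊕ d ⊗ (q a x ⊗ k b y)) ≡ c ⊗ (D p ⋆ D k) n ⊕ d ⊗ (D q ⋆ D k) n
  pair c d k = trans (∑ₛ-⊕ n (λ a b x y → c ⊗ (p a x ⊗ k b y)) (λ a b x y → d ⊗ (q a x ⊗ k b y))) (cong₂ _⊕_ (one c p k) (one d q k))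

-- The boundary terms of `Alpha` and `Beta`, halved. Beside the growing factor m - 1, the character
-- χ is taken at d in the first and at m in the second.
bdα bdβ : Seq
bdα = D (λ m d → (+ m ⊖ + 1) ⊗ (χ₄ d ⊗ χ d) ⊖ + 2 ⊗ (χ m ⊗ is3 m))
bdβ = D (λ m d → (+ m ⊖ + 1) ⊗ (χ₄ d ⊗ χ m) ⊖ χ d ⊗ (+ 4 ⊗ is2 m ⊕ + 2 ⊗ is3 m))

ones : ∀ m → sumBelow m (λ _ → + 1) ≡ + suc m ⊖ + 1
ones m = trans (sumBelow-const m (+ 1)) (lemma (+ m))
  where
  lemma : ∀ m → m ⊗ + 1 ≡ (+ 1 ⊕ m) ⊖ + 1
  lemma = solve-∀

4∣28 : 4 ∣ 28
4∣28 = divides 7 refl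
7∣28 : 7 ∣ 28
7∣28 = divides 4 refl

-- D is supported on the line through (a , b).
module Alpha where

  -- Modulo 7, `a + 6 * b`, `b + 4 * a` and `b + 2 * a` vanish precisely on the lines spanned by
  -- (1,1), (1,3) and (1,5).
  g₀ : ℕ → ℕ → ℤ
  g₀ a b = manin (χ a ⊗ z₇ b) (χ b ⊗ z₇ a) (χ a ⊗ z₇ (a + 6 * b)) (χ a ⊗ (z₇ (b + 4 * a) ⊕ z₇ (b + 2 * a))) (a % 4) (b % 4)

  F g : ℕ → ℕ → ℕ → ℕ → ℤ
  F a b x y = χ₄ b ⊗ (od a ⊗ (χ a ⊖ + 3 ⊗ (χ a ⊗ z₇ b)) ⊕ is2 a ⊗ (+ 2 ⊗ χ a ⊕ + 2 ⊗ (χ a ⊗ z₇ b)))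
  g a b x y = -2ℤ ⊗ g₀ a b

  open Periodic 28 1 F g refl refl

  F-periodic : ∀ a b x y → F↑ a b x y ≡ F a b x y
  F-periodic a b x y = cong₂ _⊗_ (χ₄-mod 28 4∣28 b) (cong₂ (λ u v → u ⊗ (proj₁ v ⊖ + 3 ⊗ (proj₁ v ⊗ proj₁ (proj₂ v))) ⊕ proj₂ (proj₂ v) ⊗ (+ 2 ⊗ proj₁ v ⊕ + 2 ⊗ (proj₁ v ⊗ proj₁ (proj₂ v))))
    (od-mod 28 (divides 14 refl) a) (cong₂ _,_ (χ-mod 28 7∣28 a) (cong₂ _,_ (z₇-mod 28 7∣28 b) (is2-mod 28 4∣28 a))))

  c : ℕ → ℤ
  c m = + 2 ⊗ (χ m ⊗ is3 m)

  rows : ∀ m → sumBelow m (λ b → g₀ (suc m % 28) (suc b % 28)) ≡ c (suc m)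
  rows = row-sum 28 g₀ c (λ _ → + 0) growth refl refl
    where
    growth : ∀ r k → c (r + k * 28) ≡ c r ⊕ + k ⊗ + 0
    growth r k = trans (cong (+ 2 ⊗_) (cong₂ _⊗_ (per χ (χ-mod 28 7∣28)) (per is3 (is3-mod 28 4∣28))))
      (sym (trans (cong (c r ⊕_) (ℤₚ.*-zeroʳ (+ k))) (ℤₚ.+-identityʳ (c r))))
      where
      per : ∀ (h : ℕ → ℤ) → (∀ n → h (n % 28) ≡ h n) → h (r + k * 28) ≡ h r
      per h h-mod = trans (sym (h-mod (r + k * 28))) (trans (cong h ([m+kn]%n≡m%n r k 28)) (h-mod r))

  first : ∀ n → ∑d n (λ a b d → g↑ (a + b) b d 0) ≡ D (λ m d → -2ℤ ⊗ c m) n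
  first n = ∑d-rows n 28 (λ _ _ → -2ℤ) g₀ c rows

  second : ∀ n → ∑d n (λ x y d → g↑ d d x y) ≡ D (λ m d → (-2ℤ ⊗ (χ₄ d ⊗ χ d)) ⊗ (+ m ⊖ + 1)) n
  second n = trans (∑d-cong n (λ x y d → trans (cong (-2ℤ ⊗_) (diagonal d)) (sym (ℤₚ.*-identityʳ (-2ℤ ⊗ (χ₄ d ⊗ χ d)))))) (∑d-rows n 1 (λ _ d → -2ℤ ⊗ (χ₄ d ⊗ χ d)) (λ _ _ → + 1) (λ m → + m ⊖ + 1) ones)
    where
    diagonal : ∀ d → g₀ (d % 28) (d % 28) ≡ χ₄ d ⊗ χ d
    diagonal d = trans (check₁-sound 28 (λ d → g₀ d d) (λ d → χ₄ d ⊗ χ d) refl (d % 28) (m%n<n d 28)) (cong₂ _⊗_ (χ₄-mod 28 4∣28 d) (χ-mod 28 7∣28 d))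

  total : ∀ n → ∑ₛ n F ≡ bdα n
  total n = double-cancel (begin
    ∑ₛ n F ⊕ ∑ₛ n F     ≡⟨ cong (λ s → s ⊕ s) (∑ₛ-cong n (λ a b x y _ → sym (F-periodic a b x y))) ⟩
    ∑ₛ n F↑ ⊕ ∑ₛ n F↑   ≡⟨ boundary n ⟩
    ∑d n (λ a b d → g↑ (a + b) b d 0) ⊖ ∑d n (λ x y d → g↑ d d x y)   ≡⟨ cong₂ _⊖_ (first n) (second n) ⟩
    D h n ⊖ D k n       ≡⟨ trans (cong (D h n ⊕_) (sym (ℤₚ.-1*i≡-i (D k n)))) (sym (D-⊖ h k n)) ⟩
    D (λ m d → h m d ⊖ k m d) n   ≡⟨ D-cong (λ m d → factor (χ m ⊗ is3 m) (χ₄ d ⊗ χ d) (+ m ⊖ + 1)) n ⟩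
    D (λ m d → + 2 ⊗ ((+ m ⊖ + 1) ⊗ (χ₄ d ⊗ χ d) ⊖ + 2 ⊗ (χ m ⊗ is3 m))) n   ≡⟨ D-⊗ (+ 2) (λ m d → (+ m ⊖ + 1) ⊗ (χ₄ d ⊗ χ d) ⊖ + 2 ⊗ (χ m ⊗ is3 m)) n ⟩
    + 2 ⊗ bdα n         ∎)
    where
    open ≡-Reasoning
    h k : ℕ → ℕ → ℤ
    h m d = -2ℤ ⊗ c m
    k m d = (-2ℤ ⊗ (χ₄ d ⊗ χ d)) ⊗ (+ m ⊖ + 1)
    factor : ∀ u v w → -[1+ 1 ] ⊗ (+ 2 ⊗ u) ⊖ (-[1+ 1 ] ⊗ v) ⊗ w ≡ + 2 ⊗ (w ⊗ v ⊖ + 2 ⊗ u)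
    factor = solve-∀

  identity : ∀ n → ((ρ ⋆ G) n ⊕ + 2 ⊗ (dil 2 ρ ⋆ G) n) ⊕ (+ 3 ⊗ (ρ ⋆ dil 7 G) n ⊖ + 2 ⊗ (dil 2 ρ ⋆ dil 7 G) n) ≡ bdα n
  identity n = begin
    ((ρ ⋆ G) n ⊕ + 2 ⊗ (dil 2 ρ ⋆ G) n) ⊕ (+ 3 ⊗ (ρ ⋆ dil 7 G) n ⊖ + 2 ⊗ (dil 2 ρ ⋆ dil 7 G) n)
      ≡⟨ tidy ((ρ ⋆ G) n) ((dil 2 ρ ⋆ G) n) ((ρ ⋆ dil 7 G) n) ((dil 2 ρ ⋆ dil 7 G) n) ⟩
    (+ 1 ⊗ (ρ ⋆ G) n ⊕ + 2 ⊗ (dil 2 ρ ⋆ G) n) ⊕ (-[1+ 2 ] ⊗ (ℤ.-1ℤ ⊗ (ρ ⋆ dil 7 G) n) ⊕ + 2 ⊗ (ℤ.-1ℤ ⊗ (dil 2 ρ ⋆ dil 7 G) n))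
      ≡⟨ cong₂ _⊕_ (cong (λ u → + 1 ⊗ (ρ ⋆ G) n ⊕ + 2 ⊗ u) (⋆-cong {t = G} (≈-sym ρ₂ᵃ) refl≈ n))
           (cong₂ (λ u v → -[1+ 2 ] ⊗ u ⊕ + 2 ⊗ v)
             (trans (sym (⋆-·ʳ ℤ.-1ℤ ρ (dil 7 G) n)) (⋆-cong {ρ} refl≈ (≈-sym G₇ᵇ) n))
             (trans (sym (⋆-·ʳ ℤ.-1ℤ (dil 2 ρ) (dil 7 G) n)) (⋆-cong (≈-sym ρ₂ᵃ) (≈-sym G₇ᵇ) n))) ⟩
    (+ 1 ⊗ (D p ⋆ D k) n ⊕ + 2 ⊗ (D q ⋆ D k) n) ⊕ (-[1+ 2 ] ⊗ (D p ⋆ D l) n ⊕ + 2 ⊗ (D q ⋆ D l) n)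
      ≡⟨ ∑ₛ-quad n p q k l (+ 1) (+ 2) -[1+ 2 ] (+ 2) ⟨
    ∑ₛ n (λ a b x y → (+ 1 ⊗ (p a x ⊗ k b y) ⊕ + 2 ⊗ (q a x ⊗ k b y)) ⊕ (-[1+ 2 ] ⊗ (p a x ⊗ l b y) ⊕ + 2 ⊗ (q a x ⊗ l b y)))
      ≡⟨ ∑ₛ-cong n (λ a b x y _ → expand (χ₄ b) (od a) (χ a) (z₇ b) (is2 a)) ⟨
    ∑ₛ n F   ≡⟨ total n ⟩
    bdα n    ∎
    where
    open ≡-Reasoning
    p q k l : ℕ → ℕ → ℤ
    p a x = χ a ⊗ od a
    q a x = χ a ⊗ is2 a
    k b y = χ₄ b
    l b y = χ₄ b ⊗ z₇ b
    tidy : ∀ r s t u → (r ⊕ + 2 ⊗ s) ⊕ (+ 3 ⊗ t ⊖ + 2 ⊗ u) ≡ (+ 1 ⊗ r ⊕ + 2 ⊗ s) ⊕ (-[1+ 2 ] ⊗ (-[1+ 0 ] ⊗ t) ⊕ + 2 ⊗ (-[1+ 0 ] ⊗ u))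
    tidy = solve-∀
    expand : ∀ b o x z e → b ⊗ (o ⊗ (x ⊖ + 3 ⊗ (x ⊗ z)) ⊕ e ⊗ (+ 2 ⊗ x ⊕ + 2 ⊗ (x ⊗ z))) ≡
      (+ 1 ⊗ ((x ⊗ o) ⊗ b) ⊕ + 2 ⊗ ((x ⊗ e) ⊗ b)) ⊕ (-[1+ 2 ] ⊗ ((x ⊗ o) ⊗ (b ⊗ z)) ⊕ + 2 ⊗ ((x ⊗ e) ⊗ (b ⊗ z)))
    expand = solve-∀

-- D takes the value χ (s x + t y) at (s , t).
module Beta where

  F g : ℕ → ℕ → ℕ → ℕ → ℤ
  F a b x y = χ₄ b ⊗ (od a ⊗ (-[1+ 2 ] ⊗ χ x ⊕ + 7 ⊗ (χ x ⊗ z₇ y)) ⊕ is2 a ⊗ (+ 2 ⊗ χ x ⊕ + 14 ⊗ (χ x ⊗ z₇ y)))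
  g a b x y = -2ℤ ⊗ manin (χ x) (χ y) (χ (x + y)) (χ (x + 3 * y) ⊕ χ (x + 5 * y)) a b

  open Periodic 4 7 F g refl refl

  F-periodic : ∀ a b x y → F↑ a b x y ≡ F a b x y
  F-periodic a b x y = cong₂ _⊗_ (χ₄-mod 4 n∣n b) (cong₂ (λ u v → u ⊗ (-[1+ 2 ] ⊗ proj₁ v ⊕ + 7 ⊗ (proj₁ v ⊗ proj₁ (proj₂ v))) ⊕ proj₂ (proj₂ v) ⊗ (+ 2 ⊗ proj₁ v ⊕ + 14 ⊗ (proj₁ v ⊗ proj₁ (proj₂ v))))
    (od-mod 4 (divides 2 refl) a) (cong₂ _,_ (χ-mod 7 n∣n x) (cong₂ _,_ (z₇-mod 7 n∣n y) (is2-mod 4 n∣n a))))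

  c : ℕ → ℤ
  c m = + 4 ⊗ is2 m ⊕ + 2 ⊗ is3 m

  -- At y = 0 the value χ(s x + t y) is χ(s) χ(x). The arguments are χ(s) at (1,0), (0,1), (1,1) and
  -- its sum over (1,3) and (1,5).
  q₁ : ℕ → ℕ → ℤ
  q₁ = manin (+ 1) (+ 0) (+ 1) (+ 2)

  rows : ∀ m → sumBelow m (λ b → q₁ (suc m % 4) (suc b % 4)) ≡ c (suc m)
  rows = row-sum 4 q₁ c (λ _ → + 0) growth refl refl
    where
    growth : ∀ r k → c (r + k * 4) ≡ c r ⊕ + k ⊗ + 0
    growth r k = trans (cong (λ w → + 4 ⊗ table₄ (+ 0) (+ 0) (+ 1) (+ 0) w ⊕ + 2 ⊗ table₄ (+ 0) (+ 0) (+ 0) (+ 1) w) ([m+kn]%n≡m%n r k 4))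
      (sym (trans (cong (c r ⊕_) (ℤₚ.*-zeroʳ (+ k))) (ℤₚ.+-identityʳ (c r))))

  first : ∀ n → ∑d n (λ a b d → g↑ (a + b) b d 0) ≡ D (λ m d → (-2ℤ ⊗ χ d) ⊗ c m) n
  first n = trans (∑d-cong n (λ a b d → pointwise (a + b) b d)) (∑d-rows n 4 (λ _ d → -2ℤ ⊗ χ d) q₁ c rows)
    where
    pointwise : ∀ m b d → g↑ m b d 0 ≡ (-2ℤ ⊗ χ d) ⊗ q₁ (m % 4) (b % 4)
    pointwise m b d = trans (check₄-sound 4 7 (λ m b d _ → g m b d 0) (λ m b d _ → (-2ℤ ⊗ χ d) ⊗ q₁ m b) refl (m % 4) (b % 4) (d % 7) 0 (m%n<n m 4) (m%n<n b 4) (m%n<n d 7) (s≤s z≤n))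
      (cong (λ w → (-2ℤ ⊗ w) ⊗ q₁ (m % 4) (b % 4)) (χ-mod 7 n∣n d))

  second : ∀ n → ∑d n (λ x y d → g↑ d d x y) ≡ D (λ m d → (-2ℤ ⊗ (χ₄ d ⊗ χ m)) ⊗ (+ m ⊖ + 1)) n
  second n = trans (∑d-cong n (λ x y d → trans (pointwise x y d) (sym (ℤₚ.*-identityʳ (-2ℤ ⊗ (χ₄ d ⊗ χ (x + y))))))) (∑d-rows n 1 (λ m d → -2ℤ ⊗ (χ₄ d ⊗ χ m)) (λ _ _ → + 1) (λ m → + m ⊖ + 1) ones)
    where
    pointwise : ∀ x y d → g↑ d d x y ≡ -2ℤ ⊗ (χ₄ d ⊗ χ (x + y))
    pointwise x y d = trans (check₄-sound 4 7 (λ d _ x y → g d d x y) (λ d _ x y → -2ℤ ⊗ (χ₄ d ⊗ χ (x + y))) refl (d % 4) 0 (x % 7) (y % 7) (m%n<n d 4) (s≤s z≤n) (m%n<n x 7) (m%n<n y 7))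
      (cong₂ (λ u v → -2ℤ ⊗ (u ⊗ v)) (χ₄-mod 4 n∣n d) (cong legendre₇ (sym (%-distribˡ-+ x y 7))))

  total : ∀ n → ∑ₛ n F ≡ bdβ n
  total n = double-cancel (begin
    ∑ₛ n F ⊕ ∑ₛ n F     ≡⟨ cong (λ s → s ⊕ s) (∑ₛ-cong n (λ a b x y _ → sym (F-periodic a b x y))) ⟩
    ∑ₛ n F↑ ⊕ ∑ₛ n F↑   ≡⟨ boundary n ⟩
    ∑d n (λ a b d → g↑ (a + b) b d 0) ⊖ ∑d n (λ x y d → g↑ d d x y)   ≡⟨ cong₂ _⊖_ (first n) (second n) ⟩
    D h n ⊖ D k n       ≡⟨ trans (cong (D h n ⊕_) (sym (ℤₚ.-1*i≡-i (D k n)))) (sym (D-⊖ h k n)) ⟩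
    D (λ m d → h m d ⊖ k m d) n   ≡⟨ D-cong (λ m d → factor (χ d) (c m) (χ₄ d ⊗ χ m) (+ m ⊖ + 1)) n ⟩
    D (λ m d → + 2 ⊗ ((+ m ⊖ + 1) ⊗ (χ₄ d ⊗ χ m) ⊖ χ d ⊗ c m)) n   ≡⟨ D-⊗ (+ 2) (λ m d → (+ m ⊖ + 1) ⊗ (χ₄ d ⊗ χ m) ⊖ χ d ⊗ c m) n ⟩
    + 2 ⊗ bdβ n         ∎)
    where
    open ≡-Reasoning
    h k : ℕ → ℕ → ℤ
    h m d = (-2ℤ ⊗ χ d) ⊗ c m
    k m d = (-2ℤ ⊗ (χ₄ d ⊗ χ m)) ⊗ (+ m ⊖ + 1)
    factor : ∀ u c v w → (-[1+ 1 ] ⊗ u) ⊗ c ⊖ (-[1+ 1 ] ⊗ v) ⊗ w ≡ + 2 ⊗ (w ⊗ v ⊖ u ⊗ c)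
    factor = solve-∀

  identity : ∀ n → (-[1+ 2 ] ⊗ (ρ ⋆ G) n ⊕ + 2 ⊗ (dil 2 ρ ⋆ G) n) ⊕ (+ 7 ⊗ (ρ ⋆ dil 7 G) n ⊕ + 14 ⊗ (dil 2 ρ ⋆ dil 7 G) n) ≡ bdβ n
  identity n = begin
    (-[1+ 2 ] ⊗ (ρ ⋆ G) n ⊕ + 2 ⊗ (dil 2 ρ ⋆ G) n) ⊕ (+ 7 ⊗ (ρ ⋆ dil 7 G) n ⊕ + 14 ⊗ (dil 2 ρ ⋆ dil 7 G) n)
      ≡⟨ cong₂ _⊕_
           (cong₂ (λ u v → -[1+ 2 ] ⊗ u ⊕ + 2 ⊗ v) (⋆-cong {t = G} (≈-sym ρˣ) refl≈ n) (⋆-cong {t = G} (≈-sym ρ₂ˣ) refl≈ n))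
           (cong₂ (λ u v → + 7 ⊗ u ⊕ + 14 ⊗ v) (⋆-cong (≈-sym ρˣ) (≈-sym G₇ʸ) n) (⋆-cong (≈-sym ρ₂ˣ) (≈-sym G₇ʸ) n)) ⟩
    (-[1+ 2 ] ⊗ (D p ⋆ D k) n ⊕ + 2 ⊗ (D q ⋆ D k) n) ⊕ (+ 7 ⊗ (D p ⋆ D l) n ⊕ + 14 ⊗ (D q ⋆ D l) n)
      ≡⟨ ∑ₛ-quad n p q k l -[1+ 2 ] (+ 2) (+ 7) (+ 14) ⟨
    ∑ₛ n (λ a b x y → (-[1+ 2 ] ⊗ (p a x ⊗ k b y) ⊕ + 2 ⊗ (q a x ⊗ k b y)) ⊕ (+ 7 ⊗ (p a x ⊗ l b y) ⊕ + 14 ⊗ (q a x ⊗ l b y)))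
      ≡⟨ ∑ₛ-cong n (λ a b x y _ → expand (χ₄ b) (od a) (χ x) (z₇ y) (is2 a)) ⟨
    ∑ₛ n F   ≡⟨ total n ⟩
    bdβ n    ∎
    where
    open ≡-Reasoning
    p q k l : ℕ → ℕ → ℤ
    p a x = χ x ⊗ od a
    q a x = χ x ⊗ is2 a
    k b y = χ₄ b
    l b y = χ₄ b ⊗ z₇ y
    expand : ∀ b o x z e → b ⊗ (o ⊗ (-[1+ 2 ] ⊗ x ⊕ + 7 ⊗ (x ⊗ z)) ⊕ e ⊗ (+ 2 ⊗ x ⊕ + 14 ⊗ (x ⊗ z))) ≡
      (-[1+ 2 ] ⊗ ((x ⊗ o) ⊗ b) ⊕ + 2 ⊗ ((x ⊗ e) ⊗ b)) ⊕ (+ 7 ⊗ ((x ⊗ o) ⊗ (b ⊗ z)) ⊕ + 14 ⊗ ((x ⊗ e) ⊗ (b ⊗ z)))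
    expand = solve-∀

-- Lambert series for φ² and π

one : Seq
one 0       = + 1
one (suc _) = + 0

⋆-one : ∀ s → one ⋆ s ≈ s
⋆-one s zero    = ℤₚ.*-identityˡ (s 0)
⋆-one s (suc n) = trans (cong₂ _⊕_ (ℤₚ.*-identityˡ (s (suc n))) (⋆-zeroˡ (one ∘ suc) s n (λ _ _ → refl))) (ℤₚ.+-identityʳ _)

dil-one : ∀ k .{{_ : NonZero k}} → dil k one ≈ one
dil-one k n with k ∣? n
dil-one k        n       | yes (divides zero    refl) = refl
dil-one (suc k)  n       | yes (divides (suc q) refl) = refl
dil-one k        zero    | no h = contradiction (divides 0 refl) h
dil-one k        (suc n) | no h = refl

⋆-cong≤ : ∀ {s s′ t t′} n → (∀ i → i ≤ n → s i ≡ s′ i) → (∀ i → i ≤ n → t i ≡ t′ i) → (s ⋆ t) n ≡ (s′ ⋆ t′) n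
⋆-cong≤ zero    h k = cong₂ _⊗_ (h 0 z≤n) (k 0 z≤n)
⋆-cong≤ (suc n) h k = cong₂ _⊕_ (cong₂ _⊗_ (h 0 z≤n) (k (suc n) ℕₚ.≤-refl)) (⋆-cong≤ n (λ i i≤n → h (suc i) (s≤s i≤n)) (λ i i≤n → k i (ℕₚ.m≤n⇒m≤1+n i≤n)))

dil-agree : ∀ k {s t} n → (∀ i → i * k ≤ n → s i ≡ t i) → ∀ i → i ≤ n → dil k s i ≡ dil k t i
dil-agree k n h i i≤n with k ∣? i
... | yes (divides q refl) = h q i≤n
... | no  _                = refl

⋆-lowest₃ : ∀ s t n → (∀ i → i < n → s i ≡ + 0) → (s ⋆ t) (2 + n) ≡ s (2 + n) ⊗ t 0 ⊕ (s (1 + n) ⊗ t 1 ⊕ s n ⊗ t 2)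
⋆-lowest₃ s t n h = trans (⋆-sucʳ s t (suc n)) (cong (s (2 + n) ⊗ t 0 ⊕_) (⋆-lowest₂ s (t ∘ suc) n h))

infixl 6 _⊟_

_⊟_ : Seq → Seq → Seq
s ⊟ t = s ⊞ ℤ.-1ℤ · t

⊟-0 : ∀ s t n → (s ⊟ t) n ≡ + 0 → s n ≡ t n
⊟-0 s t n h = ≡0⇒≡ (trans (cong (s n ⊕_) (sym (ℤₚ.-1*i≡-i (t n)))) h)

⊟-≡ : ∀ s t n → s n ≡ t n → (s ⊟ t) n ≡ + 0
⊟-≡ s t n h = trans (cong (_⊕ ℤ.-1ℤ ⊗ t n) h) (trans (cong (t n ⊕_) (ℤₚ.-1*i≡-i (t n))) (ℤₚ.+-inverseʳ (t n)))

⋆-⊟ˡ : ∀ s t u → (s ⊟ t) ⋆ u ≈ s ⋆ u ⊟ t ⋆ u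
⋆-⊟ˡ s t u = ≈-trans (⋆-distribʳ s (ℤ.-1ℤ · t) u) (⊞-cong {s ⋆ u} refl≈ (⋆-·ˡ ℤ.-1ℤ t u))

squares-diff : ∀ s t → (s ⊟ t) ⋆ (s ⊞ t) ≈ s ⋆ s ⊟ t ⋆ t
squares-diff s t n = begin
  ((s ⊟ t) ⋆ (s ⊞ t)) n                                        ≡⟨ trans (⋆-⊟ˡ s t (s ⊞ t) n) (cong₂ (λ u v → u ⊕ ℤ.-1ℤ ⊗ v) (⋆-distribˡ s s t n) (⋆-distribˡ t s t n)) ⟩
  ((s ⋆ s) n ⊕ (s ⋆ t) n) ⊕ ℤ.-1ℤ ⊗ ((t ⋆ s) n ⊕ (t ⋆ t) n)     ≡⟨ cong (λ u → ((s ⋆ s) n ⊕ u) ⊕ ℤ.-1ℤ ⊗ ((t ⋆ s) n ⊕ (t ⋆ t) n)) (⋆-comm s t n) ⟩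
  ((s ⋆ s) n ⊕ (t ⋆ s) n) ⊕ ℤ.-1ℤ ⊗ ((t ⋆ s) n ⊕ (t ⋆ t) n)     ≡⟨ lemma ((s ⋆ s) n) ((t ⋆ s) n) ((t ⋆ t) n) ⟩
  (s ⋆ s) n ⊕ ℤ.-1ℤ ⊗ (t ⋆ t) n                                 ∎
  where
  open ≡-Reasoning
  lemma : ∀ a b c → (a ⊕ b) ⊕ -[1+ 0 ] ⊗ (b ⊕ c) ≡ a ⊕ -[1+ 0 ] ⊗ c
  lemma = solve-∀

strong-induction : (P : ℕ → Set) → (∀ n → (∀ i → i < n → P i) → P n) → ∀ n → P n
strong-induction P step n = below-all (suc n) n ℕₚ.≤-refl
  where
  below-all : ∀ n i → i < n → P i
  below-all (suc n) i (s≤s i≤n) = step i (λ j j<i → below-all n j (ℕₚ.≤-trans j<i i≤n))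

cancel-factor : ∀ c .{{_ : ℤ.NonZero c}} {u} → u ⊗ c ≡ + 0 → u ≡ + 0
cancel-factor c {u} h = ℤₚ.*-cancelʳ-≡ u (+ 0) c h

-- A tilde marks the Lambert series to be identified with the theta series of the same letter.
f̃ Ṽ : Seq
f̃ = one ⊞ (+ 4) · G
Ṽ = (+ 4) · Y

-- Symmetrise in the two factors: if a x ≡ 3 modulo 4, then χ₄(a) and χ₄(x) are opposite and the
-- terms of (a , x) and (x , a) cancel; if a x is even, every term vanishes.
Y-supp : Supp 4 1 Y
Y-supp n n≢1 = double-injective (trans (cong (Y n ⊕_) (D-swap (λ a x → χ₄ a ⊗ od x) n))
  (trans (sym (D-⊕ (λ a x → χ₄ a ⊗ od x) (λ a x → χ₄ x ⊗ od a) n)) (D-0 n pointwise)))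
  where
  is1 : ℕ → ℤ
  is1 m = table₄ (+ 0) (+ 1) (+ 0) (+ 0) (m % 4)
  H : ℕ → ℕ → ℤ
  H a x = χ₄ a ⊗ od x ⊕ χ₄ x ⊗ od a
  not1 : ∀ r → r ≢ 1 → table₄ (+ 0) (+ 1) (+ 0) (+ 0) r ≡ + 0
  not1 0 _ = refl
  not1 1 h = contradiction refl h
  not1 2 _ = refl
  not1 (suc (suc (suc _))) _ = refl
  pointwise : ∀ a x → a * x ≡ n → H a x ≡ + 0
  pointwise a x eq = begin
    H a x                                                  ≡⟨ cong₂ _⊕_ (cong₂ _⊗_ (χ₄-mod 4 n∣n a) (od-mod 4 (divides 2 refl) x)) (cong₂ _⊗_ (χ₄-mod 4 n∣n x) (od-mod 4 (divides 2 refl) a)) ⟨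
    H (a % 4) (x % 4)                                      ≡⟨ check₄-sound 4 1 (λ a x _ _ → H a x) (λ a x _ _ → is1 (a * x) ⊗ H a x) refl (a % 4) (x % 4) 0 0 (m%n<n a 4) (m%n<n x 4) (s≤s z≤n) (s≤s z≤n) ⟩
    is1 (a % 4 * (x % 4)) ⊗ H (a % 4) (x % 4)              ≡⟨ cong (_⊗ H (a % 4) (x % 4)) (trans (cong (table₄ (+ 0) (+ 1) (+ 0) (+ 0)) (trans (residue-product 4 a x) (cong (_% 4) eq))) (not1 (n % 4) n≢1)) ⟩
    + 0                                                    ∎
    where open ≡-Reasoning

f̃-Ṽ : f̃ ≈ dil 2 f̃ ⊞ Ṽ
f̃-Ṽ n = begin
  one n ⊕ + 4 ⊗ G n                                    ≡⟨ cong (λ u → one n ⊕ + 4 ⊗ u) (G-split n) ⟩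
  one n ⊕ + 4 ⊗ (dil 2 G n ⊕ Y n)                      ≡⟨ lemma (one n) (dil 2 G n) (Y n) ⟩
  (one n ⊕ + 4 ⊗ dil 2 G n) ⊕ + 4 ⊗ Y n                ≡⟨ cong (_⊕ + 4 ⊗ Y n) (trans (dil-⊞ 2 one ((+ 4) · G) n) (cong₂ _⊕_ (dil-one 2 n) (dil-· 2 (+ 4) G n))) ⟨
  dil 2 f̃ n ⊕ + 4 ⊗ Y n                                ∎
  where
  open ≡-Reasoning
  lemma : ∀ o g y → o ⊕ + 4 ⊗ (g ⊕ y) ≡ (o ⊕ + 4 ⊗ g) ⊕ + 4 ⊗ y
  lemma = solve-∀

-- Both series satisfy f = f_2 + V, which determines each coefficient at a positive exponent from V
-- and the coefficient at half the exponent.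
f-from-V : ∀ N → (∀ i → i < N → V i ≡ Ṽ i) → ∀ i → i < N → f i ≡ f̃ i
f-from-V N h = strong-induction (λ i → i < N → f i ≡ f̃ i) step
  where
  step : ∀ n → (∀ i → i < n → i < N → f i ≡ f̃ i) → n < N → f n ≡ f̃ n
  step zero    ih n<N = refl
  step (suc n) ih n<N = trans (f-V (suc n)) (trans (cong₂ _⊕_ (dilated (suc n) refl) (h (suc n) n<N)) (sym (f̃-Ṽ (suc n))))
    where
    dilated : ∀ m → m ≡ suc n → dil 2 f m ≡ dil 2 f̃ m
    dilated m m≡ with 2 ∣? m
    ... | no  _ = refl
    ... | yes (divides zero    refl) = contradiction m≡ (λ ())
    ... | yes (divides (suc q) refl) = ih (suc q) (subst (suc q <_) m≡ (s≤s (s≤s (ℕₚ.m≤m*n q 2)))) (ℕₚ.≤-trans (s≤s (ℕₚ.m≤m*n (suc q) 2)) (subst (_< N) (sym m≡) n<N))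

-- Compare the coefficients at n + 1 in (V - Ṽ)(V + Ṽ) = V² - Ṽ². The left side is 8 (V n - Ṽ n), as
-- V + Ṽ begins with 8q. The right side vanishes, since 4 φ_4² V_2 involves only coefficients of
-- lower index.
V≈Ṽ : V ≈ Ṽ
V≈Ṽ = strong-induction (λ n → V n ≡ Ṽ n) step
  where
  step : ∀ n → (∀ i → i < n → V i ≡ Ṽ i) → V n ≡ Ṽ n
  step n ih with n % 4 ℕ.≟ 1
  ... | no h = trans (supp-V n h) (sym (cong (+ 4 ⊗_) (Y-supp n h)))
  ... | yes n≡1 = ⊟-0 V Ṽ n (cancel-factor (+ 8) (begin
      (V ⊟ Ṽ) n ⊗ + 8                                        ≡⟨ lowest ⟨
      ((V ⊟ Ṽ) ⋆ (V ⊞ Ṽ)) (suc n)                            ≡⟨ squares-diff V Ṽ (suc n) ⟩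
      (V ⋆ V ⊟ Ṽ ⋆ Ṽ) (suc n)                                ≡⟨ ⊟-≡ (V ⋆ V) (Ṽ ⋆ Ṽ) (suc n) squares ⟩
      + 0                                                    ∎))
    where
    open ≡-Reasoning
    lowest : ((V ⊟ Ṽ) ⋆ (V ⊞ Ṽ)) (suc n) ≡ (V ⊟ Ṽ) n ⊗ + 8
    lowest = trans (⋆-lowest₂ (V ⊟ Ṽ) (V ⊞ Ṽ) n (λ i i<n → ⊟-≡ V Ṽ i (ih i i<n)))
      (trans (cong (_⊕ (V ⊟ Ṽ) n ⊗ + 8) (ℤₚ.*-zeroʳ ((V ⊟ Ṽ) (suc n)))) (ℤₚ.+-identityˡ _))
    n≡2 : suc n % 4 ≡ 2
    n≡2 = trans (%-distribˡ-+ 1 n 4) (cong (λ r → (1 + r) % 4) n≡1)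
    Ṽ² : (Ṽ ⋆ Ṽ) (suc n) ≡ + 4 ⊗ (dil 4 f̃ ⋆ dil 2 Ṽ) (suc n)
    Ṽ² = begin
      (Ṽ ⋆ Ṽ) (suc n)                                        ≡⟨ ⋆-·· (+ 4) (+ 4) Y Y (suc n) ⟩
      + 16 ⊗ (Y ⋆ Y) (suc n)                                 ≡⟨ cong (+ 16 ⊗_) (TwoSquaresBoundary.Y² (suc n) n≡2) ⟩
      + 16 ⊗ (dil 2 Y (suc n) ⊕ + 4 ⊗ (dil 4 G ⋆ dil 2 Y) (suc n))   ≡⟨ lemma (dil 2 Y (suc n)) ((dil 4 G ⋆ dil 2 Y) (suc n)) ⟩
      + 4 ⊗ (+ 4 ⊗ (dil 2 Y (suc n) ⊕ + 4 ⊗ (dil 4 G ⋆ dil 2 Y) (suc n)))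
        ≡⟨ cong (+ 4 ⊗_) (trans (⋆-cong {s = dil 4 f̃} refl≈ (dil-· 2 (+ 4) Y) (suc n)) (trans (⋆-·ʳ (+ 4) (dil 4 f̃) (dil 2 Y) (suc n)) (cong (+ 4 ⊗_)
             (trans (⋆-cong {t = dil 2 Y} (≈-trans (dil-⊞ 4 one ((+ 4) · G)) (⊞-cong (dil-one 4) (dil-· 4 (+ 4) G))) refl≈ (suc n))
               (trans (⋆-distribʳ one ((+ 4) · dil 4 G) (dil 2 Y) (suc n)) (cong₂ _⊕_ (⋆-one (dil 2 Y) (suc n)) (⋆-·ˡ (+ 4) (dil 4 G) (dil 2 Y) (suc n)))))))) ⟨
      + 4 ⊗ (dil 4 f̃ ⋆ dil 2 Ṽ) (suc n) ∎
      where
      lemma : ∀ y g → + 16 ⊗ (y ⊕ + 4 ⊗ g) ≡ + 4 ⊗ (+ 4 ⊗ (y ⊕ + 4 ⊗ g))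
      lemma = solve-∀
    -- From 2 i ≤ n + 1 it follows that i < n unless n = 1 (n = 0 is excluded by its residue); for n
    -- = 1 the coefficients are computed.
    small : ∀ k → 2 ≤ k → ∀ i → i * k ≤ suc n → i < n ⊎ n ≡ 1
    small k 2≤k i i*k≤ with i ℕ.<? n
    ... | yes i<n = inj₁ i<n
    ... | no  i≮n = inj₂ (one-only n n≡1 (ℕₚ.+-cancelˡ-≤ n n 1 (ℕₚ.≤-trans (ℕₚ.≤-reflexive (two n)) (ℕₚ.≤-trans (ℕₚ.*-mono-≤ (ℕₚ.≮⇒≥ i≮n) 2≤k) (ℕₚ.≤-trans i*k≤ (ℕₚ.≤-reflexive (ℕₚ.+-comm 1 n)))))))
      where
      two : ∀ n → n + n ≡ n * 2
      two = ℕ-solve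
      one-only : ∀ n → n % 4 ≡ 1 → n ≤ 1 → n ≡ 1
      one-only 0 () _
      one-only 1 _ _ = refl
      one-only (suc (suc _)) _ (s≤s ())
    agree : ∀ k → 2 ≤ k → ∀ i → i * k ≤ suc n → V i ≡ Ṽ i × f i ≡ f̃ i
    agree k 2≤k i i*k≤ with small k 2≤k i i*k≤
    ... | inj₁ i<n  = ih i i<n , f-from-V n ih i i<n
    ... | inj₂ refl = first-terms i (ℕₚ.*-cancelʳ-≤ i 1 2 (ℕₚ.≤-trans (ℕₚ.*-monoʳ-≤ i 2≤k) i*k≤))
      where
      first-terms : ∀ i → i ≤ 1 → V i ≡ Ṽ i × f i ≡ f̃ i
      first-terms 0 _ = refl , refl
      first-terms 1 _ = refl , refl
      first-terms (suc (suc _)) (s≤s ())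
    squares : (V ⋆ V) (suc n) ≡ (Ṽ ⋆ Ṽ) (suc n)
    squares = trans (V² (suc n)) (trans (cong (+ 4 ⊗_) (⋆-cong≤ (suc n)
      (dil-agree 4 (suc n) (λ i i*4≤ → proj₂ (agree 4 (s≤s (s≤s z≤n)) i i*4≤)))
      (dil-agree 2 (suc n) (λ i i*2≤ → proj₁ (agree 2 (s≤s (s≤s z≤n)) i i*2≤))))) (sym Ṽ²))

f≈f̃ : f ≈ f̃
f≈f̃ n = f-from-V (suc n) (λ i _ → V≈Ṽ i) n ℕₚ.≤-refl

ρ-double : ∀ k → ρ (k * 2) ≡ ρ k
ρ-double k = begin
  ρ (k * 2)
    ≡⟨ D-cong (λ a x → lemma (χ a ⊗ od a) (od x)) (k * 2) ⟩
  D (λ a x → χ a ⊗ od a ⊗ ev x ⊕ χ a ⊗ od a ⊗ od x) (k * 2)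
    ≡⟨ D-⊕ (λ a x → χ a ⊗ od a ⊗ ev x) (λ a x → χ a ⊗ od a ⊗ od x) (k * 2) ⟩
  D (λ a x → χ a ⊗ od a ⊗ ev x) (k * 2) ⊕ D (λ a x → χ a ⊗ od a ⊗ od x) (k * 2)
    ≡⟨ cong₂ _⊕_ (trans (ρ-scaleˣ (k * 2)) (dil-* 2 ρ k)) (D-0 (k * 2) off) ⟩
  ρ k ⊕ + 0   ≡⟨ ℤₚ.+-identityʳ (ρ k) ⟩
  ρ k         ∎
  where
  open ≡-Reasoning
  lemma : ∀ u v → u ≡ u ⊗ (+ 1 ⊖ v) ⊕ u ⊗ v
  lemma = solve-∀
  off : ∀ a x → a * x ≡ k * 2 → χ a ⊗ od a ⊗ od x ≡ + 0
  off a x eq = trans (ℤₚ.*-assoc (χ a) (od a) (od x)) (trans (cong (χ a ⊗_) (trans (product (a % 2) (x % 2) (m%n<n a 2) (m%n<n x 2))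
    (cong +_ (trans (sym (%-distribˡ-* a x 2)) (trans (cong (_% 2) eq) (m*n%n≡0 k 2)))))) (ℤₚ.*-zeroʳ (χ a)))
    where
    product : ∀ r s → r < 2 → s < 2 → + r ⊗ + s ≡ + ((r * s) % 2)
    product 0 s _ _ = refl
    product 1 0 _ _ = refl
    product 1 1 _ _ = refl
    product (suc (suc _)) _ (s≤s (s≤s ())) _
    product 1 (suc (suc _)) _ (s≤s (s≤s ()))

-- 1 + 2τ is the theta series of the norm form on the integers of ℚ(√-7). The subtracted 4 ρ_2
-- accounts for the elements (x + y√-7)/2 with x and y odd, which lie outside ℤ[√-7].
Z̃ π̃ : Seq
Z̃ = (one ⊞ (+ 2) · τ) ⊞ -[1+ 3 ] · dil 2 ρ
π̃ = (+ 4) · ρ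

τ-double : ∀ k → τ (k * 2) ≡ τ k ⊕ ρ k
τ-double k = trans (τ-split (k * 2)) (cong₂ _⊕_ (dil-* 2 τ k) (ρ-double k))

Z̃-even : ∀ k → Z̃ (k * 2) ≡ one (k * 2) ⊕ + 2 ⊗ dil 2 τ k
Z̃-even k = begin
  (one (k * 2) ⊕ + 2 ⊗ τ (k * 2)) ⊕ -[1+ 3 ] ⊗ dil 2 ρ (k * 2)     ≡⟨ cong₂ (λ u v → (one (k * 2) ⊕ + 2 ⊗ u) ⊕ -[1+ 3 ] ⊗ v) (trans (τ-double k) (cong (_⊕ ρ k) (τ-split k))) (dil-* 2 ρ k) ⟩
  (one (k * 2) ⊕ + 2 ⊗ ((dil 2 τ k ⊕ ρ k) ⊕ ρ k)) ⊕ -[1+ 3 ] ⊗ ρ k   ≡⟨ lemma (one (k * 2)) (dil 2 τ k) (ρ k) ⟩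
  one (k * 2) ⊕ + 2 ⊗ dil 2 τ k                                    ∎
  where
  open ≡-Reasoning
  lemma : ∀ o t r → (o ⊕ + 2 ⊗ ((t ⊕ r) ⊕ r)) ⊕ -[1+ 3 ] ⊗ r ≡ o ⊕ + 2 ⊗ t
  lemma = solve-∀

π̃² : π̃ ⋆ π̃ ≈ (+ 4) · (Z̃ ⋆ dil 2 π̃)
π̃² n = begin
  (π̃ ⋆ π̃) n                                   ≡⟨ ⋆-·· (+ 4) (+ 4) ρ ρ n ⟩
  + 16 ⊗ (ρ ⋆ ρ) n                            ≡⟨ lemma ((ρ ⋆ ρ) n) ((τ ⋆ dil 2 ρ) n) ((dil 2 ρ ⋆ dil 2 ρ) n) ⟩
  + 4 ⊗ (+ 4 ⊗ (((((ρ ⋆ ρ) n ⊖ + 2 ⊗ (τ ⋆ dil 2 ρ) n) ⊕ + 4 ⊗ (dil 2 ρ ⋆ dil 2 ρ) n) ⊕ + 2 ⊗ (τ ⋆ dil 2 ρ) n) ⊕ -[1+ 3 ] ⊗ (dil 2 ρ ⋆ dil 2 ρ) n))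
    ≡⟨ cong (λ u → + 4 ⊗ (+ 4 ⊗ ((u ⊕ + 2 ⊗ (τ ⋆ dil 2 ρ) n) ⊕ -[1+ 3 ] ⊗ (dil 2 ρ ⋆ dil 2 ρ) n))) (SevenSquares.ρ² n) ⟩
  + 4 ⊗ (+ 4 ⊗ ((dil 2 ρ n ⊕ + 2 ⊗ (τ ⋆ dil 2 ρ) n) ⊕ -[1+ 3 ] ⊗ (dil 2 ρ ⋆ dil 2 ρ) n))
    ≡⟨ cong (+ 4 ⊗_) (trans (⋆-cong {s = Z̃} refl≈ (dil-· 2 (+ 4) ρ) n) (trans (⋆-·ʳ (+ 4) Z̃ (dil 2 ρ) n) (cong (+ 4 ⊗_)
         (trans (⋆-distribʳ (one ⊞ (+ 2) · τ) (-[1+ 3 ] · dil 2 ρ) (dil 2 ρ) n) (cong₂ _⊕_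
           (trans (⋆-distribʳ one ((+ 2) · τ) (dil 2 ρ) n) (cong₂ _⊕_ (⋆-one (dil 2 ρ) n) (⋆-·ˡ (+ 2) τ (dil 2 ρ) n)))
           (⋆-·ˡ -[1+ 3 ] (dil 2 ρ) (dil 2 ρ) n)))))) ⟨
  + 4 ⊗ (Z̃ ⋆ dil 2 π̃) n                       ∎
  where
  open ≡-Reasoning
  lemma : ∀ p q r → + 16 ⊗ p ≡ + 4 ⊗ (+ 4 ⊗ ((((p ⊖ + 2 ⊗ q) ⊕ + 4 ⊗ r) ⊕ + 2 ⊗ q) ⊕ -[1+ 3 ] ⊗ r))
  lemma = solve-∀

-- The claim at N is π N = π̃ N together with Z (N − 1) = Z̃ (N − 1); π² = 4 Z π₂ gives π N − π̃ N = 2 (Z (N − 1) − Z̃ (N − 1)).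
Claim : ℕ → Set
Claim N = π N ≡ π̃ N × (∀ j → suc j ≡ N → Z j ≡ Z̃ j)

-- For N = 2 + M, compare coefficients at N + 1 in (π - π̃)(π + π̃) = 4 (Z π_2 - Z̃ π̃_2). Here π +
-- π̃ begins with 8q and π_2 with 4q², and π_2 and π̃_2 agree as far as they enter.
relation : ∀ M → (∀ i → i < 2 + M → Claim i) → + 2 ⊗ (Z ⊟ Z̃) (1 + M) ≡ (π ⊟ π̃) (2 + M)
relation M ih = ℤₚ.*-cancelˡ-≡ (+ 8) _ _ (begin
  + 8 ⊗ (+ 2 ⊗ (Z ⊟ Z̃) (1 + M))          ≡⟨ sixteen ((Z ⊟ Z̃) (1 + M)) ⟩
  + 4 ⊗ ((Z ⊟ Z̃) (1 + M) ⊗ + 4)          ≡⟨ cong (+ 4 ⊗_) ε-part ⟨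
  + 4 ⊗ ((Z ⊟ Z̃) ⋆ dil 2 π) (3 + M)      ≡⟨ cong (+ 4 ⊗_) (⋆-⊟ˡ Z Z̃ (dil 2 π) (3 + M)) ⟩
  + 4 ⊗ (Z ⋆ dil 2 π ⊟ Z̃ ⋆ dil 2 π) (3 + M)   ≡⟨ cong (λ u → + 4 ⊗ ((Z ⋆ dil 2 π) (3 + M) ⊕ ℤ.-1ℤ ⊗ u)) π₂-agree ⟩
  + 4 ⊗ (Z ⋆ dil 2 π ⊟ Z̃ ⋆ dil 2 π̃) (3 + M)   ≡⟨ distribute ((Z ⋆ dil 2 π) (3 + M)) ((Z̃ ⋆ dil 2 π̃) (3 + M)) ⟩
  + 4 ⊗ (Z ⋆ dil 2 π) (3 + M) ⊕ ℤ.-1ℤ ⊗ (+ 4 ⊗ (Z̃ ⋆ dil 2 π̃) (3 + M))   ≡⟨ cong₂ (λ u v → u ⊕ ℤ.-1ℤ ⊗ v) (π² (3 + M)) (π̃² (3 + M)) ⟨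
  (π ⋆ π ⊟ π̃ ⋆ π̃) (3 + M)                ≡⟨ squares-diff π π̃ (3 + M) ⟨
  ((π ⊟ π̃) ⋆ (π ⊞ π̃)) (3 + M)            ≡⟨ ⋆-lowest₂ (π ⊟ π̃) (π ⊞ π̃) (2 + M) (λ i i< → ⊟-≡ π π̃ i (proj₁ (ih i i<))) ⟩
  (π ⊟ π̃) (3 + M) ⊗ + 0 ⊕ (π ⊟ π̃) (2 + M) ⊗ + 8   ≡⟨ eight ((π ⊟ π̃) (3 + M)) ((π ⊟ π̃) (2 + M)) ⟩
  + 8 ⊗ (π ⊟ π̃) (2 + M)                  ∎)
  where
  open ≡-Reasoning
  sixteen : ∀ e → + 8 ⊗ (+ 2 ⊗ e) ≡ + 4 ⊗ (e ⊗ + 4)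
  sixteen = solve-∀
  distribute : ∀ a b → + 4 ⊗ (a ⊕ -[1+ 0 ] ⊗ b) ≡ + 4 ⊗ a ⊕ -[1+ 0 ] ⊗ (+ 4 ⊗ b)
  distribute = solve-∀
  eight : ∀ a b → a ⊗ + 0 ⊕ b ⊗ + 8 ≡ + 8 ⊗ b
  eight = solve-∀
  last : ∀ a b c → a ⊗ + 0 ⊕ (b ⊗ + 0 ⊕ c ⊗ + 4) ≡ c ⊗ + 4
  last = solve-∀
  ε-part : ((Z ⊟ Z̃) ⋆ dil 2 π) (3 + M) ≡ (Z ⊟ Z̃) (1 + M) ⊗ + 4
  ε-part = trans (⋆-lowest₃ (Z ⊟ Z̃) (dil 2 π) (1 + M) (λ i i< → ⊟-≡ Z Z̃ i (proj₂ (ih (suc i) (s≤s i<)) i refl)))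
    (last ((Z ⊟ Z̃) (3 + M)) ((Z ⊟ Z̃) (2 + M)) ((Z ⊟ Z̃) (1 + M)))
  π₂-agree : (Z̃ ⋆ dil 2 π) (3 + M) ≡ (Z̃ ⋆ dil 2 π̃) (3 + M)
  π₂-agree = ⋆-cong≤ {s = Z̃} (3 + M) (λ _ _ → refl) (dil-agree 2 (3 + M) (λ i i*2≤ → proj₁ (ih i (bound i i*2≤))))
    where
    bound : ∀ i → i * 2 ≤ 3 + M → i < 2 + M
    bound 0 _ = s≤s z≤n
    bound 1 _ = s≤s (s≤s z≤n)
    bound (suc (suc i)) (s≤s (s≤s (s≤s h))) = s≤s (s≤s (ℕₚ.≤-trans (s≤s (ℕₚ.m≤m*n i 2)) h))

-- Even exponents need no product relation: Z vanishes at 4j + 2, and Z (4j) = Z j + π_2 j refers to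
-- smaller exponents.
Z-even : ∀ k → (∀ i → i < 2 + k * 2 → Claim i) → Z (suc k * 2) ≡ Z̃ (suc k * 2)
Z-even k ih with 2 ∣? suc k
... | no odd-k = trans (trans (cong Z index) (Z-4k+2 (suc k ℕ./ 2))) (sym (trans (Z̃-even (suc k)) (cong (λ u → + 0 ⊕ + 2 ⊗ u) (dil-∤ 2 τ (suc k) odd-k))))
  where
  remainder : suc k % 2 ≡ 1
  remainder with suc k % 2 in eq | m%n<n (suc k) 2
  ... | 0 | _ = contradiction (m%n≡0⇒n∣m (suc k) 2 eq) odd-k
  ... | 1 | _ = refl
  ... | suc (suc _) | s≤s (s≤s ())
  regroup : ∀ q → (1 + q * 2) * 2 ≡ 2 + q * 4
  regroup = ℕ-solve
  index : suc k * 2 ≡ 2 + suc k ℕ./ 2 * 4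
  index = trans (cong (_* 2) (trans (m≡m%n+[m/n]*n (suc k) 2) (cong (λ r → r + suc k ℕ./ 2 * 2) remainder))) (regroup (suc k ℕ./ 2))
... | yes (divides (suc j) eq) = begin
  Z (suc k * 2)                              ≡⟨ cong Z index ⟩
  Z (suc j * 4)                              ≡⟨ Z-4k (suc j) ⟩
  Z (suc j) ⊕ dil 2 π (suc j)                ≡⟨ cong₂ _⊕_ (proj₂ (ih (2 + j) small) (suc j) refl) (dil-agree 2 (suc j) (λ i h → proj₁ (ih i (ℕₚ.≤-trans (s≤s (ℕₚ.≤-trans (ℕₚ.m≤m*n i 2) h)) (ℕₚ.≤-trans (ℕₚ.n≤1+n _) small)))) (suc j) ℕₚ.≤-refl) ⟩
  Z̃ (suc j) ⊕ dil 2 π̃ (suc j)                ≡⟨ cong (Z̃ (suc j) ⊕_) (dil-· 2 (+ 4) ρ (suc j)) ⟩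
  Z̃ (suc j) ⊕ + 4 ⊗ dil 2 ρ (suc j)          ≡⟨ lemma (+ 0) (τ (suc j)) (dil 2 ρ (suc j)) ⟩
  + 0 ⊕ + 2 ⊗ τ (suc j)                      ≡⟨ cong (λ u → + 0 ⊕ + 2 ⊗ u) (trans (cong (dil 2 τ) eq) (dil-* 2 τ (suc j))) ⟨
  + 0 ⊕ + 2 ⊗ dil 2 τ (suc k)                ≡⟨ Z̃-even (suc k) ⟨
  Z̃ (suc k * 2)                              ∎
  where
  open ≡-Reasoning
  lemma : ∀ o t r → ((o ⊕ + 2 ⊗ t) ⊕ -[1+ 3 ] ⊗ r) ⊕ + 4 ⊗ r ≡ o ⊕ + 2 ⊗ t
  lemma = solve-∀
  index : suc k * 2 ≡ suc j * 4
  index = trans (cong (_* 2) eq) (ℕₚ.*-assoc (suc j) 2 2)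
  small : 2 + j < 2 + k * 2
  small = s≤s (s≤s (subst (suc j ≤_) (sym (ℕₚ.+-cancelˡ-≡ 2 _ _ index)) (s≤s (ℕₚ.≤-trans (ℕₚ.m≤m*n j 4) (ℕₚ.m≤n+m (j * 4) 1)))))

suc*2 : ∀ k → suc k * 2 ≡ 2 + k * 2
suc*2 k = refl

parity-ℕ : ∀ M → ∃ λ k → M ≡ k * 2 ⊎ M ≡ 1 + k * 2
parity-ℕ zero = 0 , inj₁ refl
parity-ℕ (suc M) with parity-ℕ M
... | k , inj₁ refl = k , inj₂ refl
... | k , inj₂ refl = suc k , inj₁ refl

-- For even N the coefficient π N is known from N/2 by `π-double`, and `relation` yields the odd
-- coefficient Z (N - 1).
claim-even : ∀ k → (∀ i → i < 2 + k * 2 → Claim i) → Claim (2 + k * 2)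
claim-even k ih = π≡ , previous
  where
  π≡ : π (2 + k * 2) ≡ π̃ (2 + k * 2)
  π≡ = subst (λ m → π m ≡ π̃ m) (suc*2 k)
    (trans (π-double (suc k)) (trans (proj₁ (ih (suc k) (s≤s (s≤s (ℕₚ.m≤m*n k 2))))) (cong (+ 4 ⊗_) (sym (ρ-double (suc k))))))
  Z≡ : Z (1 + k * 2) ≡ Z̃ (1 + k * 2)
  Z≡ = ⊟-0 Z Z̃ (1 + k * 2) (cancel-factor (+ 2)
    (trans (ℤₚ.*-comm ((Z ⊟ Z̃) (1 + k * 2)) (+ 2)) (trans (relation (k * 2) ih) (⊟-≡ π π̃ (2 + k * 2) π≡))))
  previous : ∀ j → suc j ≡ 2 + k * 2 → Z j ≡ Z̃ j
  previous j eq = subst (λ m → Z m ≡ Z̃ m) (sym (ℕₚ.suc-injective eq)) Z≡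

-- For odd N the even coefficient Z (N - 1) is known by `Z-even`, and `relation` yields π N.
claim-odd : ∀ k → (∀ i → i < 3 + k * 2 → Claim i) → Claim (3 + k * 2)
claim-odd k ih = ⊟-0 π π̃ (3 + k * 2) (trans (sym (relation (1 + k * 2) ih)) (cong (+ 2 ⊗_) (⊟-≡ Z Z̃ (2 + k * 2) Z≡))) , previous
  where
  Z≡ : Z (2 + k * 2) ≡ Z̃ (2 + k * 2)
  Z≡ = subst (λ m → Z m ≡ Z̃ m) (suc*2 k) (Z-even k (λ i i< → ih i (ℕₚ.m≤n⇒m≤1+n i<)))
  previous : ∀ j → suc j ≡ 3 + k * 2 → Z j ≡ Z̃ j
  previous j eq = subst (λ m → Z m ≡ Z̃ m) (sym (ℕₚ.suc-injective eq)) Z≡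

claim : ∀ N → Claim N
claim = strong-induction Claim step
  where
  larger : ∀ M → (∃ λ k → M ≡ k * 2 ⊎ M ≡ 1 + k * 2) → (∀ i → i < 2 + M → Claim i) → Claim (2 + M)
  larger M (k , inj₁ eq) ih = subst (λ M → Claim (2 + M)) (sym eq) (claim-even k (subst (λ M → ∀ i → i < 2 + M → Claim i) eq ih))
  larger M (k , inj₂ eq) ih = subst (λ M → Claim (2 + M)) (sym eq) (claim-odd k (subst (λ M → ∀ i → i < 2 + M → Claim i) eq ih))
  previous : ∀ j → suc j ≡ 1 → Z j ≡ Z̃ j
  previous zero    refl = refl
  step : ∀ N → (∀ i → i < N → Claim i) → Claim N
  step 0             ih = refl , λ _ ()
  step 1             ih = refl , previous
  step (suc (suc M)) ih = larger M (parity-ℕ M) ih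

π≈π̃ : π ≈ π̃
π≈π̃ n = proj₁ (claim n)

-- The two identities between the convolutions of ρ with φ(q)² and φ(q⁷)²

-- `Alpha` minus `Beta` eliminates `dil 2 ρ ⋆ G`.
ρ-combination₁ : ∀ n → + 4 ⊗ (ρ ⋆ G) n ≡ (+ 4 ⊗ (ρ ⋆ dil 7 G) n ⊕ + 16 ⊗ (dil 2 ρ ⋆ dil 7 G) n) ⊕ (bdα n ⊖ bdβ n)
ρ-combination₁ n = trans (lemma ((ρ ⋆ G) n) ((dil 2 ρ ⋆ G) n) ((ρ ⋆ dil 7 G) n) ((dil 2 ρ ⋆ dil 7 G) n))
  (cong₂ (λ u v → (+ 4 ⊗ (ρ ⋆ dil 7 G) n ⊕ + 16 ⊗ (dil 2 ρ ⋆ dil 7 G) n) ⊕ (u ⊖ v)) (Alpha.identity n) (Beta.identity n))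
  where
  lemma : ∀ a b c d → + 4 ⊗ a ≡ (+ 4 ⊗ c ⊕ + 16 ⊗ d) ⊕ (((a ⊕ + 2 ⊗ b) ⊕ (+ 3 ⊗ c ⊖ + 2 ⊗ d)) ⊖ ((-[1+ 2 ] ⊗ a ⊕ + 2 ⊗ b) ⊕ (+ 7 ⊗ c ⊕ + 14 ⊗ d)))
  lemma = solve-∀

-- 7 times `Alpha` plus `Beta` eliminates `dil 2 ρ ⋆ dil 7 G`.
ρ-combination₂ : ∀ n → (+ 4 ⊗ (ρ ⋆ G) n ⊕ + 16 ⊗ (dil 2 ρ ⋆ G) n) ⊕ + 28 ⊗ (ρ ⋆ dil 7 G) n ≡ + 7 ⊗ bdα n ⊕ bdβ n
ρ-combination₂ n = trans (lemma ((ρ ⋆ G) n) ((dil 2 ρ ⋆ G) n) ((ρ ⋆ dil 7 G) n) ((dil 2 ρ ⋆ dil 7 G) n))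
  (cong₂ (λ u v → + 7 ⊗ u ⊕ v) (Alpha.identity n) (Beta.identity n))
  where
  lemma : ∀ a b c d → (+ 4 ⊗ a ⊕ + 16 ⊗ b) ⊕ + 28 ⊗ c ≡ + 7 ⊗ ((a ⊕ + 2 ⊗ b) ⊕ (+ 3 ⊗ c ⊖ + 2 ⊗ d)) ⊕ ((-[1+ 2 ] ⊗ a ⊕ + 2 ⊗ b) ⊕ (+ 7 ⊗ c ⊕ + 14 ⊗ d))
  lemma = solve-∀

⋆-f : ∀ s n → (s ⋆ f) n ≡ s n ⊕ + 4 ⊗ (s ⋆ G) n
⋆-f s n = trans (⋆-cong {s} refl≈ f≈f̃ n) (trans (⋆-distribˡ s one ((+ 4) · G) n)
  (cong₂ _⊕_ (trans (⋆-comm s one n) (⋆-one s n)) (⋆-·ʳ (+ 4) s G n)))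

⋆-f₇ : ∀ s n → (s ⋆ dil 7 f) n ≡ s n ⊕ + 4 ⊗ (s ⋆ dil 7 G) n
⋆-f₇ s n = trans (⋆-cong {s} refl≈ (≈-trans (dil-cong 7 f≈f̃) (≈-trans (dil-⊞ 7 one ((+ 4) · G)) (⊞-cong (dil-one 7) (dil-· 7 (+ 4) G)))) n)
  (trans (⋆-distribˡ s one ((+ 4) · dil 7 G) n) (cong₂ _⊕_ (trans (⋆-comm s one n) (⋆-one s n)) (⋆-·ʳ (+ 4) s (dil 7 G) n)))

-- The convolutions at quadratic residues and at multiples of 7

IsResidue : ℕ → Set
IsResidue n = χ n ≡ + 1

χ-product : ∀ a x → χ (a * x) ≡ χ a ⊗ χ x
χ-product a x = begin
  χ (a * x)                       ≡⟨ cong legendre₇ (trans (residue-product 7 a x) refl) ⟨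
  χ (a % 7 * (x % 7))             ≡⟨ check₄-sound 7 1 (λ a x _ _ → χ (a * x)) (λ a x _ _ → χ a ⊗ χ x) refl (a % 7) (x % 7) 0 0 (m%n<n a 7) (m%n<n x 7) (s≤s z≤n) (s≤s z≤n) ⟩
  χ (a % 7) ⊗ χ (x % 7)           ≡⟨ cong₂ _⊗_ (χ-mod 7 n∣n a) (χ-mod 7 n∣n x) ⟩
  χ a ⊗ χ x                       ∎
  where open ≡-Reasoning

χ-cubed : ∀ a → χ a ⊗ (χ a ⊗ χ a) ≡ χ a
χ-cubed a = trans (cong (λ u → u ⊗ (u ⊗ u)) (sym (χ-mod 7 n∣n a)))
  (trans (check₁-sound 7 (λ a → χ a ⊗ (χ a ⊗ χ a)) χ refl (a % 7) (m%n<n a 7)) (χ-mod 7 n∣n a))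

χ-same : ∀ a x → IsResidue (a * x) → χ x ≡ χ a
χ-same a x h = begin
  χ x                       ≡⟨ ℤₚ.*-identityˡ (χ x) ⟨
  + 1 ⊗ χ x                 ≡⟨ cong (_⊗ χ x) (trans (sym (χ-product a x)) h) ⟨
  (χ a ⊗ χ x) ⊗ χ x         ≡⟨ lemma (χ a) (χ x) (χ a ⊗ χ x) (trans (sym (χ-product a x)) h) ⟩
  χ a ⊗ (χ x ⊗ (χ x ⊗ (χ a ⊗ χ x)))   ≡⟨ swap (χ a) (χ x) ⟩
  (χ a ⊗ χ x) ⊗ (χ a ⊗ (χ x ⊗ χ x))   ≡⟨ cong (_⊗ (χ a ⊗ (χ x ⊗ χ x))) (trans (sym (χ-product a x)) h) ⟩
  + 1 ⊗ (χ a ⊗ (χ x ⊗ χ x))           ≡⟨ cong (λ u → + 1 ⊗ (χ a ⊗ u)) square ⟩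
  + 1 ⊗ (χ a ⊗ + 1)                   ≡⟨ ones′ (χ a) ⟩
  χ a                       ∎
  where
  open ≡-Reasoning
  lemma : ∀ a x p → p ≡ + 1 → (a ⊗ x) ⊗ x ≡ a ⊗ (x ⊗ (x ⊗ p))
  lemma a x .(+ 1) refl = go a x
    where
    go : ∀ a x → (a ⊗ x) ⊗ x ≡ a ⊗ (x ⊗ (x ⊗ + 1))
    go = solve-∀
  swap : ∀ a x → a ⊗ (x ⊗ (x ⊗ (a ⊗ x))) ≡ (a ⊗ x) ⊗ (a ⊗ (x ⊗ x))
  swap = solve-∀
  ones′ : ∀ a → + 1 ⊗ (a ⊗ + 1) ≡ a
  ones′ = solve-∀
  square : χ x ⊗ χ x ≡ + 1
  square = begin
    χ x ⊗ χ x                              ≡⟨ expand (χ x) ⟩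
    + 1 ⊗ (χ x ⊗ χ x)                      ≡⟨ cong (_⊗ (χ x ⊗ χ x)) (trans (sym (χ-product a x)) h) ⟨
    (χ a ⊗ χ x) ⊗ (χ x ⊗ χ x)              ≡⟨ assoc (χ a) (χ x) ⟩
    χ a ⊗ (χ x ⊗ (χ x ⊗ χ x))              ≡⟨ cong (χ a ⊗_) (χ-cubed x) ⟩
    χ a ⊗ χ x                              ≡⟨ trans (sym (χ-product a x)) h ⟩
    + 1                                    ∎
    where
    expand : ∀ u → u ⊗ u ≡ + 1 ⊗ (u ⊗ u)
    expand = solve-∀
    assoc : ∀ a x → (a ⊗ x) ⊗ (x ⊗ x) ≡ a ⊗ (x ⊗ (x ⊗ x))
    assoc = solve-∀

D-diff : ∀ h k n → D h n ⊖ D k n ≡ D (λ a x → h a x ⊖ k a x) n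
D-diff h k n = trans (cong (D h n ⊕_) (sym (ℤₚ.-1*i≡-i (D k n)))) (sym (D-⊖ h k n))

-- For m d = n the hypothesis gives χ(d) = χ(m), so that the terms with the growing factor m - 1
-- cancel, and those with `is3` as well.
bd-residue : ∀ n → IsResidue n → bdα n ⊖ bdβ n ≡ + 4 ⊗ dil 2 ρ n
bd-residue n h = begin
  bdα n ⊖ bdβ n   ≡⟨ D-diff hα hβ n ⟩
  D (λ m d → hα m d ⊖ hβ m d) n   ≡⟨ D-cong-on n (λ m d eq → trans (cong (λ u → ((+ m ⊖ + 1) ⊗ (χ₄ d ⊗ u) ⊖ + 2 ⊗ (χ m ⊗ is3 m)) ⊖ ((+ m ⊖ + 1) ⊗ (χ₄ d ⊗ χ m) ⊖ u ⊗ (+ 4 ⊗ is2 m ⊕ + 2 ⊗ is3 m)))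
                                       (χ-same m d (subst IsResidue (sym eq) h))) (lemma (+ m ⊖ + 1) (χ₄ d) (χ m) (is3 m) (is2 m))) ⟩
  D (λ m d → + 4 ⊗ (χ m ⊗ is2 m)) n   ≡⟨ trans (D-⊗ (+ 4) (λ m d → χ m ⊗ is2 m) n) (cong (+ 4 ⊗_) (ρ₂ᵃ n)) ⟩
  + 4 ⊗ dil 2 ρ n ∎
  where
  open ≡-Reasoning
  hα hβ : ℕ → ℕ → ℤ
  hα m d = (+ m ⊖ + 1) ⊗ (χ₄ d ⊗ χ d) ⊖ + 2 ⊗ (χ m ⊗ is3 m)
  hβ m d = (+ m ⊖ + 1) ⊗ (χ₄ d ⊗ χ m) ⊖ χ d ⊗ (+ 4 ⊗ is2 m ⊕ + 2 ⊗ is3 m)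
  lemma : ∀ k c x t e → (k ⊗ (c ⊗ x) ⊖ + 2 ⊗ (x ⊗ t)) ⊖ (k ⊗ (c ⊗ x) ⊖ x ⊗ (+ 4 ⊗ e ⊕ + 2 ⊗ t)) ≡ + 4 ⊗ (x ⊗ e)
  lemma = solve-∀

ρ-residue : ∀ n → IsResidue n → (ρ ⋆ f) n ≡ (ρ ⋆ dil 7 f) n ⊕ + 4 ⊗ (dil 2 ρ ⋆ dil 7 f) n
ρ-residue n h = begin
  (ρ ⋆ f) n                ≡⟨ ⋆-f ρ n ⟩
  ρ n ⊕ + 4 ⊗ (ρ ⋆ G) n    ≡⟨ cong (ρ n ⊕_) (trans (ρ-combination₁ n) (cong ((+ 4 ⊗ (ρ ⋆ dil 7 G) n ⊕ + 16 ⊗ (dil 2 ρ ⋆ dil 7 G) n) ⊕_) (bd-residue n h))) ⟩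
  ρ n ⊕ ((+ 4 ⊗ (ρ ⋆ dil 7 G) n ⊕ + 16 ⊗ (dil 2 ρ ⋆ dil 7 G) n) ⊕ + 4 ⊗ dil 2 ρ n)
    ≡⟨ lemma (ρ n) ((ρ ⋆ dil 7 G) n) ((dil 2 ρ ⋆ dil 7 G) n) (dil 2 ρ n) ⟩
  (ρ n ⊕ + 4 ⊗ (ρ ⋆ dil 7 G) n) ⊕ + 4 ⊗ (dil 2 ρ n ⊕ + 4 ⊗ (dil 2 ρ ⋆ dil 7 G) n)
    ≡⟨ cong₂ (λ u v → u ⊕ + 4 ⊗ v) (⋆-f₇ ρ n) (⋆-f₇ (dil 2 ρ) n) ⟨
  (ρ ⋆ dil 7 f) n ⊕ + 4 ⊗ (dil 2 ρ ⋆ dil 7 f) n ∎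
  where
  open ≡-Reasoning
  lemma : ∀ r a b s → r ⊕ ((+ 4 ⊗ a ⊕ + 16 ⊗ b) ⊕ + 4 ⊗ s) ≡ (r ⊕ + 4 ⊗ a) ⊕ + 4 ⊗ (s ⊕ + 4 ⊗ b)
  lemma = solve-∀

χ-0 : ∀ a → 7 ∣ a → χ a ≡ + 0
χ-0 a d = cong legendre₇ (n∣m⇒m%n≡0 a 7 d)

z₇-∣ : ∀ a → 7 ∣ a → z₇ a ≡ + 1
z₇-∣ a d = cong (λ r → if r ℕ.≡ᵇ 0 then + 1 else + 0) (n∣m⇒m%n≡0 a 7 d)

prime-7 : Prime 7
prime-7 = toWitness {a? = prime? 7} _

-- The prime 7 divides a, where χ vanishes, or it divides x.
χ-z : ∀ a x n → a * x ≡ n * 7 → χ a ≡ χ a ⊗ z₇ x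
χ-z a x n eq with euclidsLemma a x prime-7 (divides n eq)
... | inj₁ d = trans (χ-0 a d) (cong (_⊗ z₇ x) (sym (χ-0 a d)))
... | inj₂ d = sym (trans (cong (χ a ⊗_) (z₇-∣ x d)) (ℤₚ.*-identityʳ (χ a)))

D-7ʳ : ∀ (h : ℕ → ℕ → ℤ) n → D (λ a x → χ a ⊗ h a x) (n * 7) ≡ D (λ a x → χ a ⊗ h a (x * 7)) n
D-7ʳ h n = begin
  D (λ a x → χ a ⊗ h a x) (n * 7)                   ≡⟨ D-cong-on (n * 7) (λ a x eq → cong (_⊗ h a x) (χ-z a x n eq)) ⟩
  D (λ a x → χ a ⊗ z₇ x ⊗ h a x) (n * 7)            ≡⟨ D-scaleʳ 6 (λ a x → χ a ⊗ z₇ x ⊗ h a x) (λ a x d → cong (_⊗ h a x) (trans (cong (χ a ⊗_) (z₇-∤ x d)) (ℤₚ.*-zeroʳ (χ a)))) (n * 7) ⟩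
  dil 7 (D (λ a x → χ a ⊗ z₇ (x * 7) ⊗ h a (x * 7))) (n * 7)   ≡⟨ dil-* 7 (D (λ a x → χ a ⊗ z₇ (x * 7) ⊗ h a (x * 7))) n ⟩
  D (λ a x → χ a ⊗ z₇ (x * 7) ⊗ h a (x * 7)) n      ≡⟨ D-cong (λ a x → cong (_⊗ h a (x * 7)) (trans (cong (χ a ⊗_) (z₇-7* x)) (ℤₚ.*-identityʳ (χ a)))) n ⟩
  D (λ a x → χ a ⊗ h a (x * 7)) n                   ∎
  where open ≡-Reasoning

D-7ˡ : ∀ (h : ℕ → ℕ → ℤ) n → D (λ a x → χ x ⊗ h a x) (n * 7) ≡ D (λ a x → χ x ⊗ h (a * 7) x) n
D-7ˡ h n = trans (D-swap (λ a x → χ x ⊗ h a x) (n * 7)) (trans (D-7ʳ (λ a x → h x a) n) (D-swap (λ a x → χ a ⊗ h (x * 7) a) n))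

ρ-7 : ∀ n → ρ (n * 7) ≡ ρ n
ρ-7 n = D-7ʳ (λ a x → od a) n

dil₂ρ-7 : ∀ n → dil 2 ρ (n * 7) ≡ dil 2 ρ n
dil₂ρ-7 n = trans (sym (ρ₂ᵃ (n * 7))) (trans (D-7ʳ (λ a x → is2 a) n) (ρ₂ᵃ n))

is2-7* : ∀ a → is2 (a * 7) ≡ is2 a
is2-7* a = trans (cong (table₄ (+ 0) (+ 0) (+ 1) (+ 0)) (trans (%-distribˡ-* a 7 4) (trans (cong (λ w → (w * 3) % 4) (sym (m%n%n≡m%n a 4))) (sym (%-distribˡ-* (a % 4) 7 4)))))
  (trans (check₁-sound 4 (λ a → is2 (a * 7)) is2 refl (a % 4) (m%n<n a 4)) (is2-mod 4 n∣n a))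

is1 : ℕ → ℤ
is1 n = table₄ (+ 0) (+ 1) (+ 0) (+ 0) (n % 4)

is3-7* : ∀ a → is3 (a * 7) ≡ is1 a
is3-7* a = trans (cong (table₄ (+ 0) (+ 0) (+ 0) (+ 1)) (trans (%-distribˡ-* a 7 4) (trans (cong (λ w → (w * 3) % 4) (sym (m%n%n≡m%n a 4))) (sym (%-distribˡ-* (a % 4) 7 4)))))
  (trans (check₁-sound 4 (λ a → is3 (a * 7)) is1 refl (a % 4) (m%n<n a 4)) (mod₄ (table₄ _ _ _ _) 4 n∣n a))

is1+is3 : ∀ a → is1 a ⊕ is3 a ≡ od a
is1+is3 a = trans (sym (cong₂ _⊕_ (mod₄ (table₄ (+ 0) (+ 1) (+ 0) (+ 0)) 4 n∣n a) (is3-mod 4 n∣n a)))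
  (trans (check₁-sound 4 (λ a → is1 a ⊕ is3 a) od refl (a % 4) (m%n<n a 4)) (od-mod 4 (divides 2 refl) a))

χ₄+2is3 : ∀ a → χ₄ a ⊕ + 2 ⊗ is3 a ≡ od a
χ₄+2is3 a = trans (sym (cong₂ (λ u v → u ⊕ + 2 ⊗ v) (χ₄-mod 4 n∣n a) (is3-mod 4 n∣n a)))
  (trans (check₁-sound 4 (λ a → χ₄ a ⊕ + 2 ⊗ is3 a) od refl (a % 4) (m%n<n a 4)) (od-mod 4 (divides 2 refl) a))

-- On m d = 7n a nonzero χ(d) forces 7 ∣ m, and a nonzero χ(m) forces 7 ∣ d. The former turns m - 1
-- into 7m - 1; in the latter χ₄(7) = -1 reverses the sign. Thus the boundary terms at n return, in
-- just the combination evaluated by `ρ-combination₂`.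
bd-7 : ∀ n → bdα (n * 7) ⊖ bdβ (n * 7) ≡ (+ 8 ⊗ ρ n ⊕ + 8 ⊗ dil 2 ρ n) ⊕ (+ 7 ⊗ bdα n ⊕ bdβ n)
bd-7 n = begin
  bdα (n * 7) ⊖ bdβ (n * 7)
    ≡⟨ trans (D-diff hα hβ (n * 7)) (D-cong (λ m d → gather (+ m ⊖ + 1) (χ₄ d) (χ d) (χ m) (is3 m) (is2 m)) (n * 7)) ⟩
  D (λ m d → χ d ⊗ p m d ⊕ χ m ⊗ q m d) (n * 7)
    ≡⟨ trans (D-⊕ (λ m d → χ d ⊗ p m d) (λ m d → χ m ⊗ q m d) (n * 7)) (cong₂ _⊕_ (D-7ˡ p n) (D-7ʳ q n)) ⟩
  D (λ m d → χ d ⊗ p (m * 7) d) n ⊕ D (λ m d → χ m ⊗ q m (d * 7)) n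
    ≡⟨ D-⊕ (λ m d → χ d ⊗ p (m * 7) d) (λ m d → χ m ⊗ q m (d * 7)) n ⟨
  D (λ m d → χ d ⊗ p (m * 7) d ⊕ χ m ⊗ q m (d * 7)) n
    ≡⟨ D-cong (λ m d → trans (cong₂ (λ u v → χ d ⊗ u ⊕ χ m ⊗ v)
         (cong₂ (λ u (v : ℤ × ℤ) → (u ⊖ + 1) ⊗ χ₄ d ⊕ (+ 4 ⊗ proj₁ v ⊕ + 2 ⊗ proj₂ v)) (ℤₚ.pos-* m 7) (cong₂ _,_ (is2-7* m) (is3-7* m)))
         (cong (λ u → (⊝ (+ m ⊖ + 1)) ⊗ u ⊖ + 2 ⊗ is3 m) (χ₄-7* d)))
       (compare (+ m) (χ₄ d) (χ d) (χ m) (is3 m) (is2 m) (is1 m))) n ⟩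
  D (λ m d → e m d ⊕ (+ 7 ⊗ hα m d ⊕ hβ m d)) n
    ≡⟨ trans (D-⊕ e (λ m d → + 7 ⊗ hα m d ⊕ hβ m d) n) (cong (D e n ⊕_) (trans (D-⊕ (λ m d → + 7 ⊗ hα m d) hβ n) (cong (_⊕ bdβ n) (D-⊗ (+ 7) hα n)))) ⟩
  D e n ⊕ (+ 7 ⊗ bdα n ⊕ bdβ n)
    ≡⟨ cong (_⊕ (+ 7 ⊗ bdα n ⊕ bdβ n)) e-sum ⟩
  (+ 8 ⊗ ρ n ⊕ + 8 ⊗ dil 2 ρ n) ⊕ (+ 7 ⊗ bdα n ⊕ bdβ n) ∎
  where
  open ≡-Reasoning
  hα hβ p q e e₁ e₂ e₃ e₄ : ℕ → ℕ → ℤ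
  hα m d = (+ m ⊖ + 1) ⊗ (χ₄ d ⊗ χ d) ⊖ + 2 ⊗ (χ m ⊗ is3 m)
  hβ m d = (+ m ⊖ + 1) ⊗ (χ₄ d ⊗ χ m) ⊖ χ d ⊗ (+ 4 ⊗ is2 m ⊕ + 2 ⊗ is3 m)
  p m d = (+ m ⊖ + 1) ⊗ χ₄ d ⊕ (+ 4 ⊗ is2 m ⊕ + 2 ⊗ is3 m)
  q m d = (⊝ (+ m ⊖ + 1)) ⊗ χ₄ d ⊖ + 2 ⊗ is3 m
  e₁ m d = χ d ⊗ χ₄ d
  e₂ m d = χ m ⊗ is3 m
  e₃ m d = χ d ⊗ is2 m
  e₄ m d = χ d ⊗ (is1 m ⊕ is3 m)
  e m d = (+ 6 ⊗ e₁ m d ⊕ + 12 ⊗ e₂ m d) ⊕ (+ 8 ⊗ e₃ m d ⊕ + 2 ⊗ e₄ m d)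
  gather : ∀ k c x y t s → (k ⊗ (c ⊗ x) ⊖ + 2 ⊗ (y ⊗ t)) ⊖ (k ⊗ (c ⊗ y) ⊖ x ⊗ (+ 4 ⊗ s ⊕ + 2 ⊗ t)) ≡
    x ⊗ (k ⊗ c ⊕ (+ 4 ⊗ s ⊕ + 2 ⊗ t)) ⊕ y ⊗ ((⊝ k) ⊗ c ⊖ + 2 ⊗ t)
  gather = solve-∀
  compare : ∀ m c x y t s u → x ⊗ ((m ⊗ + 7 ⊖ + 1) ⊗ c ⊕ (+ 4 ⊗ s ⊕ + 2 ⊗ u)) ⊕ y ⊗ ((⊝ (m ⊖ + 1)) ⊗ (-[1+ 0 ] ⊗ c) ⊖ + 2 ⊗ t) ≡
    ((+ 6 ⊗ (x ⊗ c) ⊕ + 12 ⊗ (y ⊗ t)) ⊕ (+ 8 ⊗ (x ⊗ s) ⊕ + 2 ⊗ (x ⊗ (u ⊕ t)))) ⊕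
    (+ 7 ⊗ ((m ⊖ + 1) ⊗ (c ⊗ x) ⊖ + 2 ⊗ (y ⊗ t)) ⊕ ((m ⊖ + 1) ⊗ (c ⊗ y) ⊖ x ⊗ (+ 4 ⊗ s ⊕ + 2 ⊗ t)))
  compare = solve-∀
  six : ∀ x c t → + 6 ⊗ (x ⊗ c) ⊕ + 12 ⊗ (x ⊗ t) ≡ + 6 ⊗ (x ⊗ (c ⊕ + 2 ⊗ t))
  six = solve-∀
  e-sum : D e n ≡ + 8 ⊗ ρ n ⊕ + 8 ⊗ dil 2 ρ n
  e-sum = begin
    D e n   ≡⟨ trans (D-⊕ (λ m d → + 6 ⊗ e₁ m d ⊕ + 12 ⊗ e₂ m d) (λ m d → + 8 ⊗ e₃ m d ⊕ + 2 ⊗ e₄ m d) n)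
                 (cong₂ _⊕_ (D-⊕ (λ m d → + 6 ⊗ e₁ m d) (λ m d → + 12 ⊗ e₂ m d) n) (D-⊕ (λ m d → + 8 ⊗ e₃ m d) (λ m d → + 2 ⊗ e₄ m d) n)) ⟩
    (D (λ m d → + 6 ⊗ e₁ m d) n ⊕ D (λ m d → + 12 ⊗ e₂ m d) n) ⊕ (D (λ m d → + 8 ⊗ e₃ m d) n ⊕ D (λ m d → + 2 ⊗ e₄ m d) n)
      ≡⟨ cong₂ _⊕_ sixes (cong₂ _⊕_ (trans (D-⊗ (+ 8) e₃ n) (cong (+ 8 ⊗_) (ρ₂ˣ n)))
           (trans (D-⊗ (+ 2) e₄ n) (cong (+ 2 ⊗_) (trans (D-cong (λ m d → cong (χ d ⊗_) (is1+is3 m)) n) (ρˣ n))))) ⟩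
    + 6 ⊗ ρ n ⊕ (+ 8 ⊗ dil 2 ρ n ⊕ + 2 ⊗ ρ n)   ≡⟨ total (ρ n) (dil 2 ρ n) ⟩
    + 8 ⊗ ρ n ⊕ + 8 ⊗ dil 2 ρ n ∎
    where
    total : ∀ r s → + 6 ⊗ r ⊕ (+ 8 ⊗ s ⊕ + 2 ⊗ r) ≡ + 8 ⊗ r ⊕ + 8 ⊗ s
    total = solve-∀
    sixes : D (λ m d → + 6 ⊗ e₁ m d) n ⊕ D (λ m d → + 12 ⊗ e₂ m d) n ≡ + 6 ⊗ ρ n
    sixes = trans (cong (_⊕ D (λ m d → + 12 ⊗ e₂ m d) n) (D-swap (λ m d → + 6 ⊗ e₁ m d) n))
      (trans (sym (D-⊕ (λ m d → + 6 ⊗ (χ m ⊗ χ₄ m)) (λ m d → + 12 ⊗ e₂ m d) n))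
        (trans (D-cong (λ m d → trans (six (χ m) (χ₄ m) (is3 m)) (cong (λ u → + 6 ⊗ (χ m ⊗ u)) (χ₄+2is3 m))) n) (D-⊗ (+ 6) (λ m d → χ m ⊗ od m) n)))

⋆-dil-at : ∀ k .{{_ : NonZero k}} s t n → (s ⋆ dil k t) (n * k) ≡ ((λ i → s (i * k)) ⋆ t) n
⋆-dil-at k s t n = begin
  (s ⋆ dil k t) (n * k)                                                     ≡⟨ ⋆-antidiagonal s (dil k t) (n * k) ⟩
  ∑ (antidiagonal (n * k)) term                                             ≡⟨ ∑-split multiple? (antidiagonal (n * k)) term ⟩
  ∑ (filterE multiple? (antidiagonal (n * k))) term ⊕ ∑ (filterE (¬? ∘ multiple?) (antidiagonal (n * k))) term
    ≡⟨ trans (cong (∑ (filterE multiple? (antidiagonal (n * k))) term ⊕_) (∑-0 (filterE (¬? ∘ multiple?) (antidiagonal (n * k)))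
         (λ {(i , j)} (_ , h) → trans (cong (s i ⊗_) (dil-∤ k t j h)) (ℤₚ.*-zeroʳ (s i))))) (ℤₚ.+-identityʳ _) ⟩
  ∑ (filterE multiple? (antidiagonal (n * k))) term
    ≡⟨ ∑-bij (antidiagonal n) (filterE multiple? (antidiagonal (n * k)))
         (λ (i , j) → i * k , j * k) (λ (i , j) → i ℕ./ k , j ℕ./ k)
         (λ { {i , j} refl → sym (ℕₚ.*-distribʳ-+ k i j) , divides j refl })
         (λ { {i , j} (eq , d) → trans (sym (+-distrib-/-∣ʳ i d)) (trans (cong (ℕ._/ k) eq) (m*n/n≡m n k)) })
         (λ { {i , j} _ → cong₂ _,_ (m*n/n≡m i k) (m*n/n≡m j k) })
         (λ { {i , j} (eq , d) → cong₂ _,_ (m/n*n≡m (∣m+n∣m⇒∣n (subst (k ∣_) (trans (sym eq) (ℕₚ.+-comm i j)) (divides n refl)) d)) (m/n*n≡m d) })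
         (λ {(i , j)} _ → cong (s (i * k) ⊗_) (sym (dil-* k t j))) ⟨
  ∑ (antidiagonal n) (λ (i , j) → s (i * k) ⊗ t j)                          ≡⟨ ⋆-antidiagonal (λ i → s (i * k)) t n ⟨
  ((λ i → s (i * k)) ⋆ t) n                                                 ∎
  where
  open ≡-Reasoning
  term : ℕ × ℕ → ℤ
  term (i , j) = s i ⊗ dil k t j
  multiple? : (ij : ℕ × ℕ) → Dec (k ∣ proj₂ ij)
  multiple? (i , j) = k ∣? j

-- `ρ-combination₁` at 7n and `ρ-combination₂` at n, joined by `bd-7`, eliminate all boundary terms.
-- The convolutions with `dil 7 G` at 7n descend to n, because ρ and ρ_2 take the same values at 7i
-- as at i.
ρ-multiple : ∀ n → (ρ ⋆ f) (n * 7) ≡ + 7 ⊗ (ρ ⋆ dil 7 f) n ⊕ + 2 ⊗ ((ρ ⋆ f) n ⊕ + 4 ⊗ (dil 2 ρ ⋆ f) n)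
ρ-multiple n = begin
  (ρ ⋆ f) (n * 7)                      ≡⟨ ⋆-f ρ (n * 7) ⟩
  ρ (n * 7) ⊕ + 4 ⊗ (ρ ⋆ G) (n * 7)    ≡⟨ cong₂ _⊕_ (ρ-7 n) (trans (ρ-combination₁ (n * 7)) (cong₂ _⊕_ (cong₂ (λ u v → + 4 ⊗ u ⊕ + 16 ⊗ v)
                                            (trans (⋆-dil-at 7 ρ G n) (⋆-cong {t = G} ρ-7 refl≈ n)) (trans (⋆-dil-at 7 (dil 2 ρ) G n) (⋆-cong {t = G} dil₂ρ-7 refl≈ n)))
                                            (trans (bd-7 n) (cong ((+ 8 ⊗ ρ n ⊕ + 8 ⊗ dil 2 ρ n) ⊕_) (sym (ρ-combination₂ n)))))) ⟩
  ρ n ⊕ ((+ 4 ⊗ (ρ ⋆ G) n ⊕ + 16 ⊗ (dil 2 ρ ⋆ G) n) ⊕ ((+ 8 ⊗ ρ n ⊕ + 8 ⊗ dil 2 ρ n) ⊕ ((+ 4 ⊗ (ρ ⋆ G) n ⊕ + 16 ⊗ (dil 2 ρ ⋆ G) n) ⊕ + 28 ⊗ (ρ ⋆ dil 7 G) n)))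
    ≡⟨ lemma (ρ n) ((ρ ⋆ G) n) ((dil 2 ρ ⋆ G) n) (dil 2 ρ n) ((ρ ⋆ dil 7 G) n) ⟩
  + 7 ⊗ (ρ n ⊕ + 4 ⊗ (ρ ⋆ dil 7 G) n) ⊕ + 2 ⊗ ((ρ n ⊕ + 4 ⊗ (ρ ⋆ G) n) ⊕ + 4 ⊗ (dil 2 ρ n ⊕ + 4 ⊗ (dil 2 ρ ⋆ G) n))
    ≡⟨ cong₂ (λ u v → + 7 ⊗ u ⊕ + 2 ⊗ v) (⋆-f₇ ρ n) (cong₂ (λ u v → u ⊕ + 4 ⊗ v) (⋆-f ρ n) (⋆-f (dil 2 ρ) n)) ⟨
  + 7 ⊗ (ρ ⋆ dil 7 f) n ⊕ + 2 ⊗ ((ρ ⋆ f) n ⊕ + 4 ⊗ (dil 2 ρ ⋆ f) n) ∎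
  where
  open ≡-Reasoning
  lemma : ∀ r a b s c → r ⊕ ((+ 4 ⊗ a ⊕ + 16 ⊗ b) ⊕ ((+ 8 ⊗ r ⊕ + 8 ⊗ s) ⊕ ((+ 4 ⊗ a ⊕ + 16 ⊗ b) ⊕ + 28 ⊗ c))) ≡
    + 7 ⊗ (r ⊕ + 4 ⊗ c) ⊕ + 2 ⊗ ((r ⊕ + 4 ⊗ a) ⊕ + 4 ⊗ (s ⊕ + 4 ⊗ b))
  lemma = solve-∀

-- Ternary theta series

-- At M ≡ 1 mod 8 the coefficients of R and N are (1,8,8,0,0,0)(M) and (1,14,14,0,0,0)(M) + 2 (2,7,14,0,0,0)(M).
R N : Seq
R = O ⋆ dil 8 f
N = O ⋆ dil 56 f ⊞ (+ 2) · (dil 2 O ⋆ (dil 7 O ⋆ dil 56 φ))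

⋆-swapʳ : ∀ s t u → (s ⋆ t) ⋆ u ≈ (s ⋆ u) ⋆ t
⋆-swapʳ s t u = ≈-trans (⋆-assoc s t u) (≈-trans (⋆-cong refl≈ (⋆-comm t u)) (≈-sym (⋆-assoc s u t)))

f₅₆ : dil 56 f ≈ dil 8 (dil 7 f)
f₅₆ = ≈-sym (dil-dil 8 7 f)

-- R is O φ_8², and O O_7 is π(q⁸), so both remaining factors are series in q⁸.
ΠR : R ⋆ dil 7 O ≈ dil 8 (π ⋆ f)
ΠR = ≈-trans (⋆-swapʳ O (dil 8 f) (dil 7 O)) (≈-trans (⋆-cong Π-π refl≈) (≈-sym (dil-⋆ 8 π f)))

ΠR₇ : dil 49 R ⋆ dil 7 O ≈ dil 56 (π ⋆ dil 7 f)
ΠR₇ = ≈-trans (⋆-cong (≈-sym (dil-dil 7 7 R)) refl≈) (≈-trans (≈-sym (dil-⋆ 7 (dil 7 R) O)) (≈-trans (dil-cong 7 inner) (dil-dil 7 8 (π ⋆ dil 7 f))))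
  where
  inner : dil 7 R ⋆ O ≈ dil 8 (π ⋆ dil 7 f)
  inner = ≈-trans (⋆-cong (≈-trans (dil-⋆ 7 O (dil 8 f)) (⋆-cong refl≈ (≈-trans (dil-dil 7 8 f) f₅₆))) refl≈)
    (≈-trans (⋆-swapʳ (dil 7 O) (dil 8 (dil 7 f)) O) (≈-trans (⋆-cong (≈-trans (⋆-comm (dil 7 O) O) Π-π) refl≈) (≈-sym (dil-⋆ 8 π (dil 7 f)))))

-- In the second summand O_7² = 2 O_14 φ_56, which completes O_2 to O_2 O_14 = π_2(q⁸) and φ_56 to
-- φ_56². The factor 4 is this 2 times the 2 in `N`.
ΠN : N ⋆ dil 7 O ≈ dil 8 ((π ⊞ (+ 4) · dil 2 π) ⋆ dil 7 f)
ΠN = ≈-trans (⋆-distribʳ A′ ((+ 2) · B′) (dil 7 O)) (≈-trans (⊞-cong first second)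
  (≈-trans (≈-sym (dil-⊞ 8 (π ⋆ dil 7 f) ((+ 4) · (dil 2 π ⋆ dil 7 f)))) (dil-cong 8 gather)))
  where
  A′ B′ : Seq
  A′ = O ⋆ dil 56 f
  B′ = dil 2 O ⋆ (dil 7 O ⋆ dil 56 φ)
  gather : π ⋆ dil 7 f ⊞ (+ 4) · (dil 2 π ⋆ dil 7 f) ≈ (π ⊞ (+ 4) · dil 2 π) ⋆ dil 7 f
  gather n = sym (trans (⋆-distribʳ π ((+ 4) · dil 2 π) (dil 7 f) n) (cong ((π ⋆ dil 7 f) n ⊕_) (⋆-·ˡ (+ 4) (dil 2 π) (dil 7 f) n)))
  first : A′ ⋆ dil 7 O ≈ dil 8 (π ⋆ dil 7 f)
  first = ≈-trans (⋆-swapʳ O (dil 56 f) (dil 7 O)) (≈-trans (⋆-cong Π-π f₅₆) (≈-sym (dil-⋆ 8 π (dil 7 f))))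
  Π₂π : dil 2 Π ≈ dil 8 (dil 2 π)
  Π₂π = ≈-trans (dil-cong 2 Π-π) (dil-comm 2 8 π)
  B′O : B′ ⋆ dil 7 O ≈ (+ 2) · dil 8 (dil 2 π ⋆ dil 7 f)
  B′O = ≈-trans (⋆-assoc (dil 2 O) (dil 7 O ⋆ dil 56 φ) (dil 7 O)) (≈-trans (⋆-cong refl≈ (≈-trans (⋆-swapʳ (dil 7 O) (dil 56 φ) (dil 7 O))
    (≈-trans (⋆-cong O₇² refl≈) (⋆-·ˡ (+ 2) (dil 14 O ⋆ dil 56 φ) (dil 56 φ))))) (≈-trans (⋆-·ʳ (+ 2) (dil 2 O) ((dil 14 O ⋆ dil 56 φ) ⋆ dil 56 φ))
    (·-cong (+ 2) (≈-trans (⋆-cong refl≈ (⋆-assoc (dil 14 O) (dil 56 φ) (dil 56 φ))) (≈-trans (≈-sym (⋆-assoc (dil 2 O) (dil 14 O) (dil 56 φ ⋆ dil 56 φ)))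
      (≈-trans (⋆-cong (≈-trans (≈-sym Π₂) Π₂π) (≈-trans (≈-sym (dil-⋆ 56 φ φ)) f₅₆)) (≈-sym (dil-⋆ 8 (dil 2 π) (dil 7 f)))))))))
  second : ((+ 2) · B′) ⋆ dil 7 O ≈ dil 8 ((+ 4) · (dil 2 π ⋆ dil 7 f))
  second n = trans (⋆-·ˡ (+ 2) B′ (dil 7 O) n) (trans (cong (+ 2 ⊗_) (B′O n))
    (trans (sym (ℤₚ.*-assoc (+ 2) (+ 2) _)) (sym (dil-· 8 (+ 4) (dil 2 π ⋆ dil 7 f) n))))

⋆-lowest-lowest : ∀ k s t n → (∀ i → i < n → s i ≡ + 0) → (∀ j → j < k → t j ≡ + 0) → (s ⋆ t) (k + n) ≡ s n ⊗ t k
⋆-lowest-lowest zero    s t n hs ht = ⋆-lowest s t n hs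
⋆-lowest-lowest (suc k) s t n hs ht = trans (⋆-sucʳ s t (k + n))
  (trans (cong (λ u → s (suc (k + n)) ⊗ u ⊕ (s ⋆ (t ∘ suc)) (k + n)) (ht 0 (s≤s z≤n)))
    (trans (cong (_⊕ (s ⋆ (t ∘ suc)) (k + n)) (ℤₚ.*-zeroʳ (s (suc (k + n))))) (trans (ℤₚ.+-identityˡ _)
      (⋆-lowest-lowest k s (t ∘ suc) n hs (λ j j<k → ht (suc j) (s≤s j<k))))))

supp-O₇ : Supp 56 7 (dil 7 O)
supp-O₇ n h with 7 ∣? n
... | no  _                = refl
... | yes (divides q refl) = supp-O₁ 8 8∣8 q (λ e → h (trans (cong (λ m → (m * 7) % 56) (m≡m%n+[m/n]*n q 8))
  (trans (cong (λ r → ((r + q ℕ./ 8 * 8) * 7) % 56) e) (trans (cong (_% 56) (regroup (q ℕ./ 8))) ([m+kn]%n≡m%n 7 (q ℕ./ 8) 56)))))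
  where
  regroup : ∀ k → (1 + k * 8) * 7 ≡ 7 + k * 56
  regroup = ℕ-solve

-- The lowest term of dil 7 O is 2 q⁷, and all its exponents are ≡ 7 mod 56.
descend : ∀ c δ → (∀ M → M % 56 ≡ c → (δ ⋆ dil 7 O) (7 + M) ≡ + 0) → ∀ M → M % 56 ≡ c → δ M ≡ + 0
descend c δ h = strong-induction (λ M → M % 56 ≡ c → δ M ≡ + 0) step
  where
  -- `δ` may be nonzero on other classes, so the lowest-term argument is applied to its restriction
  -- to the class c. As the exponents of `dil 7 O` are 7 modulo 56, this does not change the
  -- coefficient of the product at 7 + M.
  masked : Seq
  masked n with n % 56 ℕ.≟ c
  ... | yes _ = δ n
  ... | no  _ = + 0
  masked-in : ∀ n → n % 56 ≡ c → masked n ≡ δ n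
  masked-in n e with n % 56 ℕ.≟ c
  ... | yes _ = refl
  ... | no  ¬e = contradiction e ¬e
  small : ∀ j → j < 7 → dil 7 O j ≡ + 0
  small j j<7 = supp-O₇ j (λ e → ℕₚ.<-irrefl (trans (sym (m<n⇒m%n≡m (ℕₚ.≤-trans j<7 (ℕₚ.m≤m+n 7 49)))) e) j<7)
  step : ∀ M → (∀ i → i < M → i % 56 ≡ c → δ i ≡ + 0) → M % 56 ≡ c → δ M ≡ + 0
  step M ih e = cancel-factor (+ 2) (begin
    δ M ⊗ + 2                                   ≡⟨ cong (_⊗ + 2) (masked-in M e) ⟨
    masked M ⊗ dil 7 O 7                        ≡⟨ ⋆-lowest-lowest 7 masked (dil 7 O) M below-M small ⟨
    (masked ⋆ dil 7 O) (7 + M)                  ≡⟨ ⋆-antidiagonal masked (dil 7 O) (7 + M) ⟩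
    ∑ (antidiagonal (7 + M)) (λ (i , j) → masked i ⊗ dil 7 O j)   ≡⟨ ∑-cong (antidiagonal (7 + M)) (λ {(i , j)} eq → term i j eq) ⟩
    ∑ (antidiagonal (7 + M)) (λ (i , j) → δ i ⊗ dil 7 O j)        ≡⟨ ⋆-antidiagonal δ (dil 7 O) (7 + M) ⟨
    (δ ⋆ dil 7 O) (7 + M)                       ≡⟨ h M e ⟩
    + 0                                         ∎)
    where
    open ≡-Reasoning
    below-M : ∀ i → i < M → masked i ≡ + 0
    below-M i i<M with i % 56 ℕ.≟ c
    ... | yes e′ = ih i i<M e′
    ... | no  _  = refl
    term : ∀ i j → i + j ≡ 7 + M → masked i ⊗ dil 7 O j ≡ δ i ⊗ dil 7 O j
    term i j eq with j % 56 ℕ.≟ 7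
    ... | no ≢7 = trans (cong (masked i ⊗_) (supp-O₇ j ≢7)) (trans (ℤₚ.*-zeroʳ (masked i)) (sym (trans (cong (δ i ⊗_) (supp-O₇ j ≢7)) (ℤₚ.*-zeroʳ (δ i)))))
    ... | yes j7 = cong (_⊗ dil 7 O j) (masked-in i class)
      where
      class : i % 56 ≡ c
      class = begin
        i % 56                                     ≡⟨ [m+kn]%n≡m%n i 1 56 ⟨
        (i + 56) % 56                              ≡⟨ cong (_% 56) (ℕₚ.+-assoc i 7 49) ⟨
        (i + 7 + 49) % 56                          ≡⟨ %-distribˡ-+ (i + 7) 49 56 ⟩
        ((i + 7) % 56 + 49) % 56                   ≡⟨ cong (λ u → (u + 49) % 56) (trans (%-distribˡ-+ i 7 56) (trans (cong (λ u → (i % 56 + u) % 56) (sym j7)) (trans (sym (%-distribˡ-+ i j 56)) (cong (_% 56) eq)))) ⟩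
        ((7 + M) % 56 + 49) % 56                   ≡⟨ %-distribˡ-+ (7 + M) 49 56 ⟨
        (7 + M + 49) % 56                          ≡⟨ cong (_% 56) (rotate M) ⟩
        (M + 1 * 56) % 56                          ≡⟨ [m+kn]%n≡m%n M 1 56 ⟩
        M % 56                                     ≡⟨ e ⟩
        c                                          ∎
        where
        rotate : ∀ M → 7 + M + 49 ≡ M + 1 * 56
        rotate = ℕ-solve

π-series : ∀ s n → (π ⋆ s) n ≡ + 4 ⊗ (ρ ⋆ s) n
π-series s n = trans (⋆-cong π≈π̃ refl≈ n) (⋆-·ˡ (+ 4) ρ s n)

π₂-series : ∀ s n → ((π ⊞ (+ 4) · dil 2 π) ⋆ s) n ≡ + 4 ⊗ ((ρ ⋆ s) n ⊕ + 4 ⊗ (dil 2 ρ ⋆ s) n)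
π₂-series s n = begin
  ((π ⊞ (+ 4) · dil 2 π) ⋆ s) n           ≡⟨ ⋆-distribʳ π ((+ 4) · dil 2 π) s n ⟩
  (π ⋆ s) n ⊕ (((+ 4) · dil 2 π) ⋆ s) n   ≡⟨ cong₂ _⊕_ (π-series s n) (trans (⋆-·ˡ (+ 4) (dil 2 π) s n) (cong (+ 4 ⊗_)
                                              (trans (⋆-cong (≈-trans (dil-cong 2 π≈π̃) (dil-· 2 (+ 4) ρ)) refl≈ n) (⋆-·ˡ (+ 4) (dil 2 ρ) s n)))) ⟩
  + 4 ⊗ (ρ ⋆ s) n ⊕ + 4 ⊗ (+ 4 ⊗ (dil 2 ρ ⋆ s) n)   ≡⟨ ℤₚ.*-distribˡ-+ (+ 4) ((ρ ⋆ s) n) _ ⟨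
  + 4 ⊗ ((ρ ⋆ s) n ⊕ + 4 ⊗ (dil 2 ρ ⋆ s) n) ∎
  where open ≡-Reasoning

7+M : ∀ M → M % 8 ≡ 1 → 7 + M ≡ suc (M ℕ./ 8) * 8
7+M M e = trans (cong (λ m → 7 + m) (trans (m≡m%n+[m/n]*n M 8) (cong (_+ M ℕ./ 8 * 8) e))) (sym (ℕₚ.+-assoc 7 1 (M ℕ./ 8 * 8)))

mod-56 : ∀ M M₀ m .{{_ : NonZero m}} → m ∣ 56 → M % 56 ≡ M₀ % 56 → M % m ≡ M₀ % m
mod-56 M M₀ m d e = trans (sym (m∣n⇒o%n%m≡o%m m 56 M d)) (trans (cong (_% m) e) (m∣n⇒o%n%m≡o%m m 56 M₀ d))

8∣56 : 8 ∣ 56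
8∣56 = divides 7 refl
7∣56 : 7 ∣ 56
7∣56 = divides 8 refl

-- After multiplication by O_7 the relevant exponent is 7 + M = 8n, and χ(n) = χ(8n) = χ(M), so
-- `ρ-residue` applies at n throughout the class of M modulo 56.
R-residue : ∀ M → M % 8 ≡ 1 → IsResidue M → R M ≡ N M
R-residue M₀ e₀ res₀ = ⊟-0 R N M₀ (descend (M₀ % 56) (R ⊟ N) zero-class M₀ refl)
  where
  open ≡-Reasoning
  zero-class : ∀ M → M % 56 ≡ M₀ % 56 → ((R ⊟ N) ⋆ dil 7 O) (7 + M) ≡ + 0
  zero-class M e = trans (⋆-⊟ˡ R N (dil 7 O) (7 + M)) (⊟-≡ (R ⋆ dil 7 O) (N ⋆ dil 7 O) (7 + M) (begin
    (R ⋆ dil 7 O) (7 + M)                   ≡⟨ trans (ΠR (7 + M)) (trans (cong (dil 8 (π ⋆ f)) 7+M≡) (dil-* 8 (π ⋆ f) n)) ⟩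
    (π ⋆ f) n                               ≡⟨ trans (π-series f n) (cong (+ 4 ⊗_) (ρ-residue n res)) ⟩
    + 4 ⊗ ((ρ ⋆ dil 7 f) n ⊕ + 4 ⊗ (dil 2 ρ ⋆ dil 7 f) n)   ≡⟨ π₂-series (dil 7 f) n ⟨
    ((π ⊞ (+ 4) · dil 2 π) ⋆ dil 7 f) n     ≡⟨ trans (ΠN (7 + M)) (trans (cong (dil 8 _) 7+M≡) (dil-* 8 _ n)) ⟨
    (N ⋆ dil 7 O) (7 + M)                   ∎))
    where
    n : ℕ
    n = suc (M ℕ./ 8)
    7+M≡ : 7 + M ≡ n * 8
    7+M≡ = 7+M M (trans (mod-56 M M₀ 8 8∣56 e) e₀)
    res : IsResidue n
    res = begin
      χ n             ≡⟨ ℤₚ.*-identityʳ (χ n) ⟨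
      χ n ⊗ χ 8       ≡⟨ χ-product n 8 ⟨
      χ (n * 8)       ≡⟨ cong χ 7+M≡ ⟨
      χ (7 + M)       ≡⟨ cong (λ m → legendre₇ (m % 7)) (ℕₚ.+-comm 7 M) ⟩
      χ (M + 1 * 7)   ≡⟨ cong legendre₇ (trans ([m+kn]%n≡m%n M 1 7) (mod-56 M M₀ 7 7∣56 e)) ⟩
      χ M₀            ≡⟨ res₀ ⟩
      + 1             ∎

-- Here 7 + M = 8n with 7 ∣ n, and at n = 7m the identity `ρ-multiple` applies. The product of R_49
-- and O_7 is a series in q⁵⁶ and is therefore read at m.
R-multiple : ∀ M → M % 8 ≡ 1 → 7 ∣ M → R M ≡ + 7 ⊗ dil 49 R M ⊕ + 2 ⊗ N M
R-multiple M₀ e₀ 7∣M₀ = ⊟-0 R T M₀ (descend (M₀ % 56) (R ⊟ T) zero-class M₀ refl)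
  where
  open ≡-Reasoning
  T : Seq
  T = (+ 7) · dil 49 R ⊞ (+ 2) · N
  zero-class : ∀ M → M % 56 ≡ M₀ % 56 → ((R ⊟ T) ⋆ dil 7 O) (7 + M) ≡ + 0
  zero-class M e = trans (⋆-⊟ˡ R T (dil 7 O) (7 + M)) (⊟-≡ (R ⋆ dil 7 O) (T ⋆ dil 7 O) (7 + M) (value n 7+M≡ 7∣n))
    where
    n : ℕ
    n = suc (M ℕ./ 8)
    7+M≡ : 7 + M ≡ n * 8
    7+M≡ = 7+M M (trans (mod-56 M M₀ 8 8∣56 e) e₀)
    7∣n : 7 ∣ n
    7∣n = ∣m+n∣m⇒∣n {m = n * 7} (subst (7 ∣_) (trans 7+M≡ (split n)) (∣m∣n⇒∣m+n n∣n (m%n≡0⇒n∣m M 7 (trans (mod-56 M M₀ 7 7∣56 e) (n∣m⇒m%n≡0 M₀ 7 7∣M₀))))) (divides n refl)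
      where
      split : ∀ n → n * 8 ≡ n * 7 + n
      split = ℕ-solve
    value : ∀ n → 7 + M ≡ n * 8 → 7 ∣ n → (R ⋆ dil 7 O) (7 + M) ≡ (T ⋆ dil 7 O) (7 + M)
    value .(m * 7) eq (divides m refl) = begin
      (R ⋆ dil 7 O) (7 + M)
        ≡⟨ trans (ΠR (7 + M)) (trans (cong (dil 8 (π ⋆ f)) eq) (dil-* 8 (π ⋆ f) (m * 7))) ⟩
      (π ⋆ f) (m * 7)
        ≡⟨ trans (π-series f (m * 7)) (trans (cong (+ 4 ⊗_) (ρ-multiple m)) (distribute ((ρ ⋆ dil 7 f) m) ((ρ ⋆ f) m ⊕ + 4 ⊗ (dil 2 ρ ⋆ f) m))) ⟩
      + 7 ⊗ (+ 4 ⊗ (ρ ⋆ dil 7 f) m) ⊕ + 2 ⊗ (+ 4 ⊗ ((ρ ⋆ f) m ⊕ + 4 ⊗ (dil 2 ρ ⋆ f) m))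
        ≡⟨ cong₂ (λ u v → + 7 ⊗ u ⊕ + 2 ⊗ v) R̂ N̂ ⟨
      + 7 ⊗ (dil 49 R ⋆ dil 7 O) (7 + M) ⊕ + 2 ⊗ (N ⋆ dil 7 O) (7 + M)
        ≡⟨ trans (⋆-distribʳ ((+ 7) · dil 49 R) ((+ 2) · N) (dil 7 O) (7 + M)) (cong₂ _⊕_ (⋆-·ˡ (+ 7) (dil 49 R) (dil 7 O) (7 + M)) (⋆-·ˡ (+ 2) N (dil 7 O) (7 + M))) ⟨
      (T ⋆ dil 7 O) (7 + M) ∎
      where
      distribute : ∀ u v → + 4 ⊗ (+ 7 ⊗ u ⊕ + 2 ⊗ v) ≡ + 7 ⊗ (+ 4 ⊗ u) ⊕ + 2 ⊗ (+ 4 ⊗ v)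
      distribute = solve-∀
      R̂ : (dil 49 R ⋆ dil 7 O) (7 + M) ≡ + 4 ⊗ (ρ ⋆ dil 7 f) m
      R̂ = trans (ΠR₇ (7 + M)) (trans (cong (dil 56 (π ⋆ dil 7 f)) (trans eq (ℕₚ.*-assoc m 7 8))) (trans (dil-* 56 (π ⋆ dil 7 f) m) (π-series (dil 7 f) m)))
      N̂ : (N ⋆ dil 7 O) (7 + M) ≡ + 4 ⊗ ((ρ ⋆ f) m ⊕ + 4 ⊗ (dil 2 ρ ⋆ f) m)
      N̂ = begin
        (N ⋆ dil 7 O) (7 + M)                                   ≡⟨ trans (ΠN (7 + M)) (trans (cong (dil 8 _) eq) (dil-* 8 _ (m * 7))) ⟩
        ((π ⊞ (+ 4) · dil 2 π) ⋆ dil 7 f) (m * 7)               ≡⟨ π₂-series (dil 7 f) (m * 7) ⟩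
        + 4 ⊗ ((ρ ⋆ dil 7 f) (m * 7) ⊕ + 4 ⊗ (dil 2 ρ ⋆ dil 7 f) (m * 7))
          ≡⟨ cong₂ (λ u v → + 4 ⊗ (u ⊕ + 4 ⊗ v)) (trans (⋆-dil-at 7 ρ f m) (⋆-cong ρ-7 refl≈ m)) (trans (⋆-dil-at 7 (dil 2 ρ) f m) (⋆-cong dil₂ρ-7 refl≈ m)) ⟩
        + 4 ⊗ ((ρ ⋆ f) m ⊕ + 4 ⊗ (dil 2 ρ ⋆ f) m) ∎

-- Diagonal ternary forms

T : (a b c : ℕ) .{{_ : NonZero a}} .{{_ : NonZero b}} .{{_ : NonZero c}} → Seq
T a b c = dil a φ ⋆ (dil b φ ⋆ dil c φ)

weight : ℕ → ℕ → ℕ → Triple → ℕ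
weight a b c (x , y , z) = sq x * a + (sq y * b + sq z * c)

diagE : ∀ a b c .{{_ : NonZero a}} .{{_ : NonZero b}} .{{_ : NonZero c}} n → Enum (λ v → weight a b c v ≡ n)
diagE a b c = pairE (φE a) (φφE b c)

diagE-count : ∀ a b c .{{_ : NonZero a}} .{{_ : NonZero b}} .{{_ : NonZero c}} n → count (diagE a b c n) ≡ T a b c n
diagE-count a b c n = trans (⋆-∑ (φE a) (φφE b c) (diagE a b c n) (λ _ → + 1) (λ _ → + 1)) (⋆-cong (φE-count a) (φφE-count b c) n)

form-weight : ∀ a b c v → form (+ a) (+ b) (+ c) (+ 0) (+ 0) (+ 0) v ≡ + weight a b c v
form-weight a b c (x , y , z) = begin
  form (+ a) (+ b) (+ c) (+ 0) (+ 0) (+ 0) (x , y , z)      ≡⟨ lemma (+ a) (+ b) (+ c) x y z ⟩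
  x ⊗ x ⊗ + a ⊕ (y ⊗ y ⊗ + b ⊕ z ⊗ z ⊗ + c)                 ≡⟨ cong₂ _⊕_ (trans (ℤₚ.pos-* (sq x) a) (cong (_⊗ + a) (+-sq x))) (+-+* b y c z) ⟨
  + (sq x * a) ⊕ + (sq y * b + sq z * c)                    ≡⟨ ℤₚ.pos-+ (sq x * a) (sq y * b + sq z * c) ⟨
  + weight a b c (x , y , z)                                ∎
  where
  open ≡-Reasoning
  lemma : ∀ a b c x y z → a ⊗ x ⊗ x ⊕ b ⊗ y ⊗ y ⊕ c ⊗ z ⊗ z ⊕ + 0 ⊗ y ⊗ z ⊕ + 0 ⊗ z ⊗ x ⊕ + 0 ⊗ x ⊗ y ≡ x ⊗ x ⊗ a ⊕ (y ⊗ y ⊗ b ⊕ z ⊗ z ⊗ c)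
  lemma = solve-∀

cardE : {P : Triple → Set} {n : ℕ} → HasCard P n → Enum P
cardE (xs , u , iff , _) = enum xs u (λ {v} → Equivalence.to (iff v)) (λ {v} → Equivalence.from (iff v))

cardE-count : {P : Triple → Set} {n : ℕ} (h : HasCard P n) → count (cardE h) ≡ + n
cardE-count (xs , _ , _ , len) = trans (ones-length xs) (cong +_ len)
  where
  ones-length : (xs : List Triple) → sumOver xs (λ _ → + 1) ≡ + length xs
  ones-length []       = refl
  ones-length (_ ∷ xs) = cong (+ 1 ⊕_) (ones-length xs)

fraction≡ : ∀ M d .{{_ : NonZero d}} k → (+ M) / d ≡ toℚ k → + M ≡ k ⊗ + d
fraction≡ M (suc d) k eq with /-injective-≃ (mkℚᵘ (+ M) d) (mkℚᵘ k 0) eq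
... | *≡* e = trans (sym (ℤₚ.*-identityʳ (+ M))) e

≡fraction : ∀ M d .{{_ : NonZero d}} k → + M ≡ k ⊗ + d → (+ M) / d ≡ toℚ k
≡fraction M (suc d) k eq = fromℚᵘ-cong {mkℚᵘ (+ M) d} {mkℚᵘ k 0} (*≡* (trans (ℤₚ.*-identityʳ (+ M)) eq))

weight-* : ∀ a b c d v → weight a b c v * d ≡ weight (a * d) (b * d) (c * d) v
weight-* a b c d (x , y , z) = lemma (sq x) (sq y) (sq z) a b c d
  where
  lemma : ∀ x y z a b c d → (x * a + (y * b + z * c)) * d ≡ x * (a * d) + (y * (b * d) + z * (c * d))
  lemma = ℕ-solve

-- A form takes the value M/d where d times the form takes the value M. This treats integral and
-- fractional M/d alike.
diagonal-rep : ∀ a b c d .{{_ : NonZero d}} .{{_ : NonZero (a * d)}} .{{_ : NonZero (b * d)}} .{{_ : NonZero (c * d)}} M n →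
  Rep (+ a) (+ b) (+ c) (+ 0) (+ 0) (+ 0) ((+ M) / d) n → + n ≡ T (a * d) (b * d) (c * d) M
diagonal-rep a b c d M n h = trans (sym (cardE-count h)) (trans
  (∑-same (cardE h) (diagE (a * d) (b * d) (c * d) M)
    (λ {v} eq → ℤₚ.+-injective (trans (sym (scaled v)) (sym (fraction≡ M d (form (+ a) (+ b) (+ c) (+ 0) (+ 0) (+ 0) v) eq))))
    (λ {v} eq → ≡fraction M d (form (+ a) (+ b) (+ c) (+ 0) (+ 0) (+ 0) v) (trans (cong +_ (sym eq)) (sym (scaled v))))
    (λ _ → refl))
  (diagE-count (a * d) (b * d) (c * d) M))
  where
  scaled : ∀ v → form (+ a) (+ b) (+ c) (+ 0) (+ 0) (+ 0) v ⊗ + d ≡ + weight (a * d) (b * d) (c * d) v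
  scaled v = trans (cong (_⊗ + d) (form-weight a b c v)) (trans (sym (ℤₚ.pos-* (weight a b c v) d)) (cong +_ (weight-* a b c d v)))

dil-φ-split : ∀ k → dil k φ ≈ dil k (dil 4 φ) ⊞ dil k O
dil-φ-split k = ≈-trans (dil-cong k φ-split) (dil-⊞ k (dil 4 φ) O)

dil-4-φ : ∀ k .{{_ : NonZero k}} → dil k (dil 4 φ) ≈ dil (4 * k) φ
dil-4-φ k = ≈-trans (dil-comm k 4 φ) (dil-dil 4 k φ)

module _ (M : ℕ) (M≡1 : M % 8 ≡ 1) where

  private
    odd-M : M % 2 ≢ 0
    odd-M e with trans (sym e) (trans (sym (m∣n⇒o%n%m≡o%m 2 8 M (divides 4 refl))) (cong (_% 2) M≡1))
    ... | ()
    2∣_ : ∀ k → 2 ∣ k * 2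
    2∣ k = divides k refl
    split₁₄ : dil 14 φ ≈ dil 56 φ ⊞ dil 14 O
    split₁₄ = ≈-trans (dil-φ-split 14) (⊞-cong (dil-4-φ 14) refl≈)
    s₁ : Supp 8 1 O
    s₁ = supp-O₁ 8 8∣8
    s₅₆ : Supp 8 0 (dil 56 φ)
    s₅₆ = supp-dil 8 56 φ (divides 7 refl)
    s₁₄ : Supp 8 6 (dil 14 O)
    s₁₄ = supp-O 8 14 8∣8
    off : ∀ {s t r r′} → Supp 8 r s → Supp 8 r′ t → (r + r′) % 8 ≢ 1 → (s ⋆ t) M ≡ + 0
    off hs ht h = supp-⋆ 8 hs ht M (λ e → h (trans (sym e) M≡1))
    drop : ∀ {u v w : ℤ} → u ≡ + 0 → v ≡ w → u ⊕ v ≡ w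
    drop refl e = trans (ℤₚ.+-identityˡ _) e
    keep : ∀ {u v w : ℤ} → u ≡ w → v ≡ + 0 → u ⊕ v ≡ w
    keep e refl = trans (ℤₚ.+-identityʳ _) e

  T-1-8-8 : T 1 8 8 M ≡ R M
  T-1-8-8 = trans (⋆-cong (≈-trans (dil-1 φ) φ-split) (≈-sym (dil-⋆ 8 φ φ)) M) (trans (⋆-distribʳ (dil 4 φ) O (dil 8 f) M)
    (drop (supp-⋆ 2 (supp-dil 2 4 φ (2∣ 2)) (supp-dil 2 8 f (2∣ 4)) M odd-M) refl))

  -- As M is odd, so is x. One odd variable with coefficient 14 would make the value 7 modulo 8, and
  -- two would make it 5; hence both are even.
  T-1-14-14 : T 1 14 14 M ≡ (O ⋆ dil 56 f) M
  T-1-14-14 = trans (⋆-cong (≈-trans (dil-1 φ) φ-split) refl≈ M) (trans (⋆-distribʳ (dil 4 φ) O φ₁₄² M)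
    (drop (supp-⋆ 2 (supp-dil 2 4 φ (2∣ 2)) (supp-⋆ 2 (supp-dil 2 14 φ (2∣ 7)) (supp-dil 2 14 φ (2∣ 7))) M odd-M)
      (trans (⋆-cong (refl≈ {O}) (≈-trans (⋆-cong split₁₄ split₁₄) (⋆-expand (dil 56 φ) (dil 14 O) (dil 56 φ) (dil 14 O))) M)
        (trans (⋆-distribˡ O (dil 56 φ ⋆ dil 56 φ ⊞ dil 56 φ ⋆ dil 14 O) (dil 14 O ⋆ dil 56 φ ⊞ dil 14 O ⋆ dil 14 O) M)
          (keep (trans (⋆-distribˡ O (dil 56 φ ⋆ dil 56 φ) (dil 56 φ ⋆ dil 14 O) M)
                  (keep (⋆-cong (refl≈ {O}) (≈-sym (dil-⋆ 56 φ φ)) M) (off s₁ (supp-⋆ 8 s₅₆ s₁₄) (λ ()))))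
                (trans (⋆-distribˡ O (dil 14 O ⋆ dil 56 φ) (dil 14 O ⋆ dil 14 O) M)
                  (keep (off s₁ (supp-⋆ 8 s₁₄ s₅₆) (λ ())) (off s₁ (supp-⋆ 8 s₁₄ s₁₄) (λ ())))))))))
    where
    φ₁₄² : Seq
    φ₁₄² = dil 14 φ ⋆ dil 14 φ

  -- As M is odd, so is y, contributing 7 modulo 8. To reach 1, x must be odd, contributing 2, and z
  -- even; an odd z would contribute 6.
  T-2-7-14 : T 2 7 14 M ≡ (dil 2 O ⋆ (dil 7 O ⋆ dil 56 φ)) M
  T-2-7-14 = trans (⋆-cong (refl≈ {dil 2 φ}) (≈-trans (⋆-cong split₇ refl≈) (⋆-distribʳ (dil 28 φ) (dil 7 O) (dil 14 φ))) M)
    (trans (⋆-distribˡ (dil 2 φ) (dil 28 φ ⋆ dil 14 φ) (dil 7 O ⋆ dil 14 φ) M)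
      (drop (supp-⋆ 2 (supp-dil 2 2 φ (2∣ 1)) (supp-⋆ 2 (supp-dil 2 28 φ (2∣ 14)) (supp-dil 2 14 φ (2∣ 7))) M odd-M)
        (trans (⋆-cong split₂ (≈-trans (⋆-cong refl≈ split₁₄) (⋆-distribˡ (dil 7 O) (dil 56 φ) (dil 14 O))) M)
          (trans (⋆-expand (dil 8 φ) (dil 2 O) (dil 7 O ⋆ dil 56 φ) (dil 7 O ⋆ dil 14 O) M)
            (drop (keep (off s₈ (supp-⋆ 8 s₇ s₅₆) (λ ())) (off s₈ (supp-⋆ 8 s₇ s₁₄) (λ ())))
                  (keep refl (off s₂ (supp-⋆ 8 s₇ s₁₄) (λ ()))))))))
    where
    split₂ : dil 2 φ ≈ dil 8 φ ⊞ dil 2 O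
    split₂ = ≈-trans (dil-φ-split 2) (⊞-cong (dil-4-φ 2) refl≈)
    split₇ : dil 7 φ ≈ dil 28 φ ⊞ dil 7 O
    split₇ = ≈-trans (dil-φ-split 7) (⊞-cong (dil-4-φ 7) refl≈)
    s₂ : Supp 8 2 (dil 2 O)
    s₂ = supp-O 8 2 8∣8
    s₇ : Supp 8 7 (dil 7 O)
    s₇ = supp-O 8 7 8∣8
    s₈ : Supp 8 0 (dil 8 φ)
    s₈ = supp-dil 8 8 φ 8∣8

T-49 : ∀ M → M % 8 ≡ 1 → T 49 392 392 M ≡ dil 49 R M
T-49 M e = trans (⋆-cong (dil-cong 49 (≈-sym (dil-1 φ))) (≈-trans (⋆-cong φ₃₉₂ φ₃₉₂) (≈-sym (dil-⋆ 49 (dil 8 φ) (dil 8 φ)))) M)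
  (trans (sym (dil-⋆ 49 (dil 1 φ) (dil 8 φ ⋆ dil 8 φ) M)) at-M)
  where
  φ₃₉₂ : dil 392 φ ≈ dil 49 (dil 8 φ)
  φ₃₉₂ = ≈-sym (dil-dil 49 8 φ)
  at-M : dil 49 (T 1 8 8) M ≡ dil 49 R M
  at-M with 49 ∣? M
  ... | no _ = refl
  -- Since 49 = 1 + 6 · 8, the quotient M/49 is again 1 modulo 8.
  ... | yes (divides q eq) = T-1-8-8 q (trans (sym ([m+kn]%n≡m%n q (6 * q) 8)) (trans (cong (_% 8) (sym (trans eq (regroup q)))) e))
    where
    regroup : ∀ q → q * 49 ≡ q + 6 * q * 8
    regroup = ℕ-solve

-- Nonresidues modulo 7

NonResidue : ℕ → Set
NonResidue n = χ n ≡ ℤ.-1ℤ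

off-nonresidues : ∀ {s t} → (∀ n → NonResidue n → s n ≡ + 0) → Supp 7 0 t → ∀ n → NonResidue n → (s ⋆ t) n ≡ + 0
off-nonresidues {s} {t} hs ht n h = trans (⋆-antidiagonal s t n) (∑-0 (antidiagonal n) (λ {(i , j)} eq → term i j eq))
  where
  term : ∀ i j → i + j ≡ n → s i ⊗ t j ≡ + 0
  term i j eq with j % 7 ℕ.≟ 0
  ... | no ≢0 = trans (cong (s i ⊗_) (ht j ≢0)) (ℤₚ.*-zeroʳ (s i))
  ... | yes j≡0 with m%n≡0⇒n∣m j 7 j≡0
  ...   | divides q refl = cong (_⊗ t (q * 7)) (hs i (trans (cong legendre₇ (trans (sym ([m+kn]%n≡m%n i q 7)) (cong (_% 7) eq))) h))

O-nonresidue : ∀ n → NonResidue n → O n ≡ + 0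
O-nonresidue n h = ∑-0 (oddE n) (λ {k} eq → contradiction (trans (sym (trans (cong χ eq) h)) (χ-product ℤ.∣ odd k ∣ ℤ.∣ odd k ∣)) (not-square ℤ.∣ odd k ∣))
  where
  ind : ℤ → ℤ
  ind u = if equal? ℤ.-1ℤ u then + 1 else + 0
  not-square : ∀ j → ℤ.-1ℤ ≢ χ j ⊗ χ j
  not-square j e with trans (cong ind (trans e (cong (λ u → u ⊗ u) (sym (χ-mod 7 n∣n j))))) (check₁-sound 7 (λ j → ind (χ j ⊗ χ j)) (λ _ → + 0) refl (j % 7) (m%n<n j 7))
  ... | ()

dil₂O-nonresidue : ∀ n → NonResidue n → dil 2 O n ≡ + 0
dil₂O-nonresidue n h with 2 ∣? n
... | no _ = refl
... | yes (divides q refl) = O-nonresidue q (trans (sym (χ-2* q)) h)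

-- Modulo 7 each of the two forms reduces to x² or 2x², and 2 is a square modulo 7.
N-nonresidue : ∀ n → NonResidue n → N n ≡ + 0
N-nonresidue n h = cong₂ _⊕_ (off-nonresidues {t = dil 56 f} O-nonresidue (supp-dil 7 56 f (divides 8 refl)) n h)
  (cong (+ 2 ⊗_) (off-nonresidues {t = dil 7 O ⋆ dil 56 φ} dil₂O-nonresidue (supp-⋆ 7 (supp-dil 7 7 O n∣n) (supp-dil 7 56 φ (divides 8 refl))) n h))

-- Residues of integers

infix 4 _≡_[_]

record _≡_[_] (x y : ℤ) (m : ℕ) : Set where
  constructor congruent
  field
    quotient   : ℤ
    difference : x ≡ y ⊕ quotient ⊗ + m

mod-refl : ∀ {m x} → x ≡ x [ m ]
mod-refl {m} {x} = congruent (+ 0) $ sym (ℤₚ.+-identityʳ x)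

mod-⊕ : ∀ {m x x′ y y′} → x ≡ x′ [ m ] → y ≡ y′ [ m ] → x ⊕ y ≡ x′ ⊕ y′ [ m ]
mod-⊕ {m} {x′ = x′} {y′ = y′} (congruent k refl) (congruent l refl) = congruent (k ⊕ l) $ lemma x′ y′ k l (+ m)
  where
  lemma : ∀ x y k l m → (x ⊕ k ⊗ m) ⊕ (y ⊕ l ⊗ m) ≡ (x ⊕ y) ⊕ (k ⊕ l) ⊗ m
  lemma = solve-∀

mod-⊗ : ∀ {m x x′ y y′} → x ≡ x′ [ m ] → y ≡ y′ [ m ] → x ⊗ y ≡ x′ ⊗ y′ [ m ]
mod-⊗ {m} {x′ = x′} {y′ = y′} (congruent k refl) (congruent l refl) = congruent (x′ ⊗ l ⊕ k ⊗ y′ ⊕ k ⊗ l ⊗ + m) $ lemma x′ y′ k l (+ m)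
  where
  lemma : ∀ x y k l m → (x ⊕ k ⊗ m) ⊗ (y ⊕ l ⊗ m) ≡ x ⊗ y ⊕ (x ⊗ l ⊕ k ⊗ y ⊕ k ⊗ l ⊗ m) ⊗ m
  lemma = solve-∀

module _ (m : ℕ) .{{_ : NonZero m}} where

  mod-residue : ∀ x → x ≡ + (x %ℕ m) [ m ]
  mod-residue x = congruent (x /ℕ m) $ a≡a%ℕn+[a/ℕn]*n x m

  residue-unique : ∀ {r s} → r < m → s < m → + r ≡ + s [ m ] → r ≡ s
  residue-unique {r} {s} r<m s<m (congruent k eq) = ℤₚ.+-injective (trans eq (trans (cong (λ k → + s ⊕ k ⊗ + m) k≡0) (ℤₚ.+-identityʳ (+ s))))
    where
    difference : ∀ r s t → r ≡ s ⊕ t → r ⊖ s ≡ t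
    difference .(s ⊕ t) s t refl = lemma s t
      where
      lemma : ∀ s t → (s ⊕ t) ⊖ s ≡ t
      lemma = solve-∀
    small : ∀ k → ℤ.∣ k ∣ * m < m → k ≡ + 0
    small k h with ℤ.∣ k ∣ in eq′
    ... | zero  = ℤₚ.∣i∣≡0⇒i≡0 eq′
    ... | suc j = contradiction h (ℕₚ.≤⇒≯ (ℕₚ.m≤m+n m (j * m)))
    k≡0 : k ≡ + 0
    k≡0 = small k (ℕₚ.≤-trans (s≤s (ℕₚ.≤-reflexive (trans (sym (ℤₚ.abs-* k (+ m)))
      (cong ℤ.∣_∣ (trans (sym (difference (+ r) (+ s) (k ⊗ + m) eq)) (ℤₚ.m-n≡m⊖n r s))))))
      (ℕₚ.≤-trans (s≤s (ℤₚ.∣m⊝n∣≤m⊔n r s)) (ℕₚ.⊔-lub r<m s<m)))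

  mod⇒residue : ∀ {x y} → x ≡ y [ m ] → x %ℕ m ≡ y %ℕ m
  mod⇒residue {x} {y} (congruent k eq) = residue-unique (n%ℕd<d x m) (n%ℕd<d y m) (congruent (y /ℕ m ⊖ x /ℕ m ⊕ k) $
    move (+ (x %ℕ m)) (x /ℕ m) (+ (y %ℕ m)) (y /ℕ m) k (+ m)
      (trans (sym (a≡a%ℕn+[a/ℕn]*n x m)) (trans eq (cong (_⊕ k ⊗ + m) (a≡a%ℕn+[a/ℕn]*n y m)))))
    where
    move : ∀ r i s j k m → r ⊕ i ⊗ m ≡ (s ⊕ j ⊗ m) ⊕ k ⊗ m → r ≡ s ⊕ (j ⊖ i ⊕ k) ⊗ m
    move r i s j k m e = trans (lemma r (i ⊗ m)) (trans (cong (_⊖ i ⊗ m) e) (lemma′ s i j k m))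
      where
      lemma : ∀ r t → r ≡ (r ⊕ t) ⊖ t
      lemma = solve-∀
      lemma′ : ∀ s i j k m → ((s ⊕ j ⊗ m) ⊕ k ⊗ m) ⊖ i ⊗ m ≡ s ⊕ (j ⊖ i ⊕ k) ⊗ m
      lemma′ = solve-∀

  multiple-quotient : ∀ k → (k ⊗ + m) /ℕ m ≡ k
  multiple-quotient k = ℤₚ.*-cancelʳ-≡ ((k ⊗ + m) /ℕ m) k (+ m) (trans (sym (ℤₚ.+-identityˡ _))
    (trans (cong (λ r → + r ⊕ (k ⊗ + m) /ℕ m ⊗ + m) (sym (multiple-residue k))) (sym (a≡a%ℕn+[a/ℕn]*n (k ⊗ + m) m))))
    where
    multiple-residue : ∀ k → (k ⊗ + m) %ℕ m ≡ 0
    multiple-residue k = trans (mod⇒residue {k ⊗ + m} {+ 0} (congruent k (sym (ℤₚ.+-identityˡ _)))) (m*n%n≡0 0 m)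

  residue-0 : ∀ x → x %ℕ m ≡ 0 → x ≡ (x /ℕ m) ⊗ + m
  residue-0 x e = trans (a≡a%ℕn+[a/ℕn]*n x m) (trans (cong (λ r → + r ⊕ (x /ℕ m) ⊗ + m) e) (ℤₚ.+-identityˡ _))

  residues : Triple → Triple
  residues (x , y , z) = + (x %ℕ m) , + (y %ℕ m) , + (z %ℕ m)

  form-residue : ∀ a b c d e f v → form a b c d e f v %ℕ m ≡ form a b c d e f (residues v) %ℕ m
  form-residue a b c d e f (x , y , z) = mod⇒residue
    (mod-⊕ (mod-⊕ (mod-⊕ (mod-⊕ (mod-⊕ (term a rx rx) (term b ry ry)) (term c rz rz)) (term d ry rz)) (term e rz rx)) (term f rx ry))
    where
    rx = mod-residue x
    ry = mod-residue y
    rz = mod-residue z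
    term : ∀ k {u u′ v v′} → u ≡ u′ [ m ] → v ≡ v′ [ m ] → k ⊗ u ⊗ v ≡ k ⊗ u′ ⊗ v′ [ m ]
    term k h h′ = mod-⊗ (mod-⊗ (mod-refl {m} {k}) h) h′

-- Lines over the field with seven elements

linear : ℤ → ℤ → Triple → ℤ
linear a b (x , p , q) = x ⊕ a ⊗ p ⊕ b ⊗ q

linear-residue : ∀ a b v → linear a b v %ℕ 7 ≡ linear a b (residues 7 v) %ℕ 7
linear-residue a b (x , p , q) = mod⇒residue 7 (mod-⊕ (mod-⊕ (mod-residue 7 x) (mod-⊗ (mod-refl {7} {a}) (mod-residue 7 p))) (mod-⊗ (mod-refl {7} {b}) (mod-residue 7 q)))

δ : ℕ → ℤ
δ 0       = + 1
δ (suc _) = + 0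

∑-δ : (e : Enum P) (h : A → ℕ) → ∑ e (δ ∘ h) ≡ count (filterE (λ v → h v ℕ.≟ 0) e)
∑-δ e h = trans (∑-split (λ v → h v ℕ.≟ 0) e (δ ∘ h)) (trans (cong₂ _⊕_
  (∑-cong (filterE (λ v → h v ℕ.≟ 0) e) (λ (_ , z) → cong δ z))
  (∑-0 (filterE (¬? ∘ (λ v → h v ℕ.≟ 0)) e) (λ {v} (_ , nz) → off (h v) nz))) (ℤₚ.+-identityʳ _))
  where
  off : ∀ k → ¬ (k ≡ 0) → δ k ≡ + 0
  off zero    h = contradiction refl h
  off (suc k) h = refl

on : ℤ → ℤ → Triple → ℤ
on a b v = δ (linear a b v %ℕ 7)

origin : Triple → ℕ
origin (x , p , q) = x %ℕ 7 + (p %ℕ 7 + q %ℕ 7)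

lines : Triple → ℤ
lines v = ((on (+ 2) (+ 3) v ⊕ on -2ℤ (+ 3) v) ⊕ (on (+ 2) (⊝ + 3) v ⊕ on -2ℤ (⊝ + 3) v)) ⊕
          ((on (+ 3) (+ 2) v ⊕ on (+ 3) -2ℤ v) ⊕ (on (⊝ + 3) (+ 2) v ⊕ on (⊝ + 3) -2ℤ v))

Q₁₈₈ : Triple → ℤ
Q₁₈₈ = form (+ 1) (+ 8) (+ 8) (+ 0) (+ 0) (+ 0)

-- The eight lines x + a p + b q = 0 are the tangents of the conic x² + 8 p² + 8 q² = 0 over 𝔽₇.
lines-value : ∀ v → lines v ≡ (+ 1 ⊖ legendre₇ (Q₁₈₈ v %ℕ 7)) ⊕ + 7 ⊗ δ (origin v)
lines-value v@(x , p , q) = begin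
  lines v
    ≡⟨ cong₂ _⊕_ (cong₂ _⊕_ (cong₂ _⊕_ (on-residue (+ 2) (+ 3)) (on-residue -2ℤ (+ 3))) (cong₂ _⊕_ (on-residue (+ 2) (⊝ + 3)) (on-residue -2ℤ (⊝ + 3))))
                 (cong₂ _⊕_ (cong₂ _⊕_ (on-residue (+ 3) (+ 2)) (on-residue (+ 3) -2ℤ)) (cong₂ _⊕_ (on-residue (⊝ + 3) (+ 2)) (on-residue (⊝ + 3) -2ℤ))) ⟩
  lines (residues 7 v)
    ≡⟨ check₄-sound 7 7 (λ r s t _ → lines (+ r , + s , + t)) (λ r s t _ → (+ 1 ⊖ legendre₇ (Q₁₈₈ (+ r , + s , + t) %ℕ 7)) ⊕ + 7 ⊗ δ (r + (s + t)))
         refl (x %ℕ 7) (p %ℕ 7) (q %ℕ 7) 0 (n%ℕd<d x 7) (n%ℕd<d p 7) (n%ℕd<d q 7) (s≤s z≤n) ⟩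
  (+ 1 ⊖ legendre₇ (Q₁₈₈ (residues 7 v) %ℕ 7)) ⊕ + 7 ⊗ δ (origin v)
    ≡⟨ cong (λ r → (+ 1 ⊖ legendre₇ r) ⊕ + 7 ⊗ δ (origin v)) (form-residue 7 (+ 1) (+ 8) (+ 8) (+ 0) (+ 0) (+ 0) v) ⟨
  (+ 1 ⊖ legendre₇ (Q₁₈₈ v %ℕ 7)) ⊕ + 7 ⊗ δ (origin v) ∎
  where
  open ≡-Reasoning
  on-residue : ∀ a b → on a b v ≡ on a b (residues 7 v)
  on-residue a b = cong δ (linear-residue a b v)

module Tangents (M : ℕ) (E : Enum (λ v → weight 1 8 8 v ≡ M)) where

  line : ℤ → ℤ → ℤ
  line a b = ∑ E (on a b)

  sq-⊝ : ∀ x → sq (⊝ x) ≡ sq x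
  sq-⊝ x = cong (λ n → n * n) (ℤₚ.∣-i∣≡∣i∣ x)

  line-negˡ : ∀ a b → line a b ≡ line (⊝ a) b
  line-negˡ a b = ∑-bij E E (λ (x , p , q) → x , ⊝ p , q) (λ (x , p , q) → x , ⊝ p , q) (λ {v} → same v) (λ {v} → same v)
    (λ { {x , p , q} _ → cong (λ p → x , p , q) (ℤₚ.neg-involutive p) }) (λ { {x , p , q} _ → cong (λ p → x , p , q) (ℤₚ.neg-involutive p) })
    (λ { {x , p , q} _ → cong (λ t → δ (t %ℕ 7)) (lemma a b x p q) })
    where
    same : ∀ v → weight 1 8 8 v ≡ M → weight 1 8 8 (proj₁ v , ⊝ proj₁ (proj₂ v) , proj₂ (proj₂ v)) ≡ M
    same (x , p , q) e = trans (cong (λ s → sq x * 1 + (s * 8 + sq q * 8)) (sq-⊝ p)) e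
    lemma : ∀ a b x p q → x ⊕ a ⊗ p ⊕ b ⊗ q ≡ x ⊕ (⊝ a) ⊗ (⊝ p) ⊕ b ⊗ q
    lemma = solve-∀

  line-swap : ∀ a b → line a b ≡ line b a
  line-swap a b = ∑-bij E E (λ (x , p , q) → x , q , p) (λ (x , p , q) → x , q , p) (λ {v} → same v) (λ {v} → same v) (λ _ → refl) (λ _ → refl)
    (λ { {x , p , q} _ → cong (λ t → δ (t %ℕ 7)) (lemma a b x p q) })
    where
    same : ∀ v → weight 1 8 8 v ≡ M → weight 1 8 8 (proj₁ v , proj₂ (proj₂ v) , proj₁ (proj₂ v)) ≡ M
    same (x , p , q) e = trans (cong (λ s → sq x * 1 + s) (ℕₚ.+-comm (sq q * 8) (sq p * 8))) e
    lemma : ∀ a b x p q → x ⊕ a ⊗ p ⊕ b ⊗ q ≡ x ⊕ b ⊗ q ⊕ a ⊗ p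
    lemma = solve-∀

  line-negʳ : ∀ a b → line a b ≡ line a (⊝ b)
  line-negʳ a b = trans (line-swap a b) (trans (line-negˡ b a) (line-swap (⊝ b) a))

  -- The coefficients (±2 , ±3) and (±3 , ±2) form one orbit under the sign changes of p and q and
  -- their exchange, all of which preserve x² + 8p² + 8q².
  eight-lines : ∑ E lines ≡ + 8 ⊗ line (+ 2) (+ 3)
  eight-lines = trans (⊕₂ _ _) (trans (cong₂ _⊕_
      (trans (⊕₂ _ _) (cong₂ _⊕_ (trans (⊕₂ _ _) (cong (line (+ 2) (+ 3) ⊕_) (sym (line-negˡ (+ 2) (+ 3)))))
                                 (trans (⊕₂ _ _) (cong₂ _⊕_ l₃ (trans (sym (line-negˡ (+ 2) (⊝ + 3))) l₃)))))
      (trans (⊕₂ _ _) (cong₂ _⊕_ (trans (⊕₂ _ _) (cong₂ _⊕_ l₅ (trans (sym (line-negʳ (+ 3) (+ 2))) l₅)))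
                                 (trans (⊕₂ _ _) (cong₂ _⊕_ l₇ (trans (sym (line-negʳ (⊝ + 3) (+ 2))) l₇))))))
    (total (line (+ 2) (+ 3))))
    where
    ⊕₂ : ∀ h k → ∑ E (λ v → h v ⊕ k v) ≡ ∑ E h ⊕ ∑ E k
    ⊕₂ = ∑-⊕ E
    l₃ : line (+ 2) (⊝ + 3) ≡ line (+ 2) (+ 3)
    l₃ = sym (line-negʳ (+ 2) (+ 3))
    l₅ : line (+ 3) (+ 2) ≡ line (+ 2) (+ 3)
    l₅ = line-swap (+ 3) (+ 2)
    l₇ : line (⊝ + 3) (+ 2) ≡ line (+ 2) (+ 3)
    l₇ = trans (sym (line-negˡ (+ 3) (+ 2))) l₅
    total : ∀ l → ((l ⊕ l) ⊕ (l ⊕ l)) ⊕ ((l ⊕ l) ⊕ (l ⊕ l)) ≡ + 8 ⊗ l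
    total = solve-∀

  origins : ∑ E (δ ∘ origin) ≡ T 49 392 392 M
  origins = trans (∑-δ E origin) (trans (∑-bij (filterE (λ v → origin v ℕ.≟ 0) E) (diagE 49 392 392 M)
      quotients scale
      (λ { {v} (e , z) → trans (sym (scaled-weight (quotients v))) (trans (cong (weight 1 8 8) (scale-quotient v z)) e) })
      (λ { {v} e → trans (scaled-weight v) e , origin-scale v })
      (λ { {v} (_ , z) → scale-quotient v z })
      (λ { {x , p , q} _ → cong₂ _,_ (multiple-quotient 7 x) (cong₂ _,_ (multiple-quotient 7 p) (multiple-quotient 7 q)) })
      (λ _ → refl)) (diagE-count 49 392 392 M))
    where
    quotients scale : Triple → Triple
    quotients (x , p , q) = x /ℕ 7 , p /ℕ 7 , q /ℕ 7
    scale (x , p , q) = x ⊗ + 7 , p ⊗ + 7 , q ⊗ + 7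
    origin-scale : ∀ v → origin (scale v) ≡ 0
    origin-scale (x , p , q) = cong₂ _+_ (zero′ x) (cong₂ _+_ (zero′ p) (zero′ q))
      where
      zero′ : ∀ k → (k ⊗ + 7) %ℕ 7 ≡ 0
      zero′ k = mod⇒residue 7 {k ⊗ + 7} {+ 0} (congruent k (sym (ℤₚ.+-identityˡ _)))
    scale-quotient : ∀ v → origin v ≡ 0 → scale (quotients v) ≡ v
    scale-quotient (x , p , q) z = cong₂ _,_ (sym (residue-0 7 x (ℕₚ.m+n≡0⇒m≡0 (x %ℕ 7) z)))
      (cong₂ _,_ (sym (residue-0 7 p (ℕₚ.m+n≡0⇒m≡0 (p %ℕ 7) pq))) (sym (residue-0 7 q (ℕₚ.m+n≡0⇒n≡0 (p %ℕ 7) pq))))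
      where
      pq : p %ℕ 7 + q %ℕ 7 ≡ 0
      pq = ℕₚ.m+n≡0⇒n≡0 (x %ℕ 7) z
    scaled-weight : ∀ v → weight 1 8 8 (scale v) ≡ weight 49 392 392 v
    scaled-weight (x , p , q) = trans (cong₂ _+_ (one′ x 1) (cong₂ _+_ (one′ p 8) (one′ q 8))) refl
      where
      square : ∀ n k → n * 7 * (n * 7) * k ≡ n * n * (49 * k)
      square = ℕ-solve
      one′ : ∀ x k → sq (x ⊗ + 7) * k ≡ sq x * (49 * k)
      one′ x k = trans (cong (λ n → n * n * k) (ℤₚ.abs-* x (+ 7))) (square ℤ.∣ x ∣ k)

  line-total : + 8 ⊗ line (+ 2) (+ 3) ≡ (+ 1 ⊖ χ M) ⊗ T 1 8 8 M ⊕ + 7 ⊗ T 49 392 392 M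
  line-total = begin
    + 8 ⊗ line (+ 2) (+ 3)                                        ≡⟨ eight-lines ⟨
    ∑ E lines                                                     ≡⟨ ∑-cong E (λ {v} e → trans (lines-value v) (cong (λ n → (+ 1 ⊖ legendre₇ (n %ℕ 7)) ⊕ + 7 ⊗ δ (origin v)) (trans (form-weight 1 8 8 v) (cong +_ e)))) ⟩
    ∑ E (λ v → (+ 1 ⊖ χ M) ⊕ + 7 ⊗ δ (origin v))                  ≡⟨ ∑-⊕ E (λ _ → + 1 ⊖ χ M) (λ v → + 7 ⊗ δ (origin v)) ⟩
    ∑ E (λ _ → + 1 ⊖ χ M) ⊕ ∑ E (λ v → + 7 ⊗ δ (origin v))        ≡⟨ cong₂ _⊕_ (trans (∑-cong E (λ _ → sym (ℤₚ.*-identityʳ (+ 1 ⊖ χ M)))) (trans (∑-⊗ E (+ 1 ⊖ χ M) (λ _ → + 1)) (cong ((+ 1 ⊖ χ M) ⊗_) (trans (∑-same E (diagE 1 8 8 M) id id (λ _ → refl)) (diagE-count 1 8 8 M)))))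
                                                                     (trans (∑-⊗ E (+ 7) (δ ∘ origin)) (cong (+ 7 ⊗_) origins)) ⟩
    (+ 1 ⊖ χ M) ⊗ T 1 8 8 M ⊕ + 7 ⊗ T 49 392 392 M                ∎
    where open ≡-Reasoning

-- The form 3x² + 5y² + 14z² + 2xy

C : Triple → ℤ
C = form (+ 3) (+ 5) (+ 14) (+ 0) (+ 0) (+ 2)

even-residue : ∀ n k → n % 2 ≡ 0 → Even (+ n ⊕ k ⊗ + 8)
even-residue n k e with m%n≡0⇒n∣m n 2 e
... | divides j refl = + j ⊕ k ⊗ + 4 , trans (cong (_⊕ k ⊗ + 8) (ℤₚ.pos-* j 2)) (lemma (+ j) k)
  where
  lemma : ∀ j k → j ⊗ + 2 ⊕ k ⊗ + 8 ≡ (j ⊕ k ⊗ + 4) ⊕ (j ⊕ k ⊗ + 4)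
  lemma = solve-∀

module _ (M : ℕ) (M≡1 : M % 8 ≡ 1) where

  private
    -- The last argument is the value of the form modulo 8. Away from the value 1 the function is 0,
    -- so the implication between residues becomes an equation with 0.
    odd-parities : ℕ → ℕ → ℕ → ℕ → ℤ
    odd-parities r s t 1 = + (s % 2 + (r + t) % 2)
    odd-parities r s t _ = + 0

  -- A check of all residues modulo 8. These parities make Y/2 and (X + Z)/2 integral, as the
  -- passage to the tangent line requires.
  parities : ∀ X Y Z → C (X , Y , Z) ≡ + M → Even Y × Even (X ⊕ Z)
  parities X Y Z eq = subst Even (sym (a≡a%ℕn+[a/ℕn]*n Y 8)) (even-residue s (Y /ℕ 8) (ℕₚ.m+n≡0⇒m≡0 (s % 2) both)) ,
    subst Even (sym (trans (cong₂ _⊕_ (a≡a%ℕn+[a/ℕn]*n X 8) (a≡a%ℕn+[a/ℕn]*n Z 8)) (trans (lemma (+ r) (X /ℕ 8) (+ t) (Z /ℕ 8)) (cong (_⊕ (X /ℕ 8 ⊕ Z /ℕ 8) ⊗ + 8) (sym (ℤₚ.pos-+ r t))))))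
      (even-residue (r + t) (X /ℕ 8 ⊕ Z /ℕ 8) (ℕₚ.m+n≡0⇒n≡0 (s % 2) both))
    where
    r s t : ℕ
    r = X %ℕ 8
    s = Y %ℕ 8
    t = Z %ℕ 8
    lemma : ∀ r i t j → (r ⊕ i ⊗ + 8) ⊕ (t ⊕ j ⊗ + 8) ≡ (r ⊕ t) ⊕ (i ⊕ j) ⊗ + 8
    lemma = solve-∀
    one-mod-8 : C (+ r , + s , + t) %ℕ 8 ≡ 1
    one-mod-8 = trans (sym (form-residue 8 (+ 3) (+ 5) (+ 14) (+ 0) (+ 0) (+ 2) (X , Y , Z))) (trans (cong (_%ℕ 8) eq) M≡1)
    both : s % 2 + (r + t) % 2 ≡ 0
    both = ℤₚ.+-injective (trans (cong (odd-parities r s t) (sym one-mod-8))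
      (check₄-sound 8 8 (λ r s t _ → odd-parities r s t (C (+ r , + s , + t) %ℕ 8)) (λ _ _ _ _ → + 0)
        refl r s t 0 (n%ℕd<d X 8) (n%ℕd<d Y 8) (n%ℕd<d Z 8) (s≤s z≤n)))

  -- A vector (x , p , q) on the line x + 2p + 3q = 7t corresponds to (2p − 3t + q , 2t , t − q).
  C-line : ∀ (e : Enum (λ v → C v ≡ + M)) (E : Enum (λ v → weight 1 8 8 v ≡ M)) → count e ≡ Tangents.line M E (+ 2) (+ 3)
  C-line e E = trans (∑-bij e (filterE (λ v → linear (+ 2) (+ 3) v %ℕ 7 ℕ.≟ 0) E) to from
    (λ { {X , Y , Z} eq → let ((y , Y≡) , (s , XZ≡)) = parities X Y Z eq in to-sound X Y Z y s eq Y≡ XZ≡ })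
    (λ { {x , p , q} (eq , line) → from-sound x p q eq line })
    (λ { {X , Y , Z} eq → let ((y , Y≡) , (s , XZ≡)) = parities X Y Z eq in from-to X Y Z y s Y≡ XZ≡ })
    (λ { {x , p , q} (eq , line) → to-from x p q line })
    (λ _ → refl)) (sym (∑-δ E (λ v → linear (+ 2) (+ 3) v %ℕ 7)))
    where
    point : ℤ → ℤ → ℤ → Triple
    point s y Z = + 3 ⊗ Z ⊖ (s ⊕ s) ⊕ (y ⊕ y) , s ⊕ y , y ⊖ Z
    -- Here t = Y/2 and s = (X + Z)/2, so that p = s + t and q = t - Z; the first coordinate of
    -- `point` is then 7t - 2p - 3q.
    to from : Triple → Triple
    to (X , Y , Z) = point (half (X ⊕ Z)) (half Y) Z
    preimage : ℤ → ℤ → ℤ → Triple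
    preimage p q t = + 2 ⊗ p ⊖ + 3 ⊗ t ⊕ q , t ⊕ t , t ⊖ q
    from v@(x , p , q) = preimage p q (linear (+ 2) (+ 3) v /ℕ 7)

    to-point : ∀ X Y Z y s → Y ≡ y ⊕ y → X ⊕ Z ≡ s ⊕ s → to (X , Y , Z) ≡ point s y Z
    to-point X Y Z y s Y≡ XZ≡ = cong₂ (λ s y → point s y Z) (half-even s XZ≡) (half-even y Y≡)
    solve-X : ∀ X Z s → X ⊕ Z ≡ s ⊕ s → X ≡ s ⊕ s ⊖ Z
    solve-X X Z s e = trans (lemma X Z) (cong (_⊖ Z) e)
      where
      lemma : ∀ X Z → X ≡ X ⊕ Z ⊖ Z
      lemma = solve-∀
    on-line : ∀ s y Z → linear (+ 2) (+ 3) (point s y Z) ≡ y ⊗ + 7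
    on-line = lemma
      where
      lemma : ∀ s y Z → (+ 3 ⊗ Z ⊖ (s ⊕ s) ⊕ (y ⊕ y)) ⊕ + 2 ⊗ (s ⊕ y) ⊕ + 3 ⊗ (y ⊖ Z) ≡ y ⊗ + 7
      lemma = solve-∀
    Q-point : ∀ s y Z → Q₁₈₈ (point s y Z) ≡ C (s ⊕ s ⊖ Z , y ⊕ y , Z)
    Q-point = lemma
      where
      lemma : ∀ s y Z → let x = + 3 ⊗ Z ⊖ (s ⊕ s) ⊕ (y ⊕ y) ; p = s ⊕ y ; q = y ⊖ Z ; X = s ⊕ s ⊖ Z ; Y = y ⊕ y in
        + 1 ⊗ x ⊗ x ⊕ + 8 ⊗ p ⊗ p ⊕ + 8 ⊗ q ⊗ q ⊕ + 0 ⊗ p ⊗ q ⊕ + 0 ⊗ q ⊗ x ⊕ + 0 ⊗ x ⊗ p ≡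
        + 3 ⊗ X ⊗ X ⊕ + 5 ⊗ Y ⊗ Y ⊕ + 14 ⊗ Z ⊗ Z ⊕ + 0 ⊗ Y ⊗ Z ⊕ + 0 ⊗ Z ⊗ X ⊕ + 2 ⊗ X ⊗ Y
      lemma = solve-∀

    to-sound : ∀ X Y Z y s → C (X , Y , Z) ≡ + M → Y ≡ y ⊕ y → X ⊕ Z ≡ s ⊕ s →
               weight 1 8 8 (to (X , Y , Z)) ≡ M × linear (+ 2) (+ 3) (to (X , Y , Z)) %ℕ 7 ≡ 0
    to-sound X Y Z y s eq Y≡ XZ≡ = subst (λ v → weight 1 8 8 v ≡ M × linear (+ 2) (+ 3) v %ℕ 7 ≡ 0) (sym (to-point X Y Z y s Y≡ XZ≡))
      (ℤₚ.+-injective (trans (sym (form-weight 1 8 8 (point s y Z))) (trans (Q-point s y Z) (trans (cong₂ (λ X Y → C (X , Y , Z)) (sym (solve-X X Z s XZ≡)) (sym Y≡)) eq))) ,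
       mod⇒residue 7 {linear (+ 2) (+ 3) (point s y Z)} {+ 0} (congruent y (trans (on-line s y Z) (sym (ℤₚ.+-identityˡ (y ⊗ + 7))))))

    preimage-point : ∀ s y Z → preimage (s ⊕ y) (y ⊖ Z) y ≡ (s ⊕ s ⊖ Z , y ⊕ y , Z)
    preimage-point s y Z = cong₂ _,_ (lemma s y Z) (cong (y ⊕ y ,_) (lemma′ y Z))
      where
      lemma : ∀ s y Z → + 2 ⊗ (s ⊕ y) ⊖ + 3 ⊗ y ⊕ (y ⊖ Z) ≡ s ⊕ s ⊖ Z
      lemma = solve-∀
      lemma′ : ∀ y Z → y ⊖ (y ⊖ Z) ≡ Z
      lemma′ = solve-∀

    from-to : ∀ X Y Z y s → Y ≡ y ⊕ y → X ⊕ Z ≡ s ⊕ s → from (to (X , Y , Z)) ≡ (X , Y , Z)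
    from-to X Y Z y s Y≡ XZ≡ = begin
      from (to (X , Y , Z))                ≡⟨ cong from (to-point X Y Z y s Y≡ XZ≡) ⟩
      from (point s y Z)                   ≡⟨ cong (preimage (s ⊕ y) (y ⊖ Z)) (trans (cong (_/ℕ 7) (on-line s y Z)) (multiple-quotient 7 y)) ⟩
      preimage (s ⊕ y) (y ⊖ Z) y           ≡⟨ preimage-point s y Z ⟩
      (s ⊕ s ⊖ Z , y ⊕ y , Z)              ≡⟨ cong₂ (λ X Y → X , Y , Z) (solve-X X Z s XZ≡) Y≡ ⟨
      (X , Y , Z)                          ∎
      where open ≡-Reasoning

    point-preimage : ∀ x p q t → x ⊕ + 2 ⊗ p ⊕ + 3 ⊗ q ≡ t ⊗ + 7 → point (p ⊖ t) t (t ⊖ q) ≡ (x , p , q)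
    point-preimage x p q t e = cong₂ _,_ (trans (lemma p q t) (trans (cong (λ u → u ⊖ + 2 ⊗ p ⊖ + 3 ⊗ q) (sym e)) (lemma‴ x p q))) (cong₂ _,_ (lemma′ p t) (lemma″ q t))
      where
      lemma : ∀ p q t → + 3 ⊗ (t ⊖ q) ⊖ ((p ⊖ t) ⊕ (p ⊖ t)) ⊕ (t ⊕ t) ≡ t ⊗ + 7 ⊖ + 2 ⊗ p ⊖ + 3 ⊗ q
      lemma = solve-∀
      lemma′ : ∀ p t → (p ⊖ t) ⊕ t ≡ p
      lemma′ = solve-∀
      lemma″ : ∀ q t → t ⊖ (t ⊖ q) ≡ q
      lemma″ = solve-∀
      lemma‴ : ∀ x p q → (x ⊕ + 2 ⊗ p ⊕ + 3 ⊗ q) ⊖ + 2 ⊗ p ⊖ + 3 ⊗ q ≡ x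
      lemma‴ = solve-∀
    preimage-halves : ∀ p q t → (+ 2 ⊗ p ⊖ + 3 ⊗ t ⊕ q) ⊕ (t ⊖ q) ≡ (p ⊖ t) ⊕ (p ⊖ t)
    preimage-halves = solve-∀
    preimage-X : ∀ p q t → + 2 ⊗ p ⊖ + 3 ⊗ t ⊕ q ≡ (p ⊖ t) ⊕ (p ⊖ t) ⊖ (t ⊖ q)
    preimage-X = solve-∀

    to-from : ∀ x p q → linear (+ 2) (+ 3) (x , p , q) %ℕ 7 ≡ 0 → to (from (x , p , q)) ≡ (x , p , q)
    to-from x p q line = trans (to-point (+ 2 ⊗ p ⊖ + 3 ⊗ t ⊕ q) (t ⊕ t) (t ⊖ q) t (p ⊖ t) refl (preimage-halves p q t))
      (point-preimage x p q t (residue-0 7 (linear (+ 2) (+ 3) (x , p , q)) line))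
      where
      t : ℤ
      t = linear (+ 2) (+ 3) (x , p , q) /ℕ 7

    from-sound : ∀ x p q → weight 1 8 8 (x , p , q) ≡ M → linear (+ 2) (+ 3) (x , p , q) %ℕ 7 ≡ 0 → C (from (x , p , q)) ≡ + M
    from-sound x p q eq line = begin
      C (from (x , p , q))                           ≡⟨ cong (λ X → C (X , t ⊕ t , t ⊖ q)) (preimage-X p q t) ⟩
      C ((p ⊖ t) ⊕ (p ⊖ t) ⊖ (t ⊖ q) , t ⊕ t , t ⊖ q)   ≡⟨ Q-point (p ⊖ t) t (t ⊖ q) ⟨
      Q₁₈₈ (point (p ⊖ t) t (t ⊖ q))                 ≡⟨ cong Q₁₈₈ (point-preimage x p q t (residue-0 7 (linear (+ 2) (+ 3) (x , p , q)) line)) ⟩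
      Q₁₈₈ (x , p , q)                               ≡⟨ trans (form-weight 1 8 8 (x , p , q)) (cong +_ eq) ⟩
      + M                                            ∎
      where
      open ≡-Reasoning
      t : ℤ
      t = linear (+ 2) (+ 3) (x , p , q) /ℕ 7

C-rep : ∀ M n → M % 8 ≡ 1 → Rep (+ 3) (+ 5) (+ 14) (+ 0) (+ 0) (+ 2) ((+ M) / 1) n →
        + 8 ⊗ + n ≡ (+ 1 ⊖ χ M) ⊗ R M ⊕ + 7 ⊗ dil 49 R M
C-rep M n M≡1 h = begin
  + 8 ⊗ + n                                        ≡⟨ cong (+ 8 ⊗_) (trans (sym (cardE-count h)) (C-line M M≡1 e (diagE 1 8 8 M))) ⟩
  + 8 ⊗ Tangents.line M (diagE 1 8 8 M) (+ 2) (+ 3)   ≡⟨ Tangents.line-total M (diagE 1 8 8 M) ⟩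
  (+ 1 ⊖ χ M) ⊗ T 1 8 8 M ⊕ + 7 ⊗ T 49 392 392 M   ≡⟨ cong₂ (λ u v → (+ 1 ⊖ χ M) ⊗ u ⊕ + 7 ⊗ v) (T-1-8-8 M M≡1) (T-49 M M≡1) ⟩
  (+ 1 ⊖ χ M) ⊗ R M ⊕ + 7 ⊗ dil 49 R M             ∎
  where
  open ≡-Reasoning
  e : Enum (λ v → C v ≡ + M)
  e = sameE (cardE h) (λ {v} eq → sym (trans (fraction≡ M 1 (C v) eq) (ℤₚ.*-identityʳ (C v))))
                      (λ {v} eq → ≡fraction M 1 (C v) (trans (sym eq) (sym (ℤₚ.*-identityʳ (C v)))))

-- Derivation of the two identities

N-rep : ∀ M n₂ n₃ → M % 8 ≡ 1 → Rep (+ 1) (+ 14) (+ 14) (+ 0) (+ 0) (+ 0) ((+ M) / 1) n₂ →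
        Rep (+ 2) (+ 7) (+ 14) (+ 0) (+ 0) (+ 0) ((+ M) / 1) n₃ → + n₂ ⊕ + 2 ⊗ + n₃ ≡ N M
N-rep M n₂ n₃ e h₂ h₃ = cong₂ (λ u v → u ⊕ + 2 ⊗ v) (trans (diagonal-rep 1 14 14 1 M n₂ h₂) (T-1-14-14 M e)) (trans (diagonal-rep 2 7 14 1 M n₃ h₃) (T-2-7-14 M e))

residue-type : ∀ M → 7 ∣ M ⊎ (IsResidue M ⊎ NonResidue M)
residue-type M with legendre-type (M % 7)
  where
  legendre-type : ∀ r → r ≡ 0 ⊎ (legendre₇ r ≡ + 1 ⊎ legendre₇ r ≡ ℤ.-1ℤ)
  legendre-type 0 = inj₁ refl
  legendre-type 1 = inj₂ (inj₁ refl)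
  legendre-type 2 = inj₂ (inj₁ refl)
  legendre-type 3 = inj₂ (inj₂ refl)
  legendre-type 4 = inj₂ (inj₁ refl)
  legendre-type (suc (suc (suc (suc (suc _))))) = inj₂ (inj₂ refl)
... | inj₁ e        = inj₁ (m%n≡0⇒n∣m M 7 e)
... | inj₂ (inj₁ e) = inj₂ (inj₁ e)
... | inj₂ (inj₂ e) = inj₂ (inj₂ e)

R-off-multiples : ∀ M → ¬ (7 ∣ M) → dil 49 R M ≡ + 0
R-off-multiples M h = dil-∤ 49 R M (λ d → h (∣-trans (divides 7 refl) d))

residue-not-0 : ∀ M {u} → χ M ≡ u → u ≢ + 0 → ¬ (7 ∣ M)
residue-not-0 M e h d = h (trans (sym e) (χ-0 M d))

-- The equation is proved after doubling, where 8 `n₄` can be replaced by its value. For 7 ∣ M one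
-- copy of `R M` is expanded by `R-multiple` and the other kept; for residues `n₄` contributes 0,
-- and for nonresidues `N M` does.
R-N : ∀ M n₄ → M % 8 ≡ 1 → + 8 ⊗ + n₄ ≡ (+ 1 ⊖ χ M) ⊗ R M ⊕ + 7 ⊗ dil 49 R M → R M ≡ N M ⊕ + 4 ⊗ + n₄
R-N M n₄ M≡1 L = ℤₚ.*-cancelˡ-≡ (+ 2) (R M) (N M ⊕ + 4 ⊗ + n₄) (trans (doubled (residue-type M)) (lemma (N M) (+ n₄)))
  where
  open ≡-Reasoning
  lemma : ∀ a b → + 2 ⊗ a ⊕ + 8 ⊗ b ≡ + 2 ⊗ (a ⊕ + 4 ⊗ b)
  lemma = solve-∀
  L′ : ∀ {u} → χ M ≡ u → + 8 ⊗ + n₄ ≡ (+ 1 ⊖ u) ⊗ R M ⊕ + 7 ⊗ dil 49 R M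
  L′ refl = L
  doubled : 7 ∣ M ⊎ (IsResidue M ⊎ NonResidue M) → + 2 ⊗ R M ≡ + 2 ⊗ N M ⊕ + 8 ⊗ + n₄
  doubled (inj₁ 7∣M) = begin
    + 2 ⊗ R M                                                ≡⟨ lemma₂ (R M) ⟩
    R M ⊕ R M                                                ≡⟨ cong (_⊕ R M) (R-multiple M M≡1 7∣M) ⟩
    (+ 7 ⊗ dil 49 R M ⊕ + 2 ⊗ N M) ⊕ R M                     ≡⟨ lemma₃ (R M) (dil 49 R M) (N M) ⟩
    + 2 ⊗ N M ⊕ ((+ 1 ⊖ + 0) ⊗ R M ⊕ + 7 ⊗ dil 49 R M)       ≡⟨ cong (+ 2 ⊗ N M ⊕_) (L′ (χ-0 M 7∣M)) ⟨
    + 2 ⊗ N M ⊕ + 8 ⊗ + n₄                                   ∎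
    where
    lemma₂ : ∀ r → + 2 ⊗ r ≡ r ⊕ r
    lemma₂ = solve-∀
    lemma₃ : ∀ r s n → (+ 7 ⊗ s ⊕ + 2 ⊗ n) ⊕ r ≡ + 2 ⊗ n ⊕ ((+ 1 ⊖ + 0) ⊗ r ⊕ + 7 ⊗ s)
    lemma₃ = solve-∀
  doubled (inj₂ (inj₁ res)) = begin
    + 2 ⊗ R M                                                ≡⟨ cong (+ 2 ⊗_) (R-residue M M≡1 res) ⟩
    + 2 ⊗ N M                                                ≡⟨ ℤₚ.+-identityʳ (+ 2 ⊗ N M) ⟨
    + 2 ⊗ N M ⊕ + 0                                          ≡⟨ cong (+ 2 ⊗ N M ⊕_) (trans (L′ res) (trans (cong (λ u → (+ 1 ⊖ + 1) ⊗ R M ⊕ + 7 ⊗ u) (R-off-multiples M (residue-not-0 M res (λ ())))) (lemma₂ (R M)))) ⟨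
    + 2 ⊗ N M ⊕ + 8 ⊗ + n₄                                   ∎
    where
    lemma₂ : ∀ r → (+ 1 ⊖ + 1) ⊗ r ⊕ + 7 ⊗ + 0 ≡ + 0
    lemma₂ = solve-∀
  doubled (inj₂ (inj₂ non)) = begin
    + 2 ⊗ R M                                                ≡⟨ lemma₂ (R M) ⟩
    + 2 ⊗ + 0 ⊕ ((+ 1 ⊖ ℤ.-1ℤ) ⊗ R M ⊕ + 7 ⊗ + 0)            ≡⟨ cong₂ (λ u v → + 2 ⊗ u ⊕ v) (N-nonresidue M non) (trans (L′ non) (cong (λ u → (+ 1 ⊖ ℤ.-1ℤ) ⊗ R M ⊕ + 7 ⊗ u) (R-off-multiples M (residue-not-0 M non (λ ()))))) ⟨
    + 2 ⊗ N M ⊕ + 8 ⊗ + n₄                                   ∎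
    where
    lemma₂ : ∀ r → + 2 ⊗ r ≡ + 2 ⊗ + 0 ⊕ ((+ 1 ⊖ -[1+ 0 ]) ⊗ r ⊕ + 7 ⊗ + 0)
    lemma₂ = solve-∀

theorem1p2 :
    ((M n₁ n₂ n₃ n₄ : ℕ) → M % 8 ≡ 1 →
      Rep (+ 1) (+ 8) (+ 8) (+ 0) (+ 0) (+ 0) ((+ M) / 1) n₁ →
      Rep (+ 1) (+ 14) (+ 14) (+ 0) (+ 0) (+ 0) ((+ M) / 1) n₂ →
      Rep (+ 2) (+ 7) (+ 14) (+ 0) (+ 0) (+ 0) ((+ M) / 1) n₃ →
      Rep (+ 3) (+ 5) (+ 14) (+ 0) (+ 0) (+ 2) ((+ M) / 1) n₄ →
      n₁ ≡ n₂ + 2 * n₃ + 4 * n₄)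
    ×
    ((M n₀ n₂ n₃ n₄ : ℕ) → M % 8 ≡ 1 → 7 ∣ M →
      Rep (+ 1) (+ 8) (+ 8) (+ 0) (+ 0) (+ 0) ((+ M) / 49) n₀ →
      Rep (+ 1) (+ 14) (+ 14) (+ 0) (+ 0) (+ 0) ((+ M) / 1) n₂ →
      Rep (+ 2) (+ 7) (+ 14) (+ 0) (+ 0) (+ 0) ((+ M) / 1) n₃ →
      Rep (+ 3) (+ 5) (+ 14) (+ 0) (+ 0) (+ 2) ((+ M) / 1) n₄ →
      + 7 ℤ.* + n₀ ≡ ℤ.- (+ n₂) ℤ.- + 2 ℤ.* + n₃ ℤ.+ + 4 ℤ.* + n₄)
theorem1p2 = first , second
  where
  open ≡-Reasoning
  first : (M n₁ n₂ n₃ n₄ : ℕ) → M % 8 ≡ 1 →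
    Rep (+ 1) (+ 8) (+ 8) (+ 0) (+ 0) (+ 0) ((+ M) / 1) n₁ → Rep (+ 1) (+ 14) (+ 14) (+ 0) (+ 0) (+ 0) ((+ M) / 1) n₂ →
    Rep (+ 2) (+ 7) (+ 14) (+ 0) (+ 0) (+ 0) ((+ M) / 1) n₃ → Rep (+ 3) (+ 5) (+ 14) (+ 0) (+ 0) (+ 2) ((+ M) / 1) n₄ →
    n₁ ≡ n₂ + 2 * n₃ + 4 * n₄
  first M n₁ n₂ n₃ n₄ M≡1 h₁ h₂ h₃ h₄ = ℤₚ.+-injective (begin
    + n₁                                    ≡⟨ trans (diagonal-rep 1 8 8 1 M n₁ h₁) (T-1-8-8 M M≡1) ⟩
    R M                                     ≡⟨ R-N M n₄ M≡1 (C-rep M n₄ M≡1 h₄) ⟩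
    N M ⊕ + 4 ⊗ + n₄                        ≡⟨ cong (_⊕ + 4 ⊗ + n₄) (N-rep M n₂ n₃ M≡1 h₂ h₃) ⟨
    (+ n₂ ⊕ + 2 ⊗ + n₃) ⊕ + 4 ⊗ + n₄        ≡⟨ cong₂ _⊕_ (cong (+ n₂ ⊕_) (ℤₚ.pos-* 2 n₃)) (ℤₚ.pos-* 4 n₄) ⟨
    + (n₂ + 2 * n₃ + 4 * n₄)                ∎)
  second : (M n₀ n₂ n₃ n₄ : ℕ) → M % 8 ≡ 1 → 7 ∣ M →
    Rep (+ 1) (+ 8) (+ 8) (+ 0) (+ 0) (+ 0) ((+ M) / 49) n₀ → Rep (+ 1) (+ 14) (+ 14) (+ 0) (+ 0) (+ 0) ((+ M) / 1) n₂ →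
    Rep (+ 2) (+ 7) (+ 14) (+ 0) (+ 0) (+ 0) ((+ M) / 1) n₃ → Rep (+ 3) (+ 5) (+ 14) (+ 0) (+ 0) (+ 2) ((+ M) / 1) n₄ →
    + 7 ⊗ + n₀ ≡ ⊝ (+ n₂) ⊖ + 2 ⊗ + n₃ ⊕ + 4 ⊗ + n₄
  second M n₀ n₂ n₃ n₄ M≡1 7∣M h₀ h₂ h₃ h₄ = begin
    + 7 ⊗ + n₀                                            ≡⟨ cong (+ 7 ⊗_) (trans (diagonal-rep 1 8 8 49 M n₀ h₀) (T-49 M M≡1)) ⟩
    -- Equating the two values of `R M`, from `R-multiple` and from `R-N`, leaves 7 R(M/49) + 2N = N
    -- + 4 `n₄`.
    + 7 ⊗ dil 49 R M                                      ≡⟨ subtract (+ 7 ⊗ dil 49 R M) (N M) (+ 4 ⊗ + n₄) (trans (sym (R-multiple M M≡1 7∣M)) (R-N M n₄ M≡1 (C-rep M n₄ M≡1 h₄))) ⟩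
    (⊝ N M) ⊕ + 4 ⊗ + n₄                                  ≡⟨ cong (λ u → (⊝ u) ⊕ + 4 ⊗ + n₄) (N-rep M n₂ n₃ M≡1 h₂ h₃) ⟨
    ⊝ (+ n₂ ⊕ + 2 ⊗ + n₃) ⊕ + 4 ⊗ + n₄                    ≡⟨ cong (_⊕ + 4 ⊗ + n₄) (ℤₚ.neg-distrib-+ (+ n₂) (+ 2 ⊗ + n₃)) ⟩
    ⊝ (+ n₂) ⊖ + 2 ⊗ + n₃ ⊕ + 4 ⊗ + n₄                    ∎
    where
    subtract : ∀ r n c → r ⊕ + 2 ⊗ n ≡ n ⊕ c → r ≡ (⊝ n) ⊕ c
    subtract r n c e = trans (lemma r n) (trans (cong (λ u → (⊝ + 2 ⊗ n) ⊕ u) e) (lemma′ n c))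
      where
      lemma : ∀ r n → r ≡ (⊝ + 2 ⊗ n) ⊕ (r ⊕ + 2 ⊗ n)
      lemma = solve-∀
      lemma′ : ∀ n c → (⊝ + 2 ⊗ n) ⊕ (n ⊕ c) ≡ (⊝ n) ⊕ c
      lemma′ = solve-∀
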